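{- If $q>2$ is even, there is a unique equivalence class of non-trivial perfect $\mathbb{F}_q$-linear MSRD codes in $M_{3\times3}(\mathbb{F}_q)$, i.e. of $3$-dimensional $\mathbb{F}_q$-subspaces of symmetric $3\times3$ matrices over $\mathbb{F}_q$ in which every nonzero matrix has rank $3$; if $q$ is odd, there are exactly two such equivalence classes.
   Context: An $\mathbb{F}_q$-linear symmetric rank-distance code is an $\mathbb{F}_q$-subspace of the space of symmetric $3\times3$ matrices over $\mathbb{F}_q$, with minimum distance the minimum rank of its nonzero elements. For minimum distance $3$ the maximal dimension is $3$ (MSRD codes), and the non-trivial perfect $\mathbb{F}_q$-linear SRD codes in $M_{3\times3}(\mathbb{F}_q)$ are exactly these $3$-dimensional codes of minimum distance $3$. Two codes $C,C'$ are equivalent if $C'=\{AXB:X\in C\}$ for some $A,B\in\mathrm{GL}(3,q)$. -}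

module Defs where

open import Level using (0ℓ)
open import Data.Nat using (ℕ)
open import Data.Fin using (Fin; zero; suc)
open import Data.Product using (Σ; ∃; ∃-syntax; _×_; _,_)
open import Data.Sum using (_⊎_)
open import Relation.Nullary using (¬_)
open import Relation.Binary.PropositionalEquality using (_≡_)
open import Function.Bundles using (_↔_)
open import Algebra.Structures using (IsCommutativeRing)

record FiniteField : Set₁ where
  infixl 6 _+_
  infixl 7 _*_
  field
    Carrier : Set
    _+_ _*_ : Carrier → Carrier → Carrier
    -_      : Carrier → Carrier
    0# 1#   : Carrier
    isCommutativeRing : IsCommutativeRing _≡_ _+_ _*_ -_ 0# 1#
    0≢1     : ¬ (0# ≡ 1#)
    inverse : ∀ x → ¬ (x ≡ 0#) → ∃[ y ] (x * y ≡ 1#)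
    q       : ℕ
    enum    : Fin q ↔ Carrier

module Matrices (F : FiniteField) where
  open FiniteField F

  Vec3 : Set
  Vec3 = Fin 3 → Carrier

  Mat3 : Set
  Mat3 = Fin 3 → Fin 3 → Carrier

  sum3 : (Fin 3 → Carrier) → Carrier
  sum3 f = f zero + f (suc zero) + f (suc (suc zero))

  _≐_ : Mat3 → Mat3 → Set
  M ≐ N = ∀ i j → M i j ≡ N i j

  _·_ : Mat3 → Mat3 → Mat3
  (M · N) i j = sum3 (λ k → M i k * N k j)

  I₃ : Mat3
  I₃ zero    zero          = 1#
  I₃ (suc i) (suc j)       = I₃' i j
    where
      I₃' : Fin 2 → Fin 2 → Carrier
      I₃' zero zero = 1#
      I₃' (suc zero) (suc zero) = 1#
      I₃' _ _ = 0#
  I₃ _       _             = 0#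

  Invertible : Mat3 → Set
  Invertible A = ∃[ A' ] ((A · A') ≐ I₃ × (A' · A) ≐ I₃)

  Symmetric : Mat3 → Set
  Symmetric M = ∀ i j → M i j ≡ M j i

  -- rank M = 3 for a 3×3 matrix: the kernel of M is trivial
  -- (rank-nullity: rank M = 3 - dim ker M).
  Rank3 : Mat3 → Set
  Rank3 M = ∀ (v : Vec3) → (∀ i → sum3 (λ j → M i j * v j) ≡ 0#) → ∀ j → v j ≡ 0#

  NonzeroVec : Vec3 → Set
  NonzeroVec c = ¬ (∀ k → c k ≡ 0#)

  lin : Vec3 → (Fin 3 → Mat3) → Mat3
  lin c B i j = sum3 (λ k → c k * B k i j)

  record SymCode3 : Set where
    field
      basis     : Fin 3 → Mat3
      symmetric : ∀ k → Symmetric (basis k)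
      linIndep  : ∀ (c : Vec3) → (lin c basis ≐ (λ _ _ → 0#)) → ∀ k → c k ≡ 0#

  open SymCode3 public

  _∈_ : Mat3 → SymCode3 → Set
  X ∈ C = ∃[ c ] (X ≐ lin c (basis C))

  IsMSRD : SymCode3 → Set
  IsMSRD C = ∀ X → X ∈ C → ¬ (X ≐ (λ _ _ → 0#)) → Rank3 X

  Equivalent : SymCode3 → SymCode3 → Set
  Equivalent C C' = ∃[ A ] ∃[ B ] (Invertible A × Invertible B ×
    (∀ X → X ∈ C → ((A · X) · B) ∈ C') ×
    (∀ Y → Y ∈ C' → ∃[ X ] (X ∈ C × Y ≐ ((A · X) · B))))

  UniqueMSRDClass : Set
  UniqueMSRDClass = ∃[ C ] (IsMSRD C × (∀ D → IsMSRD D → Equivalent C D))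

  TwoMSRDClasses : Set
  TwoMSRDClasses = ∃[ C₁ ] ∃[ C₂ ] (IsMSRD C₁ × IsMSRD C₂ × ¬ Equivalent C₁ C₂ ×
    (∀ D → IsMSRD D → Equivalent C₁ D ⊎ Equivalent C₂ D))

{-# OPTIONS --safe #-}
module Submission where

-- A symmetric code of minimum distance 3 is the same as a commutative presemifield product T on K = F_{q³}, bilinear over k = F_q.
-- For every z ≠ 0 the product is, modulo z and after a change of coordinates, the product of K; this puts T in the form
-- xy − c Tr(x)Tr(y), where c depends on z ("a frame at z"). Such a product has no zero divisors iff c is not a product of two
-- elements of trace 1. For c ∈ k this forces c ∈ {0, 1}, the field and (for odd q) the twisted field.
-- Otherwise an automorphism of T of determinant 1 is a scalar, so the q² points z = (1, s, t), the three conjugates and the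
-- determinants of the frames yield at least q² different parameters c. But the number of factorisations of c into elements of
-- trace 1 has mean about q and variance about q, and by Chebyshev's inequality at most q² − q parameters have none.
open import Defs
open import Level using (0ℓ)
open import Algebra.Bundles using (CommutativeRing; RawRing)
open import Algebra.Solver.Ring.AlmostCommutativeRing
open import Algebra.Structures using (IsCommutativeRing)
import Algebra.Properties.CommutativeMonoid.Sum as MonoidSum
open import Data.Fin as Fin using (Fin)
import Data.Fin.Properties as Finₚ
open import Data.Fin.Permutation using (Permutation′; permutation)
open import Data.Integer as ℤ using (ℤ)
import Data.Integer.Properties as ℤₚ
open import Data.Maybe using (just; nothing)
open import Data.Nat using (_<_)
open import Data.Nat as ℕ using (ℕ; zero; suc)
open import Data.Nat.Divisibility using (_∣_; divides; ∣m+n∣m⇒∣n; m∣m*n; ∣1⇒≡1)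
import Data.Nat.Properties as ℕₚ
open import Data.Nat.Solver using (module +-*-Solver)
open import Data.Product using (_×_; ∃; ∃-syntax; _,_; proj₁; proj₂)
open import Data.Product.Function.NonDependent.Propositional using (_×-↔_)
open import Data.Sum using (_⊎_; inj₁; inj₂; [_,_]′)
import Data.Sum as Sum
open import Data.Vec using (Vec; []; _∷_)
open import Function using (_∘_; _↔_; mk↔ₛ′; Inverse)
open import Function.Construct.Composition using (_↔-∘_)
open import Function.Construct.Identity using (↔-id)
open import Relation.Binary.Definitions using (WeaklyDecidable)
open import Relation.Binary.PropositionalEquality using (_≡_; refl; sym; trans; cong; cong₂; subst; subst₂; isEquivalence; module ≡-Reasoning)
open import Relation.Nullary using (¬_; Dec; yes; no; contradiction)
open import Relation.Nullary.Decidable using (map′; ¬?; _×-dec_; _→-dec_)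
open import Relation.Unary using (Decidable)

-- Why determinant 1: an automorphism without eigenvectors is multiplication by an irrational l, and
-- the argument needs σ²(l)³ ≠ N(l). If k contains primitive cube roots of unity, this fails for
-- every irrational l with l³ ∈ k; norm 1 excludes such l, as it would make l a cube root of unity.
-- Frames are therefore compared only at equal determinants. Scaling χ by μ ∈ k multiplies the
-- determinant by μ³, so a pair (parameter, determinant) may come from three values of μ. The three
-- conjugates of each parameter win this factor back exactly, which matters: the margin over
-- Chebyshev's bound is only q. For irrational c no zero divisors are exhibited; only the whole
-- collection of parameters of one product is refuted. The number q is just a number of elements, so
-- additivity of x ↦ x^q is not at hand. Instead σ substitutes a second root of a cubic for the
-- first, and that root is found by counting. Finiteness also replaces most rank arguments: an
-- injective self-map is onto.

module IntegerCoefficients (R : CommutativeRing 0ℓ 0ℓ) where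
  open import Data.Integer using (+_; -[1+_]; _⊖_)
  open CommutativeRing R renaming (refl to ≈-refl; sym to ≈-sym; trans to ≈-trans)
  open import Algebra.Properties.Semiring.Mult.TCOptimised semiring using (×-homo-+; ×1-homo-*; 1+×) renaming (_×_ to _×ₙ_)
  open import Algebra.Properties.Ring ring
  open import Algebra.Properties.AbelianGroup +-abelianGroup using (⁻¹-∙-comm)
  open import Relation.Binary.Reasoning.Setoid setoid

  fromℤ : ℤ → Carrier
  fromℤ (+ n) = n ×ₙ 1#
  fromℤ -[1+ n ] = - (suc n ×ₙ 1#)

  fromℤ-⊖ : ∀ m n → fromℤ (m ⊖ n) ≈ m ×ₙ 1# + - (n ×ₙ 1#)
  fromℤ-⊖ zero zero = ≈-sym (≈-trans (+-identityˡ _) -0#≈0#)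
  fromℤ-⊖ zero (suc n) = ≈-sym (+-identityˡ _)
  fromℤ-⊖ (suc m) zero = ≈-sym (≈-trans (+-congˡ -0#≈0#) (+-identityʳ _))
  fromℤ-⊖ (suc m) (suc n) = begin
    fromℤ (suc m ⊖ suc n)                    ≡⟨ cong fromℤ (ℤₚ.[1+m]⊖[1+n]≡m⊖n m n) ⟩
    fromℤ (m ⊖ n)                            ≈⟨ fromℤ-⊖ m n ⟩
    a + - b                                  ≈⟨ +-congˡ (≈-sym (+-identityˡ _)) ⟩
    a + (0# + - b)                           ≈⟨ +-congˡ (+-congʳ (≈-sym (-‿inverseʳ 1#))) ⟩
    a + (1# + - 1# + - b)                    ≈⟨ +-congˡ (+-assoc _ _ _) ⟩
    a + (1# + (- 1# + - b))                  ≈⟨ +-congˡ (+-congˡ (⁻¹-∙-comm 1# b)) ⟩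
    a + (1# + - (1# + b))                    ≈⟨ ≈-sym (+-assoc _ _ _) ⟩
    a + 1# + - (1# + b)                      ≈⟨ +-congʳ (+-comm a 1#) ⟩
    1# + a + - (1# + b)                      ≈⟨ ≈-sym (+-cong (1+× m 1#) (-‿cong (1+× n 1#))) ⟩
    suc m ×ₙ 1# + - (suc n ×ₙ 1#)              ∎
    where a = m ×ₙ 1#
          b = n ×ₙ 1#

  fromℤ-neg : ∀ i → fromℤ (ℤ.- i) ≈ - fromℤ i
  fromℤ-neg (+ zero) = ≈-sym -0#≈0#
  fromℤ-neg (+ suc n) = ≈-refl
  fromℤ-neg -[1+ n ] = ≈-sym (-‿involutive _)

  fromℤ-+ : ∀ i j → fromℤ (i ℤ.+ j) ≈ fromℤ i + fromℤ j
  fromℤ-+ (+ m) (+ n) = ×-homo-+ 1# m n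
  fromℤ-+ (+ m) -[1+ n ] = fromℤ-⊖ m (suc n)
  fromℤ-+ -[1+ m ] (+ n) = ≈-trans (fromℤ-⊖ n (suc m)) (+-comm _ _)
  fromℤ-+ -[1+ m ] -[1+ n ] = begin
    - (suc (suc (m ℕ.+ n)) ×ₙ 1#)         ≡⟨ cong (λ t → - (suc t ×ₙ 1#)) (sym (ℕₚ.+-suc m n)) ⟩
    - ((suc m ℕ.+ suc n) ×ₙ 1#)           ≈⟨ -‿cong (×-homo-+ 1# (suc m) (suc n)) ⟩
    - (suc m ×ₙ 1# + suc n ×ₙ 1#)          ≈⟨ ≈-sym (⁻¹-∙-comm _ _) ⟩
    - (suc m ×ₙ 1#) + - (suc n ×ₙ 1#)      ∎

  fromℤ-*+ : ∀ m j → fromℤ (+ m ℤ.* j) ≈ m ×ₙ 1# * fromℤ j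
  fromℤ-*+ m (+ n) = ≈-trans (reflexive (cong fromℤ (sym (ℤₚ.pos-* m n)))) (×1-homo-* m n)
  fromℤ-*+ m -[1+ n ] = begin
    fromℤ (+ m ℤ.* ℤ.- (+ suc n))        ≡⟨ cong fromℤ (sym (ℤₚ.neg-distribʳ-* (+ m) (+ suc n))) ⟩
    fromℤ (ℤ.- (+ m ℤ.* + suc n))        ≈⟨ fromℤ-neg (+ m ℤ.* + suc n) ⟩
    - fromℤ (+ m ℤ.* + suc n)            ≈⟨ -‿cong (fromℤ-*+ m (+ suc n)) ⟩
    - (m ×ₙ 1# * (suc n ×ₙ 1#))            ≈⟨ -‿distribʳ-* _ _ ⟩
    m ×ₙ 1# * - (suc n ×ₙ 1#)              ∎

  fromℤ-* : ∀ i j → fromℤ (i ℤ.* j) ≈ fromℤ i * fromℤ j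
  fromℤ-* (+ m) j = fromℤ-*+ m j
  fromℤ-* -[1+ m ] j = begin
    fromℤ (ℤ.- (+ suc m) ℤ.* j)          ≡⟨ cong fromℤ (sym (ℤₚ.neg-distribˡ-* (+ suc m) j)) ⟩
    fromℤ (ℤ.- (+ suc m ℤ.* j))          ≈⟨ fromℤ-neg (+ suc m ℤ.* j) ⟩
    - fromℤ (+ suc m ℤ.* j)              ≈⟨ -‿cong (fromℤ-*+ (suc m) j) ⟩
    - (suc m ×ₙ 1# * fromℤ j)             ≈⟨ -‿distribˡ-* _ _ ⟩
    - (suc m ×ₙ 1#) * fromℤ j             ∎

  ℤ-rawRing : RawRing 0ℓ 0ℓ
  ℤ-rawRing = record { Carrier = ℤ; _≈_ = _≡_; _+_ = ℤ._+_; _*_ = ℤ._*_; -_ = ℤ.-_; 0# = + 0; 1# = + 1 }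

  morphism : ℤ-rawRing -Raw-AlmostCommutative⟶ fromCommutativeRing R
  morphism = record
    { ⟦_⟧ = fromℤ ; +-homo = fromℤ-+ ; *-homo = fromℤ-* ; -‿homo = fromℤ-neg
    ; 0-homo = ≈-refl ; 1-homo = ≈-refl }

  -- In characteristic p distinct integers may have equal images, so inequality in ℤ decides nothing
  -- and yields `nothing`.
  ℤ-weaklyDecidable : WeaklyDecidable (Induced-equivalence morphism)
  ℤ-weaklyDecidable i j with i ℤₚ.≟ j
  ... | yes refl = just ≈-refl
  ... | no _ = nothing

  open import Algebra.Solver.Ring ℤ-rawRing (fromCommutativeRing R) morphism ℤ-weaklyDecidable public

module FieldRing (F : FiniteField) where
  open FiniteField F public
  commutativeRing : CommutativeRing 0ℓ 0ℓ
  commutativeRing = record { isCommutativeRing = isCommutativeRing }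
  open IntegerCoefficients commutativeRing public using (solve; _:=_; _:+_; _:*_; :-_; _:-_; Polynomial)
  open IntegerCoefficients commutativeRing using (con)

  :0 :1 : ∀ {n} → Polynomial n
  :0 = con (ℤ.+ 0)
  :1 = con (ℤ.+ 1)

-- Counting by sums of indicators over enumerated types

module FiniteSums where
  open import Data.Nat
  open import Data.Nat.Properties
  module ℕΣ = MonoidSum +-0-commutativeMonoid

  private variable
    P Q : Set

  [_] : Dec P → ℕ
  [ yes _ ] = 1
  [ no _ ] = 0

  []-true : (d : Dec P) → P → [ d ] ≡ 1
  []-true (yes _) _ = refl
  []-true (no ¬p) p = contradiction p ¬p

  []-false : (d : Dec P) → ¬ P → [ d ] ≡ 0
  []-false (yes p) ¬p = contradiction p ¬p
  []-false (no _) _ = refl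

  []-mono : (d : Dec P) (e : Dec Q) → (P → Q) → [ d ] ≤ [ e ]
  []-mono (yes p) e f = ≤-reflexive (sym ([]-true e (f p)))
  []-mono (no _) e f = z≤n

  []-cong : (d : Dec P) (e : Dec Q) → (P → Q) → (Q → P) → [ d ] ≡ [ e ]
  []-cong d e f g = ≤-antisym ([]-mono d e f) ([]-mono e d g)

  ∑-mono : ∀ {n} {f g : Fin n → ℕ} → (∀ i → f i ≤ g i) → ℕΣ.sum f ≤ ℕΣ.sum g
  ∑-mono {zero} h = z≤n
  ∑-mono {suc n} h = +-mono-≤ (h Fin.zero) (∑-mono (h ∘ Fin.suc))

  ∑-*ˡ : ∀ {n} c (f : Fin n → ℕ) → ℕΣ.sum (λ i → c * f i) ≡ c * ℕΣ.sum f
  ∑-*ˡ {zero} c f = sym (*-zeroʳ c)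
  ∑-*ˡ {suc n} c f = trans (cong (λ t → c * f Fin.zero + t) (∑-*ˡ c (f ∘ Fin.suc))) (sym (*-distribˡ-+ c _ _))

  ∑-const : ∀ n c → ℕΣ.sum {n} (λ _ → c) ≡ n * c
  ∑-const zero c = refl
  ∑-const (suc n) c = cong (c +_) (∑-const n c)

  ∑-indicator : ∀ {n} (i : Fin n) (f : Fin n → ℕ) → ℕΣ.sum (λ j → [ i Fin.≟ j ] * f j) ≡ f i
  ∑-indicator {suc n} Fin.zero f = begin
    f Fin.zero + 0 + ℕΣ.sum {n} (λ _ → 0)       ≡⟨ cong₂ _+_ (+-identityʳ _) (trans (∑-const n 0) (*-zeroʳ n)) ⟩
    f Fin.zero + 0                               ≡⟨ +-identityʳ _ ⟩
    f Fin.zero                                   ∎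
    where open ≡-Reasoning
  ∑-indicator {suc n} (Fin.suc i) f = trans
    (ℕΣ.sum-cong-≗ {n} (λ j → cong (_* f (Fin.suc j))
      ([]-cong (Fin.suc i Fin.≟ Fin.suc j) (i Fin.≟ j) Finₚ.suc-injective (cong Fin.suc))))
    (∑-indicator i (f ∘ Fin.suc))

  -- Pigeonhole: a missed `j` could be punched out of the codomain, leaving an injection into a set
  -- with one element fewer.
  Fin-injective⇒surjective : ∀ {n} (f : Fin n → Fin n) → (∀ {i j} → f i ≡ f j → i ≡ j) →
                             ∀ j → ∃[ i ] f i ≡ j
  Fin-injective⇒surjective {suc n} f inj j with Finₚ.any? (λ i → f i Fin.≟ j)
  ... | yes p = p
  ... | no ¬p = contradiction
          (Finₚ.injective⇒≤ {f = λ i → Fin.punchOut (λ e → ¬p (i , sym e))}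
            (λ {x} {y} e → inj (Finₚ.punchOut-injective (λ e → ¬p (x , sym e)) (λ e → ¬p (y , sym e)) e)))
          1+n≰n

  module Enumerated {X : Set} {n : ℕ} (enum : Fin n ↔ X) where
    open Inverse enum using (to; from; strictlyInverseˡ; strictlyInverseʳ)

    to-injective : ∀ {i j} → to i ≡ to j → i ≡ j
    to-injective {i} {j} e = trans (sym (strictlyInverseʳ i)) (trans (cong from e) (strictlyInverseʳ j))

    from-injective : ∀ {x y} → from x ≡ from y → x ≡ y
    from-injective {x} {y} e = trans (sym (strictlyInverseˡ x)) (trans (cong to e) (strictlyInverseˡ y))

    infix 4 _≟ₑ_
    _≟ₑ_ : (x y : X) → Dec (x ≡ y)
    x ≟ₑ y = map′ from-injective (cong from) (from x Fin.≟ from y)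

    any? : {P : X → Set} → Decidable P → Dec (∃ P)
    any? {P} P? = map′ (λ (i , p) → to i , p) (λ (x , p) → from x , subst P (sym (strictlyInverseˡ x)) p)
                       (Finₚ.any? (P? ∘ to))

    ¬∀⇒∃¬ : {P : X → Set} → Decidable P → ¬ (∀ x → P x) → ∃[ x ] ¬ P x
    ¬∀⇒∃¬ {P} P? h with any? (¬? ∘ P?)
    ... | yes p = p
    ... | no ¬p = contradiction (λ x → decide x (P? x)) h
      where decide : ∀ x → Dec (P x) → P x
            decide x (yes p) = p
            decide x (no q) = contradiction (x , q) ¬p

    injective⇒surjective : (f : X → X) → (∀ {x y} → f x ≡ f y → x ≡ y) → ∀ y → ∃[ x ] f x ≡ y
    injective⇒surjective f inj y
      with i , e ← Fin-injective⇒surjective (from ∘ f ∘ to) (to-injective ∘ inj ∘ from-injective) (from y)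
      = to i , from-injective e

    -- If `f` were onto, a section `g` would be injective, hence onto, and `f` would be its
    -- two-sided inverse; then `f a ≡ f b` would force `a ≡ b`. The missed value is the source of
    -- the explicit cubics without roots.
    non-injective⇒missed : (f : X → X) {a b : X} → ¬ a ≡ b → f a ≡ f b → ∃[ y ] (∀ x → ¬ f x ≡ y)
    non-injective⇒missed f {a} {b} a≢b fa≡fb with ¬∀⇒∃¬ (λ y → any? (λ x → f x ≟ₑ y)) ¬onto
      where
      ¬onto : ¬ (∀ y → ∃[ x ] f x ≡ y)
      ¬onto onto = a≢b (begin
        a ≡⟨ eqa ⟨ g ya ≡⟨ cong g (trans (sym (fg ya)) (trans (cong f eqa) (trans fa≡fb (trans (sym (cong f eqb)) (fg yb))))) ⟩
        g yb ≡⟨ eqb ⟩ b ∎)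
        where
        open ≡-Reasoning
        g = λ y → proj₁ (onto y)
        fg : ∀ y → f (g y) ≡ y
        fg y = proj₂ (onto y)
        g-onto = injective⇒surjective g (λ {x} {y} e → trans (sym (fg x)) (trans (cong f e) (fg y)))
        ya = proj₁ (g-onto a)
        eqa = proj₂ (g-onto a)
        yb = proj₁ (g-onto b)
        eqb = proj₂ (g-onto b)
    ... | y , h = y , λ x e → h (x , e)

    ∑ : (X → ℕ) → ℕ
    ∑ f = ℕΣ.sum (f ∘ to)

    ∑-cong : ∀ {f g} → (∀ x → f x ≡ g x) → ∑ f ≡ ∑ g
    ∑-cong h = ℕΣ.sum-cong-≗ (h ∘ to)

    ∑-≤ : ∀ {f g} → (∀ x → f x ≤ g x) → ∑ f ≤ ∑ g
    ∑-≤ h = ∑-mono (h ∘ to)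

    ∑-+ : ∀ f g → ∑ (λ x → f x + g x) ≡ ∑ f + ∑ g
    ∑-+ f g = ℕΣ.∑-distrib-+ (f ∘ to) (g ∘ to)

    ∑-scale : ∀ c f → ∑ (λ x → c * f x) ≡ c * ∑ f
    ∑-scale c f = ∑-*ˡ c (f ∘ to)

    ∑-constant : ∀ c → ∑ (λ _ → c) ≡ n * c
    ∑-constant c = ∑-const n c

    ∑-select : ∀ a (f : X → ℕ) → ∑ (λ x → [ a ≟ₑ x ] * f x) ≡ f a
    ∑-select a f = begin
      ∑ (λ x → [ a ≟ₑ x ] * f x)                              ≡⟨ ℕΣ.sum-cong-≗ (λ j → cong (_* f (to j)) (pick j)) ⟩
      ℕΣ.sum (λ j → [ from a Fin.≟ j ] * f (to j))            ≡⟨ ∑-indicator (from a) (f ∘ to) ⟩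
      f (to (from a))                                         ≡⟨ cong f (strictlyInverseˡ a) ⟩
      f a ∎
      where
      open ≡-Reasoning
      pick : ∀ j → [ a ≟ₑ to j ] ≡ [ from a Fin.≟ j ]
      pick j = []-cong (a ≟ₑ to j) (from a Fin.≟ j) (λ { refl → strictlyInverseʳ j }) (λ { refl → sym (strictlyInverseˡ a) })

    ∑-point : ∀ a → ∑ (λ x → [ a ≟ₑ x ]) ≡ 1
    ∑-point a = trans (∑-cong {λ x → [ a ≟ₑ x ]} (λ x → sym (*-identityʳ _))) (∑-select a (λ _ → 1))

    ∑-≥-term : ∀ a f → f a ≤ ∑ f
    ∑-≥-term a f = subst (_≤ ∑ f) (∑-select a f) (∑-≤ λ x → bound x (a ≟ₑ x))
      where bound : ∀ x (d : Dec (a ≡ x)) → [ d ] * f x ≤ f x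
            bound x (yes _) = ≤-reflexive (+-identityʳ _)
            bound x (no _) = z≤n

    toPermutation : (g h : X → X) → (∀ x → g (h x) ≡ x) → (∀ x → h (g x) ≡ x) → Permutation′ n
    toPermutation g h gh hg = permutation (from ∘ g ∘ to) (from ∘ h ∘ to)
      (λ i → trans (cong (from ∘ g) (strictlyInverseˡ _)) (trans (cong from (gh (to i))) (strictlyInverseʳ i)))
      (λ i → trans (cong (from ∘ h) (strictlyInverseˡ _)) (trans (cong from (hg (to i))) (strictlyInverseʳ i)))

    ∑-reindex : ∀ f (g h : X → X) → (∀ x → g (h x) ≡ x) → (∀ x → h (g x) ≡ x) → ∑ (f ∘ g) ≡ ∑ f
    ∑-reindex f g h gh hg = sym (trans (ℕΣ.sum-permute (f ∘ to) (toPermutation g h gh hg))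
      (ℕΣ.sum-cong-≗ (λ i → cong f (strictlyInverseˡ (g (to i))))))

  module _ {X Y : Set} {m n : ℕ} (eX : Fin m ↔ X) (eY : Fin n ↔ Y) where
    private
      module EX = Enumerated eX
      module EY = Enumerated eY

    ∑-swap : (f : X → Y → ℕ) → EX.∑ (λ x → EY.∑ (f x)) ≡ EY.∑ (λ y → EX.∑ (λ x → f x y))
    ∑-swap f = ℕΣ.∑-comm (λ i j → f (Inverse.to eX i) (Inverse.to eY j))

    ×-enum : Fin (m * n) ↔ (X × Y)
    ×-enum = (eX ×-↔ eY) ↔-∘ Finₚ.*↔×

open FiniteSums

-- Field arithmetic, Fermat's theorem and roots of polynomials

module FieldProperties (F : FiniteField) where
  open FieldRing F public
  open CommutativeRing commutativeRing public
    using (+-assoc; +-comm; +-identityˡ; +-identityʳ; -‿inverseʳ; -‿inverseˡ;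
           *-assoc; *-comm; *-identityˡ; *-identityʳ; distribˡ; distribʳ; zeroˡ; zeroʳ;
           *-commutativeMonoid)
  open Enumerated enum public renaming (_≟ₑ_ to _≟_)

  infixl 6 _-_
  _-_ : Carrier → Carrier → Carrier
  x - y = x + - y

  difference-zero : ∀ {x y} → x - y ≡ 0# → x ≡ y
  difference-zero {x} {y} e = begin
    x           ≡⟨ solve 2 (λ x y → x := x :- y :+ y) refl x y ⟩
    x - y + y   ≡⟨ cong (_+ y) e ⟩
    0# + y      ≡⟨ +-identityˡ y ⟩
    y           ∎
    where open ≡-Reasoning

  zero-difference : ∀ {x y} → x ≡ y → x - y ≡ 0#
  zero-difference refl = -‿inverseʳ _

  vanish : ∀ {a b} k → a ≡ b → k * (a - b) ≡ 0#
  vanish k refl = trans (cong (k *_) (-‿inverseʳ _)) (zeroʳ k)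

  -- An equation as a linear combination of given ones; the last argument is a ring identity.
  combine₁ : ∀ {x y a b} k → a ≡ b → x - y ≡ k * (a - b) → x ≡ y
  combine₁ k p e = difference-zero (trans e (vanish k p))

  combine₂ : ∀ {x y a b a' b'} k l → a ≡ b → a' ≡ b' → x - y ≡ k * (a - b) + l * (a' - b') → x ≡ y
  combine₂ k l p p' e = difference-zero (trans e
    (trans (cong₂ _+_ (vanish k p) (vanish l p')) (+-identityˡ 0#)))

  combine₃ : ∀ {x y a b a' b' a'' b''} k l m → a ≡ b → a' ≡ b' → a'' ≡ b'' →
             x - y ≡ k * (a - b) + l * (a' - b') + m * (a'' - b'') → x ≡ y
  combine₃ k l m p p' p'' e = difference-zero (trans e (trans (cong₂ _+_
    (trans (cong₂ _+_ (vanish k p) (vanish l p')) (+-identityˡ 0#)) (vanish m p'')) (+-identityˡ 0#)))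

  inv : Carrier → Carrier
  inv x with x ≟ 0#
  ... | yes _ = 0#
  ... | no x≢0 = proj₁ (inverse x x≢0)

  inv-inverseʳ : ∀ {x} → ¬ x ≡ 0# → x * inv x ≡ 1#
  inv-inverseʳ {x} x≢0 with x ≟ 0#
  ... | yes x≡0 = contradiction x≡0 x≢0
  ... | no h = proj₂ (inverse x h)

  inv-inverseˡ : ∀ {x} → ¬ x ≡ 0# → inv x * x ≡ 1#
  inv-inverseˡ x≢0 = trans (*-comm _ _) (inv-inverseʳ x≢0)

  *-cancelˡ-0 : ∀ {x y} → ¬ x ≡ 0# → x * y ≡ 0# → y ≡ 0#
  *-cancelˡ-0 {x} {y} x≢0 e = combine₂ (inv x) (- y) e (inv-inverseˡ x≢0)
    (solve 4 (λ x y i o → y :- :0 := i :* (x :* y :- :0) :+ (:- y) :* (i :* x :- :1))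
      refl x y (inv x) 0#)

  *-cancelˡ : ∀ {x y z} → ¬ x ≡ 0# → x * y ≡ x * z → y ≡ z
  *-cancelˡ {x} {y} {z} x≢0 e = difference-zero (*-cancelˡ-0 x≢0
    (trans (solve 3 (λ x y z → x :* (y :- z) := x :* y :- x :* z) refl x y z) (zero-difference e)))

  zero-product : ∀ {x y} → x * y ≡ 0# → x ≡ 0# ⊎ y ≡ 0#
  zero-product {x} e with x ≟ 0#
  ... | yes p = inj₁ p
  ... | no p = inj₂ (*-cancelˡ-0 p e)

  *-≢0 : ∀ {x y} → ¬ x ≡ 0# → ¬ y ≡ 0# → ¬ x * y ≡ 0#
  *-≢0 x≢0 y≢0 e = y≢0 (*-cancelˡ-0 x≢0 e)

  1≢0 : ¬ 1# ≡ 0#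
  1≢0 e = 0≢1 (sym e)

  inv-≢0 : ∀ {x} → ¬ x ≡ 0# → ¬ inv x ≡ 0#
  inv-≢0 {x} x≢0 e = 1≢0 (trans (sym (inv-inverseʳ x≢0)) (trans (cong (x *_) e) (zeroʳ x)))

  module ∏ = MonoidSum *-commutativeMonoid

  infixr 8 _^_
  _^_ : Carrier → ℕ → Carrier
  x ^ zero = 1#
  x ^ suc n = x * x ^ n

  ∏-const : ∀ n x → ∏.sum {n} (λ _ → x) ≡ x ^ n
  ∏-const zero x = refl
  ∏-const (suc n) x = cong (x *_) (∏-const n x)

  choose : {A : Set} {P : Set} → Dec P → A → A → A
  choose (yes _) a b = a
  choose (no _) a b = b

  ∏-single : ∀ {n} (i : Fin n) x → ∏.sum (λ j → choose (i Fin.≟ j) x 1#) ≡ x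
  ∏-single {suc n} Fin.zero x = trans (cong (x *_) (∏.sum-replicate-zero n)) (*-identityʳ x)
  ∏-single {suc n} (Fin.suc i) x = trans (*-identityˡ _)
    (trans (∏.sum-cong-≗ {n} (λ j → same j (Fin.suc i Fin.≟ Fin.suc j) (i Fin.≟ j))) (∏-single i x))
    where
    same : ∀ j (d : Dec (Fin.suc i ≡ Fin.suc j)) (e : Dec (i ≡ j)) → choose d x 1# ≡ choose e x 1#
    same j (yes _) (yes _) = refl
    same j (yes p) (no q) = contradiction (Finₚ.suc-injective p) q
    same j (no p) (yes q) = contradiction (cong Fin.suc q) p
    same j (no _) (no _) = refl

  ∏-≢0 : ∀ {n} (f : Fin n → Carrier) → (∀ i → ¬ f i ≡ 0#) → ¬ ∏.sum f ≡ 0#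
  ∏-≢0 {zero} f h = 1≢0
  ∏-≢0 {suc n} f h = *-≢0 (h Fin.zero) (∏-≢0 (f ∘ Fin.suc) (h ∘ Fin.suc))

  -- Multiplication by x permutes the nonzero elements, so it does not change their product.
  fermat-≢0 : ∀ x → ¬ x ≡ 0# → x ^ q ≡ x
  fermat-≢0 x x≢0 = begin
    x ^ q                                           ≡⟨ ∏-const q x ⟨
    ∏.sum {q} (λ _ → x)                             ≡⟨ ∏.sum-cong-≗ {q} (λ i → split i (to i ≟ 0#) (from 0# Fin.≟ i)) ⟩
    ∏.sum (λ i → e₀ i * e (to i))                   ≡⟨ ∏.∑-distrib-+ e₀ (e ∘ to) ⟩
    ∏.sum e₀ * ∏.sum (e ∘ to)                       ≡⟨ cong₂ _*_ (∏-single (from 0#) x) ∏e≡1 ⟩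
    x * 1#                                          ≡⟨ *-identityʳ x ⟩
    x                                               ∎
    where
    open ≡-Reasoning
    open Inverse enum using (to; from; strictlyInverseˡ; strictlyInverseʳ)
    -- The product over all elements would contain 0, so the factor at 0 is replaced by 1: away from
    -- 0, `g` is the identity and `e` the constant x. `e₀` supplies the factor x left out at 0,
    -- whence the exponent q and not q - 1.
    e g : Carrier → Carrier
    e κ = choose (κ ≟ 0#) 1# x
    g κ = choose (κ ≟ 0#) 1# κ
    e₀ : Fin q → Carrier
    e₀ i = choose (from 0# Fin.≟ i) x 1#
    split : ∀ i (d : Dec (to i ≡ 0#)) (d' : Dec (from 0# ≡ i)) → x ≡ choose d' x 1# * choose d 1# x
    split i (yes _) (yes _) = sym (*-identityʳ x)
    split i (yes p) (no ¬p) = contradiction (trans (cong from (sym p)) (strictlyInverseʳ i)) ¬p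
    split i (no ¬p) (yes p) = contradiction (trans (cong to (sym p)) (strictlyInverseˡ 0#)) ¬p
    split i (no _) (no _) = sym (*-identityˡ x)
    scaled : ∀ κ (d : Dec (x * κ ≡ 0#)) (d' : Dec (κ ≡ 0#)) →
          choose d 1# (x * κ) ≡ choose d' 1# x * choose d' 1# κ
    scaled κ (yes _) (yes _) = sym (*-identityʳ 1#)
    scaled κ (yes p) (no ¬p) = contradiction (*-cancelˡ-0 x≢0 p) ¬p
    scaled κ (no ¬p) (yes p) = contradiction (trans (cong (x *_) p) (zeroʳ x)) ¬p
    scaled κ (no _) (no _) = refl
    nonzero : ∀ κ (d : Dec (κ ≡ 0#)) → ¬ choose d 1# κ ≡ 0#
    nonzero κ (yes _) = 1≢0
    nonzero κ (no ¬p) = ¬p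
    π = toPermutation (x *_) (inv x *_)
      (λ κ → trans (sym (*-assoc _ _ _)) (trans (cong (_* κ) (inv-inverseʳ x≢0)) (*-identityˡ κ)))
      (λ κ → trans (sym (*-assoc _ _ _)) (trans (cong (_* κ) (inv-inverseˡ x≢0)) (*-identityˡ κ)))
    ∏g = ∏.sum (g ∘ to)
    permuted : ∏g ≡ ∏.sum (e ∘ to) * ∏g
    permuted = begin
      ∏g                                       ≡⟨ ∏.sum-permute (g ∘ to) π ⟩
      ∏.sum (λ i → g (to (from (x * to i))))   ≡⟨ ∏.sum-cong-≗ (λ i → trans (cong g (strictlyInverseˡ _))
                                                    (scaled (to i) (x * to i ≟ 0#) (to i ≟ 0#))) ⟩
      ∏.sum (λ i → e (to i) * g (to i))        ≡⟨ ∏.∑-distrib-+ (e ∘ to) (g ∘ to) ⟩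
      ∏.sum (e ∘ to) * ∏g                      ∎
    ∏e≡1 : ∏.sum (e ∘ to) ≡ 1#
    ∏e≡1 = *-cancelˡ (∏-≢0 (g ∘ to) (λ i → nonzero (to i) (to i ≟ 0#)))
      (trans (*-comm _ _) (trans (sym permuted) (sym (*-identityʳ ∏g))))

  -- An element of `Fin n` serves as evidence that n is positive.
  0^suc : ∀ {n} → Fin n → 0# ^ n ≡ 0#
  0^suc {suc n} _ = zeroˡ _

  fermat : ∀ x → x ^ q ≡ x
  fermat x with x ≟ 0#
  ... | yes refl = 0^suc (Inverse.from enum 0#)
  ... | no x≢0 = fermat-≢0 x x≢0

  -- c₀ ∷ … ∷ cₙ₋₁ ∷ [] stands for the monic polynomial c₀ + … + cₙ₋₁ xⁿ⁻¹ + xⁿ.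
  monic : ∀ {n} → Vec Carrier n → Carrier → Carrier
  monic [] x = 1#
  monic (c ∷ cs) x = x * monic cs x + c

  -- Synthetic division by x - r: the coefficients are the intermediate values of Horner's scheme at
  -- `r`, and the remainder is `monic p r`.
  quotient : ∀ {n} → Vec Carrier (suc n) → Carrier → Vec Carrier n
  quotient (c ∷ []) r = []
  quotient (c ∷ d ∷ ds) r = monic (d ∷ ds) r ∷ quotient (d ∷ ds) r

  monic-quotient : ∀ {n} (p : Vec Carrier (suc n)) r x →
                   monic p x - monic p r ≡ (x - r) * monic (quotient p r) x
  monic-quotient (c ∷ []) r x =
    solve 3 (λ c r x → x :* :1 :+ c :- (r :* :1 :+ c) := (x :- r) :* :1) refl c r x
  monic-quotient (c ∷ d ∷ ds) r x = combine₁ x (monic-quotient (d ∷ ds) r x)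
    (solve 6 (λ c r x u v w → x :* u :+ c :- (r :* v :+ c) :- (x :- r) :* (x :* w :+ v)
                             := x :* (u :- v :- (x :- r) :* w)) refl
      c r x (monic (d ∷ ds) x) (monic (d ∷ ds) r) (monic (quotient (d ∷ ds) r) x))

  roots-≤ : ∀ {n} (p : Vec Carrier n) → ∑ (λ x → [ monic p x ≟ 0# ]) ℕ.≤ n
  roots-≤ {zero} [] = ℕₚ.≤-reflexive (trans (∑-cong (λ x → []-false (1# ≟ 0#) 1≢0))
                                           (trans (∑-constant 0) (ℕₚ.*-zeroʳ q)))
  roots-≤ {suc n} p with any? (λ x → monic p x ≟ 0#)
  ... | no ¬root = ℕₚ.≤-trans (ℕₚ.≤-reflexive (trans (∑-cong (λ x → []-false (monic p x ≟ 0#) (λ e → ¬root (x , e))))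
                                                  (trans (∑-constant 0) (ℕₚ.*-zeroʳ q)))) ℕ.z≤n
  ... | yes (r , pr≡0) = begin
    ∑ (λ x → [ monic p x ≟ 0# ])                                        ≤⟨ ∑-≤ split ⟩
    ∑ (λ x → [ r ≟ x ] ℕ.+ [ monic (quotient p r) x ≟ 0# ])             ≡⟨ ∑-+ (λ x → [ r ≟ x ]) (λ x → [ monic (quotient p r) x ≟ 0# ]) ⟩
    ∑ (λ x → [ r ≟ x ]) ℕ.+ ∑ (λ x → [ monic (quotient p r) x ≟ 0# ])   ≤⟨ ℕₚ.+-mono-≤ (ℕₚ.≤-reflexive (∑-point r)) (roots-≤ (quotient p r)) ⟩
    suc n                                                               ∎
    where
    open ℕₚ.≤-Reasoning
    split : ∀ x → [ monic p x ≟ 0# ] ℕ.≤ [ r ≟ x ] ℕ.+ [ monic (quotient p r) x ≟ 0# ]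
    split x with monic p x ≟ 0#
    ... | no _ = ℕ.z≤n
    ... | yes px≡0 with zero-product {x - r} {monic (quotient p r) x}
                          (trans (sym (monic-quotient p r x)) (trans (cong₂ _-_ px≡0 pr≡0) (-‿inverseʳ 0#)))
    ... | inj₁ x≡r = ℕₚ.≤-trans (ℕₚ.≤-reflexive (sym ([]-true (r ≟ x) (sym (difference-zero x≡r))))) (ℕₚ.m≤m+n _ _)
    ... | inj₂ root = ℕₚ.≤-trans (ℕₚ.≤-reflexive (sym ([]-true (monic (quotient p r) x ≟ 0#) root))) (ℕₚ.m≤n+m _ _)

-- The cubic extension k[θ] with θ³ = aθ² - bθ + d

record Triple (A : Set) : Set where
  constructor ⟨_,_,_⟩
  field x₀ x₁ x₂ : A
open Triple

⟨⟩-cong : {A : Set} {a b c a' b' c' : A} → a ≡ a' → b ≡ b' → c ≡ c' → ⟨ a , b , c ⟩ ≡ ⟨ a' , b' , c' ⟩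
⟨⟩-cong refl refl refl = refl

Triple-enum : {A : Set} {n : ℕ} → Fin n ↔ A → Fin (n ℕ.* (n ℕ.* n)) ↔ Triple A
Triple-enum e = mk↔ₛ′ (λ (a , b , c) → ⟨ a , b , c ⟩) (λ x → x₀ x , x₁ x , x₂ x) (λ _ → refl) (λ _ → refl)
                ↔-∘ ×-enum e (×-enum e e)

module CubicExtension (k : FiniteField) where
  open FieldProperties k

  cubic : (a b d x : Carrier) → Carrier
  cubic a b d x = x * x * x - a * (x * x) + b * x - d

  :cubic : ∀ {n} (a b d x : Polynomial n) → Polynomial n
  :cubic a b d x = x :* x :* x :- a :* (x :* x) :+ b :* x :- d

  module Quotient (a b d : Carrier) (rootless : ∀ x → ¬ cubic a b d x ≡ 0#) where

    K = Triple Carrier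

    infixl 6 _⊕_
    infixl 7 _⊗_
    -- Coordinates with respect to 1, θ, θ². The coefficients of x₁y₂ + x₂y₁ come from θ³ = aθ² - bθ
    -- + d, those of x₂y₂ from θ⁴ = (a² - b)θ² + (d - ab)θ + ad.
    _⊕_ _⊗_ : K → K → K
    ⟨ x₀ , x₁ , x₂ ⟩ ⊕ ⟨ y₀ , y₁ , y₂ ⟩ = ⟨ x₀ + y₀ , x₁ + y₁ , x₂ + y₂ ⟩
    ⟨ x₀ , x₁ , x₂ ⟩ ⊗ ⟨ y₀ , y₁ , y₂ ⟩ = ⟨
      x₀ * y₀ + d * (x₁ * y₂ + x₂ * y₁) + a * d * (x₂ * y₂) ,
      x₀ * y₁ + x₁ * y₀ - b * (x₁ * y₂ + x₂ * y₁) + (d - a * b) * (x₂ * y₂) ,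
      x₀ * y₂ + x₁ * y₁ + x₂ * y₀ + a * (x₁ * y₂ + x₂ * y₁) + (a * a - b) * (x₂ * y₂) ⟩

    ⊖_ : K → K
    ⊖ ⟨ x₀ , x₁ , x₂ ⟩ = ⟨ - x₀ , - x₁ , - x₂ ⟩

    ι : Carrier → K
    ι x = ⟨ x , 0# , 0# ⟩

    θ : K
    θ = ⟨ 0# , 1# , 0# ⟩

    private
      :⊗₀ :⊗₁ :⊗₂ : ∀ {n} (a b d x₀ x₁ x₂ y₀ y₁ y₂ : Polynomial n) → Polynomial n
      :⊗₀ a b d x₀ x₁ x₂ y₀ y₁ y₂ = x₀ :* y₀ :+ d :* (x₁ :* y₂ :+ x₂ :* y₁) :+ a :* d :* (x₂ :* y₂)
      :⊗₁ a b d x₀ x₁ x₂ y₀ y₁ y₂ = x₀ :* y₁ :+ x₁ :* y₀ :- b :* (x₁ :* y₂ :+ x₂ :* y₁) :+ (d :- a :* b) :* (x₂ :* y₂)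
      :⊗₂ a b d x₀ x₁ x₂ y₀ y₁ y₂ = x₀ :* y₂ :+ x₁ :* y₁ :+ x₂ :* y₀ :+ a :* (x₁ :* y₂ :+ x₂ :* y₁) :+ (a :* a :- b) :* (x₂ :* y₂)

    ⊗-comm : ∀ x y → x ⊗ y ≡ y ⊗ x
    ⊗-comm ⟨ x₀ , x₁ , x₂ ⟩ ⟨ y₀ , y₁ , y₂ ⟩ = ⟨⟩-cong
      (solve 9 (λ a b d x₀ x₁ x₂ y₀ y₁ y₂ → :⊗₀ a b d x₀ x₁ x₂ y₀ y₁ y₂ := :⊗₀ a b d y₀ y₁ y₂ x₀ x₁ x₂) refl a b d x₀ x₁ x₂ y₀ y₁ y₂)
      (solve 9 (λ a b d x₀ x₁ x₂ y₀ y₁ y₂ → :⊗₁ a b d x₀ x₁ x₂ y₀ y₁ y₂ := :⊗₁ a b d y₀ y₁ y₂ x₀ x₁ x₂) refl a b d x₀ x₁ x₂ y₀ y₁ y₂)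
      (solve 9 (λ a b d x₀ x₁ x₂ y₀ y₁ y₂ → :⊗₂ a b d x₀ x₁ x₂ y₀ y₁ y₂ := :⊗₂ a b d y₀ y₁ y₂ x₀ x₁ x₂) refl a b d x₀ x₁ x₂ y₀ y₁ y₂)

    ⊗-assoc : ∀ x y z → x ⊗ y ⊗ z ≡ x ⊗ (y ⊗ z)
    ⊗-assoc ⟨ x₀ , x₁ , x₂ ⟩ ⟨ y₀ , y₁ , y₂ ⟩ ⟨ z₀ , z₁ , z₂ ⟩ = ⟨⟩-cong
      (solve 12 (λ a b d x₀ x₁ x₂ y₀ y₁ y₂ z₀ z₁ z₂ → let m = λ (f : ∀ {n} (a b d x₀ x₁ x₂ y₀ y₁ y₂ : Polynomial n) → Polynomial n) → f a b d in
         m :⊗₀ (m :⊗₀ x₀ x₁ x₂ y₀ y₁ y₂) (m :⊗₁ x₀ x₁ x₂ y₀ y₁ y₂) (m :⊗₂ x₀ x₁ x₂ y₀ y₁ y₂) z₀ z₁ z₂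
         := m :⊗₀ x₀ x₁ x₂ (m :⊗₀ y₀ y₁ y₂ z₀ z₁ z₂) (m :⊗₁ y₀ y₁ y₂ z₀ z₁ z₂) (m :⊗₂ y₀ y₁ y₂ z₀ z₁ z₂)) refl a b d x₀ x₁ x₂ y₀ y₁ y₂ z₀ z₁ z₂)
      (solve 12 (λ a b d x₀ x₁ x₂ y₀ y₁ y₂ z₀ z₁ z₂ → let m = λ (f : ∀ {n} (a b d x₀ x₁ x₂ y₀ y₁ y₂ : Polynomial n) → Polynomial n) → f a b d in
         m :⊗₁ (m :⊗₀ x₀ x₁ x₂ y₀ y₁ y₂) (m :⊗₁ x₀ x₁ x₂ y₀ y₁ y₂) (m :⊗₂ x₀ x₁ x₂ y₀ y₁ y₂) z₀ z₁ z₂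
         := m :⊗₁ x₀ x₁ x₂ (m :⊗₀ y₀ y₁ y₂ z₀ z₁ z₂) (m :⊗₁ y₀ y₁ y₂ z₀ z₁ z₂) (m :⊗₂ y₀ y₁ y₂ z₀ z₁ z₂)) refl a b d x₀ x₁ x₂ y₀ y₁ y₂ z₀ z₁ z₂)
      (solve 12 (λ a b d x₀ x₁ x₂ y₀ y₁ y₂ z₀ z₁ z₂ → let m = λ (f : ∀ {n} (a b d x₀ x₁ x₂ y₀ y₁ y₂ : Polynomial n) → Polynomial n) → f a b d in
         m :⊗₂ (m :⊗₀ x₀ x₁ x₂ y₀ y₁ y₂) (m :⊗₁ x₀ x₁ x₂ y₀ y₁ y₂) (m :⊗₂ x₀ x₁ x₂ y₀ y₁ y₂) z₀ z₁ z₂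
         := m :⊗₂ x₀ x₁ x₂ (m :⊗₀ y₀ y₁ y₂ z₀ z₁ z₂) (m :⊗₁ y₀ y₁ y₂ z₀ z₁ z₂) (m :⊗₂ y₀ y₁ y₂ z₀ z₁ z₂)) refl a b d x₀ x₁ x₂ y₀ y₁ y₂ z₀ z₁ z₂)

    ⊗-distribˡ : ∀ x y z → x ⊗ (y ⊕ z) ≡ x ⊗ y ⊕ x ⊗ z
    ⊗-distribˡ ⟨ x₀ , x₁ , x₂ ⟩ ⟨ y₀ , y₁ , y₂ ⟩ ⟨ z₀ , z₁ , z₂ ⟩ = ⟨⟩-cong
      (solve 12 (λ a b d x₀ x₁ x₂ y₀ y₁ y₂ z₀ z₁ z₂ → :⊗₀ a b d x₀ x₁ x₂ (y₀ :+ z₀) (y₁ :+ z₁) (y₂ :+ z₂)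
         := :⊗₀ a b d x₀ x₁ x₂ y₀ y₁ y₂ :+ :⊗₀ a b d x₀ x₁ x₂ z₀ z₁ z₂) refl a b d x₀ x₁ x₂ y₀ y₁ y₂ z₀ z₁ z₂)
      (solve 12 (λ a b d x₀ x₁ x₂ y₀ y₁ y₂ z₀ z₁ z₂ → :⊗₁ a b d x₀ x₁ x₂ (y₀ :+ z₀) (y₁ :+ z₁) (y₂ :+ z₂)
         := :⊗₁ a b d x₀ x₁ x₂ y₀ y₁ y₂ :+ :⊗₁ a b d x₀ x₁ x₂ z₀ z₁ z₂) refl a b d x₀ x₁ x₂ y₀ y₁ y₂ z₀ z₁ z₂)
      (solve 12 (λ a b d x₀ x₁ x₂ y₀ y₁ y₂ z₀ z₁ z₂ → :⊗₂ a b d x₀ x₁ x₂ (y₀ :+ z₀) (y₁ :+ z₁) (y₂ :+ z₂)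
         := :⊗₂ a b d x₀ x₁ x₂ y₀ y₁ y₂ :+ :⊗₂ a b d x₀ x₁ x₂ z₀ z₁ z₂) refl a b d x₀ x₁ x₂ y₀ y₁ y₂ z₀ z₁ z₂)

    ι-⊗ : ∀ c x → ι c ⊗ x ≡ ⟨ c * x₀ x , c * x₁ x , c * x₂ x ⟩
    ι-⊗ c ⟨ x₀ , x₁ , x₂ ⟩ = ⟨⟩-cong
      (solve 7 (λ a b d c x₀ x₁ x₂ → :⊗₀ a b d c :0 :0 x₀ x₁ x₂ := c :* x₀) refl a b d c x₀ x₁ x₂)
      (solve 7 (λ a b d c x₀ x₁ x₂ → :⊗₁ a b d c :0 :0 x₀ x₁ x₂ := c :* x₁) refl a b d c x₀ x₁ x₂)
      (solve 7 (λ a b d c x₀ x₁ x₂ → :⊗₂ a b d c :0 :0 x₀ x₁ x₂ := c :* x₂) refl a b d c x₀ x₁ x₂)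

    ⊗-identityˡ : ∀ x → ι 1# ⊗ x ≡ x
    ⊗-identityˡ x = trans (ι-⊗ 1# x) (⟨⟩-cong (*-identityˡ _) (*-identityˡ _) (*-identityˡ _))

    ι-* : ∀ x y → ι (x * y) ≡ ι x ⊗ ι y
    ι-* x y = sym (trans (ι-⊗ x (ι y)) (⟨⟩-cong refl (zeroʳ x) (zeroʳ x)))

    ι-+ : ∀ x y → ι (x + y) ≡ ι x ⊕ ι y
    ι-+ x y = ⟨⟩-cong refl (sym (+-identityˡ 0#)) (sym (+-identityˡ 0#))

    K-isCommutativeRing : IsCommutativeRing _≡_ _⊕_ _⊗_ ⊖_ (ι 0#) (ι 1#)
    K-isCommutativeRing = record
      { isRing = record
        { +-isAbelianGroup = record
          { isGroup = record
            { isMonoid = record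
              { isSemigroup = record
                { isMagma = record { isEquivalence = isEquivalence ; ∙-cong = cong₂ _⊕_ }
                ; assoc = λ _ _ _ → ⟨⟩-cong (+-assoc _ _ _) (+-assoc _ _ _) (+-assoc _ _ _) }
              ; identity = (λ _ → ⟨⟩-cong (+-identityˡ _) (+-identityˡ _) (+-identityˡ _))
                         , (λ _ → ⟨⟩-cong (+-identityʳ _) (+-identityʳ _) (+-identityʳ _)) }
            ; inverse = (λ _ → ⟨⟩-cong (-‿inverseˡ _) (-‿inverseˡ _) (-‿inverseˡ _))
                      , (λ _ → ⟨⟩-cong (-‿inverseʳ _) (-‿inverseʳ _) (-‿inverseʳ _))
            ; ⁻¹-cong = cong ⊖_ }
          ; comm = λ _ _ → ⟨⟩-cong (+-comm _ _) (+-comm _ _) (+-comm _ _) }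
        ; *-cong = cong₂ _⊗_
        ; *-assoc = ⊗-assoc
        ; *-identity = ⊗-identityˡ , λ x → trans (⊗-comm x (ι 1#)) (⊗-identityˡ x)
        ; distrib = ⊗-distribˡ , λ x y z → trans (⊗-comm (y ⊕ z) x)
            (trans (⊗-distribˡ x y z) (cong₂ _⊕_ (⊗-comm x y) (⊗-comm x z))) }
      ; *-comm = ⊗-comm }

    Unit : K → Set
    Unit x = ∃[ y ] x ⊗ y ≡ ι 1#

    unit-ι : ∀ {x} → ¬ x ≡ 0# → Unit (ι x)
    unit-ι {x} x≢0 = ι (inv x) , trans (sym (ι-* x (inv x))) (cong ι (inv-inverseʳ x≢0))

    divisor-of-unit : ∀ {x} y → Unit (x ⊗ y) → Unit x
    divisor-of-unit {x} y (z , e) = y ⊗ z , trans (sym (⊗-assoc x y z)) e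

    -- The cofactor is chosen so that the product is the norm, which equals -x₁³ times the cubic at
    -- -x₀/x₁ and is nonzero because the cubic has no root.
    unit-linear : ∀ x₀ x₁ → ¬ (x₀ ≡ 0# × x₁ ≡ 0#) → Unit ⟨ x₀ , x₁ , 0# ⟩
    unit-linear x₀ x₁ nz with x₁ ≟ 0#
    ... | yes refl = unit-ι (λ e → nz (e , refl))
    ... | no x₁≢0 = divisor-of-unit ⟨ x₀ * x₀ + a * (x₀ * x₁) + b * (x₁ * x₁) , - (x₀ * x₁) - a * (x₁ * x₁) , x₁ * x₁ ⟩
                      (subst Unit (sym product) (unit-ι norm≢0))
      where
      norm = x₀ * x₀ * x₀ + a * (x₀ * x₀) * x₁ + b * x₀ * (x₁ * x₁) + d * (x₁ * x₁ * x₁)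
      product : ⟨ x₀ , x₁ , 0# ⟩ ⊗ ⟨ x₀ * x₀ + a * (x₀ * x₁) + b * (x₁ * x₁) , - (x₀ * x₁) - a * (x₁ * x₁) , x₁ * x₁ ⟩ ≡ ι norm
      product = ⟨⟩-cong
        (solve 5 (λ a b d x₀ x₁ → :⊗₀ a b d x₀ x₁ :0 (x₀ :* x₀ :+ a :* (x₀ :* x₁) :+ b :* (x₁ :* x₁)) (:- (x₀ :* x₁) :- a :* (x₁ :* x₁)) (x₁ :* x₁)
           := x₀ :* x₀ :* x₀ :+ a :* (x₀ :* x₀) :* x₁ :+ b :* x₀ :* (x₁ :* x₁) :+ d :* (x₁ :* x₁ :* x₁)) refl a b d x₀ x₁)
        (solve 5 (λ a b d x₀ x₁ → :⊗₁ a b d x₀ x₁ :0 (x₀ :* x₀ :+ a :* (x₀ :* x₁) :+ b :* (x₁ :* x₁)) (:- (x₀ :* x₁) :- a :* (x₁ :* x₁)) (x₁ :* x₁)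
           := :0) refl a b d x₀ x₁)
        (solve 5 (λ a b d x₀ x₁ → :⊗₂ a b d x₀ x₁ :0 (x₀ :* x₀ :+ a :* (x₀ :* x₁) :+ b :* (x₁ :* x₁)) (:- (x₀ :* x₁) :- a :* (x₁ :* x₁)) (x₁ :* x₁)
           := :0) refl a b d x₀ x₁)
      norm≢0 : ¬ norm ≡ 0#
      norm≢0 e = rootless (- (x₀ * i)) (combine₂ (- (i * i * i))
          (a * (x₀ * x₀ * (i * i)) + b * (x₀ * i) * (x₁ * i + 1#) + d * (x₁ * x₁ * (i * i) + x₁ * i + 1#))
          e (inv-inverseʳ x₁≢0)
          (solve 6 (λ a b d x₀ x₁ i → :cubic a b d (:- (x₀ :* i)) :- :0 :=
             (:- (i :* i :* i)) :* (x₀ :* x₀ :* x₀ :+ a :* (x₀ :* x₀) :* x₁ :+ b :* x₀ :* (x₁ :* x₁) :+ d :* (x₁ :* x₁ :* x₁) :- :0)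
             :+ (a :* (x₀ :* x₀ :* (i :* i)) :+ b :* (x₀ :* i) :* (x₁ :* i :+ :1) :+ d :* (x₁ :* x₁ :* (i :* i) :+ x₁ :* i :+ :1)) :* (x₁ :* i :- :1))
            refl a b d x₀ x₁ i))
        where i = inv x₁

    -- Multiplying by v clears the quadratic term; if the product vanished, −v₀/v₁ would be a root of the cubic.
    unit-quadratic : ∀ x₀ x₁ x₂ → ¬ x₂ ≡ 0# → Unit ⟨ x₀ , x₁ , x₂ ⟩
    unit-quadratic x₀ x₁ x₂ x₂≢0 with (Triple.x₀ (x ⊗ v) ≟ 0#) ×-dec (Triple.x₁ (x ⊗ v) ≟ 0#)
      where
      x = ⟨ x₀ , x₁ , x₂ ⟩
      v = ⟨ - x₁ - a * x₂ , x₂ , 0# ⟩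
    ... | no nz = divisor-of-unit v (subst Unit (⟨⟩-cong refl refl (sym quadratic-term)) (unit-linear _ _ nz))
      where
      v = ⟨ - x₁ - a * x₂ , x₂ , 0# ⟩
      quadratic-term : Triple.x₂ (⟨ x₀ , x₁ , x₂ ⟩ ⊗ v) ≡ 0#
      quadratic-term = solve 6 (λ a b d x₀ x₁ x₂ → :⊗₂ a b d x₀ x₁ x₂ (:- x₁ :- a :* x₂) x₂ :0 := :0) refl a b d x₀ x₁ x₂
    ... | yes (e₀ , e₁) = contradiction (*-cancelˡ-0 x₂≢0 (*-cancelˡ-0 x₂≢0
            (combine₃ (- (v₀ * (x₀ + x₁ * r + x₂ * (r * r)))) (- 1#) (- r) (inv-inverseʳ x₂≢0) e₀ e₁
              (solve 7 (λ a b d x₀ x₁ x₂ i → let v₀ = :- x₁ :- a :* x₂ ; r = :- (v₀ :* i) in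
                 x₂ :* (x₂ :* :cubic a b d r) :- :0 :=
                 (:- (v₀ :* (x₀ :+ x₁ :* r :+ x₂ :* (r :* r)))) :* (x₂ :* i :- :1)
                 :+ (:- :1) :* (:⊗₀ a b d x₀ x₁ x₂ v₀ x₂ :0 :- :0)
                 :+ (:- r) :* (:⊗₁ a b d x₀ x₁ x₂ v₀ x₂ :0 :- :0))
                refl a b d x₀ x₁ x₂ (inv x₂)))))
            (rootless r)
      where
      v₀ = - x₁ - a * x₂
      r = - (v₀ * inv x₂)

    K-inverse : ∀ x → ¬ x ≡ ι 0# → Unit x
    K-inverse ⟨ x₀ , x₁ , x₂ ⟩ x≢0 with x₂ ≟ 0#
    ... | yes refl = unit-linear x₀ x₁ (λ { (refl , refl) → x≢0 refl })
    ... | no x₂≢0 = unit-quadratic x₀ x₁ x₂ x₂≢0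

    field′ : FiniteField
    field′ = record
      { Carrier = K ; _+_ = _⊕_ ; _*_ = _⊗_ ; -_ = ⊖_ ; 0# = ι 0# ; 1# = ι 1#
      ; isCommutativeRing = K-isCommutativeRing
      ; 0≢1 = λ e → 0≢1 (cong Triple.x₀ e)
      ; inverse = K-inverse
      ; q = q ℕ.* (q ℕ.* q)
      ; enum = Triple-enum enum }

    θ-⊗ : ∀ p → θ ⊗ p ≡ ⟨ d * x₂ p , x₀ p - b * x₂ p , x₁ p + a * x₂ p ⟩
    θ-⊗ ⟨ p₀ , p₁ , p₂ ⟩ = ⟨⟩-cong
      (solve 6 (λ a b d p₀ p₁ p₂ → :⊗₀ a b d :0 :1 :0 p₀ p₁ p₂ := d :* p₂) refl a b d p₀ p₁ p₂)
      (solve 6 (λ a b d p₀ p₁ p₂ → :⊗₁ a b d :0 :1 :0 p₀ p₁ p₂ := p₀ :- b :* p₂) refl a b d p₀ p₁ p₂)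
      (solve 6 (λ a b d p₀ p₁ p₂ → :⊗₂ a b d :0 :1 :0 p₀ p₁ p₂ := p₁ :+ a :* p₂) refl a b d p₀ p₁ p₂)

-- Embeddings, and roots of a cubic in a field of q³ elements

record Embedding (k L : FiniteField) : Set where
  private
    module k = FieldProperties k
    module L = FieldProperties L
  field
    ι   : k.Carrier → L.Carrier
    ι-+ : ∀ x y → ι (x k.+ y) ≡ ι x L.+ ι y
    ι-* : ∀ x y → ι (x k.* y) ≡ ι x L.* ι y
    ι-1 : ι k.1# ≡ L.1#

  ι-0 : ι k.0# ≡ L.0#
  ι-0 = L.combine₁ (L.- L.1#) (trans (cong ι (sym (k.+-identityˡ k.0#))) (ι-+ k.0# k.0#))
    (L.solve 1 (λ z → z L.:- L.:0 L.:= (L.:- L.:1) L.:* (z L.:- (z L.:+ z))) refl (ι k.0#))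

  ι-neg : ∀ x → ι (k.- x) ≡ L.- ι x
  ι-neg x = L.combine₁ L.1# (trans (sym (ι-+ (k.- x) x)) (trans (cong ι (k.-‿inverseˡ x)) ι-0))
    (L.solve 2 (λ y z → y L.:- (L.:- z) L.:= L.:1 L.:* (y L.:+ z L.:- L.:0)) refl (ι (k.- x)) (ι x))

  ι-- : ∀ x y → ι (x k.- y) ≡ ι x L.- ι y
  ι-- x y = trans (ι-+ x (k.- y)) (cong (ι x L.+_) (ι-neg y))

  ι-≢0 : ∀ {x} → ¬ x ≡ k.0# → ¬ ι x ≡ L.0#
  ι-≢0 {x} x≢0 e = L.1≢0 (begin
    L.1#                     ≡⟨ ι-1 ⟨
    ι k.1#                   ≡⟨ cong ι (k.inv-inverseʳ x≢0) ⟨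
    ι (x k.* k.inv x)        ≡⟨ ι-* x (k.inv x) ⟩
    ι x L.* ι (k.inv x)      ≡⟨ cong (L._* _) e ⟩
    L.0# L.* ι (k.inv x)     ≡⟨ L.zeroˡ _ ⟩
    L.0#                     ∎)
    where open ≡-Reasoning

  ι-injective : ∀ {x y} → ι x ≡ ι y → x ≡ y
  ι-injective {x} {y} e with x k.≟ y
  ... | yes p = p
  ... | no ¬p = contradiction (trans (ι-- x y) (L.zero-difference e)) (ι-≢0 (¬p ∘ k.difference-zero))

-- Every element κ of L satisfies κ^|L| = κ, and likewise T^|L| ≡ T modulo the cubic m.
-- So T^|L| − T = m h with deg h = |L| − 3, and h alone has too few roots.
module CubicRoots (k L : FiniteField) (emb : Embedding k L)
  (card : FiniteField.q L ≡ FiniteField.q k ℕ.* (FiniteField.q k ℕ.* FiniteField.q k)) where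
  private
    module k = FieldProperties k
    module Ck = CubicExtension k
    open CubicExtension L
  open FieldProperties L
  open Embedding emb

  module _ (a b d : k.Carrier) (rootless : ∀ x → ¬ Ck.cubic a b d x ≡ k.0#) where
    private
      module E = Ck.Quotient a b d rootless
      module K = FieldProperties E.field′

    m : Carrier → Carrier
    m = cubic (ι a) (ι b) (ι d)

    eval : Carrier → E.K → Carrier
    eval κ p = ι (x₀ p) + ι (x₁ p) * κ + ι (x₂ p) * (κ * κ)

    eval-θ : ∀ κ p → eval κ (E.θ E.⊗ p) ≡ κ * eval κ p - ι (x₂ p) * m κ
    eval-θ κ p = begin
      eval κ (E.θ E.⊗ p)  ≡⟨ cong (eval κ) (E.θ-⊗ p) ⟩
      ι (d k.* x₂ p) + ι (x₀ p k.- b k.* x₂ p) * κ + ι (x₁ p k.+ a k.* x₂ p) * (κ * κ)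
        ≡⟨ cong₂ _+_ (cong₂ _+_ (ι-* d (x₂ p)) (cong (_* κ) (trans (ι-- _ _) (cong (λ t → ι (x₀ p) - t) (ι-* b (x₂ p))))))
                     (cong (_* (κ * κ)) (trans (ι-+ _ _) (cong (λ t → ι (x₁ p) + t) (ι-* a (x₂ p))))) ⟩
      ι d * ι (x₂ p) + (ι (x₀ p) - ι b * ι (x₂ p)) * κ + (ι (x₁ p) + ι a * ι (x₂ p)) * (κ * κ)
        ≡⟨ solve 7 (λ a b d p₀ p₁ p₂ κ → d :* p₂ :+ (p₀ :- b :* p₂) :* κ :+ (p₁ :+ a :* p₂) :* (κ :* κ)
             := κ :* (p₀ :+ p₁ :* κ :+ p₂ :* (κ :* κ)) :- p₂ :* :cubic a b d κ) refl
             (ι a) (ι b) (ι d) (ι (x₀ p)) (ι (x₁ p)) (ι (x₂ p)) κ ⟩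
      κ * eval κ p - ι (x₂ p) * m κ ∎
      where open ≡-Reasoning

    -- Multiplication by θ in the quotient and by κ in L differ exactly by the overflow `x₂ p` times
    -- `m κ`, so a single `p` with leading coordinate 1 tests whether κ is a root.
    root-criterion : ∀ κ p → eval κ (E.θ E.⊗ p) ≡ κ * eval κ p → ι (x₂ p) ≡ 1# → m κ ≡ 0#
    root-criterion κ p e e₁ = combine₃ 1# (- 1#) (- m κ) (eval-θ κ p) e e₁
      (solve 4 (λ u v w m → m :- :0 := :1 :* (u :- (v :- w :* m)) :+ (:- :1) :* (u :- v) :+ (:- m) :* (w :- :1))
        refl (eval κ (E.θ E.⊗ p)) (κ * eval κ p) (ι (x₂ p)) (m κ))

    θ³ : E.θ K.^ 3 ≡ ⟨ d , k.- b , a ⟩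
    θ³ = begin
      E.θ E.⊗ (E.θ E.⊗ (E.θ E.⊗ E.ι k.1#)) ≡⟨ cong (λ t → E.θ E.⊗ (E.θ E.⊗ t)) (K.*-identityʳ E.θ) ⟩
      E.θ E.⊗ (E.θ E.⊗ E.θ)                ≡⟨ cong (E.θ E.⊗_) (E.θ-⊗ E.θ) ⟩
      E.θ E.⊗ ⟨ d k.* k.0# , k.0# k.- b k.* k.0# , k.1# k.+ a k.* k.0# ⟩
        ≡⟨ cong (E.θ E.⊗_) (⟨⟩-cong (k.zeroʳ d) (k.solve 1 (λ b → k.:0 k.:- b k.:* k.:0 k.:= k.:0) refl b)
              (k.solve 1 (λ a → k.:1 k.:+ a k.:* k.:0 k.:= k.:1) refl a)) ⟩
      E.θ E.⊗ ⟨ k.0# , k.0# , k.1# ⟩       ≡⟨ E.θ-⊗ _ ⟩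
      ⟨ d k.* k.1# , k.0# k.- b k.* k.1# , k.0# k.+ a k.* k.1# ⟩
        ≡⟨ ⟨⟩-cong (k.*-identityʳ d) (k.solve 1 (λ b → k.:0 k.:- b k.:* k.:1 k.:= k.:- b) refl b)
              (k.solve 1 (λ a → k.:0 k.:+ a k.:* k.:1 k.:= a) refl a) ⟩
      ⟨ d , k.- b , a ⟩ ∎
      where open ≡-Reasoning

    expansion : ∀ n → ∃[ p ] (∀ κ → κ ^ (3 ℕ.+ n) ≡ eval κ (E.θ K.^ (3 ℕ.+ n)) + m κ * monic {n} p κ)
    expansion zero = [] , λ κ → begin
      κ * (κ * (κ * 1#))                              ≡⟨ solve 4 (λ a b d κ → κ :* (κ :* (κ :* :1))
                                                           := d :+ (:- b) :* κ :+ a :* (κ :* κ) :+ :cubic a b d κ :* :1)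
                                                           refl (ι a) (ι b) (ι d) κ ⟩
      ι d + - ι b * κ + ι a * (κ * κ) + m κ * 1#      ≡⟨ cong (λ t → ι d + t * κ + ι a * (κ * κ) + m κ * 1#) (sym (ι-neg b)) ⟩
      eval κ ⟨ d , k.- b , a ⟩ + m κ * 1#             ≡⟨ cong (λ t → eval κ t + m κ * 1#) θ³ ⟨
      eval κ (E.θ K.^ 3) + m κ * 1#                   ∎
      where open ≡-Reasoning
    -- Long division: multiplying the remainder `t` by θ overflows in degree 3 with coefficient
    -- `x₂ t`, which becomes the new constant coefficient of the quotient.
    expansion (suc n) with p , e ← expansion n = (ι (x₂ t) ∷ p) , λ κ → combine₂ κ (- 1#) (e κ) (eval-θ κ t)
        (solve 7 (λ κ κⁿ v v' c m h → κ :* κⁿ :- (v' :+ m :* (κ :* h :+ c))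
            := κ :* (κⁿ :- (v :+ m :* h)) :+ (:- :1) :* (v' :- (κ :* v :- c :* m)))
          refl κ (κ ^ (3 ℕ.+ n)) (eval κ t) (eval κ (E.θ E.⊗ t)) (ι (x₂ t)) (m κ) (monic p κ))
      where t = E.θ K.^ (3 ℕ.+ n)

    second-root : ∀ r → ∃[ κ ] (¬ κ ≡ r × m κ ≡ 0#)
    second-root r with any? (λ κ → ¬? (κ ≟ r) ×-dec (m κ ≟ 0#))
    ... | yes found = found
    ... | no none = contradiction too-few (ℕₚ.<⇒≱ (ℕ.s≤s (ℕ.s≤s (ℕₚ.n≤1+n n))))
      where
      2≤q : ∀ {n} (i j : Fin n) → ¬ i ≡ j → 2 ℕ.≤ n
      2≤q {suc zero} Fin.zero Fin.zero h = contradiction refl h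
      2≤q {suc (suc n)} _ _ _ = ℕ.s≤s (ℕ.s≤s ℕ.z≤n)
      -- k has at least two elements, since 0 ≠ 1, hence L has at least 8.
      3≤q : 3 ℕ.≤ q
      3≤q = ℕₚ.≤-trans (ℕₚ.m≤m+n 3 5) (subst (8 ℕ.≤_) (sym card) (ℕₚ.*-mono-≤ bound (ℕₚ.*-mono-≤ bound bound)))
        where bound = 2≤q (Inverse.from k.enum k.0#) (Inverse.from k.enum k.1#) (k.0≢1 ∘ k.from-injective)
      n = q ℕ.∸ 3
      q≡3+n : q ≡ 3 ℕ.+ n
      q≡3+n = sym (ℕₚ.m+[n∸m]≡n 3≤q)
      p = proj₁ (expansion n)
      θ-fixed : E.θ K.^ (3 ℕ.+ n) ≡ E.θ
      θ-fixed = trans (cong (E.θ K.^_) (trans (sym q≡3+n) card)) (K.fermat E.θ)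
      annihilated : ∀ κ → m κ * monic p κ ≡ 0#
      annihilated κ = combine₃ (- 1#) 1# (- 1#)
        (proj₂ (expansion n) κ) (trans (cong (κ ^_) (sym q≡3+n)) (fermat κ))
        (trans (cong (eval κ) θ-fixed) (trans (cong₂ _+_ (cong₂ _+_ ι-0 (cong (_* κ) ι-1)) (cong (_* (κ * κ)) ι-0))
          (solve 1 (λ κ → :0 :+ :1 :* κ :+ :0 :* (κ :* κ) := κ) refl κ)))
        (solve 4 (λ mh κⁿ v κ → mh :- :0 := (:- :1) :* (κⁿ :- (v :+ mh)) :+ :1 :* (κⁿ :- κ) :+ (:- :1) :* (v :- κ))
          refl (m κ * monic p κ) (κ ^ (3 ℕ.+ n)) (eval κ (E.θ K.^ (3 ℕ.+ n))) κ)
      -- If m has no root other than r, every κ ≠ r is a root of the quotient, whose degree is |L| -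
      -- 3. Together with r this accounts for at most |L| - 2 elements.
      covered : ∀ κ → 1 ℕ.≤ [ r ≟ κ ] ℕ.+ [ monic p κ ≟ 0# ]
      covered κ with κ ≟ r
      ... | yes refl = ℕₚ.≤-trans (ℕₚ.≤-reflexive (sym ([]-true (κ ≟ κ) refl))) (ℕₚ.m≤m+n _ _)
      ... | no κ≢r = ℕₚ.≤-trans (ℕₚ.≤-reflexive (sym ([]-true (monic p κ ≟ 0#)
                       (*-cancelˡ-0 (λ e → none (κ , κ≢r , e)) (annihilated κ))))) (ℕₚ.m≤n+m _ _)
      too-few : 3 ℕ.+ n ℕ.≤ 1 ℕ.+ n
      too-few = begin
        3 ℕ.+ n                                                  ≡⟨ q≡3+n ⟨
        q                                                        ≡⟨ ℕₚ.*-identityʳ q ⟨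
        q ℕ.* 1                                                  ≡⟨ ∑-constant 1 ⟨
        ∑ (λ κ → 1)                                              ≤⟨ ∑-≤ covered ⟩
        ∑ (λ κ → [ r ≟ κ ] ℕ.+ [ monic p κ ≟ 0# ])               ≡⟨ ∑-+ (λ κ → [ r ≟ κ ]) (λ κ → [ monic p κ ≟ 0# ]) ⟩
        ∑ (λ κ → [ r ≟ κ ]) ℕ.+ ∑ (λ κ → [ monic p κ ≟ 0# ])     ≤⟨ ℕₚ.+-mono-≤ (ℕₚ.≤-reflexive (∑-point r)) (roots-≤ p) ⟩
        1 ℕ.+ n                                                  ∎
        where open ℕₚ.≤-Reasoning

-- The automorphism σ of order 3

record CyclicCubic (k : FiniteField) : Set₁ where
  private module k = FieldProperties k
  field
    K : FiniteField
    emb : Embedding k K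
  open Embedding emb public
  open FieldProperties K
  field
    card : q ≡ k.q ℕ.* (k.q ℕ.* k.q)
    σ : Carrier → Carrier
    σ-+ : ∀ x y → σ (x + y) ≡ σ x + σ y
    σ-* : ∀ x y → σ (x * y) ≡ σ x * σ y
    σ-ι : ∀ c → σ (ι c) ≡ ι c
    σ³ : ∀ x → σ (σ (σ x)) ≡ x
    fixed : ∀ x → σ x ≡ x → ∃[ c ] x ≡ ι c
    θ : Carrier
    coords : Carrier → Triple k.Carrier
  fromCoords : Triple k.Carrier → Carrier
  fromCoords t = ι (x₀ t) + ι (x₁ t) * θ + ι (x₂ t) * (θ * θ)
  field
    fromCoords-coords : ∀ x → fromCoords (coords x) ≡ x
    coords-fromCoords : ∀ t → coords (fromCoords t) ≡ t

module Galois (k K : FiniteField) (emb : Embedding k K)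
  (card : FiniteField.q K ≡ FiniteField.q k ℕ.* (FiniteField.q k ℕ.* FiniteField.q k))
  (a b d : FiniteField.Carrier k)
  (rootless : ∀ x → ¬ CubicExtension.cubic k a b d x ≡ FiniteField.0# k) where
  private
    module k = FieldProperties k
  open FieldProperties K
  open CubicExtension K using (cubic; :cubic)
  open Embedding emb

  m : Carrier → Carrier
  m = cubic (ι a) (ι b) (ι d)

  ev : Carrier → Triple k.Carrier → Carrier
  ev u t = ι (x₀ t) + ι (x₁ t) * u + ι (x₂ t) * (u * u)

  module Conjugation (θ : Carrier) (m-θ : m θ ≡ 0#) (coords : Carrier → Triple k.Carrier)
    (decompose : ∀ x → ev θ (coords x) ≡ x) (coords-unique : ∀ t → coords (ev θ t) ≡ t)
    (θ₂ : Carrier) (θ₂≢θ : ¬ θ₂ ≡ θ) (m-θ₂ : m θ₂ ≡ 0#) where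

    σ : Carrier → Carrier
    σ x = ev θ₂ (coords x)

    σ-ev : ∀ t → σ (ev θ t) ≡ ev θ₂ t
    σ-ev t = cong (ev θ₂) (coords-unique t)

    σ-ι : ∀ c → σ (ι c) ≡ ι c
    σ-ι c = trans (cong σ (at θ)) (trans (σ-ev ⟨ c , k.0# , k.0# ⟩) (sym (at θ₂)))
      where
      at : ∀ u → ι c ≡ ev u ⟨ c , k.0# , k.0# ⟩
      at u = combine₁ (- (u + u * u)) ι-0
        (solve 3 (λ c u z → c :- (c :+ z :* u :+ z :* (u :* u)) := (:- (u :+ u :* u)) :* (z :- :0)) refl (ι c) u (ι k.0#))

    σ-θ : σ θ ≡ θ₂
    σ-θ = trans (cong σ (at θ)) (trans (σ-ev ⟨ k.0# , k.1# , k.0# ⟩) (sym (at θ₂)))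
      where
      at : ∀ u → u ≡ ev u ⟨ k.0# , k.1# , k.0# ⟩
      at u = combine₂ (- (1# + u * u)) (- u) ι-0 ι-1
        (solve 3 (λ u z o → u :- (z :+ o :* u :+ z :* (u :* u)) := (:- (:1 :+ u :* u)) :* (z :- :0) :+ (:- u) :* (o :- :1))
          refl u (ι k.0#) (ι k.1#))

    ev-+ : ∀ u s t → ev u ⟨ x₀ s k.+ x₀ t , x₁ s k.+ x₁ t , x₂ s k.+ x₂ t ⟩ ≡ ev u s + ev u t
    ev-+ u ⟨ x₀ , x₁ , x₂ ⟩ ⟨ y₀ , y₁ , y₂ ⟩ = trans
      (cong₂ _+_ (cong₂ _+_ (ι-+ x₀ y₀) (cong (_* u) (ι-+ x₁ y₁))) (cong (_* (u * u)) (ι-+ x₂ y₂)))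
      (solve 7 (λ x₀ x₁ x₂ y₀ y₁ y₂ t → (x₀ :+ y₀) :+ (x₁ :+ y₁) :* t :+ (x₂ :+ y₂) :* (t :* t)
         := (x₀ :+ x₁ :* t :+ x₂ :* (t :* t)) :+ (y₀ :+ y₁ :* t :+ y₂ :* (t :* t))) refl (ι x₀) (ι x₁) (ι x₂) (ι y₀) (ι y₁) (ι y₂) u)

    σ-+ : ∀ x y → σ (x + y) ≡ σ x + σ y
    σ-+ x y = trans (cong σ (trans (cong₂ _+_ (sym (decompose x)) (sym (decompose y))) (sym (ev-+ θ s t))))
                    (trans (σ-ev _) (ev-+ θ₂ s t))
      where s = coords x
            t = coords y

    private
      module Q = CubicExtension.Quotient k a b d rootless

    -- Both sides are values at u of polynomials that are congruent modulo the cubic; their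
    -- difference is an explicit multiple of `m u`. Applied to θ and to θ₂, this makes the
    -- substitution of one root for the other multiplicative.
    ev-* : ∀ u → m u ≡ 0# → ∀ s t → ev u (s Q.⊗ t) ≡ ev u s * ev u t
    ev-* u m-u x@(⟨ x₀ , x₁ , x₂ ⟩) y@(⟨ y₀ , y₁ , y₂ ⟩) = trans
      (cong₂ _+_ (cong₂ _+_ e₀ (cong (_* u) e₁)) (cong (_* (u * u)) e₂))
      (combine₁ (- (ι x₁ * ι y₂ + ι x₂ * ι y₁ + ι x₂ * ι y₂ * (u + ι a))) m-u
        (solve 10 (λ a b d x₀ x₁ x₂ y₀ y₁ y₂ t →
          (x₀ :* y₀ :+ d :* (x₁ :* y₂ :+ x₂ :* y₁) :+ a :* d :* (x₂ :* y₂))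
          :+ (x₀ :* y₁ :+ x₁ :* y₀ :- b :* (x₁ :* y₂ :+ x₂ :* y₁) :+ (d :- a :* b) :* (x₂ :* y₂)) :* t
          :+ (x₀ :* y₂ :+ x₁ :* y₁ :+ x₂ :* y₀ :+ a :* (x₁ :* y₂ :+ x₂ :* y₁) :+ (a :* a :- b) :* (x₂ :* y₂)) :* (t :* t)
          :- (x₀ :+ x₁ :* t :+ x₂ :* (t :* t)) :* (y₀ :+ y₁ :* t :+ y₂ :* (t :* t))
          := (:- (x₁ :* y₂ :+ x₂ :* y₁ :+ x₂ :* y₂ :* (t :+ a))) :* (:cubic a b d t :- :0))
          refl (ι a) (ι b) (ι d) (ι x₀) (ι x₁) (ι x₂) (ι y₀) (ι y₁) (ι y₂) u))
      where
      c₃ : ι (x₁ k.* y₂ k.+ x₂ k.* y₁) ≡ ι x₁ * ι y₂ + ι x₂ * ι y₁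
      c₃ = trans (ι-+ _ _) (cong₂ _+_ (ι-* x₁ y₂) (ι-* x₂ y₁))
      e₀ : ι (Triple.x₀ (x Q.⊗ y)) ≡ ι x₀ * ι y₀ + ι d * (ι x₁ * ι y₂ + ι x₂ * ι y₁) + ι a * ι d * (ι x₂ * ι y₂)
      e₀ = trans (ι-+ _ _) (cong₂ _+_ (trans (ι-+ _ _) (cong₂ _+_ (ι-* _ _) (trans (ι-* _ _) (cong (ι d *_) c₃))))
        (trans (ι-* _ _) (cong₂ _*_ (ι-* a d) (ι-* x₂ y₂))))
      e₁ : ι (Triple.x₁ (x Q.⊗ y)) ≡ ι x₀ * ι y₁ + ι x₁ * ι y₀ - ι b * (ι x₁ * ι y₂ + ι x₂ * ι y₁) + (ι d - ι a * ι b) * (ι x₂ * ι y₂)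
      e₁ = trans (ι-+ _ _) (cong₂ _+_ (trans (ι-- _ _) (cong₂ _-_ (trans (ι-+ _ _) (cong₂ _+_ (ι-* _ _) (ι-* _ _))) (trans (ι-* _ _) (cong (ι b *_) c₃))))
        (trans (ι-* _ _) (cong₂ _*_ (trans (ι-- _ _) (cong (λ t → ι d - t) (ι-* a b))) (ι-* x₂ y₂))))
      e₂ : ι (Triple.x₂ (x Q.⊗ y)) ≡ ι x₀ * ι y₂ + ι x₁ * ι y₁ + ι x₂ * ι y₀ + ι a * (ι x₁ * ι y₂ + ι x₂ * ι y₁) + (ι a * ι a - ι b) * (ι x₂ * ι y₂)
      e₂ = trans (ι-+ _ _) (cong₂ _+_ (trans (ι-+ _ _) (cong₂ _+_ (trans (ι-+ _ _) (cong₂ _+_ (trans (ι-+ _ _) (cong₂ _+_ (ι-* _ _) (ι-* _ _))) (ι-* _ _)))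
          (trans (ι-* _ _) (cong (ι a *_) c₃))))
        (trans (ι-* _ _) (cong₂ _*_ (trans (ι-- _ _) (cong (_- ι b) (ι-* a a))) (ι-* x₂ y₂))))

    σ-* : ∀ x y → σ (x * y) ≡ σ x * σ y
    σ-* x y = trans (cong σ (trans (cong₂ _*_ (sym (decompose x)) (sym (decompose y))) (sym (ev-* θ m-θ s t))))
                    (trans (σ-ev _) (ev-* θ₂ m-θ₂ s t))
      where s = coords x
            t = coords y

    σ-0 : σ 0# ≡ 0#
    σ-0 = trans (cong σ (sym ι-0)) (trans (σ-ι k.0#) ι-0)

    σ-neg : ∀ x → σ (- x) ≡ - σ x
    σ-neg x = combine₁ 1# (trans (sym (σ-+ (- x) x)) (trans (cong σ (-‿inverseˡ x)) σ-0))
      (solve 2 (λ y z → y :- (:- z) := :1 :* (y :+ z :- :0)) refl (σ (- x)) (σ x))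

    σ-m : ∀ x → σ (m x) ≡ m (σ x)
    σ-m x = trans (σ-+ _ _) (cong₂ _+_ (trans (σ-+ _ _) (cong₂ _+_ (trans (σ-+ _ _) (cong₂ _+_
        (trans (σ-* _ _) (cong (_* σ x) (σ-* x x)))
        (trans (σ-neg _) (cong -_ (trans (σ-* _ _) (cong₂ _*_ (σ-ι a) (σ-* x x)))))))
        (trans (σ-* _ _) (cong (_* σ x) (σ-ι b)))))
        (trans (σ-neg _) (cong -_ (σ-ι d))))

    -- Two candidates for the third root: the image of θ₂ under σ, and what Vieta's formula leaves.
    -- Their agreement (`θ₃≡t`) gives σ its order 3.
    θ₃ t : Carrier
    θ₃ = σ θ₂
    t = ι a - θ - θ₂

    private
      symmetric-quotient : θ * θ + θ * θ₂ + θ₂ * θ₂ - ι a * (θ + θ₂) + ι b ≡ 0#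
      symmetric-quotient = *-cancelˡ-0 (θ₂≢θ ∘ difference-zero) (combine₂ 1# (- 1#) m-θ₂ m-θ
        (solve 5 (λ a b d x y → (y :- x) :* (x :* x :+ x :* y :+ y :* y :- a :* (x :+ y) :+ b) :- :0
           := :1 :* (:cubic a b d y :- :0) :+ (:- :1) :* (:cubic a b d x :- :0))
         refl (ι a) (ι b) (ι d) θ θ₂))

    m-factors : ∀ x → m x ≡ (x - θ) * (x - θ₂) * (x - t)
    m-factors x = combine₂ 1# (x - θ) m-θ symmetric-quotient
      (solve 6 (λ a b d x u v → :cubic a b d x :- (x :- u) :* (x :- v) :* (x :- (a :- u :- v))
         := :1 :* (:cubic a b d u :- :0) :+ (x :- u) :* (u :* u :+ u :* v :+ v :* v :- a :* (u :+ v) :+ b :- :0))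
        refl (ι a) (ι b) (ι d) x θ θ₂)

    ι-not-root : ∀ c → ¬ m (ι c) ≡ 0#
    ι-not-root c e = rootless c (ι-injective {x = CubicExtension.cubic k a b d c} (trans ι-cubic (trans e (sym ι-0))))
      where
      ι-cubic : ι (CubicExtension.cubic k a b d c) ≡ m (ι c)
      ι-cubic = trans (ι-- _ _) (cong (_- ι d) (trans (ι-+ _ _) (cong₂ _+_ (trans (ι-- _ _) (cong₂ _-_
        (trans (ι-* _ _) (cong (_* ι c) (ι-* c c))) (trans (ι-* _ _) (cong (ι a *_) (ι-* c c))))) (ι-* b c))))

    m-t : m t ≡ 0#
    m-t = trans (m-factors t) (solve 3 (λ t u v → (t :- u) :* (t :- v) :* (t :- t) := :0) refl t θ θ₂)

    -- Write x = p + rθ + sθ². Dividing σ(x) - x by θ₂ - θ leaves r + s(θ + θ₂) = 0. For s ≠ 0 this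
    -- puts θ + θ₂, hence the third root of the cubic, into k, where it has none.
    fixed : ∀ x → σ x ≡ x → ∃[ c ] x ≡ ι c
    fixed x e = p , conclude (s k.≟ k.0#)
      where
      p = x₀ (coords x)
      r = x₁ (coords x)
      s = x₂ (coords x)
      relation : ι r + ι s * (θ + θ₂) ≡ 0#
      relation = *-cancelˡ-0 (θ₂≢θ ∘ difference-zero) (combine₁ 1# (trans e (sym (decompose x)))
        (solve 5 (λ p r s u v → (v :- u) :* (r :+ s :* (u :+ v)) :- :0
           := :1 :* (p :+ r :* v :+ s :* (v :* v) :- (p :+ r :* u :+ s :* (u :* u)))) refl (ι p) (ι r) (ι s) θ θ₂))
      conclude : Dec (s ≡ k.0#) → x ≡ ι p
      conclude (yes s≡0) = combine₃ (- 1#) θ (- (θ * θ₂)) (decompose x) relation (trans (cong ι s≡0) ι-0)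
        (solve 6 (λ x p r s u v → x :- p := (:- :1) :* (p :+ r :* u :+ s :* (u :* u) :- x) :+ u :* (r :+ s :* (u :+ v) :- :0)
           :+ (:- (u :* v)) :* (s :- :0)) refl x (ι p) (ι r) (ι s) θ θ₂)
      conclude (no s≢0) = contradiction (subst (λ u → m u ≡ 0#) t-rational m-t) (ι-not-root (a k.+ k.inv s k.* r))
        where
        ι-inv : ι (k.inv s) * ι s ≡ 1#
        ι-inv = trans (sym (ι-* _ _)) (trans (cong ι (k.inv-inverseˡ s≢0)) ι-1)
        t-rational : t ≡ ι (a k.+ k.inv s k.* r)
        t-rational = combine₃ (- ι (k.inv s)) (θ + θ₂) (- 1#) relation ι-inv (trans (ι-+ _ _) (cong (λ z → ι a + z) (ι-* _ _)))
          (solve 7 (λ a i r s u v z → a :- u :- v :- z := (:- i) :* (r :+ s :* (u :+ v) :- :0)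
              :+ (u :+ v) :* (i :* s :- :1) :+ (:- :1) :* (z :- (a :+ i :* r)))
            refl (ι a) (ι (k.inv s)) (ι r) (ι s) θ θ₂ (ι (a k.+ k.inv s k.* r)))

    σ-injective : ∀ {x y} → σ x ≡ σ y → x ≡ y
    σ-injective {x} {y} e with x ≟ y
    ... | yes p = p
    ... | no ¬p = contradiction (begin
        1#                                ≡⟨ trans (cong σ (sym ι-1)) (trans (σ-ι k.1#) ι-1) ⟨
        σ 1#                              ≡⟨ cong σ (inv-inverseʳ (¬p ∘ difference-zero)) ⟨
        σ ((x - y) * inv (x - y))         ≡⟨ σ-* (x - y) (inv (x - y)) ⟩
        σ (x - y) * σ (inv (x - y))       ≡⟨ cong (_* σ (inv (x - y))) (trans (σ-+ x (- y)) (trans (cong (λ z → σ x + z) (σ-neg y)) (zero-difference e))) ⟩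
        0# * σ (inv (x - y))              ≡⟨ zeroˡ _ ⟩
        0# ∎) 1≢0
      where open ≡-Reasoning

    σ-t : σ t ≡ ι a - θ₂ - θ₃
    σ-t = trans (σ-+ _ _) (cong₂ _+_ (trans (σ-+ _ _) (cong₂ _+_ (σ-ι a) (trans (σ-neg θ) (cong -_ σ-θ)))) (σ-neg θ₂))

    m-θ₃ : m θ₃ ≡ 0#
    m-θ₃ = trans (sym (σ-m θ₂)) (trans (cong σ m-θ₂) σ-0)

    θ₃≢θ₂ : ¬ θ₃ ≡ θ₂
    θ₃≢θ₂ e = θ₂≢θ (σ-injective (trans e (sym σ-θ)))

    -- If σ interchanged θ and θ₂, it would fix the remaining root t, which would then lie in k.
    θ₃≢θ : ¬ θ₃ ≡ θ
    θ₃≢θ e = ι-not-root (proj₁ rational) (subst (λ u → m u ≡ 0#) (proj₂ rational) m-t)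
      where
      rational = fixed t (trans σ-t (combine₁ (- 1#) e
        (solve 4 (λ a u v w → a :- v :- w :- (a :- u :- v) := (:- :1) :* (w :- u)) refl (ι a) θ θ₂ θ₃)))

    θ₃≡t : θ₃ ≡ t
    θ₃≡t = difference-zero (*-cancelˡ-0 (*-≢0 (θ₃≢θ ∘ difference-zero) (θ₃≢θ₂ ∘ difference-zero))
      (trans (sym (m-factors θ₃)) m-θ₃))

    σ³-θ : σ θ₃ ≡ θ
    σ³-θ = trans (cong σ θ₃≡t) (trans σ-t (combine₁ (- 1#) θ₃≡t
      (solve 4 (λ a u v w → a :- v :- w :- u := (:- :1) :* (w :- (a :- u :- v))) refl (ι a) θ θ₂ θ₃)))

    σ-poly : ∀ p r s u → σ (ι p + ι r * u + ι s * (u * u)) ≡ ι p + ι r * σ u + ι s * (σ u * σ u)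
    σ-poly p r s u = trans (σ-+ _ _) (cong₂ _+_ (trans (σ-+ _ _) (cong₂ _+_ (σ-ι p) (trans (σ-* _ _) (cong (_* σ u) (σ-ι r)))))
      (trans (σ-* _ _) (cong₂ _*_ (σ-ι s) (σ-* u u))))

    σ³ : ∀ x → σ (σ (σ x)) ≡ x
    σ³ x = begin
      σ (σ (σ x))              ≡⟨ cong σ (σ-poly p r s θ₂) ⟩
      σ (ev θ₃ (coords x))     ≡⟨ σ-poly p r s θ₃ ⟩
      ev (σ θ₃) (coords x)     ≡⟨ cong (λ u → ev u (coords x)) σ³-θ ⟩
      ev θ (coords x)          ≡⟨ decompose x ⟩
      x                        ∎
      where
      open ≡-Reasoning
      p = x₀ (coords x)
      r = x₁ (coords x)
      s = x₂ (coords x)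

    cyclicCubic : CyclicCubic k
    cyclicCubic = record
      { K = K ; emb = emb ; card = card ; σ = σ ; σ-+ = σ-+ ; σ-* = σ-* ; σ-ι = σ-ι ; σ³ = σ³ ; fixed = fixed
      ; θ = θ ; coords = coords ; fromCoords-coords = decompose ; coords-fromCoords = coords-unique }

module RootlessCubic (k : FiniteField) (a b d : FiniteField.Carrier k)
  (rootless : ∀ x → ¬ CubicExtension.cubic k a b d x ≡ FiniteField.0# k) where
  private
    module k = FieldProperties k
  open CubicExtension.Quotient k a b d rootless

  emb : Embedding k field′
  emb = record { ι = ι ; ι-+ = ι-+ ; ι-* = ι-* ; ι-1 = refl }
  open CubicRoots k field′ emb refl using (eval; root-criterion; second-root)

  decompose : ∀ x → eval a b d rootless θ x ≡ x
  decompose ⟨ p , r , s ⟩ = begin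
    ι p ⊕ ι r ⊗ θ ⊕ ι s ⊗ (θ ⊗ θ)
      ≡⟨ cong₂ _⊕_ (cong (ι p ⊕_) (trans (ι-⊗ r θ) (⟨⟩-cong (k.zeroʳ r) (k.*-identityʳ r) (k.zeroʳ r))))
                   (trans (cong (ι s ⊗_) θ²) (trans (ι-⊗ s _) (⟨⟩-cong (k.zeroʳ s) (k.zeroʳ s) (k.*-identityʳ s)))) ⟩
    ι p ⊕ ⟨ k.0# , r , k.0# ⟩ ⊕ ⟨ k.0# , k.0# , s ⟩
      ≡⟨ ⟨⟩-cong (k.solve 1 (λ p → p k.:+ k.:0 k.:+ k.:0 k.:= p) refl p)
                 (k.solve 1 (λ p → k.:0 k.:+ p k.:+ k.:0 k.:= p) refl r)
                 (k.solve 1 (λ p → k.:0 k.:+ k.:0 k.:+ p k.:= p) refl s) ⟩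
    ⟨ p , r , s ⟩ ∎
    where
    open ≡-Reasoning
    θ² : θ ⊗ θ ≡ ⟨ k.0# , k.0# , k.1# ⟩
    θ² = trans (θ-⊗ θ) (⟨⟩-cong (k.zeroʳ d) (k.solve 1 (λ b → k.:0 k.:- b k.:* k.:0 k.:= k.:0) refl b)
              (k.solve 1 (λ a → k.:1 k.:+ a k.:* k.:0 k.:= k.:1) refl a))

  cyclicCubic : CyclicCubic k
  cyclicCubic = Galois.Conjugation.cyclicCubic k field′ emb refl a b d rootless θ
    (root-criterion a b d rootless θ p (trans (decompose (θ ⊗ p)) (cong (θ ⊗_) (sym (decompose p)))) refl)
    (λ x → x) decompose decompose (proj₁ root₂) (proj₁ (proj₂ root₂)) (proj₂ (proj₂ root₂))
    where
    root₂ = second-root a b d rootless θ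
    p = ⟨ k.0# , k.0# , k.1# ⟩

-- Linear maps of K as αx + βσ(x) + γσ²(x), and their determinants

module LinearMaps (k : FiniteField) (E : CyclicCubic k) where
  module k = FieldProperties k
  open CyclicCubic E public
  open FieldProperties K public

  σ-0 : σ 0# ≡ 0#
  σ-0 = trans (cong σ (sym ι-0)) (trans (σ-ι k.0#) ι-0)

  σ-1 : σ 1# ≡ 1#
  σ-1 = trans (cong σ (sym ι-1)) (trans (σ-ι k.1#) ι-1)

  σ-neg : ∀ x → σ (- x) ≡ - σ x
  σ-neg x = combine₁ 1# (trans (sym (σ-+ (- x) x)) (trans (cong σ (-‿inverseˡ x)) σ-0))
    (solve 2 (λ y z → y :- (:- z) := :1 :* (y :+ z :- :0)) refl (σ (- x)) (σ x))

  σ-- : ∀ x y → σ (x - y) ≡ σ x - σ y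
  σ-- x y = trans (σ-+ x (- y)) (cong (λ z → σ x + z) (σ-neg y))

  σ-injective : ∀ {x y} → σ x ≡ σ y → x ≡ y
  σ-injective {x} {y} e = trans (sym (σ³ x)) (trans (cong (σ ∘ σ) e) (σ³ y))

  σ-≢0 : ∀ {x} → ¬ x ≡ 0# → ¬ σ x ≡ 0#
  σ-≢0 x≢0 e = x≢0 (σ-injective (trans e (sym σ-0)))

  Tr N : Carrier → Carrier
  Tr x = x + σ x + σ (σ x)
  N x = x * σ x * σ (σ x)

  Tr-+ : ∀ x y → Tr (x + y) ≡ Tr x + Tr y
  Tr-+ x y = trans (cong₂ _+_ (cong (λ z → x + y + z) (σ-+ x y)) (trans (cong σ (σ-+ x y)) (σ-+ _ _)))
    (solve 6 (λ x x' x'' y y' y'' → x :+ y :+ (x' :+ y') :+ (x'' :+ y'') := x :+ x' :+ x'' :+ (y :+ y' :+ y'')) refl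
      x (σ x) (σ (σ x)) y (σ y) (σ (σ y)))

  σ-Tr : ∀ x → σ (Tr x) ≡ Tr x
  σ-Tr x = trans (σ-+ _ _) (trans (cong₂ _+_ (σ-+ _ _) (σ³ x))
    (solve 3 (λ x y z → y :+ z :+ x := x :+ y :+ z) refl x (σ x) (σ (σ x))))

  tr : Carrier → k.Carrier
  tr x = proj₁ (fixed (Tr x) (σ-Tr x))

  Tr≡ι : ∀ x → Tr x ≡ ι (tr x)
  Tr≡ι x = proj₂ (fixed (Tr x) (σ-Tr x))

  σ-N : ∀ x → σ (N x) ≡ N x
  σ-N x = trans (σ-* _ _) (trans (cong₂ _*_ (σ-* _ _) (σ³ x))
    (solve 3 (λ x y z → y :* z :* x := x :* y :* z) refl x (σ x) (σ (σ x))))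

  Tr-scale : ∀ {c} x → σ c ≡ c → Tr (c * x) ≡ c * Tr x
  Tr-scale {c} x e = trans (cong₂ _+_ (cong (λ z → c * x + z) e₁) (trans (cong σ e₁) (trans (σ-* c (σ x)) (cong (_* σ (σ x)) e))))
    (solve 4 (λ c x y z → c :* x :+ c :* y :+ c :* z := c :* (x :+ y :+ z)) refl c x (σ x) (σ (σ x)))
    where
    e₁ : σ (c * x) ≡ c * σ x
    e₁ = trans (σ-* c x) (cong (_* σ x) e)

  -- λ lies outside k exactly when σ moves it.
  Irrational : Carrier → Set
  Irrational x = ¬ σ x ≡ x

  irrational-σ : ∀ {x} → Irrational x → Irrational (σ x)
  irrational-σ h e = h (σ-injective e)

  irrational-σσ : ∀ {x} → Irrational x → ¬ σ (σ x) ≡ x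
  irrational-σσ {x} h e = h (trans (cong σ (sym e)) (σ³ x))

  θ-irrational : Irrational θ
  θ-irrational e = k.0≢1 (cong x₁ (trans (sym (coords-fromCoords ⟨ c , k.0# , k.0# ⟩))
      (trans (cong coords same) (coords-fromCoords ⟨ k.0# , k.1# , k.0# ⟩))))
    where
    c = proj₁ (fixed θ e)
    same : fromCoords ⟨ c , k.0# , k.0# ⟩ ≡ fromCoords ⟨ k.0# , k.1# , k.0# ⟩
    same = combine₃ (θ - 1#) (- 1#) (- θ) ι-0 (proj₂ (fixed θ e)) ι-1
      (solve 4 (λ c t z o → c :+ z :* t :+ z :* (t :* t) :- (z :+ o :* t :+ z :* (t :* t)) :=
        (t :- :1) :* (z :- :0) :+ (:- :1) :* (t :- c) :+ (:- t) :* (o :- :1)) refl (ι c) θ (ι k.0#) (ι k.1#))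

  -- The three equations are combined with the coefficients of (X - u)(X - v), a polynomial that
  -- removes the terms with β and γ.
  vandermonde : ∀ {t u v} → ¬ t ≡ u → ¬ t ≡ v → ∀ α β γ → α + β + γ ≡ 0# → α * t + β * u + γ * v ≡ 0# →
                α * (t * t) + β * (u * u) + γ * (v * v) ≡ 0# → α ≡ 0#
  vandermonde {t} {u} {v} t≢u t≢v α β γ e₀ e₁ e₂ = *-cancelˡ-0 (t≢u ∘ difference-zero) (*-cancelˡ-0 (t≢v ∘ difference-zero)
    (combine₃ (u * v) (- (u + v)) 1# e₀ e₁ e₂
      (solve 6 (λ α β γ t u v → (t :- v) :* ((t :- u) :* α) :- :0 :=
        u :* v :* (α :+ β :+ γ :- :0) :+ (:- (u :+ v)) :* (α :* t :+ β :* u :+ γ :* v :- :0)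
        :+ :1 :* (α :* (t :* t) :+ β :* (u :* u) :+ γ :* (v :* v) :- :0)) refl α β γ t u v)))

  Lin : Set
  Lin = Triple Carrier

  ap : Lin → Carrier → Carrier
  ap f x = x₀ f * x + x₁ f * σ x + x₂ f * σ (σ x)

  0L : Lin
  0L = ⟨ 0# , 0# , 0# ⟩

  -- On x, lx, l²x the values of the map form a Vandermonde system in l, σ(l), σ²(l), which are
  -- distinct because l is irrational. Equalities of linear maps are later checked on such orbits,
  -- with l adapted to the maps at hand.
  kills-orbit : ∀ f {x l} → ¬ x ≡ 0# → Irrational l → ap f x ≡ 0# → ap f (l * x) ≡ 0# → ap f (l * (l * x)) ≡ 0# → f ≡ 0L
  kills-orbit ⟨ α , β , γ ⟩ {x} {l} x≢0 irr e₀ e₁ e₂ = ⟨⟩-cong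
    (cancel x≢0 (vandermonde (irr ∘ sym) (irrational-σσ irr ∘ sym) _ _ _ e₀ E₁ E₂))
    (cancel (σ-≢0 x≢0) (vandermonde irr (irrational-σ irr ∘ sym) _ _ _ (trans (swap₁ _ _ _) e₀) (trans (swap₁ _ _ _) E₁) (trans (swap₁ _ _ _) E₂)))
    (cancel (σ-≢0 (σ-≢0 x≢0)) (vandermonde (irrational-σσ irr) (irrational-σ irr) _ _ _ (trans (rotate _ _ _) e₀) (trans (rotate _ _ _) E₁) (trans (rotate _ _ _) E₂)))
    where
    swap₁ : ∀ a b c → b + a + c ≡ a + b + c
    swap₁ = solve 3 (λ a b c → b :+ a :+ c := a :+ b :+ c) refl
    rotate : ∀ a b c → c + a + b ≡ a + b + c
    rotate = solve 3 (λ a b c → c :+ a :+ b := a :+ b :+ c) refl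
    cancel : ∀ {y c} → ¬ y ≡ 0# → c * y ≡ 0# → c ≡ 0#
    cancel {y} {c} y≢0 e = *-cancelˡ-0 y≢0 (trans (*-comm y c) e)
    x' = σ x
    x'' = σ (σ x)
    l' = σ l
    l'' = σ (σ l)
    E₁ : α * x * l + β * x' * l' + γ * x'' * l'' ≡ 0#
    E₁ = trans (trans (solve 9 (λ α β γ x x' x'' l l' l'' → α :* x :* l :+ β :* x' :* l' :+ γ :* x'' :* l''
             := α :* (l :* x) :+ β :* (l' :* x') :+ γ :* (l'' :* x'')) refl α β γ x x' x'' l l' l'')
           (sym (cong₂ (λ y z → α * (l * x) + β * y + γ * z) (σ-* l x) (trans (cong σ (σ-* l x)) (σ-* _ _))))) e₁
    σll : σ (l * (l * x)) ≡ l' * (l' * x')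
    σll = trans (σ-* _ _) (cong (l' *_) (σ-* l x))
    E₂ : α * x * (l * l) + β * x' * (l' * l') + γ * x'' * (l'' * l'') ≡ 0#
    E₂ = trans (trans (solve 9 (λ α β γ x x' x'' l l' l'' → α :* x :* (l :* l) :+ β :* x' :* (l' :* l') :+ γ :* x'' :* (l'' :* l'')
             := α :* (l :* (l :* x)) :+ β :* (l' :* (l' :* x')) :+ γ :* (l'' :* (l'' :* x''))) refl α β γ x x' x'' l l' l'')
           (sym (cong₂ (λ y z → α * (l * (l * x)) + β * y + γ * z) σll
             (trans (cong σ σll) (trans (σ-* _ _) (cong (l'' *_) (σ-* _ _))))))) e₂

  _-L_ : Lin → Lin → Lin
  f -L g = ⟨ x₀ f - x₀ g , x₁ f - x₁ g , x₂ f - x₂ g ⟩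

  ap--L : ∀ f g x → ap (f -L g) x ≡ ap f x - ap g x
  ap--L f g x = solve 9 (λ a b c d e f x y z → (a :- d) :* x :+ (b :- e) :* y :+ (c :- f) :* z
     := a :* x :+ b :* y :+ c :* z :- (d :* x :+ e :* y :+ f :* z)) refl
     (x₀ f) (x₁ f) (x₂ f) (x₀ g) (x₁ g) (x₂ g) x (σ x) (σ (σ x))

  agree-on-orbit : ∀ f g {x l} → ¬ x ≡ 0# → Irrational l → ap f x ≡ ap g x → ap f (l * x) ≡ ap g (l * x) →
                   ap f (l * (l * x)) ≡ ap g (l * (l * x)) → f ≡ g
  agree-on-orbit f g x≢0 irr e₀ e₁ e₂ = ⟨⟩-cong (difference-zero (cong Triple.x₀ z)) (difference-zero (cong Triple.x₁ z)) (difference-zero (cong Triple.x₂ z))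
    where
    z : f -L g ≡ 0L
    z = kills-orbit (f -L g) x≢0 irr (trans (ap--L f g _) (zero-difference e₀)) (trans (ap--L f g _) (zero-difference e₁))
          (trans (ap--L f g _) (zero-difference e₂))

  ap-unique : ∀ f g → (∀ x → ap f x ≡ ap g x) → f ≡ g
  ap-unique f g h = agree-on-orbit f g 1≢0 θ-irrational (h _) (h _) (h _)

  ap-+ : ∀ f x y → ap f (x + y) ≡ ap f x + ap f y
  ap-+ ⟨ α , β , γ ⟩ x y = trans (cong₂ (λ s t → α * (x + y) + β * s + γ * t) (σ-+ x y) (trans (cong σ (σ-+ x y)) (σ-+ _ _)))
    (solve 9 (λ α β γ x x' x'' y y' y'' → α :* (x :+ y) :+ β :* (x' :+ y') :+ γ :* (x'' :+ y'')
      := α :* x :+ β :* x' :+ γ :* x'' :+ (α :* y :+ β :* y' :+ γ :* y'')) refl α β γ x (σ x) (σ (σ x)) y (σ y) (σ (σ y)))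

  ap-scale : ∀ f {c} x → σ c ≡ c → ap f (c * x) ≡ c * ap f x
  ap-scale ⟨ α , β , γ ⟩ {c} x e = trans (cong₂ (λ s t → α * (c * x) + β * s + γ * t) e₁ (trans (cong σ e₁) (trans (σ-* c (σ x)) (cong (_* σ (σ x)) e))))
    (solve 7 (λ α β γ c x x' x'' → α :* (c :* x) :+ β :* (c :* x') :+ γ :* (c :* x'') := c :* (α :* x :+ β :* x' :+ γ :* x'')) refl α β γ c x (σ x) (σ (σ x)))
    where
    e₁ : σ (c * x) ≡ c * σ x
    e₁ = trans (σ-* c x) (cong (_* σ x) e)

  ap-ι : ∀ f c x → ap f (ι c * x) ≡ ι c * ap f x
  ap-ι f c x = ap-scale f x (σ-ι c)

  ap-0 : ∀ f → ap f 0# ≡ 0#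
  ap-0 ⟨ α , β , γ ⟩ = trans (cong₂ (λ s t → α * 0# + β * s + γ * t) σ-0 (trans (cong σ σ-0) σ-0))
    (solve 3 (λ α β γ → α :* :0 :+ β :* :0 :+ γ :* :0 := :0) refl α β γ)

  ap-neg : ∀ f x → ap f (- x) ≡ - ap f x
  ap-neg f x = combine₁ 1# (trans (sym (ap-+ f (- x) x)) (trans (cong (ap f) (-‿inverseˡ x)) (ap-0 f)))
    (solve 2 (λ y z → y :- (:- z) := :1 :* (y :+ z :- :0)) refl (ap f (- x)) (ap f x))

  ap-- : ∀ f x y → ap f (x - y) ≡ ap f x - ap f y
  ap-- f x y = trans (ap-+ f x (- y)) (cong (λ z → ap f x + z) (ap-neg f y))

  record IsLinear (f : Carrier → Carrier) : Set where
    field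
      additive : ∀ x y → f (x + y) ≡ f x + f y
      homogeneous : ∀ c x → f (ι c * x) ≡ ι c * f x
  open IsLinear public

  ap-isLinear : ∀ f → IsLinear (ap f)
  ap-isLinear f = record { additive = ap-+ f ; homogeneous = ap-ι f }

  values : Carrier → Carrier → Lin → Triple Carrier
  values x l f = ⟨ ap f x , ap f (l * x) , ap f (l * (l * x)) ⟩

  private
    expand : ∀ x → ι (x₀ (coords x)) * 1# + ι (x₁ (coords x)) * (θ * 1#) + ι (x₂ (coords x)) * (θ * (θ * 1#)) ≡ x
    expand x = trans (solve 4 (λ a b c t → a :* :1 :+ b :* (t :* :1) :+ c :* (t :* (t :* :1))
        := a :+ b :* t :+ c :* (t :* t)) refl _ _ _ θ) (fromCoords-coords x)

    expand-linear : ∀ {f} → IsLinear f → ∀ x → f x ≡ ι (x₀ (coords x)) * f 1# + ι (x₁ (coords x)) * f (θ * 1#) + ι (x₂ (coords x)) * f (θ * (θ * 1#))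
    expand-linear {f} lin x = trans (cong f (sym (expand x))) (trans (additive lin _ _) (cong₂ _+_
      (trans (additive lin _ _) (cong₂ _+_ (homogeneous lin _ _) (homogeneous lin _ _))) (homogeneous lin _ _)))

  linear-ext : ∀ {f g} → IsLinear f → IsLinear g → f 1# ≡ g 1# → f (θ * 1#) ≡ g (θ * 1#) → f (θ * (θ * 1#)) ≡ g (θ * (θ * 1#)) →
               ∀ x → f x ≡ g x
  linear-ext {f} {g} F G e₀ e₁ e₂ x = trans (expand-linear F x) (trans
    (cong₂ _+_ (cong₂ _+_ (cong (_ *_) e₀) (cong (_ *_) e₁)) (cong (_ *_) e₂)) (sym (expand-linear G x)))

  abstract
    -- By `agree-on-orbit`, `values x l` is an injection of K³ into itself, hence onto; no
    -- Vandermonde matrix has to be inverted.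
    interpolate : ∀ {x l} → ¬ x ≡ 0# → Irrational l → ∀ t → ∃[ g ] values x l g ≡ t
    interpolate {x} {l} x≢0 irr = Enumerated.injective⇒surjective (Triple-enum enum) (values x l)
      (λ {g} {h} e → agree-on-orbit g h x≢0 irr (cong x₀ e) (cong x₁ e) (cong x₂ e))

    represent : ∀ {f} → IsLinear f → ∃[ g ] (∀ x → ap g x ≡ f x)
    represent {f} lin = from-values (interpolate 1≢0 θ-irrational ⟨ f 1# , f (θ * 1#) , f (θ * (θ * 1#)) ⟩)
      where
      from-values : ∃[ g ] values 1# θ g ≡ ⟨ f 1# , f (θ * 1#) , f (θ * (θ * 1#)) ⟩ → ∃[ g ] (∀ x → ap g x ≡ f x)
      from-values (g , e) = g , linear-ext (ap-isLinear g) lin (cong x₀ e) (cong x₁ e) (cong x₂ e)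

  infixr 9 _∘L_
  -- Multiplication in the skew group ring over K of the group generated by σ.
  _∘L_ : Lin → Lin → Lin
  ⟨ α , β , γ ⟩ ∘L ⟨ a , b , c ⟩ = ⟨ α * a + β * σ c + γ * σ (σ b) , α * b + β * σ a + γ * σ (σ c) , α * c + β * σ b + γ * σ (σ a) ⟩

  σ-ap : ∀ f x → σ (ap f x) ≡ σ (x₀ f) * σ x + σ (x₁ f) * σ (σ x) + σ (x₂ f) * x
  σ-ap f x = trans (σ-+ _ _) (cong₂ _+_ (trans (σ-+ _ _) (cong₂ _+_ (σ-* _ _) (σ-* _ _))) (trans (σ-* _ _) (cong (_ *_) (σ³ x))))

  σσ-ap : ∀ f x → σ (σ (ap f x)) ≡ σ (σ (x₀ f)) * σ (σ x) + σ (σ (x₁ f)) * x + σ (σ (x₂ f)) * σ x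
  σσ-ap f x = trans (cong σ (σ-ap f x)) (trans (σ-+ _ _) (cong₂ _+_ (trans (σ-+ _ _) (cong₂ _+_ (σ-* _ _) (trans (σ-* _ _) (cong (_ *_) (σ³ x))))) (σ-* _ _)))

  ap-∘ : ∀ f g x → ap (f ∘L g) x ≡ ap f (ap g x)
  ap-∘ f@(⟨ α , β , γ ⟩) g@(⟨ a , b , c ⟩) x = trans
    (solve 15 (λ α β γ a a' a'' b b' b'' c c' c'' x x' x'' →
      (α :* a :+ β :* c' :+ γ :* b'') :* x :+ (α :* b :+ β :* a' :+ γ :* c'') :* x' :+ (α :* c :+ β :* b' :+ γ :* a'') :* x''
      := α :* (a :* x :+ b :* x' :+ c :* x'') :+ β :* (a' :* x' :+ b' :* x'' :+ c' :* x) :+ γ :* (a'' :* x'' :+ b'' :* x :+ c'' :* x'))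
      refl α β γ a (σ a) (σ (σ a)) b (σ b) (σ (σ b)) c (σ c) (σ (σ c)) x (σ x) (σ (σ x)))
    (sym (cong₂ (λ s t → α * ap g x + β * s + γ * t) (σ-ap g x) (σσ-ap g x)))

  det₉ : (a b c d e f g h i : Carrier) → Carrier
  det₉ a b c d e f g h i = a * (e * i - f * h) - b * (d * i - f * g) + c * (d * h - e * g)

  :det₉ : ∀ {n} (a b c d e f g h i : Polynomial n) → Polynomial n
  :det₉ a b c d e f g h i = a :* (e :* i :- f :* h) :- b :* (d :* i :- f :* g) :+ c :* (d :* h :- e :* g)

  -- The determinant of f, read off its matrix with respect to the coordinates (x, σx, σ²x) of K ⊗ K.
  det : Lin → Carrier
  det ⟨ α , β , γ ⟩ = det₉ α β γ (σ γ) (σ α) (σ β) (σ (σ β)) (σ (σ γ)) (σ (σ α))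

  det₉-* : ∀ a b c d e f g h i a' b' c' d' e' f' g' h' i' →
    det₉ (a * a' + b * d' + c * g') (a * b' + b * e' + c * h') (a * c' + b * f' + c * i')
         (d * a' + e * d' + f * g') (d * b' + e * e' + f * h') (d * c' + e * f' + f * i')
         (g * a' + h * d' + i * g') (g * b' + h * e' + i * h') (g * c' + h * f' + i * i')
    ≡ det₉ a b c d e f g h i * det₉ a' b' c' d' e' f' g' h' i'
  det₉-* = solve 18 (λ a b c d e f g h i a' b' c' d' e' f' g' h' i' →
    :det₉ (a :* a' :+ b :* d' :+ c :* g') (a :* b' :+ b :* e' :+ c :* h') (a :* c' :+ b :* f' :+ c :* i')
          (d :* a' :+ e :* d' :+ f :* g') (d :* b' :+ e :* e' :+ f :* h') (d :* c' :+ e :* f' :+ f :* i')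
          (g :* a' :+ h :* d' :+ i :* g') (g :* b' :+ h :* e' :+ i :* h') (g :* c' :+ h :* f' :+ i :* i')
    := :det₉ a b c d e f g h i :* :det₉ a' b' c' d' e' f' g' h' i') refl

  private
    det₉-cong : ∀ {a b c d e f g h i d' e' f' g' h' i'} → d ≡ d' → e ≡ e' → f ≡ f' → g ≡ g' → h ≡ h' → i ≡ i' →
                det₉ a b c d e f g h i ≡ det₉ a b c d' e' f' g' h' i'
    det₉-cong refl refl refl refl refl refl = refl

  det-∘ : ∀ f g → det (f ∘L g) ≡ det f * det g
  det-∘ ⟨ α , β , γ ⟩ ⟨ a , b , c ⟩ = trans
    (det₉-cong (trans (σ-dot α c β b γ a) (rotate _ _ _)) (trans (σ-dot α a β c γ b) (rotate _ _ _)) (trans (σ-dot α b β a γ c) (rotate _ _ _))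
               (trans (σσ-dot α b β a γ c) (rotate' _ _ _)) (trans (σσ-dot α c β b γ a) (rotate' _ _ _)) (trans (σσ-dot α a β c γ b) (rotate' _ _ _)))
    (det₉-* α β γ (σ γ) (σ α) (σ β) (σ (σ β)) (σ (σ γ)) (σ (σ α)) a b c (σ c) (σ a) (σ b) (σ (σ b)) (σ (σ c)) (σ (σ a)))
    where
    rotate : ∀ a b c → a + b + c ≡ c + a + b
    rotate = solve 3 (λ a b c → a :+ b :+ c := c :+ a :+ b) refl
    rotate' : ∀ a b c → a + b + c ≡ b + c + a
    rotate' = solve 3 (λ a b c → a :+ b :+ c := b :+ c :+ a) refl
    σ-dot : ∀ x u y v z w → σ (x * u + y * σ v + z * σ (σ w)) ≡ σ x * σ u + σ y * σ (σ v) + σ z * w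
    σ-dot x u y v z w = trans (σ-+ _ _) (cong₂ _+_ (trans (σ-+ _ _) (cong₂ _+_ (σ-* _ _) (σ-* _ _))) (trans (σ-* _ _) (cong (_ *_) (σ³ w))))
    σσ-dot : ∀ x u y v z w → σ (σ (x * u + y * σ v + z * σ (σ w))) ≡ σ (σ x) * σ (σ u) + σ (σ y) * v + σ (σ z) * σ w
    σσ-dot x u y v z w = trans (cong σ (σ-dot x u y v z w)) (trans (σ-+ _ _) (cong₂ _+_ (trans (σ-+ _ _) (cong₂ _+_ (σ-* _ _)
      (trans (σ-* _ _) (cong (_ *_) (σ³ v))))) (σ-* _ _)))

  idL : Lin
  idL = ⟨ 1# , 0# , 0# ⟩

  ap-id : ∀ x → ap idL x ≡ x
  ap-id x = solve 3 (λ x y z → :1 :* x :+ :0 :* y :+ :0 :* z := x) refl x (σ x) (σ (σ x))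

  scalar : Carrier → Lin
  scalar c = ⟨ c , 0# , 0# ⟩

  ap-scalar : ∀ c x → ap (scalar c) x ≡ c * x
  ap-scalar c x = solve 4 (λ c x y z → c :* x :+ :0 :* y :+ :0 :* z := c :* x) refl c x (σ x) (σ (σ x))

  det-scalar : ∀ c → det (scalar c) ≡ N c
  det-scalar c = trans (cong₂ (λ s t → det₉ c 0# 0# s (σ c) s t t (σ (σ c))) σ-0 (trans (cong σ σ-0) σ-0))
    (solve 3 (λ a b c → :det₉ a :0 :0 :0 b :0 :0 :0 c := a :* b :* c) refl c (σ c) (σ (σ c)))

  σL : Lin
  σL = ⟨ 0# , 1# , 0# ⟩

  ap-σL : ∀ x → ap σL x ≡ σ x
  ap-σL x = solve 3 (λ x y z → :0 :* x :+ :1 :* y :+ :0 :* z := y) refl x (σ x) (σ (σ x))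

  σ-det : ∀ f → σ (det f) ≡ det f
  σ-det ⟨ α , β , γ ⟩ = trans (σ-det₉ _ _ _ _ _ _ _ _ _) (trans (cong₃ (λ r s t → det₉ (σ α) (σ β) (σ γ) (σ (σ γ)) (σ (σ α)) (σ (σ β)) r s t) (σ³ β) (σ³ γ) (σ³ α))
    (solve 9 (λ a b c d e f g h i → :det₉ e f d h i g b c a := :det₉ a b c d e f g h i) refl α β γ (σ γ) (σ α) (σ β) (σ (σ β)) (σ (σ γ)) (σ (σ α))))
    where
    cong₃ : ∀ (f : Carrier → Carrier → Carrier → Carrier) {a b c a' b' c'} → a ≡ a' → b ≡ b' → c ≡ c' → f a b c ≡ f a' b' c'
    cong₃ f refl refl refl = refl
    minor : ∀ a b c d → σ (a * b - c * d) ≡ σ a * σ b - σ c * σ d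
    minor a b c d = trans (σ-- _ _) (cong₂ _-_ (σ-* a b) (σ-* c d))
    σ-det₉ : ∀ a b c d e f g h i → σ (det₉ a b c d e f g h i) ≡ det₉ (σ a) (σ b) (σ c) (σ d) (σ e) (σ f) (σ g) (σ h) (σ i)
    σ-det₉ a b c d e f g h i = trans (σ-+ _ _) (cong₂ _+_ (trans (σ-- _ _) (cong₂ _-_
      (trans (σ-* _ _) (cong (σ a *_) (minor e i f h))) (trans (σ-* _ _) (cong (σ b *_) (minor d i f g)))))
      (trans (σ-* _ _) (cong (σ c *_) (minor d h e g))))

  Injective : Lin → Set
  Injective f = ∀ x → ap f x ≡ 0# → x ≡ 0#

  ap-injective : ∀ {f} → Injective f → ∀ {x y} → ap f x ≡ ap f y → x ≡ y
  ap-injective {f} inj {x} {y} e = difference-zero (inj (x - y) (trans (ap-- f x y) (zero-difference e)))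

  abstract
    surjective : ∀ {f} → Injective f → ∀ y → ∃[ x ] ap f x ≡ y
    surjective {f} inj = injective⇒surjective (ap f) (ap-injective {f} inj)

  record Inverse′ (f : Lin) : Set where
    field
      inverse′ : Lin
      inverseʳ : ∀ x → ap f (ap inverse′ x) ≡ x
      inverseˡ : ∀ x → ap inverse′ (ap f x) ≡ x

  abstract
    invert : ∀ {f} → Injective f → Inverse′ f
    invert {f} inj = record
      { inverse′ = proj₁ rep
      ; inverseʳ = λ x → trans (cong (ap f) (proj₂ rep x)) (fg x)
      ; inverseˡ = λ x → trans (proj₂ rep (ap f x)) (ap-injective {f} inj (fg (ap f x))) }
      where
      g : Carrier → Carrier
      g y = proj₁ (surjective {f} inj y)
      fg : ∀ y → ap f (g y) ≡ y
      fg y = proj₂ (surjective {f} inj y)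
      rep : ∃[ h ] (∀ x → ap h x ≡ g x)
      rep = represent {g} record
        { additive = λ x y → ap-injective {f} inj (trans (fg (x + y)) (trans (sym (cong₂ _+_ (fg x) (fg y))) (sym (ap-+ f (g x) (g y)))))
        ; homogeneous = λ c x → ap-injective {f} inj (trans (fg (ι c * x)) (trans (cong (ι c *_) (sym (fg x))) (sym (ap-ι f c (g x))))) }

  det-id : det idL ≡ 1#
  det-id = trans (det-scalar 1#) (trans (cong₂ (λ s t → 1# * s * t) σ-1 (trans (cong σ σ-1) σ-1)) (solve 0 (:1 :* :1 :* :1 := :1) refl))

  det-≢0 : ∀ {f} → Injective f → ¬ det f ≡ 0#
  det-≢0 {f} inj e = 1≢0 (begin
    1#                   ≡⟨ det-id ⟨
    det idL              ≡⟨ cong det (ap-unique (f ∘L inverse′) idL (λ x → trans (ap-∘ f inverse′ x) (trans (inverseʳ x) (sym (ap-id x))))) ⟨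
    det (f ∘L inverse′)  ≡⟨ det-∘ f inverse′ ⟩
    det f * det inverse′ ≡⟨ cong (_* det inverse′) e ⟩
    0# * det inverse′    ≡⟨ zeroˡ _ ⟩
    0#                   ∎)
    where
    open ≡-Reasoning
    open Inverse′ (invert {f} inj)

-- Characteristic polynomials and maps without eigenvectors

module CharacteristicPolynomial (k : FiniteField) (E : CyclicCubic k) where
  open LinearMaps k E
  open CubicExtension K using (cubic; :cubic)
  open CubicExtension k using () renaming (cubic to cubicₖ)

  -- Trace and sum of the principal 2×2 minors of the matrix whose determinant is `det`.
  charTr char₂ : Lin → Carrier
  charTr f = Tr (x₀ f)
  char₂ f = x₀ f * σ (x₀ f) - x₁ f * σ (x₂ f) + (σ (x₀ f) * σ (σ (x₀ f)) - σ (x₁ f) * σ (σ (x₂ f)))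
            + (σ (σ (x₀ f)) * x₀ f - σ (σ (x₁ f)) * x₂ f)

  σ-char₂ : ∀ f → σ (char₂ f) ≡ char₂ f
  σ-char₂ ⟨ α , β , γ ⟩ = trans (σ-+ _ _) (trans (cong₂ _+_ (trans (σ-+ _ _) (cong₂ _+_ (minor α (σ α) β (σ γ)) (minor (σ α) (σ (σ α)) (σ β) (σ (σ γ)))))
      (trans (minor (σ (σ α)) α (σ (σ β)) γ) (cong₂ _-_ (cong (_* σ α) (σ³ α)) (cong (_* σ γ) (σ³ β)))))
    (trans (cong₂ (λ s t → σ α * σ (σ α) - σ β * σ (σ γ) + (σ (σ α) * s - σ (σ β) * t) + (α * σ α - β * σ γ)) (σ³ α) (σ³ γ))
    (solve 9 (λ a a' a'' b b' b'' c c' c'' → a' :* a'' :- b' :* c'' :+ (a'' :* a :- b'' :* c) :+ (a :* a' :- b :* c')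
       := a :* a' :- b :* c' :+ (a' :* a'' :- b' :* c'') :+ (a'' :* a :- b'' :* c)) refl
      α (σ α) (σ (σ α)) β (σ β) (σ (σ β)) γ (σ γ) (σ (σ γ)))))
    where
    minor : ∀ a b c d → σ (a * b - c * d) ≡ σ a * σ b - σ c * σ d
    minor a b c d = trans (σ-- _ _) (cong₂ _-_ (σ-* a b) (σ-* c d))

  cayley-hamilton : ∀ f x → ap f (ap f (ap f x)) ≡ charTr f * ap f (ap f x) - char₂ f * ap f x + det f * x
  cayley-hamilton f@(⟨ α , β , γ ⟩) x = begin
    ap f (ap f y)
      ≡⟨ cong₂ (λ s t → α * ap f y + β * s + γ * t) (σ-ap f y) (σσ-ap f y) ⟩
    α * (α * y + β * σ y + γ * σ (σ y)) + β * (α' * σ y + β' * σ (σ y) + γ' * y) + γ * (α'' * σ (σ y) + β'' * y + γ'' * σ y)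
      ≡⟨ cong₂ (λ s t → α * (α * y + β * s + γ * t) + β * (α' * s + β' * t + γ' * y) + γ * (α'' * t + β'' * y + γ'' * s)) (σ-ap f x) (σσ-ap f x) ⟩
    α * (α * y + β * y' + γ * y'') + β * (α' * y' + β' * y'' + γ' * y) + γ * (α'' * y'' + β'' * y + γ'' * y')
      ≡⟨ solve 12 (λ α α' α'' β β' β'' γ γ' γ'' x x' x'' →
           let y = α :* x :+ β :* x' :+ γ :* x''
               y' = α' :* x' :+ β' :* x'' :+ γ' :* x
               y'' = α'' :* x'' :+ β'' :* x :+ γ'' :* x' in
           α :* (α :* y :+ β :* y' :+ γ :* y'') :+ β :* (α' :* y' :+ β' :* y'' :+ γ' :* y) :+ γ :* (α'' :* y'' :+ β'' :* y :+ γ'' :* y')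
           := (α :+ α' :+ α'') :* (α :* y :+ β :* y' :+ γ :* y'') :- (α :* α' :- β :* γ' :+ (α' :* α'' :- β' :* γ'') :+ (α'' :* α :- β'' :* γ)) :* y
              :+ :det₉ α β γ γ' α' β' β'' γ'' α'' :* x) refl α α' α'' β β' β'' γ γ' γ'' x (σ x) (σ (σ x)) ⟩
    charTr f * (α * y + β * y' + γ * y'') - char₂ f * y + det f * x
      ≡⟨ cong₂ (λ s t → charTr f * (α * y + β * s + γ * t) - char₂ f * y + det f * x) (σ-ap f x) (σσ-ap f x) ⟨
    charTr f * ap f y - char₂ f * y + det f * x ∎
    where
    open ≡-Reasoning
    α' = σ α
    β' = σ β
    γ' = σ γ
    α'' = σ (σ α)
    β'' = σ (σ β)
    γ'' = σ (σ γ)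
    y = ap f x
    y' = α' * σ x + β' * σ (σ x) + γ' * x
    y'' = α'' * σ (σ x) + β'' * x + γ'' * σ x

  -- The scalar c has to be fixed by σ: only then do the conjugated rows of the matrix of f - c
  -- carry the same c on the diagonal.
  det-shift : ∀ f c → σ c ≡ c → det ⟨ x₀ f - c , x₁ f , x₂ f ⟩ ≡ - cubic (charTr f) (char₂ f) (det f) c
  det-shift ⟨ α , β , γ ⟩ c e = trans (cong₂ (λ s t → det₉ (α - c) β γ (σ γ) s (σ β) (σ (σ β)) (σ (σ γ)) t) e₁
      (trans (cong σ e₁) (trans (σ-- _ c) (cong (λ z → σ (σ α) - z) e))))
    (solve 10 (λ α α' α'' β β' β'' γ γ' γ'' c → :det₉ (α :- c) β γ γ' (α' :- c) β' β'' γ'' (α'' :- c)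
       := :- :cubic (α :+ α' :+ α'') (α :* α' :- β :* γ' :+ (α' :* α'' :- β' :* γ'') :+ (α'' :* α :- β'' :* γ)) (:det₉ α β γ γ' α' β' β'' γ'' α'') c)
      refl α (σ α) (σ (σ α)) β (σ β) (σ (σ β)) γ (σ γ) (σ (σ γ)) c)
    where
    e₁ : σ (α - c) ≡ σ α - c
    e₁ = trans (σ-- α c) (cong (λ z → σ α - z) e)

  σ-cubic : ∀ {a b d} → σ a ≡ a → σ b ≡ b → σ d ≡ d → ∀ x → σ (cubic a b d x) ≡ cubic a b d (σ x)
  σ-cubic ea eb ed x = trans (σ-- _ _) (cong₂ _-_ (trans (σ-+ _ _) (cong₂ _+_ (trans (σ-- _ _) (cong₂ _-_
      (trans (σ-* _ _) (cong (_* σ x) (σ-* x x)))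
      (trans (σ-* _ _) (cong₂ _*_ ea (σ-* x x)))))
      (trans (σ-* _ _) (cong (_* σ x) eb)))) ed)

  module Vieta {a b d : Carrier} (ea : σ a ≡ a) (eb : σ b ≡ b) (ed : σ d ≡ d) {l : Carrier} (irr : Irrational l)
               (root : cubic a b d l ≡ 0#) where
    private
      l' = σ l
      l'' = σ (σ l)
      root' : cubic a b d l' ≡ 0#
      root' = trans (sym (σ-cubic ea eb ed l)) (trans (cong σ root) σ-0)
      root'' : cubic a b d l'' ≡ 0#
      root'' = trans (sym (σ-cubic ea eb ed l')) (trans (cong σ root') σ-0)
      -- Divided difference of the cubic at two distinct roots; two such relations sharing the root
      -- l determine the trace.
      secant : ∀ u v → ¬ u ≡ v → cubic a b d u ≡ 0# → cubic a b d v ≡ 0# → u * u + u * v + v * v - a * (u + v) + b ≡ 0#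
      secant u v u≢v e e' = *-cancelˡ-0 (u≢v ∘ difference-zero) (combine₂ 1# (- 1#) e e'
        (solve 5 (λ a b d u v → (u :- v) :* (u :* u :+ u :* v :+ v :* v :- a :* (u :+ v) :+ b) :- :0
           := :1 :* (:cubic a b d u :- :0) :+ (:- :1) :* (:cubic a b d v :- :0)) refl a b d u v))
      q₁ = secant l l' (irr ∘ sym) root root'
      q₂ = secant l l'' (irrational-σσ irr ∘ sym) root root''

    trace : Tr l ≡ a
    trace = difference-zero (*-cancelˡ-0 (irrational-σ irr ∘ sym ∘ difference-zero) (combine₂ 1# (- 1#) q₁ q₂
      (solve 5 (λ a b u v w → (v :- w) :* (u :+ v :+ w :- a) :- :0
         := :1 :* (u :* u :+ u :* v :+ v :* v :- a :* (u :+ v) :+ b :- :0)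
            :+ (:- :1) :* (u :* u :+ u :* w :+ w :* w :- a :* (u :+ w) :+ b :- :0)) refl a b l l' l'')))

    second : l * l' + l' * l'' + l'' * l ≡ b
    second = combine₂ (- 1#) (l + l') q₁ trace
      (solve 5 (λ a b u v w → u :* v :+ v :* w :+ w :* u :- b
         := (:- :1) :* (u :* u :+ u :* v :+ v :* v :- a :* (u :+ v) :+ b :- :0) :+ (u :+ v) :* (u :+ v :+ w :- a)) refl a b l l' l'')

    norm : N l ≡ d
    norm = combine₃ 1# (- (l * l)) l root trace second
      (solve 6 (λ a b d u v w → u :* v :* w :- d := :1 :* (:cubic a b d u :- :0) :+ (:- (u :* u)) :* (u :+ v :+ w :- a)
         :+ u :* (u :* v :+ v :* w :+ w :* u :- b)) refl a b d l l' l'')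

  open CubicRoots k K emb card using (second-root)

  ι-cubic : ∀ a b d c → ι (cubicₖ a b d c) ≡ cubic (ι a) (ι b) (ι d) (ι c)
  ι-cubic a b d c = trans (ι-- _ _) (cong (_- ι d) (trans (ι-+ _ _) (cong₂ _+_ (trans (ι-- _ _) (cong₂ _-_
      (trans (ι-* _ _) (cong (_* ι c) (ι-* c c))) (trans (ι-* _ _) (cong (ι a *_) (ι-* c c))))) (ι-* b c))))

  abstract
    root : ∀ a b d → (∀ c → ¬ cubicₖ a b d c ≡ k.0#) → ∃[ l ] (Irrational l × cubic (ι a) (ι b) (ι d) l ≡ 0#)
    root a b d rootless = l , irr , e
      where
      l : Carrier
      -- Any root will do; 0 is an arbitrary element to avoid.
      l = proj₁ (second-root a b d rootless 0#)
      e : cubic (ι a) (ι b) (ι d) l ≡ 0#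
      e = proj₂ (proj₂ (second-root a b d rootless 0#))
      irr : Irrational l
      irr f = rootless (proj₁ (fixed l f)) (ι-injective (trans (ι-cubic a b d _)
        (trans (cong (cubic (ι a) (ι b) (ι d)) (sym (proj₂ (fixed l f)))) (trans e (sym ι-0)))))

  NoEigenvector : Lin → Set
  NoEigenvector f = ∀ c x → ap f x ≡ ι c * x → x ≡ 0#

  record Cyclic (f : Lin) : Set where
    field
      l : Carrier
      χ : Lin
      l-irrational : Irrational l
      χ-injective : Injective χ
      χ-intertwines : ∀ x → ap f (ap χ x) ≡ ap χ (l * x)
      l-norm : N l ≡ det f

  -- A map without eigenvectors is multiplication by some l ∈ K in suitable coordinates:
  -- l is a root of the characteristic polynomial and χ(x) = Σᵢ Tr(x pᵢ(l)) fⁱ(1), where (m(T) − m(l))/(T − l) = Σᵢ pᵢ(l) Tⁱ.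
  module MakeCyclic (f : Lin) (noEig : NoEigenvector f) where
    private
      t e d : Carrier
      t = charTr f
      e = char₂ f
      d = det f
      σt = σ-Tr (x₀ f)
      σe = σ-char₂ f
      σd = σ-det f
      tₖ eₖ dₖ : k.Carrier
      tₖ = proj₁ (fixed t σt)
      eₖ = proj₁ (fixed e σe)
      dₖ = proj₁ (fixed d σd)

      same-cubic : ∀ x → cubic (ι tₖ) (ι eₖ) (ι dₖ) x ≡ cubic t e d x
      same-cubic x = cong₃ (λ a b c → cubic a b c x) (sym (proj₂ (fixed t σt))) (sym (proj₂ (fixed e σe))) (sym (proj₂ (fixed d σd)))
        where
        cong₃ : ∀ (f : Carrier → Carrier → Carrier → Carrier) {a b c a' b' c'} → a ≡ a' → b ≡ b' → c ≡ c' → f a b c ≡ f a' b' c'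
        cong₃ f refl refl refl = refl

      rootless : ∀ c → ¬ cubicₖ tₖ eₖ dₖ c ≡ k.0#
      rootless c z = det-≢0 {⟨ x₀ f - ι c , x₁ f , x₂ f ⟩}
        (λ x h → noEig c x (combine₁ 1# h (solve 7 (λ α β γ c x x' x'' → α :* x :+ β :* x' :+ γ :* x'' :- c :* x
            := :1 :* ((α :- c) :* x :+ β :* x' :+ γ :* x'' :- :0)) refl (x₀ f) (x₁ f) (x₂ f) (ι c) x (σ x) (σ (σ x)))))
        (trans (det-shift f (ι c) (σ-ι c)) (trans (cong -_ (trans (sym (same-cubic (ι c))) (trans (sym (ι-cubic tₖ eₖ dₖ c)) (trans (cong ι z) ι-0))))
          (solve 0 (:- :0 := :0) refl)))

      l : Carrier
      l = proj₁ (root tₖ eₖ dₖ rootless)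
      irr : Irrational l
      irr = proj₁ (proj₂ (root tₖ eₖ dₖ rootless))
      ml : cubic t e d l ≡ 0#
      ml = trans (sym (same-cubic l)) (proj₂ (proj₂ (root tₖ eₖ dₖ rootless)))

      a₁ a₂ p r : Carrier
      a₁ = ap f 1#
      a₂ = ap f a₁
      -- Collected by powers of l, Σᵢ pᵢ(l) fⁱ(1) is p + rl + l². The coefficients of `χ` are this
      -- element and the same expression at σ(l) and σ²(l).
      p = a₂ - t * a₁ + e
      r = a₁ - t
      χ : Lin
      χ = ⟨ p + r * l + l * l , p + r * σ l + σ l * σ l , p + r * σ (σ l) + σ (σ l) * σ (σ l) ⟩

      χ-formula : ∀ x → ap χ x ≡ Tr x * a₂ + (Tr (l * x) - t * Tr x) * a₁ + (Tr (l * (l * x)) - t * Tr (l * x) + e * Tr x) * 1#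
      χ-formula x = trans (solve 10 (λ a₁ a₂ t e l l' l'' x x' x'' →
          let p = a₂ :- t :* a₁ :+ e ; r = a₁ :- t in
          (p :+ r :* l :+ l :* l) :* x :+ (p :+ r :* l' :+ l' :* l') :* x' :+ (p :+ r :* l'' :+ l'' :* l'') :* x''
          := (x :+ x' :+ x'') :* a₂ :+ ((l :* x :+ l' :* x' :+ l'' :* x'') :- t :* (x :+ x' :+ x'')) :* a₁
             :+ ((l :* (l :* x) :+ l' :* (l' :* x') :+ l'' :* (l'' :* x'')) :- t :* (l :* x :+ l' :* x' :+ l'' :* x'') :+ e :* (x :+ x' :+ x'')) :* :1)
          refl a₁ a₂ t e l (σ l) (σ (σ l)) x (σ x) (σ (σ x)))
        (cong₂ (λ s₁ s₂ → Tr x * a₂ + (s₁ - t * Tr x) * a₁ + (s₂ - t * s₁ + e * Tr x) * 1#) (sym Tr₁)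
          (sym (cong₂ (λ u v → l * (l * x) + u + v) σlx (trans (cong σ σlx) (trans (σ-* _ _) (cong (σ (σ l) *_) (σ-* _ _)))))))
        where
        σlx : σ (l * (l * x)) ≡ σ l * (σ l * σ x)
        σlx = trans (σ-* _ _) (cong (σ l *_) (σ-* l x))
        Tr₁ : Tr (l * x) ≡ l * x + σ l * σ x + σ (σ l) * σ (σ x)
        Tr₁ = cong₂ (λ u v → l * x + u + v) (σ-* l x) (trans (cong σ (σ-* l x)) (σ-* _ _))

      Tr-fixed : ∀ {c} → σ c ≡ c → ∀ x → σ (c * Tr x) ≡ c * Tr x
      Tr-fixed {c} h x = trans (σ-* _ _) (cong₂ _*_ h (σ-Tr x))

      s₃ : ∀ x → Tr (l * (l * (l * x))) ≡ t * Tr (l * (l * x)) - e * Tr (l * x) + d * Tr x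
      s₃ x = trans (cong Tr (combine₁ x ml (solve 5 (λ t e d l x → l :* (l :* (l :* x)) :- (t :* (l :* (l :* x)) :+ (:- e) :* (l :* x) :+ d :* x)
              := x :* (:cubic t e d l :- :0)) refl t e d l x)))
        (trans (Tr-+ _ _) (trans (cong₂ _+_ (trans (Tr-+ _ _) (cong₂ _+_ (Tr-scale _ σt) (Tr-scale _ (trans (σ-neg e) (cong -_ σe))))) (Tr-scale _ σd))
          (solve 6 (λ t e d u v w → t :* u :+ (:- e) :* v :+ d :* w := t :* u :- e :* v :+ d :* w) refl t e d _ _ _)))

      -- Both sides reduce by the same recurrence: f³(1) by Cayley-Hamilton, Tr(l³x) because l is a
      -- root of the characteristic polynomial.
      intertwines : ∀ x → ap f (ap χ x) ≡ ap χ (l * x)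
      intertwines x = begin
        ap f (ap χ x)
          ≡⟨ cong (ap f) (χ-formula x) ⟩
        ap f (S₀ * a₂ + (S₁ - t * S₀) * a₁ + (S₂ - t * S₁ + e * S₀) * 1#)
          ≡⟨ trans (ap-+ f _ _) (cong₂ _+_ (trans (ap-+ f _ _) (cong₂ _+_ (ap-scale f a₂ (σ-Tr x))
               (ap-scale f a₁ (trans (σ-- _ _) (cong₂ _-_ (σ-Tr _) (Tr-fixed σt x))))))
               (ap-scale f 1# (trans (σ-+ _ _) (cong₂ _+_ (trans (σ-- _ _) (cong₂ _-_ (σ-Tr _) (Tr-fixed σt _))) (Tr-fixed σe x))))) ⟩
        S₀ * ap f a₂ + (S₁ - t * S₀) * a₂ + (S₂ - t * S₁ + e * S₀) * a₁
          ≡⟨ combine₂ S₀ (- 1#) (cayley-hamilton f 1#) (s₃ x)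
               (solve 10 (λ a₁ a₂ a₃ S₀ S₁ S₂ S₃ t e d →
                 S₀ :* a₃ :+ (S₁ :- t :* S₀) :* a₂ :+ (S₂ :- t :* S₁ :+ e :* S₀) :* a₁
                   :- (S₁ :* a₂ :+ (S₂ :- t :* S₁) :* a₁ :+ (S₃ :- t :* S₂ :+ e :* S₁) :* :1)
                 := S₀ :* (a₃ :- (t :* a₂ :- e :* a₁ :+ d :* :1)) :+ (:- :1) :* (S₃ :- (t :* S₂ :- e :* S₁ :+ d :* S₀)))
                 refl a₁ a₂ (ap f a₂) S₀ S₁ S₂ (Tr (l * (l * (l * x)))) t e d) ⟩
        S₁ * a₂ + (S₂ - t * S₁) * a₁ + (Tr (l * (l * (l * x))) - t * S₂ + e * S₁) * 1#
          ≡⟨ χ-formula (l * x) ⟨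
        ap χ (l * x) ∎
        where
        open ≡-Reasoning
        S₀ = Tr x
        S₁ = Tr (l * x)
        S₂ = Tr (l * (l * x))

      -- A nonzero kernel vector x drags lx and l²x into the kernel, so χ = 0. Then the monic
      -- quadratic p + rT + T² would vanish at the three distinct conjugates of l.
      injective : Injective χ
      injective x h = by-contradiction (x ≟ 0#)
        where
        h₁ : ap χ (l * x) ≡ 0#
        h₁ = trans (sym (intertwines x)) (trans (cong (ap f) h) (ap-0 f))
        h₂ : ap χ (l * (l * x)) ≡ 0#
        h₂ = trans (sym (intertwines (l * x))) (trans (cong (ap f) h₁) (ap-0 f))
        zero-map : ¬ x ≡ 0# → χ ≡ 0L
        zero-map x≢0 = kills-orbit χ x≢0 irr h h₁ h₂
        distinct : ¬ (l - σ l) * (l - σ (σ l)) * (σ l - σ (σ l)) ≡ 0#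
        distinct = *-≢0 (*-≢0 (irr ∘ sym ∘ difference-zero) (irrational-σσ irr ∘ sym ∘ difference-zero)) (irrational-σ irr ∘ sym ∘ difference-zero)
        by-contradiction : Dec (x ≡ 0#) → x ≡ 0#
        by-contradiction (yes z) = z
        by-contradiction (no x≢0) = contradiction
          (combine₃ (σ l - σ (σ l)) (σ (σ l) - l) (l - σ l) (cong x₀ (zero-map x≢0)) (cong x₁ (zero-map x≢0)) (cong x₂ (zero-map x≢0))
            (solve 5 (λ p r u v w → (u :- v) :* (u :- w) :* (v :- w) :- :0 :=
              (v :- w) :* (p :+ r :* u :+ u :* u :- :0) :+ (w :- u) :* (p :+ r :* v :+ v :* v :- :0)
              :+ (u :- v) :* (p :+ r :* w :+ w :* w :- :0)) refl p r l (σ l) (σ (σ l))))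
          distinct

    abstract
      cyclic : Cyclic f
      cyclic = record { l = l ; χ = χ ; l-irrational = irr ; χ-injective = injective ; χ-intertwines = intertwines
                      ; l-norm = Vieta.norm σt σe σd irr ml }

-- Symmetric bilinear maps and trace forms on K

module Bilinear (k : FiniteField) (E : CyclicCubic k) where
  open LinearMaps k E public
  open CharacteristicPolynomial k E public

  record SymmetricBilinear (T : Carrier → Carrier → Carrier) : Set where
    field
      T-comm : ∀ x y → T x y ≡ T y x
      T-linear : ∀ y → IsLinear (λ x → T x y)

    T-+ʳ : ∀ x y z → T x (y + z) ≡ T x y + T x z
    T-+ʳ x y z = trans (T-comm _ _) (trans (additive (T-linear x) y z) (cong₂ _+_ (T-comm _ _) (T-comm _ _)))

    T-ιʳ : ∀ c x y → T x (ι c * y) ≡ ι c * T x y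
    T-ιʳ c x y = trans (T-comm _ _) (trans (homogeneous (T-linear x) c y) (cong (ι c *_) (T-comm _ _)))

  bilinear : (t s : Lin) → Carrier → Carrier → Carrier
  bilinear t s x y = ap t (x * y) + ap s (x * σ y + σ x * y)

  σ²-* : ∀ x y → σ (σ (x * y)) ≡ σ (σ x) * σ (σ y)
  σ²-* x y = trans (cong σ (σ-* x y)) (σ-* _ _)

  σ-sym : ∀ x y → σ (x * σ y + σ x * y) ≡ σ x * σ (σ y) + σ (σ x) * σ y
  σ-sym x y = trans (σ-+ _ _) (cong₂ _+_ (σ-* _ _) (σ-* _ _))

  σσ-sym : ∀ x y → σ (σ (x * σ y + σ x * y)) ≡ σ (σ x) * y + x * σ (σ y)
  σσ-sym x y = trans (cong σ (σ-sym x y)) (trans (σ-+ _ _) (cong₂ _+_ (trans (σ-* _ _) (cong (_ *_) (σ³ y))) (trans (σ-* _ _) (cong (_* _) (σ³ x)))))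

  abstract
    -- The coefficients of x, σ(x), σ²(x) in T(x, y) are linear in y, so T is given by a 3×3 matrix
    -- over K, symmetric because T is commutative. The diagonal is the first map; the entries (0,1),
    -- (1,2), (0,2) belong to xσ(y) + σ(x)y and its conjugates and form the second.
    bilinear-form : ∀ {T} → SymmetricBilinear T → ∃[ t ] ∃[ s ] (∀ x y → T x y ≡ bilinear t s x y)
    bilinear-form {T} S = ⟨ x₀ A , x₁ B , x₂ C ⟩ , ⟨ x₁ A , x₂ B , x₂ A ⟩ , λ x y → begin
      T x y
        ≡⟨ rep y x ⟨
      x₀ (L y) * x + x₁ (L y) * σ x + x₂ (L y) * σ (σ x)
        ≡⟨ cong₂ _+_ (cong₂ _+_ (cong (_* x) (sym (A-rep y))) (cong (_* σ x) (sym (B-rep y)))) (cong (_* σ (σ x)) (sym (C-rep y))) ⟩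
      ap A y * x + ap B y * σ x + ap C y * σ (σ x)
        ≡⟨ cong₂ (λ b c → ap A y * x + (b * y + x₁ B * σ y + x₂ B * σ (σ y)) * σ x + (c * y + x₁ C * σ y + x₂ C * σ (σ y)) * σ (σ x)) (sym A₁≡B₀) (sym A₂≡C₀) ⟩
      ap A y * x + (x₁ A * y + x₁ B * σ y + x₂ B * σ (σ y)) * σ x + (x₂ A * y + x₁ C * σ y + x₂ C * σ (σ y)) * σ (σ x)
        ≡⟨ cong (λ c → ap A y * x + (x₁ A * y + x₁ B * σ y + x₂ B * σ (σ y)) * σ x + (x₂ A * y + c * σ y + x₂ C * σ (σ y)) * σ (σ x)) (sym B₂≡C₁) ⟩
      ap A y * x + (x₁ A * y + x₁ B * σ y + x₂ B * σ (σ y)) * σ x + (x₂ A * y + x₂ B * σ y + x₂ C * σ (σ y)) * σ (σ x)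
        ≡⟨ solve 12 (λ a₀ a₁ a₂ b₁ b₂ c₂ x x' x'' y y' y'' →
             (a₀ :* y :+ a₁ :* y' :+ a₂ :* y'') :* x :+ (a₁ :* y :+ b₁ :* y' :+ b₂ :* y'') :* x' :+ (a₂ :* y :+ b₂ :* y' :+ c₂ :* y'') :* x''
             := a₀ :* (x :* y) :+ b₁ :* (x' :* y') :+ c₂ :* (x'' :* y'') :+ b₂ :* (x' :* y'' :+ x'' :* y') :+ a₂ :* (x'' :* y :+ x :* y'') :+ a₁ :* (x :* y' :+ x' :* y))
             refl (x₀ A) (x₁ A) (x₂ A) (x₁ B) (x₂ B) (x₂ C) x (σ x) (σ (σ x)) y (σ y) (σ (σ y)) ⟩
      x₀ A * (x * y) + x₁ B * (σ x * σ y) + x₂ C * (σ (σ x) * σ (σ y)) + x₂ B * (σ x * σ (σ y) + σ (σ x) * σ y) + x₂ A * (σ (σ x) * y + x * σ (σ y)) + x₁ A * (x * σ y + σ x * y)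
        ≡⟨ cong₂ (λ u v → x₀ A * (x * y) + x₁ B * u + x₂ C * v + x₂ B * (σ x * σ (σ y) + σ (σ x) * σ y) + x₂ A * (σ (σ x) * y + x * σ (σ y)) + x₁ A * (x * σ y + σ x * y)) (σ-* x y) (σ²-* x y) ⟨
      ap ⟨ x₀ A , x₁ B , x₂ C ⟩ (x * y) + x₂ B * (σ x * σ (σ y) + σ (σ x) * σ y) + x₂ A * (σ (σ x) * y + x * σ (σ y)) + x₁ A * (x * σ y + σ x * y)
        ≡⟨ cong₂ (λ u v → ap ⟨ x₀ A , x₁ B , x₂ C ⟩ (x * y) + x₂ B * u + x₂ A * v + x₁ A * (x * σ y + σ x * y)) (σ-sym x y) (σσ-sym x y) ⟨
      ap ⟨ x₀ A , x₁ B , x₂ C ⟩ (x * y) + x₂ B * σ (x * σ y + σ x * y) + x₂ A * σ (σ (x * σ y + σ x * y)) + x₁ A * (x * σ y + σ x * y)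
        ≡⟨ solve 7 (λ p a b c u v w → p :+ b :* v :+ c :* w :+ a :* u := p :+ (a :* u :+ b :* v :+ c :* w)) refl (ap ⟨ x₀ A , x₁ B , x₂ C ⟩ (x * y)) (x₁ A) (x₂ B) (x₂ A) (x * σ y + σ x * y) (σ (x * σ y + σ x * y)) (σ (σ (x * σ y + σ x * y))) ⟩
      bilinear ⟨ x₀ A , x₁ B , x₂ C ⟩ ⟨ x₁ A , x₂ B , x₂ A ⟩ x y ∎
      where
      open ≡-Reasoning
      open SymmetricBilinear S
      L : Carrier → Lin
      L y = proj₁ (represent (T-linear y))
      rep : ∀ y x → ap (L y) x ≡ T x y
      rep y = proj₂ (represent (T-linear y))
      _+L_ : Lin → Lin → Lin
      f +L g = ⟨ x₀ f + x₀ g , x₁ f + x₁ g , x₂ f + x₂ g ⟩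
      ap-+L : ∀ f g x → ap (f +L g) x ≡ ap f x + ap g x
      ap-+L f g x = solve 9 (λ a b c d e f x y z → (a :+ d) :* x :+ (b :+ e) :* y :+ (c :+ f) :* z
         := a :* x :+ b :* y :+ c :* z :+ (d :* x :+ e :* y :+ f :* z)) refl (x₀ f) (x₁ f) (x₂ f) (x₀ g) (x₁ g) (x₂ g) x (σ x) (σ (σ x))
      _·L_ : Carrier → Lin → Lin
      c ·L f = ⟨ c * x₀ f , c * x₁ f , c * x₂ f ⟩
      ap-·L : ∀ c f x → ap (c ·L f) x ≡ c * ap f x
      ap-·L c f x = solve 7 (λ c a b d x y z → c :* a :* x :+ c :* b :* y :+ c :* d :* z := c :* (a :* x :+ b :* y :+ d :* z)) refl c (x₀ f) (x₁ f) (x₂ f) x (σ x) (σ (σ x))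
      L-+ : ∀ y z → L (y + z) ≡ L y +L L z
      L-+ y z = ap-unique _ _ (λ x → trans (rep (y + z) x) (trans (T-+ʳ x y z) (sym (trans (ap-+L (L y) (L z) x) (cong₂ _+_ (rep y x) (rep z x))))))
      L-ι : ∀ c y → L (ι c * y) ≡ ι c ·L L y
      L-ι c y = ap-unique _ _ (λ x → trans (rep (ι c * y) x) (trans (T-ιʳ c x y) (sym (trans (ap-·L (ι c) (L y) x) (cong (ι c *_) (rep y x))))))
      A B C : Lin
      A = proj₁ (represent {x₀ ∘ L} record { additive = λ y z → cong x₀ (L-+ y z) ; homogeneous = λ c y → cong x₀ (L-ι c y) })
      B = proj₁ (represent {x₁ ∘ L} record { additive = λ y z → cong x₁ (L-+ y z) ; homogeneous = λ c y → cong x₁ (L-ι c y) })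
      C = proj₁ (represent {x₂ ∘ L} record { additive = λ y z → cong x₂ (L-+ y z) ; homogeneous = λ c y → cong x₂ (L-ι c y) })
      A-rep : ∀ y → ap A y ≡ x₀ (L y)
      A-rep = proj₂ (represent {x₀ ∘ L} record { additive = λ y z → cong x₀ (L-+ y z) ; homogeneous = λ c y → cong x₀ (L-ι c y) })
      B-rep : ∀ y → ap B y ≡ x₁ (L y)
      B-rep = proj₂ (represent {x₁ ∘ L} record { additive = λ y z → cong x₁ (L-+ y z) ; homogeneous = λ c y → cong x₁ (L-ι c y) })
      C-rep : ∀ y → ap C y ≡ x₂ (L y)
      C-rep = proj₂ (represent {x₂ ∘ L} record { additive = λ y z → cong x₂ (L-+ y z) ; homogeneous = λ c y → cong x₂ (L-ι c y) })
      T-form : ∀ x y → T x y ≡ ap A y * x + ap B y * σ x + ap C y * σ (σ x)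
      T-form x y = trans (sym (rep y x)) (cong₂ _+_ (cong₂ _+_ (cong (_* x) (sym (A-rep y))) (cong (_* σ x) (sym (B-rep y)))) (cong (_* σ (σ x)) (sym (C-rep y))))
      transposed : ∀ y → L y ≡ ⟨ x₀ A * y + x₀ B * σ y + x₀ C * σ (σ y) , x₁ A * y + x₁ B * σ y + x₁ C * σ (σ y) , x₂ A * y + x₂ B * σ y + x₂ C * σ (σ y) ⟩
      transposed y = ap-unique _ _ (λ x → trans (rep y x) (trans (T-comm x y) (trans (T-form y x)
        (solve 15 (λ a₀ a₁ a₂ b₀ b₁ b₂ c₀ c₁ c₂ x x' x'' y y' y'' →
           (a₀ :* x :+ a₁ :* x' :+ a₂ :* x'') :* y :+ (b₀ :* x :+ b₁ :* x' :+ b₂ :* x'') :* y' :+ (c₀ :* x :+ c₁ :* x' :+ c₂ :* x'') :* y''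
           := (a₀ :* y :+ b₀ :* y' :+ c₀ :* y'') :* x :+ (a₁ :* y :+ b₁ :* y' :+ c₁ :* y'') :* x' :+ (a₂ :* y :+ b₂ :* y' :+ c₂ :* y'') :* x'')
           refl (x₀ A) (x₁ A) (x₂ A) (x₀ B) (x₁ B) (x₂ B) (x₀ C) (x₁ C) (x₂ C) x (σ x) (σ (σ x)) y (σ y) (σ (σ y))))))
      A-symmetric : A ≡ ⟨ x₀ A , x₀ B , x₀ C ⟩
      A-symmetric = ap-unique A ⟨ x₀ A , x₀ B , x₀ C ⟩ (λ y → trans (A-rep y) (cong x₀ (transposed y)))
      B-symmetric : B ≡ ⟨ x₁ A , x₁ B , x₁ C ⟩
      B-symmetric = ap-unique B ⟨ x₁ A , x₁ B , x₁ C ⟩ (λ y → trans (B-rep y) (cong x₁ (transposed y)))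
      A₁≡B₀ : x₁ A ≡ x₀ B
      A₁≡B₀ = cong x₁ A-symmetric
      A₂≡C₀ : x₂ A ≡ x₀ C
      A₂≡C₀ = cong x₂ A-symmetric
      B₂≡C₁ : x₂ B ≡ x₁ C
      B₂≡C₁ = cong x₂ B-symmetric

  Tr-σ : ∀ x → Tr (σ x) ≡ Tr x
  Tr-σ x = trans (cong (λ z → σ x + σ (σ x) + z) (σ³ x)) (solve 3 (λ x y z → y :+ z :+ x := x :+ y :+ z) refl x (σ x) (σ (σ x)))

  -- x, σ(x), σ²(x) are linearly independent over K, and x ↦ Tr(cx) has the coefficients c, σ(c),
  -- σ²(c).
  Tr-nondegenerate : ∀ {c} → (∀ x → Tr (c * x) ≡ 0#) → c ≡ 0#
  Tr-nondegenerate {c} h = cong x₀ (ap-unique ⟨ c , σ c , σ (σ c) ⟩ 0L (λ x → trans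
    (sym (cong₂ (λ u v → c * x + u + v) (σ-* c x) (σ²-* c x))) (trans (h x)
    (solve 3 (λ x y z → :0 := :0 :* x :+ :0 :* y :+ :0 :* z) refl x (σ x) (σ (σ x))))))

  Tr-0 : Tr 0# ≡ 0#
  Tr-0 = trans (cong₂ (λ u v → 0# + u + v) σ-0 (trans (cong σ σ-0) σ-0)) (solve 0 (:0 :+ :0 :+ :0 := :0) refl)

  Tr-neg : ∀ x → Tr (- x) ≡ - Tr x
  Tr-neg x = trans (cong₂ (λ u v → - x + u + v) (σ-neg x) (trans (cong σ (σ-neg x)) (σ-neg _)))
    (solve 3 (λ x y z → :- x :+ :- y :+ :- z := :- (x :+ y :+ z)) refl x (σ x) (σ (σ x)))

  Tr-- : ∀ x y → Tr (x - y) ≡ Tr x - Tr y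
  Tr-- x y = trans (Tr-+ x (- y)) (cong (λ z → Tr x + z) (Tr-neg y))

  form : (a b : Carrier) → Carrier → Carrier → Carrier
  form a b x y = Tr (a * (x * y)) + Tr (b * (x * σ y + σ x * y))

  -- The map G with Tr(G(x)y) as the form; its third coefficient is forced by self-adjointness.
  gram : (a b : Carrier) → Lin
  gram a b = ⟨ a , b , σ (σ b) ⟩

  form-gram : ∀ a b x y → form a b x y ≡ Tr (ap (gram a b) x * y)
  form-gram a b x y = begin
    Tr (a * (x * y)) + Tr (b * (x * σ y + σ x * y))
      ≡⟨ cong (λ z → Tr (a * (x * y)) + z) (trans (cong Tr (solve 5 (λ b x x' y y' → b :* (x :* y' :+ x' :* y) := b :* (x :* y') :+ b :* (x' :* y)) refl b x (σ x) y (σ y))) (Tr-+ _ _)) ⟩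
    Tr (a * (x * y)) + (Tr (b * (x * σ y)) + Tr (b * (σ x * y)))
      ≡⟨ cong (λ z → Tr (a * (x * y)) + (z + Tr (b * (σ x * y)))) (trans (sym (trans (Tr-σ _) (Tr-σ _)))
           (cong Tr (trans (σ²-* b _) (cong (σ (σ b) *_) (trans (σ²-* x (σ y)) (cong (σ (σ x) *_) (σ³ y))))))) ⟩
    Tr (a * (x * y)) + (Tr (σ (σ b) * (σ (σ x) * y)) + Tr (b * (σ x * y)))
      ≡⟨ sym (trans (cong Tr (solve 7 (λ a b b'' x x' x'' y → (a :* x :+ b :* x' :+ b'' :* x'') :* y
           := a :* (x :* y) :+ (b'' :* (x'' :* y) :+ b :* (x' :* y))) refl a b (σ (σ b)) x (σ x) (σ (σ x)) y))
           (trans (Tr-+ _ _) (cong (λ z → Tr (a * (x * y)) + z) (Tr-+ _ _)))) ⟩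
    Tr (ap (gram a b) x * y) ∎
    where open ≡-Reasoning

  form-unique : ∀ a b a' b' → (∀ x y → form a b x y ≡ form a' b' x y) → a ≡ a' × b ≡ b'
  form-unique a b a' b' h = cong x₀ same , cong x₁ same
    where
    same : gram a b ≡ gram a' b'
    same = ap-unique _ _ (λ x → difference-zero (Tr-nondegenerate (λ y → trans
      (cong Tr (solve 3 (λ u v y → (u :- v) :* y := u :* y :- v :* y) refl (ap (gram a b) x) (ap (gram a' b') x) y))
      (trans (Tr-- _ _) (zero-difference (trans (sym (form-gram a b x y)) (trans (h x y) (form-gram a' b' x y))))))))

  adjoint : Lin → Lin
  adjoint f = ⟨ x₀ f , σ (x₂ f) , σ (σ (x₁ f)) ⟩

  Tr-adjoint : ∀ f X w → Tr (X * ap f w) ≡ Tr (ap (adjoint f) X * w)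
  Tr-adjoint ⟨ α , β , γ ⟩ X w = begin
    Tr (X * (α * w + β * σ w + γ * σ (σ w)))
      ≡⟨ trans (cong Tr (solve 7 (λ X α β γ w w' w'' → X :* (α :* w :+ β :* w' :+ γ :* w'') := X :* α :* w :+ X :* β :* w' :+ X :* γ :* w'') refl X α β γ w (σ w) (σ (σ w))))
           (trans (Tr-+ _ _) (cong (_+ Tr (X * γ * σ (σ w))) (Tr-+ _ _))) ⟩
    Tr (X * α * w) + Tr (X * β * σ w) + Tr (X * γ * σ (σ w))
      ≡⟨ cong₂ (λ u v → Tr (X * α * w) + u + v)
           (trans (sym (trans (Tr-σ _) (Tr-σ _))) (cong Tr (trans (σ²-* _ _) (cong₂ _*_ (σ²-* X β) (σ³ w)))))
           (trans (sym (Tr-σ _)) (cong Tr (trans (σ-* _ _) (cong₂ _*_ (σ-* X γ) (σ³ w))))) ⟩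
    Tr (X * α * w) + Tr (σ (σ X) * σ (σ β) * w) + Tr (σ X * σ γ * w)
      ≡⟨ sym (trans (cong Tr (solve 7 (λ X X' X'' α β γ w → (α :* X :+ γ :* X' :+ β :* X'') :* w := X :* α :* w :+ X'' :* β :* w :+ X' :* γ :* w) refl X (σ X) (σ (σ X)) α (σ (σ β)) (σ γ) w))
           (trans (Tr-+ _ _) (cong (_+ Tr (σ X * σ γ * w)) (Tr-+ _ _)))) ⟩
    Tr ((α * X + σ γ * σ X + σ (σ β) * σ (σ X)) * w) ∎
    where open ≡-Reasoning

  Tr-bilinear : ∀ t s X x y → Tr (X * bilinear t s x y) ≡ form (ap (adjoint t) X) (ap (adjoint s) X) x y
  Tr-bilinear t s X x y = trans (cong Tr (distribˡ X _ _)) (trans (Tr-+ _ _) (cong₂ _+_ (Tr-adjoint t X _) (Tr-adjoint s X _)))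

  -- θ - σ(θ) and θ² - σ(θ²), a basis of the elements of trace zero. The quotient τ₁/τ₀ = θ + σ(θ)
  -- is irrational and so generates K.
  τ₀ τ₁ : Carrier
  τ₀ = θ - σ θ
  τ₁ = τ₀ * (θ + σ θ)

  τ₀≢0 : ¬ τ₀ ≡ 0#
  τ₀≢0 e = θ-irrational (sym (difference-zero e))

  Tr-τ₀ : Tr τ₀ ≡ 0#
  Tr-τ₀ = trans (Tr-- θ (σ θ)) (zero-difference (sym (Tr-σ θ)))

  Tr-τ₁ : Tr τ₁ ≡ 0#
  Tr-τ₁ = trans (cong Tr (trans (solve 2 (λ u v → (u :- v) :* (u :+ v) := u :* u :- v :* v) refl θ (σ θ)) (cong (λ z → θ * θ - z) (sym (σ-* θ θ)))))
    (trans (Tr-- (θ * θ) (σ (θ * θ))) (zero-difference (sym (Tr-σ (θ * θ)))))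

  τ-independent : ¬ τ₀ * σ τ₁ - σ τ₀ * τ₁ ≡ 0#
  τ-independent e = *-≢0 (*-≢0 τ₀≢0 (σ-≢0 τ₀≢0)) (irrational-σσ θ-irrational ∘ difference-zero)
    (trans (solve 5 (λ p p' u v w → p :* p' :* (w :- u) := p :* (p' :* (v :+ w)) :- p' :* (p :* (u :+ v))) refl τ₀ (σ τ₀) θ (σ θ) (σ (σ θ)))
      (trans (cong (λ z → τ₀ * z - σ τ₀ * τ₁) (sym (trans (σ-* _ _) (cong (σ τ₀ *_) (σ-+ _ _))))) e))

  τ₁-τ₀ : ∀ c → ¬ τ₁ - ι c * τ₀ ≡ 0#
  τ₁-τ₀ c e = τ-independent (combine₂ τ₀ (- σ τ₀) (trans (sym (trans (σ-- _ _) (cong (λ z → σ τ₁ - z) (trans (σ-* _ _) (cong (_* σ τ₀) (σ-ι c)))))) (trans (cong σ e) σ-0)) e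
    (solve 5 (λ a a' b b' c → a :* b' :- a' :* b :- :0 := a :* (b' :- c :* a' :- :0) :+ (:- a') :* (b :- c :* a :- :0)) refl τ₀ (σ τ₀) τ₁ (σ τ₁) (ι c)))

  -- The conclusion says that f is a multiple of the trace: subtracting γ Tr leaves two
  -- coefficients, and these are annihilated by the nonzero determinant of `τ-independent`.
  vanishes-on-τ : ∀ f → ap f τ₀ ≡ 0# → ap f τ₁ ≡ 0# → x₁ f ≡ x₀ f × x₂ f ≡ x₀ f
  vanishes-on-τ f@(⟨ α , β , γ ⟩) e₀ e₁ = trans β≡γ (sym α≡γ) , sym α≡γ
    where
    α≡γ : α ≡ γ
    α≡γ = difference-zero (*-cancelˡ-0 τ-independent (combine₂ (σ τ₁) (- σ τ₀) e₀' e₁'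
      (solve 7 (λ a a' b b' α β γ → (a :* b' :- a' :* b) :* (α :- γ) :- :0 := b' :* ((α :- γ) :* a :+ (β :- γ) :* a' :- :0)
         :+ (:- a') :* ((α :- γ) :* b :+ (β :- γ) :* b' :- :0)) refl τ₀ (σ τ₀) τ₁ (σ τ₁) α β γ)))
      where
      reduce : ∀ x → Tr x ≡ 0# → ap f x ≡ 0# → (α - γ) * x + (β - γ) * σ x ≡ 0#
      reduce x t e = combine₂ 1# (- γ) e t (solve 6 (λ α β γ x y z → (α :- γ) :* x :+ (β :- γ) :* y :- :0
        := :1 :* (α :* x :+ β :* y :+ γ :* z :- :0) :+ (:- γ) :* (x :+ y :+ z :- :0)) refl α β γ x (σ x) (σ (σ x)))
      e₀' = reduce τ₀ Tr-τ₀ e₀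
      e₁' = reduce τ₁ Tr-τ₁ e₁
    β≡γ : β ≡ γ
    β≡γ = difference-zero (*-cancelˡ-0 (σ-≢0 τ₀≢0) (combine₃ 1# (- γ) (- τ₀) e₀ Tr-τ₀ (zero-difference α≡γ)
      (solve 6 (λ α β γ x y z → y :* (β :- γ) :- :0 := :1 :* (α :* x :+ β :* y :+ γ :* z :- :0) :+ (:- γ) :* (x :+ y :+ z :- :0)
        :+ (:- x) :* (α :- γ :- :0)) refl α β γ τ₀ (σ τ₀) (σ (σ τ₀)))))

-- Frames: the normal form xy - c Tr(x)Tr(y)

module Frames (k : FiniteField) (E : CyclicCubic k) where
  open Bilinear k E public

  record Presemifield (T : Carrier → Carrier → Carrier) : Set where
    field
      symmetricBilinear : SymmetricBilinear T
      cancel : ∀ {x y} → ¬ x ≡ 0# → T x y ≡ 0# → y ≡ 0#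
    open SymmetricBilinear symmetricBilinear public

  Tr-cancel : ∀ {u v} → (∀ y → Tr (u * y) ≡ Tr (v * y)) → u ≡ v
  Tr-cancel {u} {v} h = difference-zero (Tr-nondegenerate (λ y → trans
    (cong Tr (solve 3 (λ u v y → (u :- v) :* y := u :* y :- v :* y) refl u v y)) (trans (Tr-- _ _) (zero-difference (h y)))))

  -- For x ≠ 0 the map y ↦ T x y is onto, so X would be orthogonal to all of K under the trace form.
  form-nondegenerate : ∀ {T} → Presemifield T → ∀ {X x} → ¬ X ≡ 0# → (∀ y → Tr (X * T x y) ≡ 0#) → x ≡ 0#
  form-nondegenerate {T} P {X} {x} X≢0 h = decide (x ≟ 0#)
    where
    open Presemifield P
    decide : Dec (x ≡ 0#) → x ≡ 0#
    decide (yes e) = e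
    decide (no x≢0) = contradiction (Tr-nondegenerate (λ w → trans (cong (λ u → Tr (X * u)) (sym (trans (sym (proj₂ rep _)) (proj₂ (onto w))))) (h _))) X≢0
      where
      rep : ∃[ g ] (∀ y → ap g y ≡ T x y)
      rep = represent record { additive = T-+ʳ x ; homogeneous = λ c y → T-ιʳ c x y }
      onto : ∀ w → ∃[ y ] ap (proj₁ rep) y ≡ w
      onto = surjective {proj₁ rep} (λ y e → cancel x≢0 (trans (sym (proj₂ rep y)) e))

  transform : ∀ {T} → Presemifield T → ∀ {u χ} → ¬ u ≡ 0# → Injective χ → Presemifield (λ x y → u * T (ap χ x) (ap χ y))
  transform {T} P {u} {χ} u≢0 inj = record
    { symmetricBilinear = record
      { T-comm = λ x y → cong (u *_) (T-comm _ _)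
      ; T-linear = λ y → record
        { additive = λ x z → trans (cong (u *_) (trans (cong (λ w → T w (ap χ y)) (ap-+ χ x z)) (additive (T-linear _) _ _))) (distribˡ u _ _)
        ; homogeneous = λ c x → trans (cong (u *_) (trans (cong (λ w → T w (ap χ y)) (ap-ι χ c x)) (homogeneous (T-linear _) c _)))
            (solve 3 (λ u c t → u :* (c :* t) := c :* (u :* t)) refl u (ι c) _) } }
    ; cancel = λ x≢0 e → inj _ (cancel (x≢0 ∘ inj _) (*-cancelˡ-0 u≢0 e)) }
    where open Presemifield P

  ∘-injective : ∀ {f g} → Injective f → Injective g → Injective (f ∘L g)
  ∘-injective {f} {g} F G x e = G x (F _ (trans (sym (ap-∘ f g x)) e))

  scalar-injective : ∀ {c} → ¬ c ≡ 0# → Injective (scalar c)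
  scalar-injective {c} c≢0 x e = *-cancelˡ-0 c≢0 (trans (sym (ap-scalar c x)) e)

  inverse-injective : ∀ {f} (I : Inverse′ f) → Injective (Inverse′.inverse′ I)
  inverse-injective {f} I x e = trans (sym (inverseʳ x)) (trans (cong (ap f) e) (ap-0 f))
    where open Inverse′ I

  record Frame (T : Carrier → Carrier → Carrier) (c : Carrier) : Set where
    field
      χ ψ : Lin
      χ-injective : Injective χ
      ψ-injective : Injective ψ
      law : ∀ x y → ap ψ (T (ap χ x) (ap χ y)) ≡ x * y - c * (Tr x * Tr y)

  -- `position` remembers z: c is a rational multiple of ψ(z). For c ≠ 0 the frame therefore
  -- determines the direction of z, which is what the counting exploits.
  record FrameAt (T : Carrier → Carrier → Carrier) (z : Carrier) : Set where
    field
      c : Carrier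
      frame : Frame T c
      ν : k.Carrier
      position : c ≡ ι ν * ap (Frame.ψ frame) z

  Tr-*-Tr : ∀ x y → Tr x * Tr y ≡ Tr (x * y) + Tr (x * σ y + σ x * y)
  Tr-*-Tr x y = trans
    (solve 6 (λ x x' x'' y y' y'' → (x :+ x' :+ x'') :* (y :+ y' :+ y'') := (x :* y :+ x' :* y' :+ x'' :* y'')
      :+ (x :* y' :+ x' :* y :+ (x' :* y'' :+ x'' :* y') :+ (x'' :* y :+ x :* y''))) refl x (σ x) (σ (σ x)) y (σ y) (σ (σ y)))
    (sym (cong₂ _+_ (cong₂ (λ u v → x * y + u + v) (σ-* x y) (σ²-* x y))
                    (cong₂ (λ u v → x * σ y + σ x * y + u + v) (σ-sym x y) (σσ-sym x y))))

  -- Modulo z the product becomes a field product: the forms Tr(X T(x, y)/z) with Tr X = 0 form a pencil Tr(G₀x·y), Tr(G₁x·y),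
  -- and G₀⁻¹G₁ has no eigenvector, hence is multiplication by a generator of K.
  module AtPoint {T : Carrier → Carrier → Carrier} (P : Presemifield T) {z : Carrier} (z≢0 : ¬ z ≡ 0#) where
    private
      module P = Presemifield P
      T₁ : Carrier → Carrier → Carrier
      T₁ x y = inv z * T (ap idL x) (ap idL y)
      P₁ : Presemifield T₁
      P₁ = transform P (inv-≢0 z≢0) (λ x e → trans (sym (ap-id x)) e)
      form₁ : ∃[ t ] ∃[ s ] (∀ x y → T₁ x y ≡ bilinear t s x y)
      form₁ = bilinear-form (Presemifield.symmetricBilinear P₁)
      t₁ s₁ : Lin
      t₁ = proj₁ form₁
      s₁ = proj₁ (proj₂ form₁)
      G : Carrier → Lin
      G X = gram (ap (adjoint t₁) X) (ap (adjoint s₁) X)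
      G-form : ∀ X x y → Tr (X * T₁ x y) ≡ Tr (ap (G X) x * y)
      G-form X x y = trans (cong (λ w → Tr (X * w)) (proj₂ (proj₂ form₁) x y)) (trans (Tr-bilinear t₁ s₁ X x y) (form-gram _ _ x y))
      G₀-injective : Injective (G τ₀)
      G₀-injective x e = form-nondegenerate P₁ τ₀≢0 (λ y → trans (G-form τ₀ x y) (trans (cong (λ w → Tr (w * y)) e) (trans (cong Tr (zeroˡ y)) Tr-0)))
      I₀ : Inverse′ (G τ₀)
      I₀ = invert {G τ₀} G₀-injective
      A : Lin
      A = Inverse′.inverse′ I₀ ∘L G τ₁
      G₀A : ∀ x → ap (G τ₀) (ap A x) ≡ ap (G τ₁) x
      G₀A x = trans (cong (ap (G τ₀)) (ap-∘ (Inverse′.inverse′ I₀) (G τ₁) x)) (Inverse′.inverseʳ I₀ _)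
      -- An eigenvector for the rational value c would be degenerate for the form of τ₁ - cτ₀, and
      -- this element is not zero.
      noEig : NoEigenvector A
      noEig c x e = form-nondegenerate P₁ (τ₁-τ₀ c) (λ y → begin
        Tr ((τ₁ - ι c * τ₀) * T₁ x y)
          ≡⟨ trans (cong Tr (solve 4 (λ a b c t → (a :- c :* b) :* t := a :* t :- c :* (b :* t)) refl τ₁ τ₀ (ι c) (T₁ x y))) (trans (Tr-- _ _) (cong (λ w → Tr (τ₁ * T₁ x y) - w) (Tr-scale _ (σ-ι c)))) ⟩
        Tr (τ₁ * T₁ x y) - ι c * Tr (τ₀ * T₁ x y)
          ≡⟨ cong₂ (λ u v → u - ι c * v) (trans (G-form τ₁ x y) (cong (λ w → Tr (w * y)) eigen)) (G-form τ₀ x y) ⟩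
        Tr (ι c * ap (G τ₀) x * y) - ι c * Tr (ap (G τ₀) x * y)
          ≡⟨ cong (_- ι c * Tr (ap (G τ₀) x * y)) (trans (cong Tr (*-assoc _ _ _)) (Tr-scale _ (σ-ι c))) ⟩
        ι c * Tr (ap (G τ₀) x * y) - ι c * Tr (ap (G τ₀) x * y)
          ≡⟨ -‿inverseʳ _ ⟩
        0# ∎)
        where
        open ≡-Reasoning
        eigen : ap (G τ₁) x ≡ ι c * ap (G τ₀) x
        eigen = trans (sym (G₀A x)) (trans (cong (ap (G τ₀)) e) (ap-ι (G τ₀) c x))
      C : Cyclic A
      C = MakeCyclic.cyclic A noEig
      open Cyclic C renaming (χ to χ₀; χ-injective to χ₀-injective)
      T₂ : Carrier → Carrier → Carrier
      T₂ x y = inv z * T (ap χ₀ x) (ap χ₀ y)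
      P₂ : Presemifield T₂
      P₂ = transform P (inv-≢0 z≢0) χ₀-injective
      T₂≡T₁ : ∀ x y → T₂ x y ≡ T₁ (ap χ₀ x) (ap χ₀ y)
      T₂≡T₁ x y = cong₂ (λ u v → inv z * T u v) (sym (ap-id _)) (sym (ap-id _))
      form₂ : ∃[ t ] ∃[ s ] (∀ x y → T₂ x y ≡ bilinear t s x y)
      form₂ = bilinear-form (Presemifield.symmetricBilinear P₂)
      t s : Lin
      t = proj₁ form₂
      s = proj₁ (proj₂ form₂)
      T₂-form : ∀ x y → T₂ x y ≡ bilinear t s x y
      T₂-form = proj₂ (proj₂ form₂)
      H : Carrier → Lin
      H X = gram (ap (adjoint t) X) (ap (adjoint s) X)
      H-form : ∀ X x y → Tr (X * T₂ x y) ≡ Tr (ap (H X) x * y)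
      H-form X x y = trans (cong (λ w → Tr (X * w)) (T₂-form x y)) (trans (Tr-bilinear t s X x y) (form-gram _ _ x y))
      shift : ∀ x y → Tr (τ₁ * T₂ x y) ≡ Tr (τ₀ * T₂ (l * x) y)
      shift x y = begin
        Tr (τ₁ * T₂ x y)                               ≡⟨ cong (λ w → Tr (τ₁ * w)) (T₂≡T₁ x y) ⟩
        Tr (τ₁ * T₁ (ap χ₀ x) (ap χ₀ y))               ≡⟨ G-form τ₁ _ _ ⟩
        Tr (ap (G τ₁) (ap χ₀ x) * ap χ₀ y)             ≡⟨ cong (λ w → Tr (w * ap χ₀ y)) (trans (sym (G₀A _)) (cong (ap (G τ₀)) (χ-intertwines x))) ⟩
        Tr (ap (G τ₀) (ap χ₀ (l * x)) * ap χ₀ y)       ≡⟨ G-form τ₀ _ _ ⟨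
        Tr (τ₀ * T₁ (ap χ₀ (l * x)) (ap χ₀ y))         ≡⟨ cong (λ w → Tr (τ₀ * w)) (T₂≡T₁ (l * x) y) ⟨
        Tr (τ₀ * T₂ (l * x) y)                         ∎
        where open ≡-Reasoning
      -- Multiplication by l is self-adjoint for the form of τ₀, because the form of τ₁ is
      -- symmetric. The Gram map `H τ₀` then commutes with l and, as l is irrational, is itself a
      -- multiplication.
      balanced : ∀ x y → Tr (τ₀ * T₂ (l * x) y) ≡ Tr (τ₀ * T₂ x (l * y))
      balanced x y = trans (sym (shift x y)) (trans (cong (λ w → Tr (τ₁ * w)) (Presemifield.T-comm P₂ x y))
        (trans (shift y x) (cong (λ w → Tr (τ₀ * w)) (Presemifield.T-comm P₂ (l * y) x))))
      H₀-l : Lin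
      H₀-l = ⟨ x₀ (H τ₀) * l , x₁ (H τ₀) * σ l , x₂ (H τ₀) * σ (σ l) ⟩
      ap-H₀-l : ∀ x → ap (H τ₀) (l * x) ≡ ap H₀-l x
      ap-H₀-l x = trans (cong₂ (λ u v → x₀ (H τ₀) * (l * x) + x₁ (H τ₀) * u + x₂ (H τ₀) * v) (σ-* l x) (σ²-* l x))
        (solve 9 (λ a b c l l' l'' x x' x'' → a :* (l :* x) :+ b :* (l' :* x') :+ c :* (l'' :* x'') := a :* l :* x :+ b :* l' :* x' :+ c :* l'' :* x'')
          refl (x₀ (H τ₀)) (x₁ (H τ₀)) (x₂ (H τ₀)) l (σ l) (σ (σ l)) x (σ x) (σ (σ x)))
      commutes : H₀-l ≡ ⟨ l * x₀ (H τ₀) , l * x₁ (H τ₀) , l * x₂ (H τ₀) ⟩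
      commutes = ap-unique _ _ (λ x → trans (sym (ap-H₀-l x)) (trans (Tr-cancel {ap (H τ₀) (l * x)} {l * ap (H τ₀) x} (λ y → trans (sym (H-form τ₀ (l * x) y))
        (trans (balanced x y) (trans (H-form τ₀ x (l * y)) (cong Tr (solve 3 (λ h l y → h :* (l :* y) := l :* h :* y) refl (ap (H τ₀) x) l y))))))
        (solve 7 (λ a b c l x x' x'' → l :* (a :* x :+ b :* x' :+ c :* x'') := l :* a :* x :+ l :* b :* x' :+ l :* c :* x'') refl (x₀ (H τ₀)) (x₁ (H τ₀)) (x₂ (H τ₀)) l x (σ x) (σ (σ x)))))
      b₀≡0 : ap (adjoint s) τ₀ ≡ 0#
      b₀≡0 = *-cancelˡ-0 (l-irrational ∘ difference-zero) (combine₁ 1# (cong x₁ commutes)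
        (solve 3 (λ b l l' → (l' :- l) :* b :- :0 := :1 :* (b :* l' :- l :* b)) refl (ap (adjoint s) τ₀) l (σ l)))
      b₁≡0 : ap (adjoint s) τ₁ ≡ 0#
      b₁≡0 = trans (cong x₁ {y = H₀-l} (ap-unique (H τ₁) H₀-l (λ x → trans (Tr-cancel {ap (H τ₁) x} {ap (H τ₀) (l * x)} (λ y → trans (sym (H-form τ₁ x y)) (trans (shift x y) (H-form τ₀ (l * x) y)))) (ap-H₀-l x))))
        (trans (cong (_* σ l) b₀≡0) (zeroˡ _))
      -- The adjoint of s vanishes on the elements of trace zero, so it is X ↦ b Tr(X); dually, s is
      -- v ↦ Tr(bv).
      b : Carrier
      b = x₀ s
      s₁≡ : x₁ s ≡ σ b
      s₁≡ = trans (sym (σ³ (x₁ s))) (cong σ (proj₂ (vanishes-on-τ (adjoint s) b₀≡0 b₁≡0)))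
      s₂≡ : x₂ s ≡ σ (σ b)
      s₂≡ = σ-injective (trans (proj₁ (vanishes-on-τ (adjoint s) b₀≡0 b₁≡0)) (sym (σ³ b)))
      ap-s : ∀ v → ap s v ≡ Tr (b * v)
      ap-s v = trans (cong₂ (λ p q → b * v + p * σ v + q * σ (σ v)) s₁≡ s₂≡) (sym (cong₂ (λ p q → b * v + p + q) (σ-* b v) (σ²-* b v)))
      T₂-normal : ∀ x y → T₂ x y ≡ ap t (x * y) + Tr (b * (x * σ y + σ x * y))
      T₂-normal x y = trans (T₂-form x y) (cong (λ w → ap t (x * y) + w) (ap-s _))

      module FieldCase (b≡0 : b ≡ 0#) where
        T₂-field : ∀ x y → T₂ x y ≡ ap t (x * y)
        T₂-field x y = trans (T₂-normal x y) (trans (cong (λ w → ap t (x * y) + w) (trans (cong Tr (trans (cong (_* _) b≡0) (zeroˡ _))) Tr-0)) (+-identityʳ _))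
        t-injective : Injective t
        t-injective u e = Presemifield.cancel P₂ 1≢0 (trans (T₂-field 1# u) (trans (cong (ap t) (*-identityˡ u)) e))
        I : Inverse′ t
        I = invert {t} t-injective
        ψ : Lin
        ψ = Inverse′.inverse′ I ∘L scalar (inv z)
        frameAt : FrameAt T z
        frameAt = record
          { c = 0#
          ; frame = record
            { χ = χ₀ ; ψ = ψ ; χ-injective = χ₀-injective
            ; ψ-injective = ∘-injective {Inverse′.inverse′ I} {scalar (inv z)} (inverse-injective I) (scalar-injective (inv-≢0 z≢0))
            ; law = λ x y → trans (ap-∘ (Inverse′.inverse′ I) (scalar (inv z)) _) (trans (cong (ap (Inverse′.inverse′ I)) (trans (ap-scalar (inv z) _) (T₂-field x y)))
                (trans (Inverse′.inverseˡ I (x * y)) (solve 2 (λ p q → p := p :- :0 :* q) refl (x * y) (Tr x * Tr y)))) }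
          ; ν = k.0#
          ; position = sym (trans (cong (_* ap ψ z) ι-0) (zeroˡ _)) }

      module TwistedCase (b≢0 : ¬ b ≡ 0#) where
        -- Scaling both arguments by σ(b) makes bσ(b)σ²(b) = N(b) the coefficient of xσ(y) + σ(x)y,
        -- and a norm can be taken out of the trace. The identity Tr(x)Tr(y) = Tr(xy) + Tr(xσ(y) +
        -- σ(x)y) moves the remaining term into `Ψ`.
        n bb : Carrier
        n = N b
        bb = σ b
        χ₂ : Lin
        χ₂ = χ₀ ∘L scalar bb
        Ψ : Lin
        Ψ = ⟨ x₀ t * (bb * bb) - n , x₁ t * σ (bb * bb) - n , x₂ t * σ (σ (bb * bb)) - n ⟩
        ap-Ψ : ∀ u → ap Ψ u ≡ ap t (bb * bb * u) - n * Tr u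
        ap-Ψ u = trans (solve 10 (λ t₀ t₁ t₂ p p' p'' n u u' u'' → (t₀ :* p :- n) :* u :+ (t₁ :* p' :- n) :* u' :+ (t₂ :* p'' :- n) :* u''
            := t₀ :* (p :* u) :+ t₁ :* (p' :* u') :+ t₂ :* (p'' :* u'') :- n :* (u :+ u' :+ u'')) refl
            (x₀ t) (x₁ t) (x₂ t) (bb * bb) (σ (bb * bb)) (σ (σ (bb * bb))) n u (σ u) (σ (σ u)))
          (cong (_- n * Tr u) (sym (cong₂ (λ p q → x₀ t * (bb * bb * u) + x₁ t * p + x₂ t * q) (σ-* _ u) (σ²-* _ u))))
        T₂-scaled : ∀ x y → T₂ (bb * x) (bb * y) ≡ ap Ψ (x * y) + n * (Tr x * Tr y)
        T₂-scaled x y = begin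
          T₂ (bb * x) (bb * y)
            ≡⟨ T₂-normal _ _ ⟩
          ap t (bb * x * (bb * y)) + Tr (b * (bb * x * σ (bb * y) + σ (bb * x) * (bb * y)))
            ≡⟨ cong₂ _+_ (cong (ap t) (solve 3 (λ p x y → p :* x :* (p :* y) := p :* p :* (x :* y)) refl bb x y))
                 (trans (cong Tr (trans (cong₂ (λ u v → b * (bb * x * u + v * (bb * y))) (σ-* bb y) (σ-* bb x))
                   (solve 7 (λ b b' b'' x x' y y' → b :* (b' :* x :* (b'' :* y') :+ b'' :* x' :* (b' :* y)) := b :* b' :* b'' :* (x :* y' :+ x' :* y))
                     refl b bb (σ bb) x (σ x) y (σ y)))) (Tr-scale _ (σ-N b))) ⟩
          ap t (bb * bb * (x * y)) + n * Tr (x * σ y + σ x * y)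
            ≡⟨ combine₂ (- 1#) (- n) (ap-Ψ (x * y)) (Tr-*-Tr x y)
                 (solve 6 (λ p w s q n m → p :+ n :* w :- (q :+ n :* s) := (:- :1) :* (q :- (p :- n :* m)) :+ (:- n) :* (s :- (m :+ w)))
                   refl (ap t (bb * bb * (x * y))) (Tr (x * σ y + σ x * y)) (Tr x * Tr y) (ap Ψ (x * y)) n (Tr (x * y))) ⟩
          ap Ψ (x * y) + n * (Tr x * Tr y) ∎
          where open ≡-Reasoning
        bb≢0 : ¬ bb ≡ 0#
        bb≢0 = σ-≢0 b≢0
        Ψ-injective : Injective Ψ
        -- Since Tr(τ₀) = 0, the trace term vanishes on the factorisation u = τ₀(u/τ₀): a nonzero
        -- kernel element of Ψ would give zero divisors of T₂.
        Ψ-injective u e = combine₂ τ₀ (- u) (*-cancelˡ-0 bb≢0 (Presemifield.cancel P₂ (*-≢0 bb≢0 τ₀≢0) zero-divisor)) (inv-inverseʳ τ₀≢0)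
          (solve 3 (λ p i u → u :- :0 := p :* (i :* u :- :0) :+ (:- u) :* (p :* i :- :1)) refl τ₀ (inv τ₀) u)
          where
          zero-divisor : T₂ (bb * τ₀) (bb * (inv τ₀ * u)) ≡ 0#
          zero-divisor = trans (T₂-scaled τ₀ (inv τ₀ * u)) (trans (cong₂ (λ p q → p + n * (q * Tr (inv τ₀ * u)))
            (trans (cong (ap Ψ) (trans (sym (*-assoc _ _ _)) (trans (cong (_* u) (inv-inverseʳ τ₀≢0)) (*-identityˡ u)))) e) Tr-τ₀)
            (solve 2 (λ n w → :0 :+ n :* (:0 :* w) := :0) refl n (Tr (inv τ₀ * u))))
        I : Inverse′ Ψ
        I = invert {Ψ} Ψ-injective
        ψ₀ ψ : Lin
        ψ₀ = Inverse′.inverse′ I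
        ψ = ψ₀ ∘L scalar (inv z)
        -- The trace term is the rational multiple n Tr(x)Tr(y) of 1, which ψ₀ carries to the same
        -- multiple of ψ₀(1). Dividing T by z beforehand makes ψ₀(1) = ψ(z), so `position` holds by
        -- construction.
        c : Carrier
        c = - n * ap ψ₀ 1#
        ψ-z : ap ψ z ≡ ap ψ₀ 1#
        ψ-z = trans (ap-∘ ψ₀ (scalar (inv z)) z) (cong (ap ψ₀) (trans (ap-scalar (inv z) z) (inv-inverseˡ z≢0)))
        law : ∀ x y → ap ψ (T (ap χ₂ x) (ap χ₂ y)) ≡ x * y - c * (Tr x * Tr y)
        law x y = begin
          ap ψ (T (ap χ₂ x) (ap χ₂ y))
            ≡⟨ trans (ap-∘ ψ₀ (scalar (inv z)) _) (cong (ap ψ₀) (trans (ap-scalar (inv z) _)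
                 (cong₂ (λ u v → inv z * T u v) (trans (ap-∘ χ₀ (scalar bb) x) (cong (ap χ₀) (ap-scalar bb x))) (trans (ap-∘ χ₀ (scalar bb) y) (cong (ap χ₀) (ap-scalar bb y)))))) ⟩
          ap ψ₀ (T₂ (bb * x) (bb * y))
            ≡⟨ trans (cong (ap ψ₀) (T₂-scaled x y)) (ap-+ ψ₀ _ _) ⟩
          ap ψ₀ (ap Ψ (x * y)) + ap ψ₀ (n * (Tr x * Tr y))
            ≡⟨ cong₂ _+_ (Inverse′.inverseˡ I (x * y)) (trans (cong (ap ψ₀) (sym (*-identityʳ _)))
                 (ap-scale ψ₀ 1# (trans (σ-* _ _) (cong₂ _*_ (σ-N b) (trans (σ-* _ _) (cong₂ _*_ (σ-Tr x) (σ-Tr y))))))) ⟩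
          x * y + n * (Tr x * Tr y) * ap ψ₀ 1#
            ≡⟨ solve 4 (λ p n s w → p :+ n :* s :* w := p :- (:- n) :* w :* s) refl (x * y) n (Tr x * Tr y) (ap ψ₀ 1#) ⟩
          x * y - c * (Tr x * Tr y) ∎
          where open ≡-Reasoning
        σ-n : σ (- n) ≡ - n
        σ-n = trans (σ-neg n) (cong -_ (σ-N b))
        frameAt : FrameAt T z
        frameAt = record
          { c = c
          ; frame = record
            { χ = χ₂ ; ψ = ψ ; law = law
            ; χ-injective = ∘-injective {χ₀} {scalar bb} χ₀-injective (scalar-injective bb≢0)
            ; ψ-injective = ∘-injective {ψ₀} {scalar (inv z)} (inverse-injective I) (scalar-injective (inv-≢0 z≢0)) }
          ; ν = proj₁ (fixed (- n) σ-n)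
          ; position = cong₂ _*_ (proj₂ (fixed (- n) σ-n)) (sym ψ-z) }

    abstract
      frameAt : FrameAt T z
      frameAt = decide (b ≟ 0#)
        where
        decide : Dec (b ≡ 0#) → FrameAt T z
        decide (yes b≡0) = FieldCase.frameAt b≡0
        decide (no b≢0) = TwistedCase.frameAt b≢0

-- Automorphisms of a product

module Automorphisms (k : FiniteField) (E : CyclicCubic k) where
  open Frames k E public
  open CubicExtension k using () renaming (cubic to cubicₖ; :cubic to :cubicₖ)

  -- For rational c ≠ 0, 1 put d = 1/c. The map T ↦ T²(T − d)/(1 − T) takes the value 0 twice, so it misses some n;
  -- then T³ − dT² + nT − n has no root in k, and a root w ∈ K has Tr w = d, Tr w⁻¹ = 1.
  module RationalParameter (c : k.Carrier) (c≢0 : ¬ c ≡ k.0#) (c≢1 : ¬ c ≡ k.1#) where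
    private
      d : k.Carrier
      d = k.inv c
      -- At T = 1 the default value of `inv` makes f vanish, so missing n says nothing about a root
      -- there; this case is settled separately, since the cubic has the value 1 - d at 1.
      f : k.Carrier → k.Carrier
      f T = T k.* T k.* (T k.- d) k.* k.inv (k.1# k.- T)
      f0 : f k.0# ≡ k.0#
      f0 = k.solve 2 (λ d i → k.:0 k.:* k.:0 k.:* (k.:0 k.:- d) k.:* i k.:= k.:0) refl d (k.inv (k.1# k.- k.0#))
      fd : f d ≡ k.0#
      fd = k.solve 2 (λ d i → d k.:* d k.:* (d k.:- d) k.:* i k.:= k.:0) refl d (k.inv (k.1# k.- d))
      missed : ∃[ n ] (∀ T → ¬ f T ≡ n)
      missed = k.non-injective⇒missed f (k.inv-≢0 c≢0 ∘ sym) (trans f0 (sym fd))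
      n : k.Carrier
      n = proj₁ missed
      n≢0 : ¬ n ≡ k.0#
      n≢0 e = proj₂ missed k.0# (trans f0 (sym e))
      d≢1 : ¬ d ≡ k.1#
      d≢1 e = c≢1 (trans (sym (k.*-identityʳ c)) (trans (cong (c k.*_) (sym e)) (k.inv-inverseʳ c≢0)))
      rootless : ∀ T → ¬ cubicₖ d n n T ≡ k.0#
      rootless T e = decide (k.1# k.- T k.≟ k.0#)
        where
        decide : ¬ Dec (k.1# k.- T ≡ k.0#)
        decide (yes z) = d≢1 (k.combine₂ (k.- k.1#) (k.- (T k.* T k.+ T k.+ k.1# k.- d k.* T k.- d k.+ n)) e z
          (k.solve 3 (λ d n T → d k.:- k.:1 k.:= (k.:- k.:1) k.:* (:cubicₖ d n n T k.:- k.:0)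
             k.:+ (k.:- (T k.:* T k.:+ T k.:+ k.:1 k.:- d k.:* T k.:- d k.:+ n)) k.:* (k.:1 k.:- T k.:- k.:0)) refl d n T))
        decide (no nz) = proj₂ missed T (k.combine₂ (k.inv (k.1# k.- T)) n e (k.inv-inverseʳ nz)
          (k.solve 4 (λ d n T i → T k.:* T k.:* (T k.:- d) k.:* i k.:- n k.:= i k.:* (:cubicₖ d n n T k.:- k.:0)
             k.:+ n k.:* ((k.:1 k.:- T) k.:* i k.:- k.:1)) refl d n T (k.inv (k.1# k.- T))))
      w : Carrier
      w = proj₁ (root d n n rootless)
      module V = Vieta (σ-ι d) (σ-ι n) (σ-ι n) (proj₁ (proj₂ (root d n n rootless))) (proj₂ (proj₂ (root d n n rootless)))
      w≢0 : ¬ w ≡ 0#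
      w≢0 e = proj₁ (proj₂ (root d n n rootless)) (trans (cong σ e) (trans σ-0 (sym e)))
      Tr-inv : Tr (inv w) ≡ 1#
      Tr-inv = *-cancelˡ (ι-≢0 n≢0) (begin
        ι n * Tr (inv w)         ≡⟨ Tr-scale (inv w) (σ-ι n) ⟨
        Tr (ι n * inv w)         ≡⟨ cong Tr (combine₂ (- inv w) (σ w * σ (σ w)) V.norm (inv-inverseʳ w≢0)
                                      (solve 5 (λ n i w w' w'' → n :* i :- w' :* w'' := (:- i) :* (w :* w' :* w'' :- n) :+ w' :* w'' :* (w :* i :- :1)) refl (ι n) (inv w) w (σ w) (σ (σ w)))) ⟩
        Tr (σ w * σ (σ w))       ≡⟨ cong₂ (λ u v → σ w * σ (σ w) + u + v) (trans (σ-* _ _) (cong (σ (σ w) *_) (σ³ w))) (trans (σ²-* _ _) (cong₂ _*_ (σ³ w) (σ³ (σ w)))) ⟩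
        σ w * σ (σ w) + σ (σ w) * w + w * σ w ≡⟨ solve 3 (λ u v w → v :* w :+ w :* u :+ u :* v := u :* v :+ v :* w :+ w :* u) refl w (σ w) (σ (σ w)) ⟩
        w * σ w + σ w * σ (σ w) + σ (σ w) * w ≡⟨ V.second ⟩
        ι n                      ≡⟨ *-identityʳ _ ⟨
        ι n * 1#                 ∎)
        where open ≡-Reasoning

    zero-divisors : ∃[ x ] ∃[ y ] (¬ x ≡ 0# × ¬ y ≡ 0# × x * y - ι c * (Tr x * Tr y) ≡ 0#)
    zero-divisors = w , inv w , w≢0 , inv-≢0 w≢0 , zero-difference (begin
      w * inv w                     ≡⟨ inv-inverseʳ w≢0 ⟩
      1#                            ≡⟨ ι-1 ⟨
      ι k.1#                        ≡⟨ cong ι (k.inv-inverseʳ c≢0) ⟨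
      ι (c k.* d)                   ≡⟨ ι-* c d ⟩
      ι c * ι d                     ≡⟨ cong (ι c *_) (*-identityʳ _) ⟨
      ι c * (ι d * 1#)              ≡⟨ cong₂ (λ u v → ι c * (u * v)) V.trace Tr-inv ⟨
      ι c * (Tr w * Tr (inv w))     ∎)
      where open ≡-Reasoning

  -- For fixed y both sides are linear in x, so the coefficients of x, σ(x), σ²(x) agree; these are
  -- linear in y, and uniqueness applies once more.
  bilinear-unique : ∀ {t s t' s'} → (∀ x y → bilinear t s x y ≡ bilinear t' s' x y) → t ≡ t' × s ≡ s'
  bilinear-unique {t} {s} {t'} {s'} h =
      ⟨⟩-cong (cong x₀ L₀) (cong x₁ L₁) (cong x₂ L₂)
    , ⟨⟩-cong (cong x₁ L₀) (cong x₂ L₁) (cong x₂ L₀)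
    where
    rows : Lin → Lin → Carrier → Lin
    rows t s y = ⟨ ap ⟨ x₀ t , x₀ s , x₂ s ⟩ y , ap ⟨ x₀ s , x₁ t , x₁ s ⟩ y , ap ⟨ x₂ s , x₁ s , x₂ t ⟩ y ⟩
    bilinear-rows : ∀ t s x y → bilinear t s x y ≡ ap (rows t s y) x
    bilinear-rows t s x y = trans (cong₂ _+_ (cong₂ (λ u v → x₀ t * (x * y) + x₁ t * u + x₂ t * v) (σ-* x y) (σ²-* x y))
        (cong₂ (λ u v → x₀ s * (x * σ y + σ x * y) + x₁ s * u + x₂ s * v) (σ-sym x y) (σσ-sym x y)))
      (solve 12 (λ t₀ t₁ t₂ s₀ s₁ s₂ x x' x'' y y' y'' →
         t₀ :* (x :* y) :+ t₁ :* (x' :* y') :+ t₂ :* (x'' :* y'') :+ (s₀ :* (x :* y' :+ x' :* y) :+ s₁ :* (x' :* y'' :+ x'' :* y') :+ s₂ :* (x'' :* y :+ x :* y''))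
         := (t₀ :* y :+ s₀ :* y' :+ s₂ :* y'') :* x :+ (s₀ :* y :+ t₁ :* y' :+ s₁ :* y'') :* x' :+ (s₂ :* y :+ s₁ :* y' :+ t₂ :* y'') :* x'')
        refl (x₀ t) (x₁ t) (x₂ t) (x₀ s) (x₁ s) (x₂ s) x (σ x) (σ (σ x)) y (σ y) (σ (σ y)))
    same : ∀ y → rows t s y ≡ rows t' s' y
    same y = ap-unique _ _ (λ x → trans (sym (bilinear-rows t s x y)) (trans (h x y) (bilinear-rows t' s' x y)))
    L₀ : ⟨ x₀ t , x₀ s , x₂ s ⟩ ≡ ⟨ x₀ t' , x₀ s' , x₂ s' ⟩
    L₀ = ap-unique _ _ (λ y → cong x₀ (same y))
    L₁ : ⟨ x₀ s , x₁ t , x₁ s ⟩ ≡ ⟨ x₀ s' , x₁ t' , x₁ s' ⟩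
    L₁ = ap-unique _ _ (λ y → cong x₁ (same y))
    L₂ : ⟨ x₂ s , x₁ s , x₂ t ⟩ ≡ ⟨ x₂ s' , x₁ s' , x₂ t' ⟩
    L₂ = ap-unique _ _ (λ y → cong x₂ (same y))

  Tr-ap : ∀ u f → Tr (ap f u) ≡ Tr (ap (adjoint f) 1# * u)
  Tr-ap u f = trans (cong Tr (sym (*-identityˡ _))) (Tr-adjoint f 1# u)

  -- Comparing coefficients of xy, xσ(y), …: the products αβ, βγ, γα are c times the conjugates of ηση − m,
  -- where Tr(M x) = Tr(η x). If these are nonzero M has rank one, otherwise M is η or ησ or ησ².
  module Stabiliser {c m : Carrier} (c≢0 : ¬ c ≡ 0#) (σm : σ m ≡ m) (M Nn : Lin) (M-injective : Injective M)
      (law : ∀ x y → ap M x * ap M y - c * (Tr (ap M x) * Tr (ap M y)) ≡ ap Nn (x * y - c * (Tr x * Tr y)))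
      (eigen : ap Nn c ≡ m * c) where
    private
      α β γ η b : Carrier
      α = x₀ M
      β = x₁ M
      γ = x₂ M
      η = ap (adjoint M) 1#
      b = η * σ η - m
      σb : σ b ≡ σ η * σ (σ η) - m
      σb = trans (σ-- _ _) (cong₂ _-_ (σ-* _ _) σm)
      σσb : σ (σ b) ≡ σ (σ η) * η - m
      σσb = trans (cong σ σb) (trans (σ-- _ _) (cong₂ _-_ (trans (σ-* _ _) (cong (σ (σ η) *_) (σ³ η))) σm))
      tˡ sˡ tʳ sʳ : Lin
      tˡ = ⟨ α * α - c * (η * η) , β * β - c * (σ η * σ η) , γ * γ - c * (σ (σ η) * σ (σ η)) ⟩
      sˡ = ⟨ α * β - c * (η * σ η) , β * γ - c * (σ η * σ (σ η)) , γ * α - c * (σ (σ η) * η) ⟩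
      tʳ = ⟨ x₀ Nn - m * c , x₁ Nn - m * c , x₂ Nn - m * c ⟩
      sʳ = ⟨ - (m * c) , - (m * c) , - (m * c) ⟩

      lhs : ∀ x y → ap M x * ap M y - c * (Tr (ap M x) * Tr (ap M y)) ≡ bilinear tˡ sˡ x y
      lhs x y = begin
        ap M x * ap M y - c * (Tr (ap M x) * Tr (ap M y))
          ≡⟨ cong₂ (λ u v → ap M x * ap M y - c * (u * v)) (trans (Tr-ap x M) (expand x)) (trans (Tr-ap y M) (expand y)) ⟩
        ap M x * ap M y - c * ((η * x + σ η * σ x + σ (σ η) * σ (σ x)) * (η * y + σ η * σ y + σ (σ η) * σ (σ y)))
          ≡⟨ solve 13 (λ α β γ η η' η'' c x x' x'' y y' y'' →
               (α :* x :+ β :* x' :+ γ :* x'') :* (α :* y :+ β :* y' :+ γ :* y'') :- c :* ((η :* x :+ η' :* x' :+ η'' :* x'') :* (η :* y :+ η' :* y' :+ η'' :* y''))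
               := (α :* α :- c :* (η :* η)) :* (x :* y) :+ (β :* β :- c :* (η' :* η')) :* (x' :* y') :+ (γ :* γ :- c :* (η'' :* η'')) :* (x'' :* y'')
                  :+ ((α :* β :- c :* (η :* η')) :* (x :* y' :+ x' :* y) :+ (β :* γ :- c :* (η' :* η'')) :* (x' :* y'' :+ x'' :* y') :+ (γ :* α :- c :* (η'' :* η)) :* (x'' :* y :+ x :* y'')))
               refl α β γ η (σ η) (σ (σ η)) c x (σ x) (σ (σ x)) y (σ y) (σ (σ y)) ⟩
        x₀ tˡ * (x * y) + x₁ tˡ * (σ x * σ y) + x₂ tˡ * (σ (σ x) * σ (σ y))
          + (x₀ sˡ * (x * σ y + σ x * y) + x₁ sˡ * (σ x * σ (σ y) + σ (σ x) * σ y) + x₂ sˡ * (σ (σ x) * y + x * σ (σ y)))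
          ≡⟨ cong₂ _+_ (cong₂ (λ u v → x₀ tˡ * (x * y) + x₁ tˡ * u + x₂ tˡ * v) (σ-* x y) (σ²-* x y))
               (cong₂ (λ u v → x₀ sˡ * (x * σ y + σ x * y) + x₁ sˡ * u + x₂ sˡ * v) (σ-sym x y) (σσ-sym x y)) ⟨
        bilinear tˡ sˡ x y ∎
        where
        open ≡-Reasoning
        expand : ∀ u → Tr (η * u) ≡ η * u + σ η * σ u + σ (σ η) * σ (σ u)
        expand u = cong₂ (λ p q → η * u + p + q) (σ-* η u) (σ²-* η u)

      rhs : ∀ x y → ap Nn (x * y - c * (Tr x * Tr y)) ≡ bilinear tʳ sʳ x y
      rhs x y = begin
        ap Nn (x * y - c * (Tr x * Tr y))
          ≡⟨ trans (ap-- Nn _ _) (cong (λ u → ap Nn (x * y) - u) (trans (cong (ap Nn) (*-comm c _)) (trans (ap-scale Nn c (trans (σ-* _ _) (cong₂ _*_ (σ-Tr x) (σ-Tr y)))) (cong (Tr x * Tr y *_) eigen)))) ⟩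
        ap Nn (x * y) - Tr x * Tr y * (m * c)
          ≡⟨ cong (λ u → ap Nn (x * y) - u * (m * c)) (Tr-*-Tr x y) ⟩
        ap Nn (x * y) - (Tr (x * y) + Tr (x * σ y + σ x * y)) * (m * c)
          ≡⟨ solve 10 (λ n₀ n₁ n₂ p w w' w'' v v' v'' → n₀ :* w :+ n₁ :* w' :+ n₂ :* w'' :- (w :+ w' :+ w'' :+ (v :+ v' :+ v'')) :* p
               := (n₀ :- p) :* w :+ (n₁ :- p) :* w' :+ (n₂ :- p) :* w'' :+ ((:- p) :* v :+ (:- p) :* v' :+ (:- p) :* v''))
               refl (x₀ Nn) (x₁ Nn) (x₂ Nn) (m * c) (x * y) (σ (x * y)) (σ (σ (x * y))) (x * σ y + σ x * y) (σ (x * σ y + σ x * y)) (σ (σ (x * σ y + σ x * y))) ⟩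
        bilinear tʳ sʳ x y ∎
        where open ≡-Reasoning

      unique : tˡ ≡ tʳ × sˡ ≡ sʳ
      unique = bilinear-unique (λ x y → trans (sym (lhs x y)) (trans (law x y) (rhs x y)))

      αβ : α * β ≡ c * b
      αβ = combine₁ 1# (cong x₀ (proj₂ unique)) (solve 4 (λ p e c m → p :- c :* (e :- m) := :1 :* (p :- c :* e :- (:- (m :* c)))) refl (α * β) (η * σ η) c m)
      βγ : β * γ ≡ c * σ b
      βγ = trans (combine₁ 1# (cong x₁ (proj₂ unique)) (solve 4 (λ p e c m → p :- c :* (e :- m) := :1 :* (p :- c :* e :- (:- (m :* c)))) refl (β * γ) (σ η * σ (σ η)) c m)) (cong (c *_) (sym σb))
      γα : γ * α ≡ c * σ (σ b)
      γα = trans (combine₁ 1# (cong x₂ (proj₂ unique)) (solve 4 (λ p e c m → p :- c :* (e :- m) := :1 :* (p :- c :* e :- (:- (m :* c)))) refl (γ * α) (σ (σ η) * η) c m)) (cong (c *_) (sym σσb))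

    Conclusion : Set
    Conclusion = (∃[ e ] (σ e ≡ e × (∀ x → ap M x ≡ e * x))) ⊎ σ c ≡ c

    private
      rank-one : ¬ b ≡ 0# → Conclusion
      -- Here α, β, γ are proportional to 1/σ(b), 1/σ²(b), 1/b, so M(x) is a multiple of Tr(x/σ(b))
      -- and σ(b)τ₀ lies in its kernel.
      rank-one b≢0 = contradiction (M-injective (σ b * τ₀) kernel) (*-≢0 (σ-≢0 b≢0) τ₀≢0)
        where
        nonzero : ∀ {u v w} → u * v ≡ c * w → ¬ w ≡ 0# → ¬ u ≡ 0#
        nonzero {u} {v} e w≢0 z = *-≢0 c≢0 w≢0 (trans (sym e) (trans (cong (_* v) z) (zeroˡ v)))
        αb'≡γb : α * σ b ≡ γ * b
        αb'≡γb = *-cancelˡ (nonzero βγ (σ-≢0 b≢0)) (combine₂ (σ b) (- b) αβ βγ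
          (solve 6 (λ α β γ b b' c → β :* (α :* b') :- β :* (γ :* b) := b' :* (α :* β :- c :* b) :+ (:- b) :* (β :* γ :- c :* b')) refl α β γ b (σ b) c))
        βb''≡αb' : β * σ (σ b) ≡ α * σ b
        βb''≡αb' = *-cancelˡ (nonzero γα (σ-≢0 (σ-≢0 b≢0))) (combine₂ (σ (σ b)) (- σ b) βγ γα
          (solve 6 (λ α β γ b' b'' c → γ :* (β :* b'') :- γ :* (α :* b') := b'' :* (β :* γ :- c :* b') :+ (:- b') :* (γ :* α :- c :* b'')) refl α β γ (σ b) (σ (σ b)) c))
        kernel : ap M (σ b * τ₀) ≡ 0#
        kernel = trans (cong₂ (λ u v → α * (σ b * τ₀) + β * u + γ * v) (σ-* _ _) (trans (σ²-* _ _) (cong (_* σ (σ τ₀)) (σ³ b))))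
          (combine₃ (σ τ₀) (- σ (σ τ₀)) (α * σ b) βb''≡αb' αb'≡γb Tr-τ₀
            (solve 9 (λ α β γ b b' b'' t t' t'' → α :* (b' :* t) :+ β :* (b'' :* t') :+ γ :* (b :* t'') :- :0
              := t' :* (β :* b'' :- α :* b') :+ (:- t'') :* (α :* b' :- γ :* b) :+ α :* b' :* (t :+ t' :+ t'' :- :0))
              refl α β γ b (σ b) (σ (σ b)) τ₀ (σ τ₀) (σ (σ τ₀))))

      module Monomial (b≡0 : b ≡ 0#) where
        vanish₂ : ∀ {u v w} → u * v ≡ c * w → w ≡ 0# → u * v ≡ 0#
        vanish₂ e z = trans e (trans (cong (c *_) z) (zeroʳ c))
        αβ0 : α * β ≡ 0#
        αβ0 = vanish₂ αβ b≡0
        βγ0 : β * γ ≡ 0#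
        βγ0 = vanish₂ βγ (trans (cong σ b≡0) σ-0)
        γα0 : γ * α ≡ 0#
        γα0 = vanish₂ γα (trans (cong (σ ∘ σ) b≡0) (trans (cong σ σ-0) σ-0))
        M-nonzero : ¬ (α ≡ 0# × β ≡ 0# × γ ≡ 0#)
        M-nonzero (p , q , r) = 1≢0 (M-injective 1# (trans (cong₂ _+_ (cong₂ _+_ (cong (_* 1#) p) (cong (_* σ 1#) q)) (cong (_* σ (σ 1#)) r))
          (solve 3 (λ u v w → :0 :* u :+ :0 :* v :+ :0 :* w := :0) refl 1# (σ 1#) (σ (σ 1#)))))
        ηση : η * σ η ≡ m
        ηση = difference-zero b≡0
        -- Applying σ to ησ(η) = m and cancelling σ(η) gives σ²(η) = η, and σ has order 3.
        η-fixed : ¬ η ≡ 0# → σ η ≡ η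
        η-fixed η≢0 = trans (cong σ (sym σση)) (σ³ η)
          where
          σση : σ (σ η) ≡ η
          σση = *-cancelˡ (σ-≢0 η≢0) (trans (sym (σ-* _ _)) (trans (cong σ ηση) (trans σm (trans (sym ηση) (*-comm _ _)))))

        case-α : ¬ α ≡ 0# → Conclusion
        case-α α≢0 = inj₁ (α , trans (cong σ (sym η≡α)) (trans (η-fixed (λ e → α≢0 (trans (sym η≡α) e))) η≡α) , λ x →
            trans (cong₂ (λ u v → α * x + u * σ x + v * σ (σ x)) β≡0 γ≡0) (solve 4 (λ a x y z → a :* x :+ :0 :* y :+ :0 :* z := a :* x) refl α x (σ x) (σ (σ x))))
          where
          β≡0 = *-cancelˡ-0 α≢0 αβ0
          γ≡0 = *-cancelˡ-0 α≢0 (trans (*-comm _ _) γα0)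
          η≡α : η ≡ α
          η≡α = trans (cong₂ (λ u v → α * 1# + u * σ 1# + v * σ (σ 1#)) (trans (cong σ γ≡0) σ-0) (trans (cong (σ ∘ σ) β≡0) (trans (cong σ σ-0) σ-0)))
            (solve 3 (λ a u v → a :* :1 :+ :0 :* u :+ :0 :* v := a) refl α (σ 1#) (σ (σ 1#)))

        module Fixed (e : σ η ≡ η) where
          ηη : η * η ≡ m
          ηη = trans (cong (η *_) (sym e)) ηση
          entry : ∀ u h n → h ≡ η → u * u - c * (h * h) ≡ n - m * c → n ≡ u * u
          entry u h n refl eq = combine₂ (- 1#) (- c) eq ηη
            (solve 5 (λ u h n c m → n :- u :* u := (:- :1) :* (u :* u :- c :* (h :* h) :- (n :- m :* c)) :+ (:- c) :* (h :* h :- m)) refl u η n c m)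
          -- Because η² = m, the terms with c cancel in the diagonal coefficients of `Nn`, which are
          -- thus α², β², γ².
          eigen' : α * α * c + β * β * σ c + γ * γ * σ (σ c) ≡ η * η * c
          eigen' = trans (sym (cong₂ _+_ (cong₂ _+_ (cong (_* c) (entry α η (x₀ Nn) refl (cong x₀ (proj₁ unique))))
              (cong (_* σ c) (entry β (σ η) (x₁ Nn) e (cong x₁ (proj₁ unique)))))
              (cong (_* σ (σ c)) (entry γ (σ (σ η)) (x₂ Nn) (trans (cong σ e) e) (cong x₂ (proj₁ unique))))))
            (trans eigen (cong (_* c) (sym ηη)))

        -- Here M(x) = βσ(x), and `eigen'` reads β²σ(c) = η²c. As η = σ²(β) is fixed by σ, it equals
        -- β, and c is fixed.
        case-β : ¬ β ≡ 0# → Conclusion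
        case-β β≢0 = inj₂ (*-cancelˡ (*-≢0 β≢0 β≢0) (begin
            β * β * σ c                                              ≡⟨ solve 4 (λ b c d e → b :* b :* d := :0 :* :0 :* c :+ b :* b :* d :+ :0 :* :0 :* e) refl β c (σ c) (σ (σ c)) ⟩
            0# * 0# * c + β * β * σ c + 0# * 0# * σ (σ c)             ≡⟨ cong₂ (λ u v → u * u * c + β * β * σ c + v * v * σ (σ c)) α≡0 γ≡0 ⟨
            α * α * c + β * β * σ c + γ * γ * σ (σ c)                 ≡⟨ Fixed.eigen' η-fix ⟩
            η * η * c                                                ≡⟨ cong (λ u → u * u * c) η≡β ⟩
            β * β * c ∎))
          where
          open ≡-Reasoning
          α≡0 : α ≡ 0#
          α≡0 = *-cancelˡ-0 β≢0 (trans (*-comm _ _) αβ0)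
          γ≡0 : γ ≡ 0#
          γ≡0 = *-cancelˡ-0 β≢0 βγ0
          η≡ : η ≡ σ (σ β)
          η≡ = trans (cong₂ (λ u v → u * 1# + v * σ 1# + σ (σ β) * σ (σ 1#)) α≡0 (trans (cong σ γ≡0) σ-0))
            (trans (cong (λ u → 0# * 1# + 0# * σ 1# + σ (σ β) * u) (trans (cong σ σ-1) σ-1))
            (solve 2 (λ b u → :0 :* :1 :+ :0 :* u :+ b :* :1 := b) refl (σ (σ β)) (σ 1#)))
          η-fix : σ η ≡ η
          η-fix = η-fixed (λ e → σ-≢0 (σ-≢0 β≢0) (trans (sym η≡) e))
          η≡β : η ≡ β
          η≡β = trans (sym η-fix) (trans (cong σ η≡) (σ³ β))

        case-γ : ¬ γ ≡ 0# → Conclusion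
        case-γ γ≢0 = inj₂ (trans (sym (cong σ σσc)) (σ³ c))
          where
          open ≡-Reasoning
          α≡0 : α ≡ 0#
          α≡0 = *-cancelˡ-0 γ≢0 γα0
          β≡0 : β ≡ 0#
          β≡0 = *-cancelˡ-0 γ≢0 (trans (*-comm _ _) βγ0)
          η≡ : η ≡ σ γ
          η≡ = trans (cong₂ (λ u v → u * 1# + σ γ * σ 1# + v * σ (σ 1#)) α≡0 (trans (cong (σ ∘ σ) β≡0) (trans (cong σ σ-0) σ-0)))
            (trans (cong (λ u → 0# * 1# + σ γ * u + 0# * σ (σ 1#)) σ-1)
            (solve 2 (λ b u → :0 :* :1 :+ b :* :1 :+ :0 :* u := b) refl (σ γ) (σ (σ 1#))))
          η-fix : σ η ≡ η
          η-fix = η-fixed (λ e → σ-≢0 γ≢0 (trans (sym η≡) e))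
          η≡γ : η ≡ γ
          η≡γ = trans (sym (trans (cong σ η-fix) η-fix)) (trans (cong (σ ∘ σ) η≡) (σ³ γ))
          σσc : σ (σ c) ≡ c
          σσc = *-cancelˡ (*-≢0 γ≢0 γ≢0) (begin
            γ * γ * σ (σ c)                                          ≡⟨ solve 4 (λ b c d e → b :* b :* e := :0 :* :0 :* c :+ :0 :* :0 :* d :+ b :* b :* e) refl γ c (σ c) (σ (σ c)) ⟩
            0# * 0# * c + 0# * 0# * σ c + γ * γ * σ (σ c)             ≡⟨ cong₂ (λ u v → u * u * c + v * v * σ c + γ * γ * σ (σ c)) α≡0 β≡0 ⟨
            α * α * c + β * β * σ c + γ * γ * σ (σ c)                 ≡⟨ Fixed.eigen' η-fix ⟩
            η * η * c                                                ≡⟨ cong (λ u → u * u * c) η≡γ ⟩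
            γ * γ * c ∎)

        conclusion : Conclusion
        conclusion = decide (α ≟ 0#) (β ≟ 0#) (γ ≟ 0#)
          where
          decide : Dec (α ≡ 0#) → Dec (β ≡ 0#) → Dec (γ ≡ 0#) → Conclusion
          decide (no p) _ _ = case-α p
          decide (yes _) (no p) _ = case-β p
          decide (yes _) (yes _) (no p) = case-γ p
          decide (yes p) (yes q) (yes r) = contradiction (p , q , r) M-nonzero

    conclusion : Conclusion
    conclusion = decide (b ≟ 0#)
      where
      decide : Dec (b ≡ 0#) → Conclusion
      decide (no b≢0) = rank-one b≢0
      decide (yes b≡0) = Monomial.conclusion b≡0

  record Exotic (T : Carrier → Carrier → Carrier) : Set where
    field
      presemifield : Presemifield T
      not-field : ¬ Frame T 0#
      not-twisted : ¬ Frame T 1#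

    c≢0 : ∀ {c} → Frame T c → ¬ c ≡ 0#
    c≢0 f refl = not-field f

    c-irrational : ∀ {c} → Frame T c → ¬ σ c ≡ c
    c-irrational {c} f e = contradiction (χ-injective y (Presemifield.cancel presemifield (x≢0 ∘ χ-injective x) degenerate)) y≢0
      where
      open Frame f
      rational : ∃[ a ] c ≡ ι a
      rational = fixed c e
      module R = RationalParameter (proj₁ rational)
        (λ z → not-field (subst (Frame T) (trans (proj₂ rational) (trans (cong ι z) ι-0)) f))
        (λ z → not-twisted (subst (Frame T) (trans (proj₂ rational) (trans (cong ι z) ι-1)) f))
      x y : Carrier
      x = proj₁ R.zero-divisors
      y = proj₁ (proj₂ R.zero-divisors)
      x≢0 : ¬ x ≡ 0#
      x≢0 = proj₁ (proj₂ (proj₂ R.zero-divisors))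
      y≢0 : ¬ y ≡ 0#
      y≢0 = proj₁ (proj₂ (proj₂ (proj₂ R.zero-divisors)))
      degenerate : T (ap χ x) (ap χ y) ≡ 0#
      degenerate = ψ-injective _ (trans (law x y) (trans (cong (λ u → x * y - u * (Tr x * Tr y)) (proj₂ rational))
        (proj₂ (proj₂ (proj₂ (proj₂ R.zero-divisors))))))

  Scalar : Lin → Set
  Scalar f = ∃[ e ] (σ e ≡ e × (∀ x → ap f x ≡ e * x))

  module ExoticAutomorphism {T : Carrier → Carrier → Carrier} (X : Exotic T) (M Nn : Lin) (M-injective : Injective M)
      (automorphism : ∀ x y → T (ap M x) (ap M y) ≡ ap Nn (T x y)) where
    open Exotic X
    private module P = Presemifield presemifield

    module WithEigenvector (μ : k.Carrier) (v : Carrier) (v≢0 : ¬ v ≡ 0#) (eigenvector : ap M v ≡ ι μ * v) where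
      private
        -- The frame is taken at z = T v v because the companion map multiplies it by the rational
        -- factor μ². By `position`, c is then an eigenvector of the transported companion, as
        -- `Stabiliser` requires.
        z : Carrier
        z = T v v
        z≢0 : ¬ z ≡ 0#
        z≢0 e = v≢0 (P.cancel v≢0 e)
        N-z : ap Nn z ≡ ι μ * ι μ * z
        N-z = trans (sym (automorphism v v)) (trans (cong₂ T eigenvector eigenvector)
          (trans (homogeneous (P.T-linear _) μ v) (trans (cong (ι μ *_) (P.T-ιʳ μ v v)) (sym (*-assoc _ _ _)))))
        open FrameAt (AtPoint.frameAt presemifield z≢0)
        open Frame frame
        Iχ : Inverse′ χ
        Iχ = invert {χ} χ-injective
        Iψ : Inverse′ ψ
        Iψ = invert {ψ} ψ-injective
        χ⁻¹ ψ⁻¹ M̃ Ñ : Lin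
        χ⁻¹ = Inverse′.inverse′ Iχ
        ψ⁻¹ = Inverse′.inverse′ Iψ
        M̃ = χ⁻¹ ∘L (M ∘L χ)
        Ñ = ψ ∘L (Nn ∘L ψ⁻¹)
        χM̃ : ∀ x → ap χ (ap M̃ x) ≡ ap M (ap χ x)
        χM̃ x = trans (cong (ap χ) (ap-∘ χ⁻¹ (M ∘L χ) x)) (trans (Inverse′.inverseʳ Iχ _) (ap-∘ M χ x))
        Ñψ : ∀ w → ap Ñ (ap ψ w) ≡ ap ψ (ap Nn w)
        Ñψ w = trans (ap-∘ ψ (Nn ∘L ψ⁻¹) _) (cong (ap ψ) (trans (ap-∘ Nn ψ⁻¹ _) (cong (ap Nn) (Inverse′.inverseˡ Iψ w))))
        M̃-injective : Injective M̃
        M̃-injective x e = χ-injective x (M-injective _ (trans (sym (χM̃ x)) (trans (cong (ap χ) e) (ap-0 χ))))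
        law′ : ∀ x y → ap M̃ x * ap M̃ y - c * (Tr (ap M̃ x) * Tr (ap M̃ y)) ≡ ap Ñ (x * y - c * (Tr x * Tr y))
        law′ x y = begin
          ap M̃ x * ap M̃ y - c * (Tr (ap M̃ x) * Tr (ap M̃ y))   ≡⟨ law (ap M̃ x) (ap M̃ y) ⟨
          ap ψ (T (ap χ (ap M̃ x)) (ap χ (ap M̃ y)))             ≡⟨ cong₂ (λ u w → ap ψ (T u w)) (χM̃ x) (χM̃ y) ⟩
          ap ψ (T (ap M (ap χ x)) (ap M (ap χ y)))             ≡⟨ cong (ap ψ) (automorphism _ _) ⟩
          ap ψ (ap Nn (T (ap χ x) (ap χ y)))                   ≡⟨ Ñψ _ ⟨
          ap Ñ (ap ψ (T (ap χ x) (ap χ y)))                    ≡⟨ cong (ap Ñ) (law x y) ⟩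
          ap Ñ (x * y - c * (Tr x * Tr y))                     ∎
          where open ≡-Reasoning
        σm : σ (ι μ * ι μ) ≡ ι μ * ι μ
        σm = trans (σ-* _ _) (cong₂ _*_ (σ-ι μ) (σ-ι μ))
        eigen : ap Ñ c ≡ ι μ * ι μ * c
        eigen = begin
          ap Ñ c                              ≡⟨ cong (ap Ñ) position ⟩
          ap Ñ (ι ν * ap ψ z)                 ≡⟨ ap-ι Ñ ν _ ⟩
          ι ν * ap Ñ (ap ψ z)                 ≡⟨ cong (ι ν *_) (trans (Ñψ z) (trans (cong (ap ψ) N-z) (ap-scale ψ z σm))) ⟩
          ι ν * (ι μ * ι μ * ap ψ z)          ≡⟨ solve 3 (λ n m p → n :* (m :* p) := m :* (n :* p)) refl (ι ν) (ι μ * ι μ) (ap ψ z) ⟩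
          ι μ * ι μ * (ι ν * ap ψ z)          ≡⟨ cong (ι μ * ι μ *_) position ⟨
          ι μ * ι μ * c                       ∎
          where open ≡-Reasoning
        module S = Stabiliser (c≢0 frame) σm M̃ Ñ M̃-injective law′ eigen

      scalar-map : Scalar M
      scalar-map = [ from-scalar , (λ e → contradiction e (c-irrational frame)) ]′ S.conclusion
        where
        from-scalar : Scalar M̃ → Scalar M
        from-scalar (e , fix , h) = e , fix , λ w → begin
          ap M w                       ≡⟨ cong (ap M) (Inverse′.inverseʳ Iχ w) ⟨
          ap M (ap χ (ap χ⁻¹ w))       ≡⟨ χM̃ _ ⟨
          ap χ (ap M̃ (ap χ⁻¹ w))       ≡⟨ cong (ap χ) (h _) ⟩
          ap χ (e * ap χ⁻¹ w)          ≡⟨ ap-scale χ _ fix ⟩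
          e * ap χ (ap χ⁻¹ w)          ≡⟨ cong (e *_) (Inverse′.inverseʳ Iχ w) ⟩
          e * w                        ∎
          where open ≡-Reasoning

    -- In coordinates where M is multiplication by l, the forms Tr(X T(x, y)) = Tr(a xy) + Tr(b(xσ(y) + σ(x)y)) span a space
    -- stable under (a, b) ↦ (l² a, lσ(l) b). As lσ(l) is not conjugate to l², a or b vanishes identically.
    module WithoutEigenvector (noEig : NoEigenvector M) (det-M : det M ≡ 1#) where
      private
        open Cyclic (MakeCyclic.cyclic M noEig)
        T₂ : Carrier → Carrier → Carrier
        T₂ x y = 1# * T (ap χ x) (ap χ y)
        P₂ : Presemifield T₂
        P₂ = transform presemifield 1≢0 χ-injective
        form₂ : ∃[ t ] ∃[ s ] (∀ x y → T₂ x y ≡ bilinear t s x y)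
        form₂ = bilinear-form (Presemifield.symmetricBilinear P₂)
        t s At As g : Lin
        t = proj₁ form₂
        s = proj₁ (proj₂ form₂)
        At = adjoint t
        As = adjoint s
        g = adjoint Nn
        T₂-form : ∀ x y → T₂ x y ≡ bilinear t s x y
        T₂-form = proj₂ (proj₂ form₂)
        Tr-T₂ : ∀ X x y → Tr (X * T₂ x y) ≡ form (ap At X) (ap As X) x y
        Tr-T₂ X x y = trans (cong (λ w → Tr (X * w)) (T₂-form x y)) (Tr-bilinear t s X x y)
        T₂-l : ∀ x y → T₂ (l * x) (l * y) ≡ ap Nn (T₂ x y)
        T₂-l x y = trans (cong₂ (λ u v → 1# * T u v) (sym (χ-intertwines x)) (sym (χ-intertwines y)))
          (trans (*-identityˡ _) (trans (automorphism _ _) (cong (ap Nn) (sym (*-identityˡ _)))))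
        form-l : ∀ a b x y → form a b (l * x) (l * y) ≡ form (l * l * a) (l * σ l * b) x y
        form-l a b x y = cong₂ _+_ (cong Tr (solve 4 (λ a l x y → a :* (l :* x :* (l :* y)) := l :* l :* a :* (x :* y)) refl a l x y))
          (cong Tr (trans (cong₂ (λ u v → b * (l * x * u + v * (l * y))) (σ-* l y) (σ-* l x))
            (solve 7 (λ b l l' x x' y y' → b :* (l :* x :* (l' :* y') :+ l' :* x' :* (l :* y)) := l :* l' :* b :* (x :* y' :+ x' :* y)) refl b l (σ l) x (σ x) y (σ y))))
        equivariant : ∀ X → ap At (ap g X) ≡ l * l * ap At X × ap As (ap g X) ≡ l * σ l * ap As X
        equivariant X = form-unique _ _ _ _ (λ x y → begin
          form (ap At (ap g X)) (ap As (ap g X)) x y        ≡⟨ Tr-T₂ (ap g X) x y ⟨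
          Tr (ap g X * T₂ x y)                              ≡⟨ Tr-adjoint Nn X (T₂ x y) ⟨
          Tr (X * ap Nn (T₂ x y))                           ≡⟨ cong (λ w → Tr (X * w)) (T₂-l x y) ⟨
          Tr (X * T₂ (l * x) (l * y))                       ≡⟨ Tr-T₂ X _ _ ⟩
          form (ap At X) (ap As X) (l * x) (l * y)          ≡⟨ form-l _ _ x y ⟩
          form (l * l * ap At X) (l * σ l * ap As X) x y    ∎)
          where open ≡-Reasoning
        nontrivial : ∀ X → ap At X ≡ 0# → ap As X ≡ 0# → X ≡ 0#
        nontrivial X e f = decide (X ≟ 0#)
          where
          decide : Dec (X ≡ 0#) → X ≡ 0#
          decide (yes z) = z
          decide (no X≢0) = contradiction (form-nondegenerate P₂ {X} {1#} X≢0 (λ y → trans (Tr-T₂ X 1# y) (trans (cong₂ (λ a b → form a b 1# y) e f)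
            (trans (cong₂ _+_ (trans (cong Tr (zeroˡ _)) Tr-0) (trans (cong Tr (zeroˡ _)) Tr-0)) (+-identityˡ 0#))))) 1≢0

        l≢0 : ¬ l ≡ 0#
        l≢0 e = l-irrational (trans (cong σ e) (trans σ-0 (sym e)))

        N-l : N l ≡ 1#
        N-l = trans l-norm det-M

        -- Otherwise l and its two conjugates would be three distinct roots of u² + u + 1, while
        -- every root other than l equals -1 - l.
        l³≢1 : ¬ l * (l * l) ≡ 1#
        l³≢1 e = irrational-σ l-irrational (trans (conjugate (σ (σ l)) (irrational-σσ l-irrational) (σ-quadratic q'))
                                                  (sym (conjugate (σ l) l-irrational q')))
          where
          q₀ : l * l + l + 1# ≡ 0#
          q₀ = *-cancelˡ-0 (λ z → l-irrational (trans (cong σ (difference-zero z)) (trans σ-1 (sym (difference-zero z)))))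
            (combine₁ 1# e (solve 1 (λ u → (u :- :1) :* (u :* u :+ u :+ :1) :- :0 := :1 :* (u :* (u :* u) :- :1)) refl l))
          σ-quadratic : ∀ {u} → u * u + u + 1# ≡ 0# → σ u * σ u + σ u + 1# ≡ 0#
          σ-quadratic {u} h = trans (sym (trans (σ-+ _ _) (cong₂ _+_ (trans (σ-+ _ _) (cong (_+ σ u) (σ-* u u))) σ-1))) (trans (cong σ h) σ-0)
          q' : σ l * σ l + σ l + 1# ≡ 0#
          q' = σ-quadratic q₀
          conjugate : ∀ u → ¬ u ≡ l → u * u + u + 1# ≡ 0# → u ≡ - 1# - l
          conjugate u u≢l h = difference-zero (*-cancelˡ-0 (u≢l ∘ difference-zero) (combine₂ 1# (- 1#) h q₀
            (solve 2 (λ u l → (u :- l) :* (u :- (:- :1 :- l)) :- :0 := :1 :* (u :* u :+ u :+ :1 :- :0)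
               :+ (:- :1) :* (l :* l :+ l :+ :1 :- :0)) refl u l)))

        -- Comparing coefficients, R ≠ 0 requires lσ(l) to be one of l², σ(l²), σ²(l²). The first
        -- two would make l rational; the third gives σ²(l)³ = N(l) = 1. This is where determinant 1
        -- enters.
        no-intertwiner : ∀ R → (∀ y → ap R (l * l * y) ≡ l * σ l * ap R y) → R ≡ 0L
        no-intertwiner R h = ⟨⟩-cong
          (*-cancelˡ-0 (*-≢0 l≢0 (l-irrational ∘ sym ∘ difference-zero)) (combine₁ 1# (cong x₀ same)
            (solve 3 (λ r l l' → l :* (l :- l') :* r :- :0 := :1 :* (r :* (l :* l) :- l :* l' :* r)) refl (x₀ R) l (σ l))))
          (*-cancelˡ-0 (*-≢0 (σ-≢0 l≢0) (l-irrational ∘ difference-zero)) (combine₂ 1# (- x₁ R) (cong x₁ same) (σ-* l l)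
            (solve 4 (λ r l l' p → l' :* (l' :- l) :* r :- :0 := :1 :* (r :* p :- l :* l' :* r) :+ (:- r) :* (p :- l' :* l')) refl (x₁ R) l (σ l) (σ (l * l)))))
          (*-cancelˡ-0 cube≢1 (combine₃ (σ (σ l)) (- (σ (σ l) * x₂ R)) (x₂ R) (cong x₂ same) (σ²-* l l) N-l
            (solve 5 (λ r l l' l'' p → (l'' :* (l'' :* l'') :- :1) :* r :- :0 := l'' :* (r :* p :- l :* l' :* r) :+ (:- (l'' :* r)) :* (p :- l'' :* l'')
               :+ r :* (l :* l' :* l'' :- :1)) refl (x₂ R) l (σ l) (σ (σ l)) (σ (σ (l * l))))))
          where
          cube≢1 : ¬ σ (σ l) * (σ (σ l) * σ (σ l)) - 1# ≡ 0#
          cube≢1 z = l³≢1 (σ-injective (σ-injective (trans (trans (σ²-* _ _) (cong (σ (σ l) *_) (σ²-* l l))) (trans (difference-zero z) (sym (trans (cong σ σ-1) σ-1))))))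
          same : ⟨ x₀ R * (l * l) , x₁ R * σ (l * l) , x₂ R * σ (σ (l * l)) ⟩ ≡ ⟨ l * σ l * x₀ R , l * σ l * x₁ R , l * σ l * x₂ R ⟩
          same = ap-unique _ _ (λ y → trans (trans
              (solve 9 (λ a b c p p' p'' y y' y'' → a :* p :* y :+ b :* p' :* y' :+ c :* p'' :* y'' := a :* (p :* y) :+ b :* (p' :* y') :+ c :* (p'' :* y''))
                refl (x₀ R) (x₁ R) (x₂ R) (l * l) (σ (l * l)) (σ (σ (l * l))) y (σ y) (σ (σ y)))
              (sym (cong₂ (λ u v → x₀ R * (l * l * y) + x₁ R * u + x₂ R * v) (σ-* _ y) (σ²-* _ y))))
            (trans (h y) (solve 7 (λ a b c p y y' y'' → p :* (a :* y :+ b :* y' :+ c :* y'') := p :* a :* y :+ p :* b :* y' :+ p :* c :* y'') refl (x₀ R) (x₁ R) (x₂ R) (l * σ l) y (σ y) (σ (σ y)))))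

        adjoint-zero : ∀ f → adjoint f ≡ 0L → ∀ u → ap f u ≡ 0#
        adjoint-zero f e u = trans (cong₂ _+_ (cong₂ _+_ (cong (_* u) (cong x₀ e)) (cong (_* σ u) (σ-injective (σ-injective (trans (cong x₂ e) (sym (trans (cong σ σ-0) σ-0)))))))
            (cong (_* σ (σ u)) (σ-injective (trans (cong x₁ e) (sym σ-0)))))
          (solve 3 (λ x y z → :0 :* x :+ :0 :* y :+ :0 :* z := :0) refl u (σ u) (σ (σ u)))

        -- `equivariant` makes As At⁻¹ an intertwiner from multiplication by l² to multiplication by
        -- lσ(l), so As = 0 and T₂ depends on xy alone.
        field-case : Injective At → Frame T 0#
        field-case At-injective = record
          { χ = χ ; ψ = Inverse′.inverse′ I ; χ-injective = χ-injective ; ψ-injective = inverse-injective I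
          ; law = λ x y → trans (cong (ap (Inverse′.inverse′ I)) (trans (sym (*-identityˡ _)) (T₂-field x y)))
              (trans (Inverse′.inverseˡ I (x * y)) (solve 2 (λ p q → p := p :- :0 :* q) refl (x * y) (Tr x * Tr y))) }
          where
          IAt : Inverse′ At
          IAt = invert {At} At-injective
          R : Lin
          R = As ∘L Inverse′.inverse′ IAt
          RAt : ∀ X → ap R (ap At X) ≡ ap As X
          RAt X = trans (ap-∘ As _ _) (cong (ap As) (Inverse′.inverseˡ IAt X))
          R-zero : R ≡ 0L
          R-zero = no-intertwiner R (λ y → begin
            ap R (l * l * y)                                      ≡⟨ cong (λ u → ap R (l * l * u)) (Inverse′.inverseʳ IAt y) ⟨
            ap R (l * l * ap At (ap (Inverse′.inverse′ IAt) y))      ≡⟨ cong (ap R) (proj₁ (equivariant _)) ⟨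
            ap R (ap At (ap g (ap (Inverse′.inverse′ IAt) y)))       ≡⟨ RAt _ ⟩
            ap As (ap g (ap (Inverse′.inverse′ IAt) y))              ≡⟨ proj₂ (equivariant _) ⟩
            l * σ l * ap As (ap (Inverse′.inverse′ IAt) y)           ≡⟨ cong (l * σ l *_) (ap-∘ As _ y) ⟨
            l * σ l * ap R y                                      ∎)
            where open ≡-Reasoning
          As-zero : As ≡ 0L
          As-zero = ap-unique As 0L (λ X → trans (sym (RAt X)) (trans (cong (λ f → ap f (ap At X)) R-zero)
            (trans (ap-0L _) (sym (ap-0L X)))))
            where
            ap-0L : ∀ u → ap 0L u ≡ 0#
            ap-0L u = solve 3 (λ x y z → :0 :* x :+ :0 :* y :+ :0 :* z := :0) refl u (σ u) (σ (σ u))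
          T₂-field : ∀ x y → T₂ x y ≡ ap t (x * y)
          T₂-field x y = trans (T₂-form x y) (trans (cong (λ w → ap t (x * y) + w) (adjoint-zero s As-zero _)) (+-identityʳ _))
          t-injective : Injective t
          t-injective u e = Presemifield.cancel P₂ 1≢0 (trans (T₂-field 1# u) (trans (cong (ap t) (*-identityˡ u)) e))
          I : Inverse′ t
          I = invert {t} t-injective

        module Twisted (X : Carrier) (X≢0 : ¬ X ≡ 0#) (AtX : ap At X ≡ 0#) where
          β ll : Carrier
          β = ap As X
          ll = l * σ l
          β≢0 : ¬ β ≡ 0#
          β≢0 e = X≢0 (nontrivial X AtX e)
          ll-irrational : Irrational ll
          ll-irrational e = irrational-σσ l-irrational (*-cancelˡ (σ-≢0 l≢0) (trans (sym (σ-* _ _)) (trans e (*-comm _ _))))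
          -- The orbit of β under multiplication by lσ(l) is lifted through As to X, g(X), g²(X),
          -- all of which At kills. The linear lift κ is a right inverse of As, hence injective and
          -- onto, so At vanishes everywhere.
          interpolated : ∃[ κ ] values β ll κ ≡ ⟨ X , ap g X , ap g (ap g X) ⟩
          interpolated = interpolate β≢0 ll-irrational _
          κ : Lin
          κ = proj₁ interpolated
          κ₀ : ap κ β ≡ X
          κ₀ = cong x₀ (proj₂ interpolated)
          κ₁ : ap κ (ll * β) ≡ ap g X
          κ₁ = cong x₁ (proj₂ interpolated)
          κ₂ : ap κ (ll * (ll * β)) ≡ ap g (ap g X)
          κ₂ = cong x₂ (proj₂ interpolated)
          As-gX : ap As (ap g X) ≡ ll * β
          As-gX = proj₂ (equivariant X)
          Asκ : As ∘L κ ≡ idL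
          Asκ = agree-on-orbit (As ∘L κ) idL β≢0 ll-irrational
            (trans (ap-∘ As κ _) (trans (cong (ap As) κ₀) (sym (ap-id _))))
            (trans (ap-∘ As κ _) (trans (cong (ap As) κ₁) (trans As-gX (sym (ap-id _)))))
            (trans (ap-∘ As κ _) (trans (cong (ap As) κ₂) (trans (proj₂ (equivariant (ap g X))) (trans (cong (ll *_) As-gX) (sym (ap-id _))))))
          As-κ : ∀ y → ap As (ap κ y) ≡ y
          As-κ y = trans (sym (ap-∘ As κ y)) (trans (cong (λ f → ap f y) Asκ) (ap-id y))
          κ-injective : Injective κ
          κ-injective y e = trans (sym (As-κ y)) (trans (cong (ap As) e) (ap-0 As))
          At-gX : ap At (ap g X) ≡ 0#
          At-gX = trans (proj₁ (equivariant X)) (trans (cong (l * l *_) AtX) (zeroʳ _))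
          Atκ : At ∘L κ ≡ 0L
          Atκ = kills-orbit (At ∘L κ) β≢0 ll-irrational
            (trans (ap-∘ At κ _) (trans (cong (ap At) κ₀) AtX))
            (trans (ap-∘ At κ _) (trans (cong (ap At) κ₁) At-gX))
            (trans (ap-∘ At κ _) (trans (cong (ap At) κ₂) (trans (proj₁ (equivariant (ap g X))) (trans (cong (l * l *_) At-gX) (zeroʳ _)))))
          At-zero : At ≡ 0L
          At-zero = ap-unique At 0L (λ Y → trans (cong (ap At) (sym (proj₂ (surjective {κ} κ-injective Y))))
            (trans (sym (ap-∘ At κ _)) (trans (cong (λ f → ap f (proj₁ (surjective {κ} κ-injective Y))) Atκ) (trans (ap-0L _) (sym (ap-0L Y))))))
            where
            ap-0L : ∀ u → ap 0L u ≡ 0#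
            ap-0L u = solve 3 (λ x y z → :0 :* x :+ :0 :* y :+ :0 :* z := :0) refl u (σ u) (σ (σ u))
          T₂-twisted : ∀ x y → T₂ x y ≡ ap s (x * σ y + σ x * y)
          T₂-twisted x y = trans (T₂-form x y) (trans (cong (_+ ap s (x * σ y + σ x * y)) (adjoint-zero t At-zero _)) (+-identityˡ _))
          s-injective : Injective s
          s-injective u e = Tr-nondegenerate (λ w → begin
            Tr (u * w)                   ≡⟨ cong Tr (*-comm u w) ⟩
            Tr (w * u)                   ≡⟨ cong (λ v → Tr (v * u)) (As-κ w) ⟨
            Tr (ap As (ap κ w) * u)      ≡⟨ Tr-adjoint s (ap κ w) u ⟨
            Tr (ap κ w * ap s u)         ≡⟨ cong (λ v → Tr (ap κ w * v)) e ⟩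
            Tr (ap κ w * 0#)             ≡⟨ trans (cong Tr (zeroʳ _)) Tr-0 ⟩
            0#                           ∎)
            where open ≡-Reasoning
          -- Now T₂ 1 1 = s(1 + 1), so in characteristic 2 the element 1 would be a zero divisor.
          2≢0 : ¬ 1# + 1# ≡ 0#
          2≢0 e = 1≢0 (Presemifield.cancel P₂ 1≢0 (trans (T₂-twisted 1# 1#) (trans (cong (ap s) (trans (cong (λ u → 1# * u + u * 1#) σ-1)
            (trans (cong₂ _+_ (*-identityˡ 1#) (*-identityʳ 1#)) e))) (ap-0 s))))
          h : Carrier
          h = inv (1# + 1#)
          -- u₀(x) = Tr(x) - x and v₀(w) = -(w + σ²(w))/2 form the change of coordinates from xσ(y)
          -- + σ(x)y to xy - Tr(x)Tr(y), verified in `twist`.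
          u₀ v₀ : Lin
          u₀ = ⟨ 0# , 1# , 1# ⟩
          v₀ = ⟨ - h , 0# , - h ⟩
          ap-u₀ : ∀ x → ap u₀ x ≡ σ x + σ (σ x)
          ap-u₀ x = solve 3 (λ x y z → :0 :* x :+ :1 :* y :+ :1 :* z := y :+ z) refl x (σ x) (σ (σ x))
          cancel-2 : ∀ {x} → x + x ≡ 0# → x ≡ 0#
          cancel-2 {x} e = *-cancelˡ-0 2≢0 (trans (solve 1 (λ x → (:1 :+ :1) :* x := x :+ x) refl x) e)
          u₀-injective : Injective u₀
          u₀-injective x e = cancel-2 (combine₃ (- 1#) 1# 1# e₀ e₁ e₂
            (solve 3 (λ x y z → x :+ x :- :0 := (:- :1) :* (y :+ z :- :0) :+ :1 :* (z :+ x :- :0) :+ :1 :* (x :+ y :- :0)) refl x (σ x) (σ (σ x))))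
            where
            e₀ : σ x + σ (σ x) ≡ 0#
            e₀ = trans (sym (ap-u₀ x)) e
            e₁ : σ (σ x) + x ≡ 0#
            e₁ = trans (sym (trans (σ-+ _ _) (cong (λ w → σ (σ x) + w) (σ³ x)))) (trans (cong σ e₀) σ-0)
            e₂ : x + σ x ≡ 0#
            e₂ = trans (sym (trans (σ-+ _ _) (cong (_+ σ x) (σ³ x)))) (trans (cong σ e₁) σ-0)
          v₀-injective : Injective v₀
          v₀-injective x e = cancel-2 (combine₃ 1# (- 1#) 1# e₀ e₁ e₂
            (solve 3 (λ x y z → x :+ x :- :0 := :1 :* (x :+ z :- :0) :+ (:- :1) :* (z :+ y :- :0) :+ :1 :* (y :+ x :- :0)) refl x (σ x) (σ (σ x))))
            where
            e₀ : x + σ (σ x) ≡ 0#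
            e₀ = *-cancelˡ-0 (inv-≢0 2≢0) (combine₁ (- 1#) e (solve 4 (λ h x y z → h :* (x :+ z) :- :0
              := (:- :1) :* ((:- h) :* x :+ :0 :* y :+ (:- h) :* z :- :0)) refl h x (σ x) (σ (σ x))))
            e₂ : σ x + x ≡ 0#
            e₂ = trans (sym (trans (σ-+ _ _) (cong (λ w → σ x + w) (σ³ x)))) (trans (cong σ e₀) σ-0)
            e₁ : σ (σ x) + σ x ≡ 0#
            e₁ = trans (sym (σ-+ _ _)) (trans (cong σ e₂) σ-0)
          I : Inverse′ s
          I = invert {s} s-injective
          s⁻¹ : Lin
          s⁻¹ = Inverse′.inverse′ I
          twist : ∀ x y → ap v₀ (ap u₀ x * σ (ap u₀ y) + σ (ap u₀ x) * ap u₀ y) ≡ x * y - 1# * (Tr x * Tr y)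
          twist x y = trans (cong (λ w → - h * (u * σ v + σ u * v) + 0# * σ (u * σ v + σ u * v) + - h * w) (σσ-sym u v))
            (trans (cong₆ (ap-u₀ x) (σu x) (σσu x) (ap-u₀ y) (σu y) (σσu y))
            (combine₁ (x * y - 1# * (Tr x * Tr y)) (inv-inverseʳ 2≢0)
              (solve 8 (λ h r x x' x'' y y' y'' → let u = x' :+ x'' ; u' = x'' :+ x ; u'' = x :+ x' ; v = y' :+ y'' ; v' = y'' :+ y ; v'' = y :+ y'
                                                      S = (x :+ x' :+ x'') :* (y :+ y' :+ y'') in
                 (:- h) :* (u :* v' :+ u' :* v) :+ :0 :* r :+ (:- h) :* (u'' :* v :+ u :* v'') :- (x :* y :- :1 :* S)
                 := (x :* y :- :1 :* S) :* ((:1 :+ :1) :* h :- :1))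
                refl h (σ (u * σ v + σ u * v)) x (σ x) (σ (σ x)) y (σ y) (σ (σ y)))))
            where
            u v : Carrier
            u = ap u₀ x
            v = ap u₀ y
            σu : ∀ x → σ (ap u₀ x) ≡ σ (σ x) + x
            σu x = trans (cong σ (ap-u₀ x)) (trans (σ-+ _ _) (cong (λ w → σ (σ x) + w) (σ³ x)))
            σσu : ∀ x → σ (σ (ap u₀ x)) ≡ x + σ x
            σσu x = trans (cong σ (σu x)) (trans (σ-+ _ _) (cong (_+ σ x) (σ³ x)))
            r = σ (u * σ v + σ u * v)
            cong₆ : ∀ {u u' u'' v v' v'' p p' p'' q q' q''} → u ≡ p → u' ≡ p' → u'' ≡ p'' → v ≡ q → v' ≡ q' → v'' ≡ q'' →
              - h * (u * v' + u' * v) + 0# * r + - h * (u'' * v + u * v'') ≡ - h * (p * q' + p' * q) + 0# * r + - h * (p'' * q + p * q'')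
            cong₆ refl refl refl refl refl refl = refl
          frame-1 : Frame T 1#
          frame-1 = record
            { χ = χ ∘L u₀ ; ψ = v₀ ∘L s⁻¹
            ; χ-injective = ∘-injective {χ} {u₀} χ-injective u₀-injective
            ; ψ-injective = ∘-injective {v₀} {s⁻¹} v₀-injective (inverse-injective I)
            ; law = λ x y → begin
                ap (v₀ ∘L s⁻¹) (T (ap (χ ∘L u₀) x) (ap (χ ∘L u₀) y))
                  ≡⟨ trans (ap-∘ v₀ s⁻¹ _) (cong (ap v₀ ∘ ap s⁻¹) (trans (cong₂ T (ap-∘ χ u₀ x) (ap-∘ χ u₀ y)) (trans (sym (*-identityˡ _)) (T₂-twisted _ _)))) ⟩
                ap v₀ (ap s⁻¹ (ap s (ap u₀ x * σ (ap u₀ y) + σ (ap u₀ x) * ap u₀ y)))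
                  ≡⟨ cong (ap v₀) (Inverse′.inverseˡ I _) ⟩
                ap v₀ (ap u₀ x * σ (ap u₀ y) + σ (ap u₀ x) * ap u₀ y)
                  ≡⟨ twist x y ⟩
                x * y - 1# * (Tr x * Tr y) ∎ }
            where open ≡-Reasoning

      absurd : Scalar M
      absurd = decide (any? (λ X → ¬? (X ≟ 0#) ×-dec (ap At X ≟ 0#)))
        where
        decide : Dec (∃[ X ] (¬ X ≡ 0# × ap At X ≡ 0#)) → Scalar M
        decide (yes (X , X≢0 , e)) = contradiction (Twisted.frame-1 X X≢0 e) not-twisted
        decide (no none) = contradiction (field-case (λ X e → stable X e (X ≟ 0#))) not-field
          where
          stable : ∀ X → ap At X ≡ 0# → Dec (X ≡ 0#) → X ≡ 0#
          stable X e (yes z) = z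
          stable X e (no nz) = contradiction (X , nz , e) none

    abstract
      unimodular⇒scalar : det M ≡ 1# → Scalar M
      unimodular⇒scalar det-M = decide (k.any? (λ μ → any? (λ v → ¬? (v ≟ 0#) ×-dec (ap M v ≟ ι μ * v))))
        where
        decide : Dec (∃[ μ ] ∃[ v ] (¬ v ≡ 0# × ap M v ≡ ι μ * v)) → Scalar M
        decide (yes (μ , v , v≢0 , e)) = WithEigenvector.scalar-map μ v v≢0 e
        decide (no none) = WithoutEigenvector.absurd (λ μ v e → stable μ v e (v ≟ 0#)) det-M
          where
          stable : ∀ μ v → ap M v ≡ ι μ * v → Dec (v ≡ 0#) → v ≡ 0#
          stable μ v e (yes z) = z
          stable μ v e (no nz) = contradiction (μ , v , nz , e) none

-- First and second moments of the number of factorisations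

am-gm : ∀ m n → 2 ℕ.* (m ℕ.* n) ℕ.≤ m ℕ.* m ℕ.+ n ℕ.* n
am-gm m n = [ below m n , (λ n≤m → subst₂ ℕ._≤_ (cong (2 ℕ.*_) (ℕₚ.*-comm n m)) (ℕₚ.+-comm (n ℕ.* n) (m ℕ.* m)) (below n m n≤m)) ]′ (ℕₚ.≤-total m n)
  where
  open +-*-Solver
  below : ∀ m n → m ℕ.≤ n → 2 ℕ.* (m ℕ.* n) ℕ.≤ m ℕ.* m ℕ.+ n ℕ.* n
  below m n m≤n = subst (λ n → 2 ℕ.* (m ℕ.* n) ℕ.≤ m ℕ.* m ℕ.+ n ℕ.* n) (ℕₚ.m+[n∸m]≡n m≤n)
    (subst (2 ℕ.* (m ℕ.* (m ℕ.+ d)) ℕ.≤_)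
      (solve 2 (λ m d → con 2 :* (m :* (m :+ d)) :+ d :* d := m :* m :+ (m :+ d) :* (m :+ d)) refl m d)
      (ℕₚ.m≤m+n _ (d ℕ.* d)))
    where d = n ℕ.∸ m

module SecondMoment (k : FiniteField) (E : CyclicCubic k) where
  open Automorphisms k E

  private
    p : ℕ
    p = k.q

  p-positive : 1 ℕ.≤ p
  p-positive = positive (Inverse.from k.enum k.0#)
    where
    positive : ∀ {n} → Fin n → 1 ℕ.≤ n
    positive {suc n} _ = ℕ.s≤s ℕ.z≤n

  p-nonZero : ℕ.NonZero p
  p-nonZero = ℕ.>-nonZero p-positive

  unit-trace : ∀ y → ¬ Tr y ≡ 0# → ∃[ a ] Tr (ι a * y) ≡ 1#
  unit-trace y h = k.inv (tr y) , trans (Tr-scale y (σ-ι _)) (trans (cong (ι (k.inv (tr y)) *_) (Tr≡ι y))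
    (trans (sym (ι-* _ _)) (trans (cong ι (k.inv-inverseˡ (λ e → h (trans (Tr≡ι y) (trans (cong ι e) ι-0))))) ι-1)))

  trace-one : ∃[ e ] Tr e ≡ 1#
  trace-one = decide (any? (λ y → ¬? (Tr y ≟ 0#)))
    where
    decide : Dec (∃[ y ] ¬ Tr y ≡ 0#) → ∃[ e ] Tr e ≡ 1#
    decide (yes (y , h)) = ι (proj₁ (unit-trace y h)) * y , proj₂ (unit-trace y h)
    decide (no none) = contradiction (Tr-nondegenerate (λ x → stable (1# * x) (Tr (1# * x) ≟ 0#))) 1≢0
      where
      stable : ∀ x → Dec (Tr x ≡ 0#) → Tr x ≡ 0#
      stable x (yes e) = e
      stable x (no h) = contradiction (x , h) none

  -- The fibres of x ↦ Tr(x w) are permuted by translations along e.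
  fibre-size : ∀ (f : Carrier → ℕ) w e → Tr (e * w) ≡ 1# → (∀ a x → f (x + ι a * e) ≡ f x) →
               p ℕ.* ∑ (λ x → f x ℕ.* [ Tr (x * w) ≟ 1# ]) ≡ ∑ f
  fibre-size f w e Tr-e invariant = sym (begin
    ∑ f
      ≡⟨ ∑-cong (λ x → sym (trans (cong (f x ℕ.*_) (k.∑-point (tr (x * w)))) (ℕₚ.*-identityʳ (f x)))) ⟩
    ∑ (λ x → f x ℕ.* k.∑ (λ a → [ tr (x * w) k.≟ a ]))
      ≡⟨ ∑-cong (λ x → k.∑-scale (f x) (λ a → [ tr (x * w) k.≟ a ])) ⟨
    ∑ (λ x → k.∑ (λ a → f x ℕ.* [ tr (x * w) k.≟ a ]))
      ≡⟨ ∑-swap enum k.enum (λ x a → f x ℕ.* [ tr (x * w) k.≟ a ]) ⟩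
    k.∑ (λ a → ∑ (λ x → f x ℕ.* [ tr (x * w) k.≟ a ]))
      ≡⟨ k.∑-cong same ⟩
    k.∑ (λ a → ∑ (λ x → f x ℕ.* [ Tr (x * w) ≟ 1# ]))
      ≡⟨ k.∑-constant _ ⟩
    p ℕ.* ∑ (λ x → f x ℕ.* [ Tr (x * w) ≟ 1# ]) ∎)
    where
    open ≡-Reasoning
    Tr-shift : ∀ a x → Tr ((x + ι a * e) * w) ≡ Tr (x * w) + ι a
    Tr-shift a x = trans (cong Tr (solve 4 (λ x a e w → (x :+ a :* e) :* w := x :* w :+ a :* (e :* w)) refl x (ι a) e w))
      (trans (Tr-+ _ _) (cong (λ u → Tr (x * w) + u) (trans (Tr-scale _ (σ-ι a)) (trans (cong (ι a *_) Tr-e) (*-identityʳ _)))))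
    same : ∀ a → ∑ (λ x → f x ℕ.* [ tr (x * w) k.≟ a ]) ≡ ∑ (λ x → f x ℕ.* [ Tr (x * w) ≟ 1# ])
    same a = trans (sym (∑-reindex (λ x → f x ℕ.* [ tr (x * w) k.≟ a ]) (λ x → x + ι b * e) (λ x → x - ι b * e)
        (λ x → solve 2 (λ x y → x :- y :+ y := x) refl x (ι b * e)) (λ x → solve 2 (λ x y → x :+ y :- y := x) refl x (ι b * e))))
      (∑-cong (λ x → cong₂ ℕ._*_ (invariant b x) ([]-cong (tr ((x + ι b * e) * w) k.≟ a) (Tr (x * w) ≟ 1#) (to x) (from x))))
      where
      b : k.Carrier
      b = a k.- k.1#
      ιb : ι b ≡ ι a - 1#
      ιb = trans (ι-- _ _) (cong (λ u → ι a - u) ι-1)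
      to : ∀ x → tr ((x + ι b * e) * w) ≡ a → Tr (x * w) ≡ 1#
      to x h = combine₃ 1# (- 1#) (- 1#) (trans (Tr≡ι _) (cong ι h)) (Tr-shift b x) ιb
        (solve 4 (λ u t b a → t :- :1 := :1 :* (u :- a) :+ (:- :1) :* (u :- (t :+ b)) :+ (:- :1) :* (b :- (a :- :1)))
          refl (Tr ((x + ι b * e) * w)) (Tr (x * w)) (ι b) (ι a))
      from : ∀ x → Tr (x * w) ≡ 1# → tr ((x + ι b * e) * w) ≡ a
      from x h = ι-injective (trans (sym (Tr≡ι _)) (trans (Tr-shift b x) (combine₂ 1# 1# h ιb
        (solve 3 (λ t b a → t :+ b :- a := :1 :* (t :- :1) :+ :1 :* (b :- (a :- :1))) refl (Tr (x * w)) (ι b) (ι a)))))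

  p² : ℕ
  p² = p ℕ.* p

  cancel-p : ∀ {m n} → p ℕ.* m ≡ p ℕ.* n → m ≡ n
  cancel-p = ℕₚ.*-cancelˡ-≡ _ _ p {{p-nonZero}}

  trace-fibre : ∀ w → ¬ w ≡ 0# → ∑ (λ x → [ Tr (x * w) ≟ 1# ]) ≡ p²
  trace-fibre w w≢0 = cancel-p (begin
    p ℕ.* ∑ (λ x → [ Tr (x * w) ≟ 1# ])             ≡⟨ cong (p ℕ.*_) (∑-cong {λ x → [ Tr (x * w) ≟ 1# ]} (λ x → sym (ℕₚ.*-identityˡ _))) ⟩
    p ℕ.* ∑ (λ x → 1 ℕ.* [ Tr (x * w) ≟ 1# ])       ≡⟨ fibre-size (λ _ → 1) w (proj₁ trace-one * inv w) unit (λ _ _ → refl) ⟩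
    ∑ (λ _ → 1)                                     ≡⟨ trans (∑-constant 1) (ℕₚ.*-identityʳ _) ⟩
    q                                               ≡⟨ card ⟩
    p ℕ.* p²                                        ∎)
    where
    open ≡-Reasoning
    unit : Tr (proj₁ trace-one * inv w * w) ≡ 1#
    unit = trans (cong Tr (trans (*-assoc _ _ _) (trans (cong (proj₁ trace-one *_) (inv-inverseˡ w≢0)) (*-identityʳ _)))) (proj₂ trace-one)

  H : Carrier → ℕ
  H u = [ Tr u ≟ 1# ]

  ∑H : ∑ H ≡ p²
  ∑H = trans (∑-cong (λ u → []-cong (Tr u ≟ 1#) (Tr (u * 1#) ≟ 1#) (trans (cong Tr (*-identityʳ u))) (trans (cong Tr (sym (*-identityʳ u)))))) (trace-fibre 1# 1≢0)

  G : Carrier → Carrier → ℕ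
  G c u = [ Tr (c * inv u) ≟ 1# ]

  -- The factors are u and c/u; `inv` takes its default value only at u = 0, where `H` vanishes.
  factorisations : Carrier → ℕ
  factorisations c = ∑ (λ u → H u ℕ.* G c u)

  Tr-one-≢0 : ∀ {u} → Tr u ≡ 1# → ¬ u ≡ 0#
  Tr-one-≢0 h refl = 1≢0 (trans (sym h) Tr-0)

  -- For each of the q² elements u of trace 1, the nonzero functional c ↦ Tr(c/u) takes the value 1
  -- on q² elements. Over the q³ values of c the mean is therefore q.
  first-moment : ∑ factorisations ≡ p² ℕ.* p²
  first-moment = begin
    ∑ factorisations                                            ≡⟨ ∑-swap enum enum (λ c u → H u ℕ.* G c u) ⟩
    ∑ (λ u → ∑ (λ c → H u ℕ.* G c u))                  ≡⟨ ∑-cong (λ u → trans (∑-scale (H u) (λ c → G c u)) (inner u (Tr u ≟ 1#))) ⟩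
    ∑ (λ u → p² ℕ.* H u)                               ≡⟨ ∑-scale p² H ⟩
    p² ℕ.* ∑ H                                         ≡⟨ cong (p² ℕ.*_) ∑H ⟩
    p² ℕ.* p²                                          ∎
    where
    open ≡-Reasoning
    inner : ∀ u (d : Dec (Tr u ≡ 1#)) → [ d ] ℕ.* ∑ (λ c → G c u) ≡ p² ℕ.* [ d ]
    inner u (yes h) = trans (ℕₚ.*-identityˡ _) (trans (trace-fibre (inv u) (inv-≢0 (Tr-one-≢0 h))) (sym (ℕₚ.*-identityʳ _)))
    inner u (no _) = sym (ℕₚ.*-zeroʳ p²)

  -- The ratio u/v is irrational, since a rational one would be a quotient of equal traces, that is
  -- 1. Hence some translation of c moves Tr(c/v) and leaves Tr(c/u) alone, and the two conditions
  -- on c are independent.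
  pair-fibre : ∀ u v → Tr u ≡ 1# → Tr v ≡ 1# → ¬ u ≡ v → ∑ (λ c → G c u ℕ.* G c v) ≡ p
  pair-fibre u v hu hv u≢v = cancel-p (trans (fibre-size (λ c → G c u) (inv v) e Tr-e invariant) (trace-fibre (inv u) (inv-≢0 (Tr-one-≢0 hu))))
    where
    r : Carrier
    r = u * inv v
    r-irrational : Irrational r
    r-irrational fix = u≢v (trans u≡rv (trans (cong (_* v) r≡1) (*-identityˡ v)))
      where
      u≡rv : u ≡ r * v
      u≡rv = sym (trans (*-assoc _ _ _) (trans (cong (u *_) (inv-inverseˡ (Tr-one-≢0 hv))) (*-identityʳ u)))
      r≡1 : r ≡ 1#
      r≡1 = trans (sym (*-identityʳ r)) (trans (cong (r *_) (sym hv)) (trans (sym (Tr-scale v fix)) (trans (cong Tr (sym u≡rv)) hu)))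
    witness : ∃[ y ] (Tr y ≡ 0# × ¬ Tr (y * r) ≡ 0#)
    witness = decide (Tr (τ₀ * r) ≟ 0#) (Tr (τ₁ * r) ≟ 0#)
      where
      as-ap : ∀ y → ap ⟨ r , σ r , σ (σ r) ⟩ y ≡ Tr (y * r)
      as-ap y = trans (sym (cong₂ (λ s t → r * y + s + t) (σ-* r y) (σ²-* r y))) (cong Tr (*-comm r y))
      decide : Dec (Tr (τ₀ * r) ≡ 0#) → Dec (Tr (τ₁ * r) ≡ 0#) → ∃[ y ] (Tr y ≡ 0# × ¬ Tr (y * r) ≡ 0#)
      decide (no h) _ = τ₀ , Tr-τ₀ , h
      decide (yes _) (no h) = τ₁ , Tr-τ₁ , h
      decide (yes h₀) (yes h₁) = contradiction (proj₁ (vanishes-on-τ ⟨ r , σ r , σ (σ r) ⟩ (trans (as-ap τ₀) h₀) (trans (as-ap τ₁) h₁))) r-irrational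
    y : Carrier
    y = proj₁ witness
    a : k.Carrier
    a = proj₁ (unit-trace (y * r) (proj₂ (proj₂ witness)))
    e : Carrier
    e = ι a * (y * u)
    Tr-e : Tr (e * inv v) ≡ 1#
    Tr-e = trans (cong Tr (solve 4 (λ a y u v → a :* (y :* u) :* v := a :* (y :* (u :* v))) refl (ι a) y u (inv v))) (proj₂ (unit-trace (y * r) (proj₂ (proj₂ witness))))
    Tr-e₀ : ∀ b → Tr (ι b * e * inv u) ≡ 0#
    Tr-e₀ b = begin
      Tr (ι b * (ι a * (y * u)) * inv u)   ≡⟨ cong Tr (combine₁ (ι b * ι a * y) (inv-inverseʳ (Tr-one-≢0 hu))
                                                (solve 5 (λ b a y u i → b :* (a :* (y :* u)) :* i :- b :* (a :* y) := b :* a :* y :* (u :* i :- :1)) refl (ι b) (ι a) y u (inv u))) ⟩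
      Tr (ι b * (ι a * y))                 ≡⟨ trans (Tr-scale _ (σ-ι b)) (cong (ι b *_) (Tr-scale y (σ-ι a))) ⟩
      ι b * (ι a * Tr y)                   ≡⟨ cong (λ t → ι b * (ι a * t)) (proj₁ (proj₂ witness)) ⟩
      ι b * (ι a * 0#)                     ≡⟨ solve 2 (λ a b → b :* (a :* :0) := :0) refl (ι a) (ι b) ⟩
      0#                                   ∎
      where open ≡-Reasoning
    shift : ∀ b x → Tr ((x + ι b * e) * inv u) ≡ Tr (x * inv u)
    shift b x = trans (cong Tr (distribʳ (inv u) x (ι b * e))) (trans (Tr-+ _ _) (trans (cong (λ t → Tr (x * inv u) + t) (Tr-e₀ b)) (+-identityʳ _)))
    invariant : ∀ b x → G (x + ι b * e) u ≡ G x u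
    invariant b x = []-cong (Tr ((x + ι b * e) * inv u) ≟ 1#) (Tr (x * inv u) ≟ 1#) (trans (sym (shift b x))) (trans (shift b x))

  private
    S : Carrier → Carrier → ℕ
    S u v = ∑ (λ c → G c u ℕ.* G c v)

    ∑-product : ∀ (f g : Carrier → ℕ) → ∑ f ℕ.* ∑ g ≡ ∑ (λ u → ∑ (λ v → f u ℕ.* g v))
    ∑-product f g = begin
      ∑ f ℕ.* ∑ g                        ≡⟨ ℕₚ.*-comm (∑ f) (∑ g) ⟩
      ∑ g ℕ.* ∑ f                        ≡⟨ ∑-scale (∑ g) f ⟨
      ∑ (λ u → ∑ g ℕ.* f u)              ≡⟨ ∑-cong (λ u → trans (ℕₚ.*-comm (∑ g) (f u)) (sym (∑-scale (f u) g))) ⟩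
      ∑ (λ u → ∑ (λ v → f u ℕ.* g v))    ∎
      where open ≡-Reasoning

    ∑∑ : (Carrier → Carrier → ℕ) → ℕ
    ∑∑ f = ∑ (λ u → ∑ (f u))

    square-sum : ∑ (λ c → factorisations c ℕ.* factorisations c) ≡ ∑∑ (λ u v → H u ℕ.* H v ℕ.* S u v)
    square-sum = begin
      ∑ (λ c → factorisations c ℕ.* factorisations c)
        ≡⟨ ∑-cong (λ c → ∑-product (λ u → H u ℕ.* G c u) (λ v → H v ℕ.* G c v)) ⟩
      ∑ (λ c → ∑ (λ u → ∑ (λ v → H u ℕ.* G c u ℕ.* (H v ℕ.* G c v))))
        ≡⟨ ∑-swap enum enum (λ c u → ∑ (λ v → H u ℕ.* G c u ℕ.* (H v ℕ.* G c v))) ⟩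
      ∑ (λ u → ∑ (λ c → ∑ (λ v → H u ℕ.* G c u ℕ.* (H v ℕ.* G c v))))
        ≡⟨ ∑-cong (λ u → ∑-swap enum enum (λ c v → H u ℕ.* G c u ℕ.* (H v ℕ.* G c v))) ⟩
      ∑ (λ u → ∑ (λ v → ∑ (λ c → H u ℕ.* G c u ℕ.* (H v ℕ.* G c v))))
        ≡⟨ ∑-cong (λ u → ∑-cong (λ v → trans (∑-cong (λ c → rearrange (H u) (G c u) (H v) (G c v))) (∑-scale (H u ℕ.* H v) (λ c → G c u ℕ.* G c v)))) ⟩
      ∑∑ (λ u v → H u ℕ.* H v ℕ.* S u v) ∎
      where
      open ≡-Reasoning
      rearrange : ∀ a b c d → a ℕ.* b ℕ.* (c ℕ.* d) ≡ a ℕ.* c ℕ.* (b ℕ.* d)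
      rearrange = +-*-Solver.solve 4 (λ a b c d → a +-*-Solver.:* b +-*-Solver.:* (c +-*-Solver.:* d) +-*-Solver.:= a +-*-Solver.:* c +-*-Solver.:* (b +-*-Solver.:* d)) refl

    -- For u, v of trace 1, `S u v` is q off the diagonal and q² on it. The corrections at u = v
    -- stand on both sides so that no subtraction occurs.
    pointwise : ∀ u v → H u ℕ.* H v ℕ.* S u v ℕ.+ [ u ≟ v ] ℕ.* (H u ℕ.* p) ℕ.≤ p ℕ.* (H u ℕ.* H v) ℕ.+ [ u ≟ v ] ℕ.* (H u ℕ.* p²)
    pointwise u v = cases (Tr u ≟ 1#) (Tr v ≟ 1#) (u ≟ v)
      where
      cases : (d : Dec (Tr u ≡ 1#)) (e : Dec (Tr v ≡ 1#)) (f : Dec (u ≡ v)) →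
        [ d ] ℕ.* [ e ] ℕ.* S u v ℕ.+ [ f ] ℕ.* ([ d ] ℕ.* p) ℕ.≤ p ℕ.* ([ d ] ℕ.* [ e ]) ℕ.+ [ f ] ℕ.* ([ d ] ℕ.* p²)
      cases (no _) _ (yes _) = ℕ.z≤n
      cases (no _) _ (no _) = ℕ.z≤n
      cases (yes hu) (no hv) (yes refl) = contradiction hu hv
      cases (yes _) (no _) (no _) = ℕ.z≤n
      cases (yes hu) (yes hv) (no u≢v) = ℕₚ.≤-reflexive (cong (ℕ._+ 0) (trans (ℕₚ.+-identityʳ (S u v)) (trans (pair-fibre u v hu hv u≢v) (sym (ℕₚ.*-identityʳ p)))))
      cases (yes hu) (yes _) (yes refl) = ℕₚ.≤-reflexive (begin
        S u u ℕ.+ 0 ℕ.+ (p ℕ.+ 0 ℕ.+ 0)           ≡⟨ cong₂ ℕ._+_ (ℕₚ.+-identityʳ (S u u)) (trans (ℕₚ.+-identityʳ (p ℕ.+ 0)) (ℕₚ.+-identityʳ p)) ⟩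
        S u u ℕ.+ p                               ≡⟨ cong (ℕ._+ p) (trans (∑-cong (λ c → idempotent (Tr (c * inv u) ≟ 1#))) (trace-fibre (inv u) (inv-≢0 (Tr-one-≢0 hu)))) ⟩
        p² ℕ.+ p                                  ≡⟨ ℕₚ.+-comm p² p ⟩
        p ℕ.+ p²                                  ≡⟨ cong₂ ℕ._+_ (sym (ℕₚ.*-identityʳ p)) (sym (trans (ℕₚ.+-identityʳ (p² ℕ.+ 0)) (ℕₚ.+-identityʳ p²))) ⟩
        p ℕ.* 1 ℕ.+ (p² ℕ.+ 0 ℕ.+ 0)              ∎)
        where
        open ≡-Reasoning
        idempotent : ∀ {A : Set} (d : Dec A) → [ d ] ℕ.* [ d ] ≡ [ d ]
        idempotent (yes _) = refl
        idempotent (no _) = refl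

    diagonal : ∀ n → ∑∑ (λ u v → [ u ≟ v ] ℕ.* (H u ℕ.* n)) ≡ n ℕ.* p²
    diagonal n = begin
      ∑∑ (λ u v → [ u ≟ v ] ℕ.* (H u ℕ.* n))   ≡⟨ ∑-cong (λ u → trans (∑-select u (λ _ → H u ℕ.* n)) (ℕₚ.*-comm (H u) n)) ⟩
      ∑ (λ u → n ℕ.* H u)                      ≡⟨ ∑-scale n H ⟩
      n ℕ.* ∑ H                                ≡⟨ cong (n ℕ.*_) ∑H ⟩
      n ℕ.* p²                                 ∎
      where open ≡-Reasoning

    ∑∑-+ : ∀ f g → ∑∑ (λ u v → f u v ℕ.+ g u v) ≡ ∑∑ f ℕ.+ ∑∑ g
    ∑∑-+ f g = trans (∑-cong (λ u → ∑-+ (f u) (g u))) (∑-+ (λ u → ∑ (f u)) (λ u → ∑ (g u)))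

  second-moment : ∑ (λ c → factorisations c ℕ.* factorisations c) ℕ.+ p ℕ.* p² ℕ.≤ p ℕ.* (p² ℕ.* p²) ℕ.+ p² ℕ.* p²
  second-moment = begin
    ∑ (λ c → factorisations c ℕ.* factorisations c) ℕ.+ p ℕ.* p²
      ≡⟨ cong₂ ℕ._+_ square-sum (sym (diagonal p)) ⟩
    ∑∑ (λ u v → H u ℕ.* H v ℕ.* S u v) ℕ.+ ∑∑ (λ u v → [ u ≟ v ] ℕ.* (H u ℕ.* p))
      ≡⟨ ∑∑-+ (λ u v → H u ℕ.* H v ℕ.* S u v) (λ u v → [ u ≟ v ] ℕ.* (H u ℕ.* p)) ⟨
    ∑∑ (λ u v → H u ℕ.* H v ℕ.* S u v ℕ.+ [ u ≟ v ] ℕ.* (H u ℕ.* p))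
      ≤⟨ ∑-≤ (λ u → ∑-≤ (λ v → pointwise u v)) ⟩
    ∑∑ (λ u v → p ℕ.* (H u ℕ.* H v) ℕ.+ [ u ≟ v ] ℕ.* (H u ℕ.* p²))
      ≡⟨ ∑∑-+ (λ u v → p ℕ.* (H u ℕ.* H v)) (λ u v → [ u ≟ v ] ℕ.* (H u ℕ.* p²)) ⟩
    ∑∑ (λ u v → p ℕ.* (H u ℕ.* H v)) ℕ.+ ∑∑ (λ u v → [ u ≟ v ] ℕ.* (H u ℕ.* p²))
      ≡⟨ cong₂ ℕ._+_ (trans (∑-cong (λ u → ∑-scale p (λ v → H u ℕ.* H v))) (trans (∑-scale p (λ u → ∑ (λ v → H u ℕ.* H v)))
           (cong (p ℕ.*_) (trans (sym (∑-product H H)) (cong₂ ℕ._*_ ∑H ∑H))))) (diagonal p²) ⟩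
    p ℕ.* (p² ℕ.* p²) ℕ.+ p² ℕ.* p² ∎
    where open ℕₚ.≤-Reasoning

  unfactorable : Carrier → ℕ
  unfactorable c = [ factorisations c ℕ.≟ 0 ]

  -- Chebyshev's inequality for the number of factorisations.
  few-unfactorable : ∑ unfactorable ℕ.+ p ℕ.≤ p²
  few-unfactorable = ℕₚ.*-cancelˡ-≤ p² {{ℕₚ.m*n≢0 p p {{p-nonZero}} {{p-nonZero}}}} (ℕₚ.+-cancelˡ-≤ (2 ℕ.* (p ℕ.* (p² ℕ.* p²)) ℕ.+ S₂) _ _ (begin
    2 ℕ.* (p ℕ.* (p² ℕ.* p²)) ℕ.+ S₂ ℕ.+ p² ℕ.* (D ℕ.+ p)
      ≡⟨ rearrange₁ p D S₂ ⟩
    (2 ℕ.* p ℕ.* (p² ℕ.* p²) ℕ.+ p² ℕ.* D) ℕ.+ (S₂ ℕ.+ p ℕ.* p²)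
      ≡⟨ cong (λ m → (2 ℕ.* p ℕ.* m ℕ.+ p² ℕ.* D) ℕ.+ (S₂ ℕ.+ p ℕ.* p²)) first-moment ⟨
    (2 ℕ.* p ℕ.* ∑ factorisations ℕ.+ p² ℕ.* D) ℕ.+ (S₂ ℕ.+ p ℕ.* p²)
      ≤⟨ ℕₚ.+-mono-≤ summed second-moment ⟩
    (S₂ ℕ.+ p ℕ.* p² ℕ.* p²) ℕ.+ (p ℕ.* (p² ℕ.* p²) ℕ.+ p² ℕ.* p²)
      ≡⟨ rearrange₂ p S₂ ⟩
    2 ℕ.* (p ℕ.* (p² ℕ.* p²)) ℕ.+ S₂ ℕ.+ p² ℕ.* p² ∎))
    where
    open ℕₚ.≤-Reasoning
    D S₂ : ℕ
    D = ∑ unfactorable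
    S₂ = ∑ (λ c → factorisations c ℕ.* factorisations c)
    open +-*-Solver renaming (solve to solveℕ; _:+_ to _⊹_; _:*_ to _×′_; _:=_ to _≔_; con to conℕ)
    rearrange₁ : ∀ p D S → 2 ℕ.* (p ℕ.* (p ℕ.* p ℕ.* (p ℕ.* p))) ℕ.+ S ℕ.+ p ℕ.* p ℕ.* (D ℕ.+ p)
      ≡ (2 ℕ.* p ℕ.* (p ℕ.* p ℕ.* (p ℕ.* p)) ℕ.+ p ℕ.* p ℕ.* D) ℕ.+ (S ℕ.+ p ℕ.* (p ℕ.* p))
    rearrange₁ = solveℕ 3 (λ p D S → conℕ 2 ×′ (p ×′ (p ×′ p ×′ (p ×′ p))) ⊹ S ⊹ p ×′ p ×′ (D ⊹ p)
      ≔ (conℕ 2 ×′ p ×′ (p ×′ p ×′ (p ×′ p)) ⊹ p ×′ p ×′ D) ⊹ (S ⊹ p ×′ (p ×′ p))) refl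
    rearrange₂ : ∀ p S → (S ℕ.+ p ℕ.* (p ℕ.* p) ℕ.* (p ℕ.* p)) ℕ.+ (p ℕ.* (p ℕ.* p ℕ.* (p ℕ.* p)) ℕ.+ p ℕ.* p ℕ.* (p ℕ.* p))
      ≡ 2 ℕ.* (p ℕ.* (p ℕ.* p ℕ.* (p ℕ.* p))) ℕ.+ S ℕ.+ p ℕ.* p ℕ.* (p ℕ.* p)
    rearrange₂ = solveℕ 2 (λ p S → (S ⊹ p ×′ (p ×′ p) ×′ (p ×′ p)) ⊹ (p ×′ (p ×′ p ×′ (p ×′ p)) ⊹ p ×′ p ×′ (p ×′ p))
      ≔ conℕ 2 ×′ (p ×′ (p ×′ p ×′ (p ×′ p))) ⊹ S ⊹ p ×′ p ×′ (p ×′ p)) refl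
    -- The bound (n - p)² ≥ p²[n = 0], multiplied out so that no subtraction occurs. The two moments
    -- give Σ(n - p)² ≤ p⁴ - p³, whence p²D ≤ p⁴ - p³.
    deviation : ∀ n (d : Dec (n ≡ 0)) → 2 ℕ.* p ℕ.* n ℕ.+ p² ℕ.* [ d ] ℕ.≤ n ℕ.* n ℕ.+ p²
    deviation n (yes refl) = ℕₚ.≤-reflexive (cong₂ ℕ._+_ (ℕₚ.*-zeroʳ (2 ℕ.* p)) (ℕₚ.*-identityʳ p²))
    deviation n (no _) = ℕₚ.≤-trans (ℕₚ.≤-reflexive (trans (cong₂ ℕ._+_ (trans (ℕₚ.*-assoc 2 p n) (cong (2 ℕ.*_) (ℕₚ.*-comm p n))) (ℕₚ.*-zeroʳ p²)) (ℕₚ.+-identityʳ _))) (am-gm n p)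
    summed : 2 ℕ.* p ℕ.* ∑ factorisations ℕ.+ p² ℕ.* D ℕ.≤ S₂ ℕ.+ p ℕ.* p² ℕ.* p²
    summed = begin
      2 ℕ.* p ℕ.* ∑ factorisations ℕ.+ p² ℕ.* D
        ≡⟨ cong₂ ℕ._+_ (∑-scale (2 ℕ.* p) factorisations) (∑-scale p² unfactorable) ⟨
      ∑ (λ c → 2 ℕ.* p ℕ.* factorisations c) ℕ.+ ∑ (λ c → p² ℕ.* unfactorable c)
        ≡⟨ ∑-+ (λ c → 2 ℕ.* p ℕ.* factorisations c) (λ c → p² ℕ.* unfactorable c) ⟨
      ∑ (λ c → 2 ℕ.* p ℕ.* factorisations c ℕ.+ p² ℕ.* unfactorable c)
        ≤⟨ ∑-≤ (λ c → deviation (factorisations c) (factorisations c ℕ.≟ 0)) ⟩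
      ∑ (λ c → factorisations c ℕ.* factorisations c ℕ.+ p²)
        ≡⟨ ∑-+ (λ c → factorisations c ℕ.* factorisations c) (λ _ → p²) ⟩
      S₂ ℕ.+ ∑ (λ _ → p²)
        ≡⟨ cong (S₂ ℕ.+_) (trans (∑-constant p²) (cong (ℕ._* p²) card)) ⟩
      S₂ ℕ.+ p ℕ.* p² ℕ.* p² ∎

-- Too many parameters: there is no exotic product

module NoExotic (k : FiniteField) (E : CyclicCubic k) where
  open Automorphisms k E
  open SecondMoment k E

  determinant : ∀ {T z} → FrameAt T z → Carrier
  determinant F = det (Frame.χ (FrameAt.frame F))

  -- σ is applied to the law and σ² is substituted into its arguments; traces do not change, and
  -- `position` survives because ν is rational.
  conjugateFrame : ∀ {T z} → FrameAt T z → FrameAt T z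
  conjugateFrame {T} {z} F = record
    { c = σ c
    ; frame = record
      { χ = χ ∘L (σL ∘L σL) ; ψ = σL ∘L ψ
      ; χ-injective = ∘-injective {χ} {σL ∘L σL} χ-injective (∘-injective {σL} {σL} σL-injective σL-injective)
      ; ψ-injective = ∘-injective {σL} {ψ} σL-injective ψ-injective
      ; law = λ x y → begin
          ap (σL ∘L ψ) (T (ap (χ ∘L (σL ∘L σL)) x) (ap (χ ∘L (σL ∘L σL)) y))
            ≡⟨ trans (ap-∘ σL ψ _) (trans (ap-σL _) (cong (σ ∘ ap ψ) (cong₂ T (moved x) (moved y)))) ⟩
          σ (ap ψ (T (ap χ (σ (σ x))) (ap χ (σ (σ y)))))
            ≡⟨ cong σ (law (σ (σ x)) (σ (σ y))) ⟩
          σ (σ (σ x) * σ (σ y) - c * (Tr (σ (σ x)) * Tr (σ (σ y))))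
            ≡⟨ trans (σ-- _ _) (cong₂ _-_ (trans (σ-* _ _) (cong₂ _*_ (σ³ x) (σ³ y)))
                 (trans (σ-* _ _) (cong (σ c *_) (trans (σ-* _ _) (cong₂ _*_ (trace x) (trace y)))))) ⟩
          x * y - σ c * (Tr x * Tr y) ∎ }
    ; ν = ν
    ; position = trans (cong σ position) (trans (σ-* _ _) (cong₂ _*_ (σ-ι ν) (sym (trans (ap-∘ σL ψ z) (ap-σL _))))) }
    where
    open ≡-Reasoning
    open FrameAt F
    open Frame frame
    σL-injective : Injective σL
    σL-injective x e = σ-injective (trans (sym (ap-σL x)) (trans e (sym σ-0)))
    moved : ∀ x → ap (χ ∘L (σL ∘L σL)) x ≡ ap χ (σ (σ x))
    moved x = trans (ap-∘ χ (σL ∘L σL) x) (cong (ap χ) (trans (ap-∘ σL σL x) (trans (ap-σL _) (cong σ (ap-σL x)))))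
    trace : ∀ x → σ (Tr (σ (σ x))) ≡ Tr x
    trace x = trans (σ-Tr _) (trans (Tr-σ _) (Tr-σ x))

  -- Same c and same z, but the determinant of χ is multiplied by μ³. This is the freedom that
  -- brings different frames to equal determinants.
  scaleFrame : ∀ {T z} → Presemifield T → (μ : k.Carrier) → ¬ μ ≡ k.0# → FrameAt T z → FrameAt T z
  scaleFrame {T} {z} P μ μ≢0 F = record
    { c = c
    ; frame = record
      { χ = χ ∘L scalar (ι μ) ; ψ = scalar (ι m) ∘L ψ
      ; χ-injective = ∘-injective {χ} {scalar (ι μ)} χ-injective (scalar-injective (ι-≢0 μ≢0))
      ; ψ-injective = ∘-injective {scalar (ι m)} {ψ} (scalar-injective (ι-≢0 (k.*-≢0 (k.inv-≢0 μ≢0) (k.inv-≢0 μ≢0)))) ψ-injective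
      ; law = λ x y → begin
          ap (scalar (ι m) ∘L ψ) (T (ap (χ ∘L scalar (ι μ)) x) (ap (χ ∘L scalar (ι μ)) y))
            ≡⟨ trans (ap-∘ (scalar (ι m)) ψ _) (trans (ap-scalar (ι m) _) (cong (λ w → ι m * ap ψ w) (cong₂ T (moved x) (moved y)))) ⟩
          ι m * ap ψ (T (ι μ * ap χ x) (ι μ * ap χ y))
            ≡⟨ cong (λ w → ι m * ap ψ w) (trans (homogeneous (Presemifield.T-linear P _) μ _) (cong (ι μ *_) (Presemifield.T-ιʳ P μ _ _))) ⟩
          ι m * ap ψ (ι μ * (ι μ * T (ap χ x) (ap χ y)))
            ≡⟨ cong (ι m *_) (trans (ap-ι ψ μ _) (cong (ι μ *_) (ap-ι ψ μ _))) ⟩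
          ι m * (ι μ * (ι μ * ap ψ (T (ap χ x) (ap χ y))))
            ≡⟨ cancels _ ⟩
          ap ψ (T (ap χ x) (ap χ y))
            ≡⟨ law x y ⟩
          x * y - c * (Tr x * Tr y) ∎ }
    ; ν = ν k.* (μ k.* μ)
    ; position = trans position (sym (begin
        ι (ν k.* (μ k.* μ)) * ap (scalar (ι m) ∘L ψ) z   ≡⟨ cong₂ _*_ (trans (ι-* _ _) (cong (ι ν *_) (ι-* μ μ))) (trans (ap-∘ (scalar (ι m)) ψ z) (ap-scalar (ι m) _)) ⟩
        ι ν * (ι μ * ι μ) * (ι m * ap ψ z)               ≡⟨ solve 4 (λ n u m w → n :* (u :* u) :* (m :* w) := n :* (m :* (u :* (u :* w)))) refl (ι ν) (ι μ) (ι m) (ap ψ z) ⟩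
        ι ν * (ι m * (ι μ * (ι μ * ap ψ z)))             ≡⟨ cong (ι ν *_) (cancels (ap ψ z)) ⟩
        ι ν * ap ψ z                                     ∎)) }
    where
    open ≡-Reasoning
    open FrameAt F
    open Frame frame
    m : k.Carrier
    m = k.inv μ k.* k.inv μ
    ιinv : ι (k.inv μ) * ι μ ≡ 1#
    ιinv = trans (sym (ι-* _ _)) (trans (cong ι (k.inv-inverseˡ μ≢0)) ι-1)
    cancels : ∀ w → ι m * (ι μ * (ι μ * w)) ≡ w
    cancels w = trans (cong (_* (ι μ * (ι μ * w))) (ι-* _ _)) (combine₁ (w * (ι (k.inv μ) * ι μ + 1#)) ιinv
      (solve 3 (λ i u w → i :* i :* (u :* (u :* w)) :- w := w :* (i :* u :+ :1) :* (i :* u :- :1)) refl (ι (k.inv μ)) (ι μ) w))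
    moved : ∀ x → ap (χ ∘L scalar (ι μ)) x ≡ ι μ * ap χ x
    moved x = trans (ap-∘ χ (scalar (ι μ)) x) (trans (cong (ap χ) (ap-scalar (ι μ) x)) (ap-ι χ μ x))

  determinant-scale : ∀ {T z} (P : Presemifield T) μ μ≢0 (F : FrameAt T z) →
                      determinant (scaleFrame P μ μ≢0 F) ≡ determinant F * (ι μ * ι μ * ι μ)
  determinant-scale P μ μ≢0 F = trans (det-∘ (Frame.χ (FrameAt.frame F)) (scalar (ι μ))) (cong (determinant F *_)
    (trans (det-scalar (ι μ)) (cong₂ (λ u v → ι μ * u * v) (σ-ι μ) (trans (cong σ (σ-ι μ)) (σ-ι μ)))))

  -- Two frames with the same parameter and the same determinant differ by an automorphism of determinant 1.
  module SameFrame {T : Carrier → Carrier → Carrier} (X : Exotic T) {z z' : Carrier} (F : FrameAt T z) (F' : FrameAt T z')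
      (same-c : FrameAt.c F ≡ FrameAt.c F') (same-det : determinant F ≡ determinant F') where
    private
      open Exotic X
      module F = FrameAt F
      module F' = FrameAt F'
      module f = Frame F.frame
      module f' = Frame F'.frame
      module P = Presemifield presemifield
      Iχ : Inverse′ f.χ
      Iχ = invert {f.χ} f.χ-injective
      Iψ' : Inverse′ f'.ψ
      Iψ' = invert {f'.ψ} f'.ψ-injective
      χ⁻¹ ψ'⁻¹ M Nn : Lin
      χ⁻¹ = Inverse′.inverse′ Iχ
      ψ'⁻¹ = Inverse′.inverse′ Iψ'
      M = f'.χ ∘L χ⁻¹
      Nn = ψ'⁻¹ ∘L f.ψ
      M-injective : Injective M
      M-injective = ∘-injective {f'.χ} {χ⁻¹} f'.χ-injective (inverse-injective Iχ)
      ψ'-M : ∀ x y → ap f'.ψ (T (ap M x) (ap M y)) ≡ ap f.ψ (T x y)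
      ψ'-M x y = begin
        ap f'.ψ (T (ap M x) (ap M y))                        ≡⟨ cong₂ (λ u v → ap f'.ψ (T u v)) (ap-∘ f'.χ χ⁻¹ x) (ap-∘ f'.χ χ⁻¹ y) ⟩
        ap f'.ψ (T (ap f'.χ a) (ap f'.χ b))                  ≡⟨ f'.law a b ⟩
        a * b - F'.c * (Tr a * Tr b)                         ≡⟨ cong (λ u → a * b - u * (Tr a * Tr b)) same-c ⟨
        a * b - F.c * (Tr a * Tr b)                          ≡⟨ f.law a b ⟨
        ap f.ψ (T (ap f.χ a) (ap f.χ b))                     ≡⟨ cong₂ (λ u v → ap f.ψ (T u v)) (Inverse′.inverseʳ Iχ x) (Inverse′.inverseʳ Iχ y) ⟩
        ap f.ψ (T x y)                                       ∎
        where
        open ≡-Reasoning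
        a b : Carrier
        a = ap χ⁻¹ x
        b = ap χ⁻¹ y
      automorphism : ∀ x y → T (ap M x) (ap M y) ≡ ap Nn (T x y)
      automorphism x y = trans (sym (Inverse′.inverseˡ Iψ' _)) (trans (cong (ap ψ'⁻¹) (ψ'-M x y)) (sym (ap-∘ ψ'⁻¹ f.ψ _)))
      det-M : det M ≡ 1#
      det-M = begin
        det (f'.χ ∘L χ⁻¹)        ≡⟨ det-∘ f'.χ χ⁻¹ ⟩
        det f'.χ * det χ⁻¹       ≡⟨ cong (_* det χ⁻¹) same-det ⟨
        det f.χ * det χ⁻¹        ≡⟨ det-∘ f.χ χ⁻¹ ⟨
        det (f.χ ∘L χ⁻¹)         ≡⟨ cong det (ap-unique (f.χ ∘L χ⁻¹) idL (λ x → trans (ap-∘ f.χ χ⁻¹ x) (trans (Inverse′.inverseʳ Iχ x) (sym (ap-id x))))) ⟩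
        det idL                  ≡⟨ det-id ⟩
        1#                       ∎
        where open ≡-Reasoning
      scalar-M : Scalar M
      scalar-M = ExoticAutomorphism.unimodular⇒scalar X M Nn M-injective automorphism det-M
      e : Carrier
      e = proj₁ scalar-M
      σe : σ e ≡ e
      σe = proj₁ (proj₂ scalar-M)
      M-e : ∀ x → ap M x ≡ e * x
      M-e = proj₂ (proj₂ scalar-M)
      e≢0 : ¬ e ≡ 0#
      e≢0 z = 1≢0 (M-injective 1# (trans (M-e 1#) (trans (cong (_* 1#) z) (zeroˡ 1#))))
      eₖ : k.Carrier
      eₖ = proj₁ (fixed e σe)
      e≡ι : e ≡ ι eₖ
      e≡ι = proj₂ (fixed e σe)
      eₖ≢0 : ¬ eₖ ≡ k.0#
      eₖ≢0 h = e≢0 (trans e≡ι (trans (cong ι h) ι-0))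
      ψ-e : ∀ x y → ap f.ψ (T x y) ≡ e * e * ap f'.ψ (T x y)
      ψ-e x y = begin
        ap f.ψ (T x y)                              ≡⟨ ψ'-M x y ⟨
        ap f'.ψ (T (ap M x) (ap M y))               ≡⟨ cong₂ (λ u v → ap f'.ψ (T u v)) (trans (M-e x) (cong (_* x) e≡ι)) (trans (M-e y) (cong (_* y) e≡ι)) ⟩
        ap f'.ψ (T (ι eₖ * x) (ι eₖ * y))           ≡⟨ cong (ap f'.ψ) (trans (homogeneous (P.T-linear _) eₖ x) (cong (ι eₖ *_) (P.T-ιʳ eₖ x y))) ⟩
        ap f'.ψ (ι eₖ * (ι eₖ * T x y))             ≡⟨ trans (ap-ι f'.ψ eₖ _) (cong (ι eₖ *_) (ap-ι f'.ψ eₖ _)) ⟩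
        ι eₖ * (ι eₖ * ap f'.ψ (T x y))             ≡⟨ cong (λ u → u * (u * ap f'.ψ (T x y))) e≡ι ⟨
        e * (e * ap f'.ψ (T x y))                   ≡⟨ *-assoc e e _ ⟨
        e * e * ap f'.ψ (T x y)                     ∎
        where open ≡-Reasoning
      rep : ∃[ g ] (∀ y → ap g y ≡ T 1# y)
      rep = represent record { additive = P.T-+ʳ 1# ; homogeneous = λ c y → P.T-ιʳ c 1# y }
      onto : ∀ w → ∃[ y ] ap (proj₁ rep) y ≡ w
      onto = surjective {proj₁ rep} (λ y h → P.cancel 1≢0 (trans (sym (proj₂ rep y)) h))
      ψ-everywhere : ∀ w → ap f.ψ w ≡ e * e * ap f'.ψ w
      ψ-everywhere w = subst (λ u → ap f.ψ u ≡ e * e * ap f'.ψ u) (trans (sym (proj₂ rep _)) (proj₂ (onto w))) (ψ-e 1# _)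

    -- As M is a rational scalar e, ψ = e²ψ'. Equating c = νψ(z) with c = ν'ψ'(z') gives νe²z =
    -- ν'z', where ν ≠ 0 because c ≠ 0.
    proportional : ∃[ r ] ∃[ r' ] (¬ r ≡ k.0# × ι r * z ≡ ι r' * z')
    proportional = F.ν k.* (eₖ k.* eₖ) , F'.ν , k.*-≢0 ν≢0 (k.*-≢0 eₖ≢0 eₖ≢0) , ap-injective {f'.ψ} f'.ψ-injective (begin
      ap f'.ψ (ι (F.ν k.* (eₖ k.* eₖ)) * z)      ≡⟨ ap-ι f'.ψ _ z ⟩
      ι (F.ν k.* (eₖ k.* eₖ)) * ap f'.ψ z        ≡⟨ cong (_* ap f'.ψ z) (trans (ι-* _ _) (cong (ι F.ν *_) (trans (ι-* _ _) (cong₂ _*_ (sym e≡ι) (sym e≡ι))))) ⟩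
      ι F.ν * (e * e) * ap f'.ψ z                ≡⟨ trans (*-assoc _ _ _) (cong (ι F.ν *_) (sym (ψ-everywhere z))) ⟩
      ι F.ν * ap f.ψ z                           ≡⟨ F.position ⟨
      F.c                                        ≡⟨ same-c ⟩
      F'.c                                       ≡⟨ F'.position ⟩
      ι F'.ν * ap f'.ψ z'                        ≡⟨ ap-ι f'.ψ _ z' ⟨
      ap f'.ψ (ι F'.ν * z')                      ∎)
      where
      open ≡-Reasoning
      ν≢0 : ¬ F.ν ≡ k.0#
      ν≢0 h = c≢0 F.frame (trans F.position (trans (cong (_* ap f.ψ z) (trans (cong ι h) ι-0)) (zeroˡ _)))

  -- If u and c/u have trace 1, then u(c/u) - c·1·1 = 0, and their images under χ are zero divisors
  -- of T.
  unfactorable-frame : ∀ {T c} → Exotic T → Frame T c → factorisations c ≡ 0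
  unfactorable-frame {T} {c} X f = trans (∑-cong (λ u → vanishes u (Tr u ≟ 1#) (Tr (c * inv u) ≟ 1#))) (trans (∑-constant 0) (ℕₚ.*-zeroʳ q))
    where
    open Exotic X
    open Frame f
    vanishes : ∀ u (d : Dec (Tr u ≡ 1#)) (d' : Dec (Tr (c * inv u) ≡ 1#)) → [ d ] ℕ.* [ d' ] ≡ 0
    vanishes u (no _) _ = refl
    vanishes u (yes _) (no _) = refl
    vanishes u (yes h) (yes h') = contradiction (χ-injective _ (Presemifield.cancel presemifield (u≢0 ∘ χ-injective u) zero-product')) (*-≢0 (c≢0 f) (inv-≢0 u≢0))
      where
      u≢0 : ¬ u ≡ 0#
      u≢0 = Tr-one-≢0 h
      zero-product' : T (ap χ u) (ap χ (c * inv u)) ≡ 0#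
      zero-product' = ψ-injective _ (trans (law u (c * inv u)) (trans (cong₂ (λ s t → u * (c * inv u) - c * (s * t)) h h')
        (combine₁ c (inv-inverseʳ u≢0) (solve 3 (λ u i c → u :* (c :* i) :- c :* (:1 :* :1) :- :0 := c :* (u :* i :- :1)) refl u (inv u) c))))

  module Counting {Index : Set} (index-enum : Fin (k.q ℕ.* k.q ℕ.* 3) ↔ Index)
      (parameter : Index → Carrier) (δ : Index → k.Carrier) (δ≢0 : ∀ y → ¬ δ y ≡ k.0#)
      (injective : ∀ y y' μ μ' → ¬ μ ≡ k.0# → ¬ μ' ≡ k.0# → parameter y ≡ parameter y' →
        δ y k.* (μ k.* μ k.* μ) ≡ δ y' k.* (μ' k.* μ' k.* μ') → y ≡ y')
      (unfactorable-parameter : ∀ y → factorisations (parameter y) ≡ 0) where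
    private
      p : ℕ
      p = k.q

      value : k.Carrier → Index → k.Carrier
      value μ y = δ y k.* (μ k.* μ k.* μ)

      module I = Enumerated index-enum

      nz : k.Carrier → ℕ
      nz μ = [ ¬? (μ k.≟ k.0#) ]

      -- Indicator of (y, μ) ↦ (c, d) with μ ≠ 0. Its total is evaluated along (y, μ) and bounded
      -- along (c, d).
      term : Index → k.Carrier → Carrier → k.Carrier → ℕ
      term y μ c d = nz μ ℕ.* ([ parameter y ≟ c ] ℕ.* [ value μ y k.≟ d ])

      n₁ : ℕ
      n₁ = k.∑ nz

      D : ℕ
      D = ∑ unfactorable

      term-total : ∀ y μ → ∑ (λ c → k.∑ (λ d → term y μ c d)) ≡ nz μ
      term-total y μ = begin
        ∑ (λ c → k.∑ (λ d → term y μ c d))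
          ≡⟨ ∑-cong (λ c → trans (k.∑-scale (nz μ) (λ d → [ parameter y ≟ c ] ℕ.* [ value μ y k.≟ d ]))
               (cong (nz μ ℕ.*_) (trans (k.∑-scale [ parameter y ≟ c ] (λ d → [ value μ y k.≟ d ])) (cong ([ parameter y ≟ c ] ℕ.*_) (k.∑-point (value μ y)))))) ⟩
        ∑ (λ c → nz μ ℕ.* ([ parameter y ≟ c ] ℕ.* 1))
          ≡⟨ ∑-scale (nz μ) (λ c → [ parameter y ≟ c ] ℕ.* 1) ⟩
        nz μ ℕ.* ∑ (λ c → [ parameter y ≟ c ] ℕ.* 1)
          ≡⟨ trans (cong (nz μ ℕ.*_) (∑-select (parameter y) (λ _ → 1))) (ℕₚ.*-identityʳ _) ⟩
        nz μ ∎
        where open ≡-Reasoning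

      cube-roots : ∀ y d → k.∑ (λ μ → [ value μ y k.≟ d ]) ℕ.≤ 3
      cube-roots y d = ℕₚ.≤-trans (k.∑-≤ (λ μ → []-mono (value μ y k.≟ d) (k.monic poly μ k.≟ k.0#) (is-root μ))) (k.roots-≤ poly)
        where
        a : k.Carrier
        a = k.- (k.inv (δ y) k.* d)
        poly : Vec k.Carrier 3
        poly = a ∷ k.0# ∷ k.0# ∷ []
        is-root : ∀ μ → value μ y ≡ d → k.monic poly μ ≡ k.0#
        is-root μ e = k.combine₂ (k.inv (δ y)) (k.- (μ k.* μ k.* μ)) e (k.inv-inverseˡ (δ≢0 y))
          (k.solve 4 (λ μ i δ d → μ k.:* (μ k.:* (μ k.:* k.:1 k.:+ k.:0) k.:+ k.:0) k.:+ (k.:- (i k.:* d)) k.:- k.:0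
             k.:= i k.:* (δ k.:* (μ k.:* μ k.:* μ) k.:- d) k.:+ (k.:- (μ k.:* μ k.:* μ)) k.:* (i k.:* δ k.:- k.:1)) refl μ (k.inv (δ y)) (δ y) d)

      Hit : Carrier → k.Carrier → Index → k.Carrier → Set
      Hit c d y μ = ¬ μ ≡ k.0# × parameter y ≡ c × value μ y ≡ d

      -- A hit at (c, d) fixes the index y by `injective`; then μ³ = d/δ(y) has at most three
      -- solutions. The right-hand side also records that c is unfactorable and d ≠ 0.
      fibre-bound : ∀ c d → I.∑ (λ y → k.∑ (λ μ → term y μ c d)) ℕ.≤ unfactorable c ℕ.* (nz d ℕ.* 3)
      fibre-bound c d = decide (I.any? (λ y → k.any? (λ μ → ¬? (μ k.≟ k.0#) ×-dec ((parameter y ≟ c) ×-dec (value μ y k.≟ d)))))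
        where
        decide : Dec (∃[ y ] ∃[ μ ] Hit c d y μ) → I.∑ (λ y → k.∑ (λ μ → term y μ c d)) ℕ.≤ unfactorable c ℕ.* (nz d ℕ.* 3)
        decide (no none) = ℕₚ.≤-trans (ℕₚ.≤-reflexive (trans (I.∑-cong (λ y → trans (k.∑-cong (λ μ → zero-term y μ (¬? (μ k.≟ k.0#)) (parameter y ≟ c) (value μ y k.≟ d)))
            (trans (k.∑-constant 0) (ℕₚ.*-zeroʳ p)))) (trans (I.∑-constant 0) (ℕₚ.*-zeroʳ (p ℕ.* p ℕ.* 3))))) ℕ.z≤n
          where
          zero-term : ∀ y μ (d₁ : Dec (¬ μ ≡ k.0#)) (d₂ : Dec (parameter y ≡ c)) (d₃ : Dec (value μ y ≡ d)) → [ d₁ ] ℕ.* ([ d₂ ] ℕ.* [ d₃ ]) ≡ 0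
          zero-term y μ (no _) _ _ = refl
          zero-term y μ (yes _) (no _) _ = refl
          zero-term y μ (yes _) (yes _) (no _) = refl
          zero-term y μ (yes h₁) (yes h₂) (yes h₃) = contradiction (y , μ , h₁ , h₂ , h₃) none
        decide (yes (y₀ , μ₀ , μ₀≢0 , c₀ , d₀)) = begin
          I.∑ (λ y → k.∑ (λ μ → term y μ c d))
            ≤⟨ I.∑-≤ (λ y → k.∑-≤ (λ μ → single y μ (¬? (μ k.≟ k.0#)) (parameter y ≟ c) (value μ y k.≟ d))) ⟩
          I.∑ (λ y → k.∑ (λ μ → [ y₀ I.≟ₑ y ] ℕ.* [ value μ y₀ k.≟ d ]))
            ≡⟨ I.∑-cong (λ y → k.∑-scale [ y₀ I.≟ₑ y ] (λ μ → [ value μ y₀ k.≟ d ])) ⟩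
          I.∑ (λ y → [ y₀ I.≟ₑ y ] ℕ.* k.∑ (λ μ → [ value μ y₀ k.≟ d ]))
            ≡⟨ I.∑-select y₀ (λ _ → k.∑ (λ μ → [ value μ y₀ k.≟ d ])) ⟩
          k.∑ (λ μ → [ value μ y₀ k.≟ d ])
            ≤⟨ cube-roots y₀ d ⟩
          3
            ≡⟨ cong₂ (λ a b → a ℕ.* (b ℕ.* 3))
                 ([]-true (factorisations c ℕ.≟ 0) (trans (cong factorisations (sym c₀)) (unfactorable-parameter y₀)))
                 ([]-true (¬? (d k.≟ k.0#)) (λ e → k.*-≢0 (δ≢0 y₀) (k.*-≢0 (k.*-≢0 μ₀≢0 μ₀≢0) μ₀≢0) (trans d₀ e))) ⟨
          unfactorable c ℕ.* (nz d ℕ.* 3) ∎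
          where
          open ℕₚ.≤-Reasoning
          single : ∀ y μ (d₁ : Dec (¬ μ ≡ k.0#)) (d₂ : Dec (parameter y ≡ c)) (d₃ : Dec (value μ y ≡ d)) →
                   [ d₁ ] ℕ.* ([ d₂ ] ℕ.* [ d₃ ]) ℕ.≤ [ y₀ I.≟ₑ y ] ℕ.* [ value μ y₀ k.≟ d ]
          single y μ (no _) _ _ = ℕ.z≤n
          single y μ (yes _) (no _) _ = ℕ.z≤n
          single y μ (yes _) (yes _) (no _) = ℕ.z≤n
          single y μ (yes h₁) (yes h₂) (yes h₃) = ℕₚ.≤-reflexive (sym (cong₂ ℕ._*_ ([]-true (y₀ I.≟ₑ y) same)
              ([]-true (value μ y₀ k.≟ d) (trans (cong (value μ) same) h₃))))
            where
            same : y₀ ≡ y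
            same = injective y₀ y μ₀ μ μ₀≢0 h₁ (trans c₀ (sym h₂)) (trans d₀ (sym h₃))

      -- The number n₁ = q - 1 counts scalings on the left and determinants on the right; 3 counts
      -- conjugates on the left and cube roots on the right.
      counted : p ℕ.* p ℕ.* 3 ℕ.* n₁ ℕ.≤ D ℕ.* (n₁ ℕ.* 3)
      counted = begin
        p ℕ.* p ℕ.* 3 ℕ.* n₁
          ≡⟨ I.∑-constant n₁ ⟨
        I.∑ (λ y → k.∑ nz)
          ≡⟨ I.∑-cong (λ y → k.∑-cong (λ μ → term-total y μ)) ⟨
        I.∑ (λ y → k.∑ (λ μ → ∑ (λ c → k.∑ (λ d → term y μ c d))))
          ≡⟨ I.∑-cong (λ y → ∑-swap k.enum enum (λ μ c → k.∑ (λ d → term y μ c d))) ⟩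
        I.∑ (λ y → ∑ (λ c → k.∑ (λ μ → k.∑ (λ d → term y μ c d))))
          ≡⟨ ∑-swap index-enum enum (λ y c → k.∑ (λ μ → k.∑ (λ d → term y μ c d))) ⟩
        ∑ (λ c → I.∑ (λ y → k.∑ (λ μ → k.∑ (λ d → term y μ c d))))
          ≡⟨ ∑-cong (λ c → I.∑-cong (λ y → ∑-swap k.enum k.enum (λ μ d → term y μ c d))) ⟩
        ∑ (λ c → I.∑ (λ y → k.∑ (λ d → k.∑ (λ μ → term y μ c d))))
          ≡⟨ ∑-cong (λ c → ∑-swap index-enum k.enum (λ y d → k.∑ (λ μ → term y μ c d))) ⟩
        ∑ (λ c → k.∑ (λ d → I.∑ (λ y → k.∑ (λ μ → term y μ c d))))
          ≤⟨ ∑-≤ (λ c → k.∑-≤ (λ d → fibre-bound c d)) ⟩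
        ∑ (λ c → k.∑ (λ d → unfactorable c ℕ.* (nz d ℕ.* 3)))
          ≡⟨ ∑-cong (λ c → trans (k.∑-scale (unfactorable c) (λ d → nz d ℕ.* 3)) (trans (cong (unfactorable c ℕ.*_)
               (trans (k.∑-cong (λ d → ℕₚ.*-comm (nz d) 3)) (trans (k.∑-scale 3 nz) (ℕₚ.*-comm 3 n₁)))) (ℕₚ.*-comm (unfactorable c) (n₁ ℕ.* 3)))) ⟩
        ∑ (λ c → n₁ ℕ.* 3 ℕ.* unfactorable c)
          ≡⟨ trans (∑-scale (n₁ ℕ.* 3) unfactorable) (ℕₚ.*-comm (n₁ ℕ.* 3) D) ⟩
        D ℕ.* (n₁ ℕ.* 3) ∎
        where open ℕₚ.≤-Reasoning

      n₁-nonZero : ℕ.NonZero (n₁ ℕ.* 3)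
      n₁-nonZero = ℕ.>-nonZero (ℕₚ.≤-trans (subst (ℕ._≤ n₁) ([]-true (¬? (k.1# k.≟ k.0#)) k.1≢0) (k.∑-≥-term k.1# nz)) (ℕₚ.m≤m*n n₁ 3))

      many : p ℕ.* p ℕ.≤ D
      many = ℕₚ.*-cancelʳ-≤ (p ℕ.* p) D (n₁ ℕ.* 3) {{n₁-nonZero}}
        (subst (ℕ._≤ D ℕ.* (n₁ ℕ.* 3)) (trans (ℕₚ.*-assoc (p ℕ.* p) 3 n₁) (cong (p ℕ.* p ℕ.*_) (ℕₚ.*-comm 3 n₁))) counted)

    impossible : ¬ (1 ℕ.≤ p)
    impossible 1≤p = ℕₚ.<-irrefl refl (ℕₚ.<-≤-trans (ℕₚ.m<m+n (p ℕ.* p) 1≤p) (ℕₚ.≤-trans (ℕₚ.+-monoˡ-≤ p many) few-unfactorable))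

  module ExoticFrames {T : Carrier → Carrier → Carrier} (X : Exotic T) where
    private
      open Exotic X

      -- The leading coordinate 1 makes proportional points equal, so these are q² distinct
      -- directions among the q² + q + 1 of K.
      z : k.Carrier → k.Carrier → Carrier
      z s t = fromCoords ⟨ k.1# , s , t ⟩

      ι-z : ∀ r s t → ι r * z s t ≡ fromCoords ⟨ r , r k.* s , r k.* t ⟩
      ι-z r s t = trans (cong (λ u → ι r * (u + ι s * θ + ι t * (θ * θ))) ι-1) (trans
        (solve 4 (λ r s t θ → r :* (:1 :+ s :* θ :+ t :* (θ :* θ)) := r :+ r :* s :* θ :+ r :* t :* (θ :* θ)) refl (ι r) (ι s) (ι t) θ)
        (sym (cong₂ (λ u v → ι r + u * θ + v * (θ * θ)) (ι-* r s) (ι-* r t))))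

      z≢0 : ∀ s t → ¬ z s t ≡ 0#
      z≢0 s t e = k.1≢0 (cong x₀ (trans (sym (coords-fromCoords _)) (trans (cong coords (trans e (sym zero-coords))) (coords-fromCoords _))))
        where
        zero-coords : fromCoords ⟨ k.0# , k.0# , k.0# ⟩ ≡ 0#
        zero-coords = trans (cong (λ u → u + u * θ + u * (θ * θ)) ι-0) (solve 1 (λ θ → :0 :+ :0 :* θ :+ :0 :* (θ :* θ) := :0) refl θ)

      proportional⇒≡ : ∀ {r r' s t s' t'} → ¬ r ≡ k.0# → ι r * z s t ≡ ι r' * z s' t' → s ≡ s' × t ≡ t'
      proportional⇒≡ {r} {r'} {s} {t} {s'} {t'} r≢0 e = k.*-cancelˡ r≢0 (trans (cong x₁ same) (cong (k._* s') (sym (cong x₀ same))))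
                                                     , k.*-cancelˡ r≢0 (trans (cong x₂ same) (cong (k._* t') (sym (cong x₀ same))))
        where
        same : ⟨ r , r k.* s , r k.* t ⟩ ≡ ⟨ r' , r' k.* s' , r' k.* t' ⟩
        same = trans (sym (coords-fromCoords _)) (trans (cong coords (trans (sym (ι-z r s t)) (trans e (ι-z r' s' t')))) (coords-fromCoords _))

      Index : Set
      Index = (k.Carrier × k.Carrier) × Fin 3

      point : Index → Carrier
      point ((s , t) , _) = z s t

      conjugates : ∀ {z} → Fin 3 → FrameAt T z → FrameAt T z
      conjugates Fin.zero F = F
      conjugates (Fin.suc Fin.zero) F = conjugateFrame F
      conjugates (Fin.suc (Fin.suc Fin.zero)) F = conjugateFrame (conjugateFrame F)

      frameOf : (y : Index) → FrameAt T (point y)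
      frameOf ((s , t) , i) = conjugates i (AtPoint.frameAt presemifield (z≢0 s t))

      parameter : Index → Carrier
      parameter y = FrameAt.c (frameOf y)

      δ : Index → k.Carrier
      δ y = proj₁ (fixed (determinant (frameOf y)) (σ-det (Frame.χ (FrameAt.frame (frameOf y)))))

      δ≡ : ∀ y → determinant (frameOf y) ≡ ι (δ y)
      δ≡ y = proj₂ (fixed (determinant (frameOf y)) (σ-det (Frame.χ (FrameAt.frame (frameOf y)))))

      δ≢0 : ∀ y → ¬ δ y ≡ k.0#
      δ≢0 y e = det-≢0 {Frame.χ (FrameAt.frame (frameOf y))} (Frame.χ-injective (FrameAt.frame (frameOf y))) (trans (δ≡ y) (trans (cong ι e) ι-0))

      value : k.Carrier → Index → k.Carrier
      value μ y = δ y k.* (μ k.* μ k.* μ)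

      scaled-determinant : ∀ μ μ≢0 y → determinant (scaleFrame presemifield μ μ≢0 (frameOf y)) ≡ ι (value μ y)
      scaled-determinant μ μ≢0 y = trans (determinant-scale presemifield μ μ≢0 (frameOf y)) (trans (cong₂ _*_ (δ≡ y)
        (sym (trans (ι-* _ _) (cong (_* ι μ) (ι-* μ μ))))) (sym (ι-* _ _)))

      conjugates-injective : ∀ {z} (F : FrameAt T z) i j → FrameAt.c (conjugates i F) ≡ FrameAt.c (conjugates j F) → i ≡ j
      conjugates-injective F i j = cases i j
        where
        irr : Irrational (FrameAt.c F)
        irr = c-irrational (FrameAt.frame F)
        cases : ∀ i j → FrameAt.c (conjugates i F) ≡ FrameAt.c (conjugates j F) → i ≡ j
        cases Fin.zero Fin.zero _ = refl
        cases Fin.zero (Fin.suc Fin.zero) e = contradiction (sym e) irr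
        cases Fin.zero (Fin.suc (Fin.suc Fin.zero)) e = contradiction (sym e) (irrational-σσ irr)
        cases (Fin.suc Fin.zero) Fin.zero e = contradiction e irr
        cases (Fin.suc Fin.zero) (Fin.suc Fin.zero) _ = refl
        cases (Fin.suc Fin.zero) (Fin.suc (Fin.suc Fin.zero)) e = contradiction (sym e) (irrational-σ irr)
        cases (Fin.suc (Fin.suc Fin.zero)) Fin.zero e = contradiction e (irrational-σσ irr)
        cases (Fin.suc (Fin.suc Fin.zero)) (Fin.suc Fin.zero) e = contradiction e (irrational-σ irr)
        cases (Fin.suc (Fin.suc Fin.zero)) (Fin.suc (Fin.suc Fin.zero)) _ = refl

      injective : ∀ y y' μ μ' → ¬ μ ≡ k.0# → ¬ μ' ≡ k.0# → parameter y ≡ parameter y' → value μ y ≡ value μ' y' → y ≡ y'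
      injective y@((s , t) , i) y'@((s' , t') , i') μ μ' μ≢0 μ'≢0 e e' =
        finish (proportional⇒≡ (proj₁ (proj₂ (proj₂ prop))) (proj₂ (proj₂ (proj₂ prop))))
        where
        prop : ∃[ r ] ∃[ r' ] (¬ r ≡ k.0# × ι r * z s t ≡ ι r' * z s' t')
        prop = SameFrame.proportional X (scaleFrame presemifield μ μ≢0 (frameOf y)) (scaleFrame presemifield μ' μ'≢0 (frameOf y')) e
          (trans (scaled-determinant μ μ≢0 y) (trans (cong ι e') (sym (scaled-determinant μ' μ'≢0 y'))))
        finish : s ≡ s' × t ≡ t' → y ≡ y'
        finish (s≡s' , t≡t') = cong₂ _,_ (cong₂ _,_ s≡s' t≡t') (conjugates-injective (AtPoint.frameAt presemifield (z≢0 s' t')) i i'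
          (trans (sym (cong₂ (λ u v → parameter ((u , v) , i)) s≡s' t≡t')) e))

    impossible : ¬ (1 ℕ.≤ k.q)
    impossible = Counting.impossible (×-enum (×-enum k.enum k.enum) (↔-id (Fin 3))) parameter δ δ≢0 injective
      (λ y → unfactorable-frame X (FrameAt.frame (frameOf y)))

  no-exotic : ∀ {T} → ¬ Exotic T
  no-exotic X = ExoticFrames.impossible X p-positive

-- Classification: field or twisted field

module Classification (k : FiniteField) (E : CyclicCubic k) where
  open Automorphisms k E public
  open SecondMoment k E using (trace-one)
  open NoExotic k E

  twistedProduct : Carrier → Carrier → Carrier → Carrier
  twistedProduct c x y = x * y - c * (Tr x * Tr y)

  all? : {P : Carrier → Set} → (∀ x → Dec (P x)) → Dec (∀ x → P x)
  all? {P} P? = decide (any? (λ x → ¬? (P? x)))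
    where
    stable : ¬ (∃[ x ] ¬ P x) → ∀ x → Dec (P x) → P x
    stable none x (yes h) = h
    stable none x (no h) = contradiction (x , h) none
    decide : Dec (∃[ x ] ¬ P x) → Dec (∀ x → P x)
    decide (yes (x , h)) = no (λ all → h (all x))
    decide (no none) = yes (λ x → stable none x (P? x))

  -- Exhaustive search over the finitely many pairs (χ, ψ). It turns the absence of exotic products
  -- into a disjunction constructively.
  frame? : ∀ T c → Dec (Frame T c)
  frame? T c = map′ build split (anyLin? (λ χ → anyLin? (λ ψ → injective? χ ×-dec (injective? ψ ×-dec
      all? (λ x → all? (λ y → ap ψ (T (ap χ x) (ap χ y)) ≟ twistedProduct c x y))))))
    where
    anyLin? : {P : Lin → Set} → (∀ f → Dec (P f)) → Dec (∃ P)
    anyLin? = Enumerated.any? (Triple-enum enum)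
    injective? : ∀ f → Dec (Injective f)
    injective? f = all? (λ x → (ap f x ≟ 0#) →-dec (x ≟ 0#))
    Found : Set
    Found = ∃[ χ ] ∃[ ψ ] (Injective χ × (Injective ψ × (∀ x y → ap ψ (T (ap χ x) (ap χ y)) ≡ twistedProduct c x y)))
    build : Found → Frame T c
    build (χ , ψ , i , j , l) = record { χ = χ ; ψ = ψ ; χ-injective = i ; ψ-injective = j ; law = l }
    split : Frame T c → Found
    split f = χ , ψ , χ-injective , ψ-injective , law
      where open Frame f

  classification : ∀ {T} → Presemifield T → Frame T 0# ⊎ Frame T 1#
  classification {T} P = decide (frame? T 0#) (frame? T 1#)
    where
    decide : Dec (Frame T 0#) → Dec (Frame T 1#) → Frame T 0# ⊎ Frame T 1#
    decide (yes f) _ = inj₁ f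
    decide (no _) (yes f) = inj₂ f
    decide (no f) (no g) = contradiction (record { presemifield = P ; not-field = f ; not-twisted = g }) no-exotic

  twisted-symmetricBilinear : ∀ c → SymmetricBilinear (twistedProduct c)
  twisted-symmetricBilinear c = record
    { T-comm = λ x y → cong₂ (λ u v → u - c * v) (*-comm x y) (*-comm (Tr x) (Tr y))
    ; T-linear = λ y → record
      { additive = λ x z → trans (cong (λ u → (x + z) * y - c * (u * Tr y)) (Tr-+ x z))
          (solve 7 (λ x z y c t s w → (x :+ z) :* y :- c :* ((t :+ s) :* w) := x :* y :- c :* (t :* w) :+ (z :* y :- c :* (s :* w))) refl x z y c (Tr x) (Tr z) (Tr y))
      ; homogeneous = λ a x → trans (cong (λ u → ι a * x * y - c * (u * Tr y)) (Tr-scale x (σ-ι a)))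
          (solve 6 (λ a x y c t w → a :* x :* y :- c :* (a :* t :* w) := a :* (x :* y :- c :* (t :* w))) refl (ι a) x y c (Tr x) (Tr y)) } }
  field-presemifield : Presemifield (twistedProduct 0#)
  field-presemifield = record
    { symmetricBilinear = twisted-symmetricBilinear 0#
    ; cancel = λ {x} {y} x≢0 e → *-cancelˡ-0 x≢0 (trans (solve 2 (λ p s → p := p :- :0 :* s) refl (x * y) (Tr x * Tr y)) e) }

  -- If xy = Tr x Tr y ≠ 0 then the elementary symmetric functions of the conjugates of x satisfy e₁e₂ = e₃,
  -- that is (x + σx)(σx + σ²x)(σ²x + x) = 0.
  twisted-presemifield : ¬ 1# + 1# ≡ 0# → Presemifield (twistedProduct 1#)
  twisted-presemifield 2≢0 = record { symmetricBilinear = twisted-symmetricBilinear 1# ; cancel = λ {x} {y} x≢0 e → decide x y x≢0 e (y ≟ 0#) }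
    where
    anti : ∀ {x} → ¬ x ≡ 0# → ¬ x + σ x ≡ 0#
    anti {x} x≢0 e = x≢0 (*-cancelˡ-0 2≢0 (combine₃ 1# (- 1#) 1# e e₁ e₂
      (solve 3 (λ x y z → (:1 :+ :1) :* x :- :0 := :1 :* (x :+ y :- :0) :+ (:- :1) :* (y :+ z :- :0) :+ :1 :* (z :+ x :- :0)) refl x (σ x) (σ (σ x)))))
      where
      e₁ : σ x + σ (σ x) ≡ 0#
      e₁ = trans (sym (σ-+ _ _)) (trans (cong σ e) σ-0)
      e₂ : σ (σ x) + x ≡ 0#
      e₂ = trans (sym (trans (σ-+ _ _) (cong (λ u → σ (σ x) + u) (σ³ x)))) (trans (cong σ e₁) σ-0)
    decide : ∀ x y → ¬ x ≡ 0# → twistedProduct 1# x y ≡ 0# → Dec (y ≡ 0#) → y ≡ 0#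
    decide x y x≢0 e (yes z) = z
    decide x y x≢0 e (no y≢0) = contradiction product (*-≢0 (*-≢0 (anti x≢0) (anti (σ-≢0 x≢0))) third)
      where
      w : Carrier
      w = x * y
      w≡ : w ≡ Tr x * Tr y
      w≡ = trans (difference-zero e) (*-identityˡ _)
      σw : σ x * σ y ≡ w
      σw = trans (sym (σ-* x y)) (trans (cong σ w≡) (trans (σ-* _ _) (trans (cong₂ _*_ (σ-Tr x) (σ-Tr y)) (sym w≡))))
      σσw : σ (σ x) * σ (σ y) ≡ w
      σσw = trans (sym (σ-* _ _)) (trans (cong σ σw) (trans (σ-* x y) σw))
      third : ¬ σ (σ x) + x ≡ 0#
      third h = anti (σ-≢0 (σ-≢0 x≢0)) (trans (cong (λ u → σ (σ x) + u) (σ³ x)) h)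
      product : (x + σ x) * (σ x + σ (σ x)) * (σ (σ x) + x) ≡ 0#
      product = *-cancelˡ-0 (*-≢0 x≢0 y≢0) (combine₃ (- (x * σ x * σ (σ x))) (- (x * σ (σ x) * Tr x)) (- (x * σ x * Tr x)) w≡ σw σσw
        (solve 6 (λ x x' x'' y y' y'' → let t = x :+ x' :+ x'' in
          x :* y :* ((x :+ x') :* (x' :+ x'') :* (x'' :+ x)) :- :0
          := (:- (x :* x' :* x'')) :* (x :* y :- t :* (y :+ y' :+ y'')) :+ (:- (x :* x'' :* t)) :* (x' :* y' :- x :* y) :+ (:- (x :* x' :* t)) :* (x'' :* y'' :- x :* y)) refl x (σ x) (σ (σ x)) y (σ y) (σ (σ y))))

  -- Tr(1) = 3, so the product of 1 with itself is 1 - 9 = -8, which vanishes in characteristic 2.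
  twisted-degenerate : 1# + 1# ≡ 0# → ¬ Presemifield (twistedProduct 1#)
  twisted-degenerate 2≡0 P = 1≢0 (Presemifield.cancel P 1≢0 (trans (cong (λ t → 1# * 1# - 1# * (t * t)) (cong₂ (λ u v → 1# + u + v) σ-1 (trans (cong σ σ-1) σ-1)))
    (combine₁ (- (1# + 1# + 1# + 1#)) 2≡0 (solve 0 (:1 :* :1 :- :1 :* ((:1 :+ :1 :+ :1) :* (:1 :+ :1 :+ :1)) :- :0
       := (:- (:1 :+ :1 :+ :1 :+ :1)) :* (:1 :+ :1 :- :0)) refl))))

  -- An isotopism would satisfy φ(ry) = κφ(y) for the generator r = τ₁/τ₀ of K, hence φ(xy)φ(1) = φ(x)φ(y).
  module NotIsotopic (Ψ φ χ : Lin) (φ-injective : Injective φ) (χ-injective : Injective χ)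
      (law : ∀ x y → ap Ψ (twistedProduct 1# x y) ≡ ap φ x * ap χ y) where
    private
      a b r : Carrier
      a = ap φ 1#
      b = ap χ 1#
      r = θ + σ θ
      a≢0 : ¬ a ≡ 0#
      a≢0 e = 1≢0 (φ-injective 1# e)
      b≢0 : ¬ b ≡ 0#
      b≢0 e = 1≢0 (χ-injective 1# e)
      -- The twisted product is commutative, so the laws at (1, y) and (y, 1) agree; this ties χ to
      -- φ up to the factor b/a.
      proportional : ∀ y → a * ap χ y ≡ ap φ y * b
      proportional y = trans (sym (law 1# y)) (trans (cong (ap Ψ) (SymmetricBilinear.T-comm (twisted-symmetricBilinear 1#) 1# y)) (law y 1#))
      traceless : ∀ x y → Tr x ≡ 0# → a * ap Ψ (x * y) ≡ b * (ap φ x * ap φ y)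
      traceless x y t = begin
        a * ap Ψ (x * y)                     ≡⟨ cong (λ u → a * ap Ψ u) (trans (solve 2 (λ p s → p := p :- :1 :* (:0 :* s)) refl (x * y) (Tr y)) (cong (λ u → x * y - 1# * (u * Tr y)) (sym t))) ⟩
        a * ap Ψ (twistedProduct 1# x y)     ≡⟨ cong (a *_) (law x y) ⟩
        a * (ap φ x * ap χ y)                ≡⟨ combine₁ (ap φ x) (proportional y) (solve 5 (λ a b p x y → a :* (p :* x) :- b :* (p :* y) := p :* (a :* x :- y :* b)) refl a b (ap φ x) (ap χ y) (ap φ y)) ⟩
        b * (ap φ x * ap φ y)                ∎
        where open ≡-Reasoning
      shift : ∀ y → ap φ τ₀ * ap φ (r * y) ≡ ap φ τ₁ * ap φ y
      shift y = *-cancelˡ b≢0 (trans (sym (traceless τ₀ (r * y) Tr-τ₀)) (trans (cong (λ u → a * ap Ψ u) (sym (*-assoc τ₀ r y))) (traceless τ₁ y Tr-τ₁)))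
      r-irrational : Irrational r
      r-irrational e = irrational-σσ θ-irrational (combine₁ 1# (trans (sym (σ-+ θ (σ θ))) e)
        (solve 3 (λ u v w → w :- u := :1 :* (v :+ w :- (u :+ v))) refl θ (σ θ) (σ (σ θ))))
      f₀ f₁ : Carrier
      f₀ = ap φ τ₀
      f₁ = ap φ τ₁
      f₀≢0 : ¬ f₀ ≡ 0#
      f₀≢0 e = τ₀≢0 (φ-injective τ₀ e)
      κ : Carrier
      κ = inv f₀ * f₁
      φ-r : ∀ y → ap φ (r * y) ≡ κ * ap φ y
      φ-r y = *-cancelˡ f₀≢0 (trans (shift y) (combine₁ (- (f₁ * ap φ y)) (inv-inverseʳ f₀≢0)
        (solve 4 (λ f g i y → g :* y :- f :* (i :* g :* y) := (:- (g :* y)) :* (f :* i :- :1)) refl f₀ f₁ (inv f₀) (ap φ y))))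
      multiplicative : ∀ x y → ap φ (x * y) * a ≡ ap φ x * ap φ y
      multiplicative x y = trans (sym (ap-f x)) (trans (cong (λ h → ap h x) same) (ap-g x))
        where
        f g : Lin
        f = ⟨ a * x₀ φ * y , a * x₁ φ * σ y , a * x₂ φ * σ (σ y) ⟩
        g = ⟨ x₀ φ * ap φ y , x₁ φ * ap φ y , x₂ φ * ap φ y ⟩
        ap-f : ∀ x → ap f x ≡ ap φ (x * y) * a
        ap-f x = trans (solve 10 (λ a p q r x x' x'' y y' y'' → a :* p :* y :* x :+ a :* q :* y' :* x' :+ a :* r :* y'' :* x''
            := (p :* (x :* y) :+ q :* (x' :* y') :+ r :* (x'' :* y'')) :* a) refl a (x₀ φ) (x₁ φ) (x₂ φ) x (σ x) (σ (σ x)) y (σ y) (σ (σ y)))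
          (cong₂ (λ u v → (x₀ φ * (x * y) + x₁ φ * u + x₂ φ * v) * a) (sym (σ-* x y)) (sym (σ²-* x y)))
        ap-g : ∀ x → ap g x ≡ ap φ x * ap φ y
        ap-g x = solve 7 (λ p q r w x x' x'' → p :* w :* x :+ q :* w :* x' :+ r :* w :* x'' := (p :* x :+ q :* x' :+ r :* x'') :* w) refl (x₀ φ) (x₁ φ) (x₂ φ) (ap φ y) x (σ x) (σ (σ x))
        at : ∀ x → ap φ (x * y) * a ≡ ap φ x * ap φ y → ap φ (r * x * y) * a ≡ ap φ (r * x) * ap φ y
        at x e = trans (cong (λ u → ap φ u * a) (*-assoc r x y)) (trans (cong (_* a) (φ-r (x * y))) (trans (*-assoc _ _ _) (trans (cong (κ *_) e)
          (trans (sym (*-assoc _ _ _)) (cong (_* ap φ y) (sym (φ-r x)))))))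
        at₁ : ap φ (1# * y) * a ≡ ap φ 1# * ap φ y
        at₁ = trans (cong (λ u → ap φ u * a) (*-identityˡ y)) (*-comm _ _)
        same : f ≡ g
        -- Both sides are linear in x, and `at` passes from x to rx, so the trivial case x = 1
        -- suffices.
        same = agree-on-orbit f g 1≢0 r-irrational (trans (ap-f _) (trans at₁ (sym (ap-g _))))
          (trans (ap-f _) (trans (at 1# at₁) (sym (ap-g _)))) (trans (ap-f _) (trans (at (r * 1#) (at 1# at₁)) (sym (ap-g _))))
      Ψ≡bφ : ∀ u → ap Ψ u ≡ b * ap φ u
      Ψ≡bφ u = *-cancelˡ a≢0 (begin
        a * ap Ψ u                                ≡⟨ cong (λ w → a * ap Ψ w) restore ⟨
        a * ap Ψ (τ₀ * (inv τ₀ * u))              ≡⟨ traceless τ₀ (inv τ₀ * u) Tr-τ₀ ⟩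
        b * (ap φ τ₀ * ap φ (inv τ₀ * u))         ≡⟨ cong (b *_) (multiplicative τ₀ (inv τ₀ * u)) ⟨
        b * (ap φ (τ₀ * (inv τ₀ * u)) * a)        ≡⟨ cong (λ w → b * (ap φ w * a)) restore ⟩
        b * (ap φ u * a)                          ≡⟨ solve 3 (λ a b p → b :* (p :* a) := a :* (b :* p)) refl a b (ap φ u) ⟩
        a * (b * ap φ u)                          ∎)
        where
        open ≡-Reasoning
        restore : τ₀ * (inv τ₀ * u) ≡ u
        restore = trans (sym (*-assoc _ _ _)) (trans (cong (_* u) (inv-inverseʳ τ₀≢0)) (*-identityˡ u))
      untwisted : ∀ x y → twistedProduct 1# x y ≡ x * y
      untwisted x y = ap-injective {φ} φ-injective (*-cancelˡ (*-≢0 a≢0 b≢0) (begin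
        a * b * ap φ (twistedProduct 1# x y)      ≡⟨ trans (*-assoc _ _ _) (cong (a *_) (trans (sym (Ψ≡bφ _)) (law x y))) ⟩
        a * (ap φ x * ap χ y)                     ≡⟨ combine₁ (ap φ x) (proportional y) (solve 5 (λ a b p x y → a :* (p :* x) :- b :* (p :* y) := p :* (a :* x :- y :* b)) refl a b (ap φ x) (ap χ y) (ap φ y)) ⟩
        b * (ap φ x * ap φ y)                     ≡⟨ cong (b *_) (multiplicative x y) ⟨
        b * (ap φ (x * y) * a)                    ≡⟨ solve 3 (λ a b p → b :* (p :* a) := a :* b :* p) refl a b (ap φ (x * y)) ⟩
        a * b * ap φ (x * y)                      ∎))
        where open ≡-Reasoning

    impossible : ∀ {A : Set} → A
    -- At an element e of trace 1 the two products are e² - 1 and e².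
    impossible = contradiction (combine₂ (- 1#) (- (Tr e + 1#)) (untwisted e e) (proj₂ trace-one)
        (solve 2 (λ p t → :1 :- :0 := (:- :1) :* (p :- :1 :* (t :* t) :- p) :+ (:- (t :+ :1)) :* (t :- :1)) refl (e * e) (Tr e))) 1≢0
      where
      e : Carrier
      e = proj₁ trace-one

-- From products to codes and back

module Codes (k : FiniteField) (E : CyclicCubic k) where
  open Classification k E public
  open Matrices k

  pattern i₀ = Fin.zero
  pattern i₁ = Fin.suc Fin.zero
  pattern i₂ = Fin.suc (Fin.suc Fin.zero)

  toVec : Carrier → Vec3
  toVec x i₀ = x₀ (coords x)
  toVec x i₁ = x₁ (coords x)
  toVec x i₂ = x₂ (coords x)

  fromVec : Vec3 → Carrier
  fromVec v = fromCoords ⟨ v i₀ , v i₁ , v i₂ ⟩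

  toVec-fromVec : ∀ v i → toVec (fromVec v) i ≡ v i
  toVec-fromVec v i₀ = cong x₀ (coords-fromCoords _)
  toVec-fromVec v i₁ = cong x₁ (coords-fromCoords _)
  toVec-fromVec v i₂ = cong x₂ (coords-fromCoords _)

  fromVec-toVec : ∀ x → fromVec (toVec x) ≡ x
  fromVec-toVec = fromCoords-coords

  fromVec-cong : ∀ {v w} → (∀ i → v i ≡ w i) → fromVec v ≡ fromVec w
  fromVec-cong h = cong fromCoords (⟨⟩-cong (h i₀) (h i₁) (h i₂))

  toVec-injective : ∀ {x y} → (∀ i → toVec x i ≡ toVec y i) → x ≡ y
  toVec-injective {x} {y} h = trans (sym (fromVec-toVec x)) (trans (fromVec-cong h) (fromVec-toVec y))

  fromVec-+ : ∀ v w → fromVec (λ i → v i k.+ w i) ≡ fromVec v + fromVec w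
  fromVec-+ v w = trans (cong₂ _+_ (cong₂ _+_ (ι-+ _ _) (cong (_* θ) (ι-+ _ _))) (cong (_* (θ * θ)) (ι-+ _ _)))
    (solve 7 (λ a b c d e f t → a :+ d :+ (b :+ e) :* t :+ (c :+ f) :* (t :* t) := a :+ b :* t :+ c :* (t :* t) :+ (d :+ e :* t :+ f :* (t :* t))) refl
      (ι (v i₀)) (ι (v i₁)) (ι (v i₂)) (ι (w i₀)) (ι (w i₁)) (ι (w i₂)) θ)

  fromVec-ι : ∀ c v → fromVec (λ i → c k.* v i) ≡ ι c * fromVec v
  fromVec-ι c v = trans (cong₂ _+_ (cong₂ _+_ (ι-* _ _) (cong (_* θ) (ι-* _ _))) (cong (_* (θ * θ)) (ι-* _ _)))
    (solve 5 (λ c x y z t → c :* x :+ c :* y :* t :+ c :* z :* (t :* t) := c :* (x :+ y :* t :+ z :* (t :* t))) refl (ι c) (ι (v i₀)) (ι (v i₁)) (ι (v i₂)) θ)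

  toVec-+ : ∀ x y i → toVec (x + y) i ≡ toVec x i k.+ toVec y i
  toVec-+ x y i = trans (cong (λ u → toVec u i) (sym (trans (fromVec-+ (toVec x) (toVec y)) (cong₂ _+_ (fromVec-toVec x) (fromVec-toVec y))))) (toVec-fromVec (λ i → toVec x i k.+ toVec y i) i)

  toVec-ι : ∀ c x i → toVec (ι c * x) i ≡ c k.* toVec x i
  toVec-ι c x i = trans (cong (λ u → toVec u i) (sym (trans (fromVec-ι c (toVec x)) (cong (ι c *_) (fromVec-toVec x))))) (toVec-fromVec (λ i → c k.* toVec x i) i)

  fromVec-0 : fromVec (λ _ → k.0#) ≡ 0#
  fromVec-0 = trans (cong (λ u → u + u * θ + u * (θ * θ)) ι-0) (solve 1 (λ θ → :0 :+ :0 :* θ :+ :0 :* (θ :* θ) := :0) refl θ)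

  toVec-0 : ∀ i → toVec 0# i ≡ k.0#
  toVec-0 i = trans (cong (λ u → toVec u i) (sym fromVec-0)) (toVec-fromVec (λ _ → k.0#) i)

  e : Fin 3 → Carrier
  e i = fromVec (I₃ i)

  e₀≡ : e i₀ ≡ 1#
  e₀≡ = trans (cong₂ (λ a b → a + b * θ + b * (θ * θ)) ι-1 ι-0) (solve 1 (λ t → :1 :+ :0 :* t :+ :0 :* (t :* t) := :1) refl θ)

  e₁≡ : e i₁ ≡ θ
  e₁≡ = trans (cong₂ (λ a b → b + a * θ + b * (θ * θ)) ι-1 ι-0) (solve 1 (λ t → :0 :+ :1 :* t :+ :0 :* (t :* t) := t) refl θ)

  e₂≡ : e i₂ ≡ θ * θ
  e₂≡ = trans (cong₂ (λ a b → b + b * θ + a * (θ * θ)) ι-1 ι-0) (solve 1 (λ t → :0 :+ :0 :* t :+ :1 :* (t :* t) := t :* t) refl θ)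

  expansion : ∀ x → x ≡ ι (toVec x i₀) * e i₀ + ι (toVec x i₁) * e i₁ + ι (toVec x i₂) * e i₂
  expansion x = trans (sym (fromVec-toVec x)) (cong₂ _+_ (cong₂ _+_ (trans (sym (*-identityʳ _)) (cong (ι (toVec x i₀) *_) (sym e₀≡))) (cong (ι (toVec x i₁) *_) (sym e₁≡))) (cong (ι (toVec x i₂) *_) (sym e₂≡)))

  record IsFunctional (f : Carrier → k.Carrier) : Set where
    field
      f-+ : ∀ x y → f (x + y) ≡ f x k.+ f y
      f-ι : ∀ c x → f (ι c * x) ≡ c k.* f x
  open IsFunctional

  functional-expand : ∀ {f} → IsFunctional f → ∀ x → f x ≡ sum3 (λ i → toVec x i k.* f (e i))
  functional-expand {f} F x = trans (cong f (expansion x)) (trans (f-+ F _ _) (cong₂ k._+_ (trans (f-+ F _ _) (cong₂ k._+_ (f-ι F _ _) (f-ι F _ _))) (f-ι F _ _)))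

  sum3-cong : ∀ {f g : Fin 3 → k.Carrier} → (∀ i → f i ≡ g i) → sum3 f ≡ sum3 g
  sum3-cong h = cong₂ k._+_ (cong₂ k._+_ (h i₀) (h i₁)) (h i₂)

  sum3-zero : ∀ {f : Fin 3 → k.Carrier} → (∀ i → f i ≡ k.0#) → sum3 f ≡ k.0#
  sum3-zero h = trans (sum3-cong h) (k.solve 0 (k.:0 k.:+ k.:0 k.:+ k.:0 k.:= k.:0) refl)

  sum3-I₃ : ∀ i (v : Vec3) → sum3 (λ j → I₃ i j k.* v j) ≡ v i
  sum3-I₃ i₀ v = k.solve 3 (λ a b c → k.:1 k.:* a k.:+ k.:0 k.:* b k.:+ k.:0 k.:* c k.:= a) refl (v i₀) (v i₁) (v i₂)
  sum3-I₃ i₁ v = k.solve 3 (λ a b c → k.:0 k.:* a k.:+ k.:1 k.:* b k.:+ k.:0 k.:* c k.:= b) refl (v i₀) (v i₁) (v i₂)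
  sum3-I₃ i₂ v = k.solve 3 (λ a b c → k.:0 k.:* a k.:+ k.:0 k.:* b k.:+ k.:1 k.:* c k.:= c) refl (v i₀) (v i₁) (v i₂)

  I₃-sym : ∀ i j → I₃ i j ≡ I₃ j i
  I₃-sym i₀ i₀ = refl
  I₃-sym i₀ i₁ = refl
  I₃-sym i₀ i₂ = refl
  I₃-sym i₁ i₀ = refl
  I₃-sym i₁ i₁ = refl
  I₃-sym i₁ i₂ = refl
  I₃-sym i₂ i₀ = refl
  I₃-sym i₂ i₁ = refl
  I₃-sym i₂ i₂ = refl

  mulVec : Mat3 → Vec3 → Vec3
  mulVec M v i = sum3 (λ j → M i j k.* v j)

  sum3-assoc : ∀ (c : Vec3) (P : Mat3) (w : Vec3) → sum3 (λ m → sum3 (λ l → c l k.* P l m) k.* w m) ≡ sum3 (λ l → c l k.* mulVec P w l)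
  sum3-assoc c P w = k.solve 15 (λ c₀ c₁ c₂ p₀₀ p₀₁ p₀₂ p₁₀ p₁₁ p₁₂ p₂₀ p₂₁ p₂₂ w₀ w₁ w₂ →
      (c₀ k.:* p₀₀ k.:+ c₁ k.:* p₁₀ k.:+ c₂ k.:* p₂₀) k.:* w₀ k.:+ (c₀ k.:* p₀₁ k.:+ c₁ k.:* p₁₁ k.:+ c₂ k.:* p₂₁) k.:* w₁ k.:+ (c₀ k.:* p₀₂ k.:+ c₁ k.:* p₁₂ k.:+ c₂ k.:* p₂₂) k.:* w₂
      k.:= c₀ k.:* (p₀₀ k.:* w₀ k.:+ p₀₁ k.:* w₁ k.:+ p₀₂ k.:* w₂) k.:+ c₁ k.:* (p₁₀ k.:* w₀ k.:+ p₁₁ k.:* w₁ k.:+ p₁₂ k.:* w₂) k.:+ c₂ k.:* (p₂₀ k.:* w₀ k.:+ p₂₁ k.:* w₁ k.:+ p₂₂ k.:* w₂))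
    refl (c i₀) (c i₁) (c i₂) (P i₀ i₀) (P i₀ i₁) (P i₀ i₂) (P i₁ i₀) (P i₁ i₁) (P i₁ i₂) (P i₂ i₀) (P i₂ i₁) (P i₂ i₂) (w i₀) (w i₁) (w i₂)

  pairing : Mat3 → Vec3 → Vec3 → k.Carrier
  pairing M v w = sum3 (λ i → v i k.* mulVec M w i)

  pairing-cong : ∀ {M N v v' w w'} → M ≐ N → (∀ i → v i ≡ v' i) → (∀ i → w i ≡ w' i) → pairing M v w ≡ pairing N v' w'
  pairing-cong m h h' = sum3-cong (λ i → cong₂ k._*_ (h i) (sum3-cong (λ j → cong₂ k._*_ (m i j) (h' j))))

  functional : Vec3 → Carrier → k.Carrier
  functional a x = sum3 (λ l → a l k.* toVec x l)

  functional-isFunctional : ∀ a → IsFunctional (functional a)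
  functional-isFunctional a = record
    { f-+ = λ x y → trans (sum3-cong (λ l → cong (a l k.*_) (toVec-+ x y l)))
        (k.solve 9 (λ a b c x y z u v w → a k.:* (x k.:+ u) k.:+ b k.:* (y k.:+ v) k.:+ c k.:* (z k.:+ w)
          k.:= a k.:* x k.:+ b k.:* y k.:+ c k.:* z k.:+ (a k.:* u k.:+ b k.:* v k.:+ c k.:* w)) refl
          (a i₀) (a i₁) (a i₂) (toVec x i₀) (toVec x i₁) (toVec x i₂) (toVec y i₀) (toVec y i₁) (toVec y i₂))
    ; f-ι = λ c x → trans (sum3-cong (λ l → cong (a l k.*_) (toVec-ι c x l)))
        (k.solve 7 (λ a b c m x y z → a k.:* (m k.:* x) k.:+ b k.:* (m k.:* y) k.:+ c k.:* (m k.:* z) k.:= m k.:* (a k.:* x k.:+ b k.:* y k.:+ c k.:* z)) refl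
          (a i₀) (a i₁) (a i₂) c (toVec x i₀) (toVec x i₁) (toVec x i₂)) }

  functional-e : ∀ a l → functional a (e l) ≡ a l
  functional-e a l = trans (sum3-cong (λ j → trans (k.*-comm _ _) (cong (k._* a j) (toVec-fromVec (I₃ l) j)))) (sum3-I₃ l a)

  gramMatrix : Vec3 → (Carrier → Carrier → Carrier) → Mat3
  gramMatrix a T i j = functional a (T (e i) (e j))

  module _ {T : Carrier → Carrier → Carrier} (S : SymmetricBilinear T) where
    open SymmetricBilinear S

    pairing-gram : ∀ a x y → functional a (T x y) ≡ pairing (gramMatrix a T) (toVec x) (toVec y)
    pairing-gram a x y = trans (functional-expand left x)
        (sum3-cong {λ i → toVec x i k.* functional a (T (e i) y)} (λ i → cong (toVec x i k.*_) (trans (functional-expand (right i) y)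
          (sum3-cong {λ j → toVec y j k.* functional a (T (e i) (e j))} {λ j → functional a (T (e i) (e j)) k.* toVec y j} (λ j → k.*-comm _ _)))))
      where
      F : IsFunctional (functional a)
      F = functional-isFunctional a
      left : IsFunctional (λ x → functional a (T x y))
      left = record { f-+ = λ x z → trans (cong (functional a) (additive (T-linear y) x z)) (f-+ F _ _)
                    ; f-ι = λ c x → trans (cong (functional a) (homogeneous (T-linear y) c x)) (f-ι F _ _) }
      right : ∀ i → IsFunctional (λ y → functional a (T (e i) y))
      right i = record { f-+ = λ y z → trans (cong (functional a) (T-+ʳ (e i) y z)) (f-+ F _ _)
                       ; f-ι = λ c y → trans (cong (functional a) (T-ιʳ c (e i) y)) (f-ι F _ _) }

  onto : ∀ {T} → Presemifield T → ∀ {y} → ¬ y ≡ 0# → ∀ w → ∃[ x ] T x y ≡ w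
  onto {T} P {y} y≢0 w = proj₁ hit , trans (sym (proj₂ rep _)) (proj₂ hit)
    where
    open Presemifield P
    rep : ∃[ g ] (∀ x → ap g x ≡ T x y)
    rep = represent (T-linear y)
    hit : ∃[ x ] ap (proj₁ rep) x ≡ w
    hit = surjective {proj₁ rep} (λ x h → cancel y≢0 (trans (T-comm y x) (trans (sym (proj₂ rep x)) h))) w

  functional-zero : ∀ {T} → Presemifield T → ∀ {y} → ¬ y ≡ 0# → ∀ a → (∀ x → functional a (T x y) ≡ k.0#) → ∀ l → a l ≡ k.0#
  functional-zero P y≢0 a h l = trans (sym (functional-e a l)) (trans (cong (functional a) (sym (proj₂ (onto P y≢0 (e l))))) (h _))

  -- The basis matrices are the slices of the structure tensor of T by output coordinate. A codeword
  -- is then the Gram matrix of a functional composed with T (`lin-gram`).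
  Represents : SymCode3 → (Carrier → Carrier → Carrier) → Set
  Represents C T = ∀ l i j → basis C l i j ≡ toVec (T (e i) (e j)) l

  lin-gram : ∀ {C T} → Represents C T → ∀ a → lin a (basis C) ≐ gramMatrix a T
  lin-gram R a i j = sum3-cong (λ l → cong (a l k.*_) (R l i j))

  pairing-zeroˡ : ∀ {M} → M ≐ (λ _ _ → k.0#) → ∀ v w → pairing M v w ≡ k.0#
  pairing-zeroˡ {M} h v w = sum3-zero (λ i → trans (cong (v i k.*_) (sum3-zero (λ j → trans (cong (k._* w j) (h i j)) (k.zeroˡ _)))) (k.zeroʳ _))

  codeOf : ∀ {T} → Presemifield T → SymCode3
  codeOf {T} P = record
    { basis = λ l i j → toVec (T (e i) (e j)) l
    ; symmetric = λ l i j → cong (λ u → toVec u l) (T-comm (e i) (e j))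
    ; linIndep = λ a h → functional-zero P 1≢0 a (λ x → trans (pairing-gram symmetricBilinear a x 1#) (pairing-zeroˡ h (toVec x) (toVec 1#))) }
    where open Presemifield P

  codeOf-represents : ∀ {T} (P : Presemifield T) → Represents (codeOf P) T
  codeOf-represents P l i j = refl

  -- If v ≠ 0 lies in the kernel of the codeword with coefficients a, the functional given by a
  -- vanishes on all T x v; these fill K, so a = 0.
  codeOf-MSRD : ∀ {T} (P : Presemifield T) → IsMSRD (codeOf P)
  codeOf-MSRD {T} P X (a , X≐) X≢0 v h j = decide (fromVec v ≟ 0#)
    where
    open Presemifield P
    decide : Dec (fromVec v ≡ 0#) → v j ≡ k.0#
    decide (yes z) = trans (sym (toVec-fromVec v j)) (trans (cong (λ u → toVec u j) z) (toVec-0 j))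
    decide (no nz) = contradiction (λ i m → trans (X≐ i m) (sum3-zero {λ l → a l k.* toVec (T (e i) (e m)) l} (λ l → trans (cong (k._* toVec (T (e i) (e m)) l) (a-zero l)) (k.zeroˡ _)))) X≢0
      where
      a-zero : ∀ l → a l ≡ k.0#
      a-zero = functional-zero P nz a (λ x → trans (pairing-gram symmetricBilinear a x (fromVec v))
        (trans (pairing-cong {gramMatrix a T} {X} {toVec x} {toVec x} {toVec (fromVec v)} {v} (λ i m → sym (X≐ i m)) (λ _ → refl) (toVec-fromVec v))
        (sum3-zero (λ i → trans (cong (toVec x i k.*_) (h i)) (k.zeroʳ _)))))

  -- Row rank equals column rank, by counting: the injective map c ↦ cP is onto, so the j-th unit
  -- vector is some cP, and the j-th entry of w is cPw = 0.
  transpose-injective : (P : Mat3) → (∀ c → (∀ j → sum3 (λ l → c l k.* P l j) ≡ k.0#) → ∀ l → c l ≡ k.0#) →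
                        ∀ w → (∀ l → mulVec P w l ≡ k.0#) → ∀ j → w j ≡ k.0#
  transpose-injective P inj w h j = begin
    w j                                                     ≡⟨ sum3-I₃ j w ⟨
    sum3 (λ m → I₃ j m k.* w m)                             ≡⟨ sum3-cong (λ m → cong (k._* w m) (solves m)) ⟨
    sum3 (λ m → sum3 (λ l → c l k.* P l m) k.* w m)
      ≡⟨ sum3-assoc c P w ⟩
    sum3 (λ l → c l k.* mulVec P w l)                       ≡⟨ sum3-zero (λ l → trans (cong (c l k.*_) (h l)) (k.zeroʳ _)) ⟩
    k.0#                                                    ∎
    where
    open ≡-Reasoning
    image : Vec3 → Vec3
    image c j = sum3 (λ l → c l k.* P l j)
    f : Carrier → Carrier
    f x = fromVec (image (toVec x))
    image-- : ∀ c d j → image (λ l → c l k.- d l) j ≡ image c j k.- image d j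
    image-- c d j = k.solve 9 (λ c₀ c₁ c₂ d₀ d₁ d₂ p q r → (c₀ k.:- d₀) k.:* p k.:+ (c₁ k.:- d₁) k.:* q k.:+ (c₂ k.:- d₂) k.:* r
      k.:= c₀ k.:* p k.:+ c₁ k.:* q k.:+ c₂ k.:* r k.:- (d₀ k.:* p k.:+ d₁ k.:* q k.:+ d₂ k.:* r)) refl (c i₀) (c i₁) (c i₂) (d i₀) (d i₁) (d i₂) (P i₀ j) (P i₁ j) (P i₂ j)
    f-injective : ∀ {x y} → f x ≡ f y → x ≡ y
    f-injective {x} {y} eq = toVec-injective (λ l → k.difference-zero (inj (λ l → toVec x l k.- toVec y l)
      (λ j → trans (image-- (toVec x) (toVec y) j) (k.zero-difference (trans (sym (toVec-fromVec (image (toVec x)) j)) (trans (cong (λ u → toVec u j) eq) (toVec-fromVec (image (toVec y)) j))))) l))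
    hit : ∃[ x ] f x ≡ e j
    hit = injective⇒surjective f f-injective (e j)
    c : Vec3
    c = toVec (proj₁ hit)
    solves : ∀ m → sum3 (λ l → c l k.* P l m) ≡ I₃ j m
    solves m = trans (sym (toVec-fromVec (image c) m)) (trans (cong (λ u → toVec u m) (proj₂ hit)) (toVec-fromVec (I₃ j) m))

  pairing-sym : ∀ {M} → Symmetric M → ∀ v w → pairing M v w ≡ pairing M w v
  pairing-sym {M} s v w = begin
    sum3 (λ i → v i k.* mulVec M w i)                         ≡⟨ sum3-assoc v M w ⟨
    sum3 (λ m → sum3 (λ l → v l k.* M l m) k.* w m)           ≡⟨ sum3-cong {λ m → sum3 (λ l → v l k.* M l m) k.* w m} (λ m → trans (k.*-comm _ (w m))
                                                                   (cong (w m k.*_) (sum3-cong {λ l → v l k.* M l m} (λ l → trans (k.*-comm _ _) (cong (k._* v l) (s l m)))))) ⟩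
    sum3 (λ m → w m k.* mulVec M v m)                         ∎
    where open ≡-Reasoning

  productOf : SymCode3 → Carrier → Carrier → Carrier
  productOf D x y = fromVec (λ l → pairing (basis D l) (toVec x) (toVec y))

  productOf-represents : ∀ D → Represents D (productOf D)
  productOf-represents D l i j = sym (begin
    toVec (productOf D (e i) (e j)) l                       ≡⟨ toVec-fromVec (λ l → pairing (basis D l) (toVec (e i)) (toVec (e j))) l ⟩
    pairing (basis D l) (toVec (e i)) (toVec (e j))         ≡⟨ pairing-cong {basis D l} {basis D l} (λ _ _ → refl) (toVec-fromVec (I₃ i)) (toVec-fromVec (I₃ j)) ⟩
    pairing (basis D l) (I₃ i) (I₃ j)                       ≡⟨ sum3-I₃ i (mulVec (basis D l) (I₃ j)) ⟩
    sum3 (λ m → basis D l i m k.* I₃ j m)                   ≡⟨ sum3-cong {λ m → basis D l i m k.* I₃ j m} {λ m → I₃ j m k.* basis D l i m} (λ m → k.*-comm _ _) ⟩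
    sum3 (λ m → I₃ j m k.* basis D l i m)                   ≡⟨ sum3-I₃ j (basis D l i) ⟩
    basis D l i j                                           ∎)
    where open ≡-Reasoning

  productOf-presemifield : ∀ D → IsMSRD D → Presemifield (productOf D)
  productOf-presemifield D msrd = record
    { symmetricBilinear = record
      { T-comm = λ x y → fromVec-cong (λ l → pairing-sym {basis D l} (symmetric D l) (toVec x) (toVec y))
      ; T-linear = λ y → record
        { additive = λ x z → trans (fromVec-cong (λ l → trans (sum3-cong {λ i → toVec (x + z) i k.* mulVec (basis D l) (toVec y) i} (λ i → cong (k._* mulVec (basis D l) (toVec y) i) (toVec-+ x z i)))
            (k.solve 9 (λ a b c d e f p q r → (a k.:+ d) k.:* p k.:+ (b k.:+ e) k.:* q k.:+ (c k.:+ f) k.:* r k.:= a k.:* p k.:+ b k.:* q k.:+ c k.:* r k.:+ (d k.:* p k.:+ e k.:* q k.:+ f k.:* r)) refl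
              (toVec x i₀) (toVec x i₁) (toVec x i₂) (toVec z i₀) (toVec z i₁) (toVec z i₂) (mulVec (basis D l) (toVec y) i₀) (mulVec (basis D l) (toVec y) i₁) (mulVec (basis D l) (toVec y) i₂))))
            (fromVec-+ (λ l → pairing (basis D l) (toVec x) (toVec y)) (λ l → pairing (basis D l) (toVec z) (toVec y)))
        ; homogeneous = λ c x → trans (fromVec-cong (λ l → trans (sum3-cong {λ i → toVec (ι c * x) i k.* mulVec (basis D l) (toVec y) i} (λ i → cong (k._* mulVec (basis D l) (toVec y) i) (toVec-ι c x i)))
            (k.solve 7 (λ m a b c p q r → m k.:* a k.:* p k.:+ m k.:* b k.:* q k.:+ m k.:* c k.:* r k.:= m k.:* (a k.:* p k.:+ b k.:* q k.:+ c k.:* r)) refl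
              c (toVec x i₀) (toVec x i₁) (toVec x i₂) (mulVec (basis D l) (toVec y) i₀) (mulVec (basis D l) (toVec y) i₁) (mulVec (basis D l) (toVec y) i₂))))
            (fromVec-ι c (λ l → pairing (basis D l) (toVec x) (toVec y))) } }
    ; cancel = λ {x} {y} x≢0 h → Cancel.y≡0 x y x≢0 h }
    where
    module Cancel (x y : Carrier) (x≢0 : ¬ x ≡ 0#) (h : productOf D x y ≡ 0#) where
      v w : Vec3
      v = toVec x
      w = toVec y
      -- Row l of P is v times the l-th basis matrix. If cP = 0 then, by symmetry, the codeword with
      -- coefficients c kills v ≠ 0, so c = 0. Thus P is invertible, and Pw = 0 gives w = 0.
      P : Mat3
      P l j = sum3 (λ i → v i k.* basis D l i j)
      P-w : ∀ l → mulVec P w l ≡ k.0#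
      P-w l = trans (sum3-assoc v (basis D l) w)
        (trans (sym (toVec-fromVec (λ l → pairing (basis D l) v w) l)) (trans (cong (λ u → toVec u l) h) (toVec-0 l)))
      P-injective : ∀ c → (∀ j → sum3 (λ l → c l k.* P l j) ≡ k.0#) → ∀ l → c l ≡ k.0#
      P-injective c h' l = decide (fromVec c ≟ 0#)
        where
        kernel : ∀ j → sum3 (λ i → lin c (basis D) j i k.* v i) ≡ k.0#
        kernel j = trans (sum3-cong {λ i → lin c (basis D) j i k.* v i} (λ i → cong (k._* v i) (sum3-cong {λ l → c l k.* basis D l j i} (λ l → cong (c l k.*_) (symmetric D l j i)))))
          (trans (trans (sum3-assoc c (λ l i → basis D l i j) v) (sum3-cong {λ l → c l k.* mulVec (λ l i → basis D l i j) v l} (λ l → cong (c l k.*_) (sum3-cong {λ i → basis D l i j k.* v i} (λ i → k.*-comm _ _)))))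
            (h' j))
        decide : Dec (fromVec c ≡ 0#) → c l ≡ k.0#
        decide (yes z) = trans (sym (toVec-fromVec c l)) (trans (cong (λ u → toVec u l) z) (toVec-0 l))
        decide (no nz) = contradiction (trans (sym (fromVec-toVec x)) (trans (fromVec-cong v≡0) fromVec-0)) x≢0
          where
          v≡0 : ∀ i → v i ≡ k.0#
          v≡0 = msrd (lin c (basis D)) (c , λ _ _ → refl) (λ z → nz (trans (fromVec-cong (linIndep D c z)) fromVec-0)) v kernel
      y≡0 : y ≡ 0#
      y≡0 = trans (sym (fromVec-toVec y)) (trans (fromVec-cong (transpose-injective P P-injective w P-w)) fromVec-0)

  matrix : Lin → Mat3
  matrix f i j = toVec (ap f (e j)) i

  matrix-ap : ∀ f x i → sum3 (λ j → matrix f i j k.* toVec x j) ≡ toVec (ap f x) i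
  matrix-ap f x i = sym (trans (functional-expand {λ x → toVec (ap f x) i} record
      { f-+ = λ x y → trans (cong (λ u → toVec u i) (ap-+ f x y)) (toVec-+ _ _ i)
      ; f-ι = λ c x → trans (cong (λ u → toVec u i) (ap-ι f c x)) (toVec-ι c _ i) } x)
    (sum3-cong {λ j → toVec x j k.* matrix f i j} (λ j → k.*-comm _ _)))

  transposed : Mat3 → Mat3
  transposed M i j = M j i

  matrix-inverse : ∀ f g → (∀ x → ap f (ap g x) ≡ x) → (matrix f · matrix g) ≐ I₃
  matrix-inverse f g h i j = trans (matrix-ap f (ap g (e j)) i) (trans (cong (λ u → toVec u i) (h (e j))) (trans (toVec-fromVec (I₃ j) i) (I₃-sym j i)))

  transposed-inverse : ∀ {M N} → (M · N) ≐ I₃ → (transposed N · transposed M) ≐ I₃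
  transposed-inverse {M} {N} h i j = trans (sum3-cong {λ m → N m i k.* M j m} (λ m → k.*-comm _ _)) (trans (h j i) (I₃-sym j i))

  congruence : ∀ (A X B : Mat3) v w → pairing ((A · X) · B) v w ≡ pairing X (mulVec (transposed A) v) (mulVec B w)
  congruence A X B v w = trans (outer (A · X)) (inner (mulVec B w))
    where
    outer : ∀ (Y : Mat3) → pairing (Y · B) v w ≡ pairing Y v (mulVec B w)
    outer Y = sum3-cong {λ i → v i k.* mulVec (Y · B) w i} (λ i → cong (v i k.*_)
      (sum3-assoc (Y i) B w))
    inner : ∀ u → pairing (A · X) v u ≡ pairing X (mulVec (transposed A) v) u
    inner u = trans (sum3-cong {λ i → v i k.* mulVec (A · X) u i} (λ i → cong (v i k.*_)
      (sum3-assoc (A i) X u)))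
      (trans (sym (sum3-assoc v A (mulVec X u))) (sum3-cong {λ m → sum3 (λ l → v l k.* A l m) k.* mulVec X u m} (λ m → cong (k._* mulVec X u m) (sum3-cong {λ l → v l k.* A l m} (λ l → k.*-comm _ _)))))

  pairing-unit : ∀ (M : Mat3) i j → pairing M (I₃ i) (I₃ j) ≡ M i j
  pairing-unit M i j = trans (sum3-I₃ i (mulVec M (I₃ j))) (trans (sum3-cong {λ m → M i m k.* I₃ j m} (λ m → k.*-comm _ _)) (sum3-I₃ j (M i)))

  pullback : Vec3 → Lin → Vec3
  pullback a f l = functional a (ap f (e l))

  functional-pullback : ∀ a f x → functional (pullback a f) x ≡ functional a (ap f x)
  functional-pullback a f x = trans (sum3-cong {λ l → pullback a f l k.* toVec x l} (λ l → k.*-comm _ _))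
    (sym (functional-expand {λ x → functional a (ap f x)} record
      { f-+ = λ x y → trans (cong (functional a) (ap-+ f x y)) (f-+ (functional-isFunctional a) _ _)
      ; f-ι = λ c x → trans (cong (functional a) (ap-ι f c x)) (f-ι (functional-isFunctional a) _ _) } x))

  -- The equivalence is a congruence X ↦ φᵀXφ with φ = χ⁻¹, since χ acts alike on both arguments; ψ
  -- only moves the coefficients of a codeword, by `pullback`.
  frame-equivalent : ∀ {C D T c} → Represents C (twistedProduct c) → Represents D T → Frame T c → Equivalent C D
  frame-equivalent {C} {D} {T} {c} RC RD F = A , B , (transposed (matrix χ) , transposed-inverse {matrix χ} {matrix φ} (matrix-inverse χ φ (inverseʳ Iχ)) , transposed-inverse {matrix φ} {matrix χ} (matrix-inverse φ χ (inverseˡ Iχ)))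
      , (matrix χ , matrix-inverse φ χ (inverseˡ Iχ) , matrix-inverse χ φ (inverseʳ Iχ))
      , (λ { X (a , X≐) → pullback a ψ , λ i j → trans (transport a X≐ i j) (trans (sym (functional-pullback a ψ (T (e i) (e j)))) (sym (lin-gram {D} {T} RD (pullback a ψ) i j))) })
      , (λ { Y (b , Y≐) → lin (pullback b ψ⁻¹) (basis C) , (pullback b ψ⁻¹ , λ _ _ → refl) , λ i j → trans (Y≐ i j) (trans (lin-gram {D} {T} RD b i j)
            (sym (trans (transport (pullback b ψ⁻¹) (λ _ _ → refl) i j) (trans (functional-pullback b ψ⁻¹ (ap ψ (T (e i) (e j)))) (cong (functional b) (inverseˡ Iψ (T (e i) (e j)))))))) })
    where
    open Frame F
    open Inverse′
    Iχ : Inverse′ χ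
    Iχ = invert {χ} χ-injective
    Iψ : Inverse′ ψ
    Iψ = invert {ψ} ψ-injective
    φ ψ⁻¹ : Lin
    φ = inverse′ Iχ
    ψ⁻¹ = inverse′ Iψ
    A B : Mat3
    A = transposed (matrix φ)
    B = matrix φ
    transport : ∀ a {X} → X ≐ lin a (basis C) → ∀ i j → ((A · X) · B) i j ≡ functional a (ap ψ (T (e i) (e j)))
    transport a {X} X≐ i j = begin
      ((A · X) · B) i j
        ≡⟨ pairing-unit ((A · X) · B) i j ⟨
      pairing ((A · X) · B) (I₃ i) (I₃ j)
        ≡⟨ congruence A X B (I₃ i) (I₃ j) ⟩
      pairing X (mulVec B (I₃ i)) (mulVec B (I₃ j))
        ≡⟨ pairing-cong {X} {gramMatrix a (twistedProduct c)} (λ m n → trans (X≐ m n) (lin-gram {C} {twistedProduct c} RC a m n)) (column i) (column j) ⟩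
      pairing (gramMatrix a (twistedProduct c)) (toVec (ap φ (e i))) (toVec (ap φ (e j)))
        ≡⟨ pairing-gram (twisted-symmetricBilinear c) a (ap φ (e i)) (ap φ (e j)) ⟨
      functional a (twistedProduct c (ap φ (e i)) (ap φ (e j)))
        ≡⟨ cong (functional a) (trans (sym (law _ _)) (cong₂ (λ u v → ap ψ (T u v)) (inverseʳ Iχ (e i)) (inverseʳ Iχ (e j)))) ⟩
      functional a (ap ψ (T (e i) (e j))) ∎
      where
      open ≡-Reasoning
      column : ∀ j m → mulVec B (I₃ j) m ≡ toVec (ap φ (e j)) m
      column j m = trans (sum3-cong {λ n → B m n k.* I₃ j n} (λ n → cong (B m n k.*_) (sym (toVec-fromVec (I₃ j) n)))) (matrix-ap φ (e j) m)

  -- A and B are unrelated, so an equivalence yields an isotopism with separate maps Aᵀ and B of the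
  -- two arguments, as `NotIsotopic` allows. The map Ψ is read off the coefficients of the images of
  -- the basis of C.
  not-equivalent : ∀ {C D} → Represents C (twistedProduct 0#) → Represents D (twistedProduct 1#) → ¬ Equivalent C D
  not-equivalent {C} {D} RC RD (A , B , (A' , AA' , _) , (B' , _ , B'B) , into , _) =
      NotIsotopic.impossible (proj₁ Ψ-rep) (proj₁ φ-rep) (proj₁ χ-rep)
        (λ x h → φ-injective x (trans (sym (proj₂ φ-rep x)) h)) (λ x h → χ-injective x (trans (sym (proj₂ χ-rep x)) h))
        (λ x y → trans (proj₂ Ψ-rep _) (trans (law x y) (sym (cong₂ _*_ (proj₂ φ-rep x) (proj₂ χ-rep y)))))
    where
    C-l : ∀ l → basis C l ≐ lin (I₃ l) (basis C)
    C-l l i j = sym (sum3-I₃ l (λ m → basis C m i j))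
    g : Fin 3 → Vec3
    g l = proj₁ (into (basis C l) (I₃ l , C-l l))
    g-eq : ∀ l → ((A · basis C l) · B) ≐ lin (g l) (basis D)
    g-eq l = proj₂ (into (basis C l) (I₃ l , C-l l))
    mulVec-isLinear : ∀ M → IsLinear (λ x → fromVec (mulVec M (toVec x)))
    mulVec-isLinear M = record
      { additive = λ x y → trans (fromVec-cong (λ i → f-+ (functional-isFunctional (M i)) x y)) (fromVec-+ (mulVec M (toVec x)) (mulVec M (toVec y)))
      ; homogeneous = λ c x → trans (fromVec-cong (λ i → f-ι (functional-isFunctional (M i)) c x)) (fromVec-ι c (mulVec M (toVec x))) }
    φ χ Ψ : Carrier → Carrier
    φ x = fromVec (mulVec (transposed A) (toVec x))
    χ y = fromVec (mulVec B (toVec y))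
    Ψ u = fromVec (mulVec g (toVec u))
    φ-rep : ∃[ f ] (∀ x → ap f x ≡ φ x)
    φ-rep = represent (mulVec-isLinear (transposed A))
    χ-rep : ∃[ f ] (∀ x → ap f x ≡ χ x)
    χ-rep = represent (mulVec-isLinear B)
    Ψ-rep : ∃[ f ] (∀ x → ap f x ≡ Ψ x)
    Ψ-rep = represent (mulVec-isLinear g)
    left-inverse⇒injective : ∀ (M N : Mat3) → (N · M) ≐ I₃ → ∀ x → fromVec (mulVec M (toVec x)) ≡ 0# → x ≡ 0#
    left-inverse⇒injective M N NM x h = trans (sym (fromVec-toVec x)) (trans (fromVec-cong v≡0) fromVec-0)
      where
      v : Vec3
      v = toVec x
      Mv : ∀ i → mulVec M v i ≡ k.0#
      Mv i = trans (sym (toVec-fromVec (mulVec M v) i)) (trans (cong (λ u → toVec u i) h) (toVec-0 i))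
      v≡0 : ∀ i → v i ≡ k.0#
      v≡0 i = begin
        v i                                   ≡⟨ sum3-I₃ i v ⟨
        sum3 (λ j → I₃ i j k.* v j)           ≡⟨ sum3-cong (λ j → cong (k._* v j) (NM i j)) ⟨
        mulVec (N · M) v i
          ≡⟨ sum3-assoc (N i) M v ⟩
        mulVec N (mulVec M v) i               ≡⟨ sum3-zero (λ m → trans (cong (N i m k.*_) (Mv m)) (k.zeroʳ _)) ⟩
        k.0#                                  ∎
        where open ≡-Reasoning
    φ-injective : ∀ x → φ x ≡ 0# → x ≡ 0#
    φ-injective = left-inverse⇒injective (transposed A) (transposed A') (transposed-inverse {A} {A'} AA')
    χ-injective : ∀ x → χ x ≡ 0# → x ≡ 0#
    χ-injective = left-inverse⇒injective B B' B'B
    law : ∀ x y → Ψ (twistedProduct 1# x y) ≡ φ x * χ y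
    law x y = toVec-injective (λ l → begin
      toVec (Ψ (twistedProduct 1# x y)) l
        ≡⟨ toVec-fromVec (mulVec g (toVec (twistedProduct 1# x y))) l ⟩
      functional (g l) (twistedProduct 1# x y)
        ≡⟨ pairing-gram (twisted-symmetricBilinear 1#) (g l) x y ⟩
      pairing (gramMatrix (g l) (twistedProduct 1#)) (toVec x) (toVec y)
        ≡⟨ pairing-cong {(A · basis C l) · B} {gramMatrix (g l) (twistedProduct 1#)} {toVec x} {toVec x} {toVec y} {toVec y} (λ i j → trans (g-eq l i j) (lin-gram {D} {twistedProduct 1#} RD (g l) i j)) (λ _ → refl) (λ _ → refl) ⟨
      pairing ((A · basis C l) · B) (toVec x) (toVec y)
        ≡⟨ congruence A (basis C l) B (toVec x) (toVec y) ⟩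
      pairing (basis C l) (mulVec (transposed A) (toVec x)) (mulVec B (toVec y))
        ≡⟨ pairing-cong {basis C l} {gramMatrix (I₃ l) (twistedProduct 0#)} (λ i j → trans (C-l l i j) (lin-gram {C} {twistedProduct 0#} RC (I₃ l) i j))
             (λ i → sym (toVec-fromVec (mulVec (transposed A) (toVec x)) i)) (λ i → sym (toVec-fromVec (mulVec B (toVec y)) i)) ⟩
      pairing (gramMatrix (I₃ l) (twistedProduct 0#)) (toVec (φ x)) (toVec (χ y))
        ≡⟨ pairing-gram (twisted-symmetricBilinear 0#) (I₃ l) (φ x) (χ y) ⟨
      functional (I₃ l) (twistedProduct 0# (φ x) (χ y))
        ≡⟨ sum3-I₃ l (toVec (twistedProduct 0# (φ x) (χ y))) ⟩
      toVec (twistedProduct 0# (φ x) (χ y)) l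
        ≡⟨ cong (λ u → toVec u l) (solve 2 (λ p s → p :- :0 :* s := p) refl (φ x * χ y) (Tr (φ x) * Tr (χ y))) ⟩
      toVec (φ x * χ y) l ∎)
      where open ≡-Reasoning

-- Parity of q and the characteristic

module Parity (k : FiniteField) where
  open FieldProperties k
  private
    index : Carrier → ℕ
    index x = Fin.toℕ (Inverse.from enum x)

    index-injective : ∀ {x y} → index x ≡ index y → x ≡ y
    index-injective h = from-injective (Finₚ.toℕ-injective h)

  -- The moved points are split by whether π raises or lowers their `index`; π exchanges the two
  -- halves.
  involution-parity : ∀ (π : Carrier → Carrier) → (∀ x → π (π x) ≡ x) → ∃[ n ] q ≡ 2 ℕ.* n ℕ.+ ∑ (λ x → [ x ≟ π x ])
  involution-parity π ππ = A , (begin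
    q                                                        ≡⟨ ℕₚ.*-identityʳ q ⟨
    q ℕ.* 1                                                  ≡⟨ ∑-constant 1 ⟨
    ∑ (λ _ → 1)                                              ≡⟨ ∑-cong (λ x → trichotomy x (index x ℕ.<? index (π x)) (index (π x) ℕ.<? index x) (x ≟ π x)) ⟩
    ∑ (λ x → up x ℕ.+ down x ℕ.+ [ x ≟ π x ])                ≡⟨ ∑-+ (λ x → up x ℕ.+ down x) (λ x → [ x ≟ π x ]) ⟩
    ∑ (λ x → up x ℕ.+ down x) ℕ.+ ∑ (λ x → [ x ≟ π x ])      ≡⟨ cong (ℕ._+ ∑ (λ x → [ x ≟ π x ])) (trans (∑-+ up down) (cong (A ℕ.+_) (trans down≡up (sym (ℕₚ.+-identityʳ A))))) ⟩
    2 ℕ.* A ℕ.+ ∑ (λ x → [ x ≟ π x ])                        ∎)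
    where
    open ≡-Reasoning
    up down : Carrier → ℕ
    up x = [ index x ℕ.<? index (π x) ]
    down x = [ index (π x) ℕ.<? index x ]
    A : ℕ
    A = ∑ up
    down≡up : ∑ down ≡ A
    down≡up = trans (∑-cong (λ x → []-cong (index (π x) ℕ.<? index x) (index (π x) ℕ.<? index (π (π x))) (subst (λ y → index (π x) ℕ.< index y) (sym (ππ x))) (subst (λ y → index (π x) ℕ.< index y) (ππ x))))
      (∑-reindex up π π ππ ππ)
    trichotomy : ∀ x (a : Dec (index x ℕ.< index (π x))) (b : Dec (index (π x) ℕ.< index x)) (c : Dec (x ≡ π x)) → 1 ≡ [ a ] ℕ.+ [ b ] ℕ.+ [ c ]
    trichotomy x (yes a) (yes b) _ = contradiction b (ℕₚ.<-asym a)
    trichotomy x (yes a) (no _) (yes c) = contradiction (cong index c) (ℕₚ.<⇒≢ a)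
    trichotomy x (yes _) (no _) (no _) = refl
    trichotomy x (no _) (yes b) (yes c) = contradiction (cong index (sym c)) (ℕₚ.<⇒≢ b)
    trichotomy x (no _) (yes _) (no _) = refl
    trichotomy x (no _) (no _) (yes _) = refl
    trichotomy x (no a) (no b) (no c) = contradiction (index-injective (ℕₚ.≤-antisym (ℕₚ.≮⇒≥ b) (ℕₚ.≮⇒≥ a))) c

  -- Translation by 1 is then an involution without fixed points.
  char-2⇒even : 1# + 1# ≡ 0# → 2 ∣ q
  char-2⇒even 2≡0 = divides n (trans (proj₂ parity) (trans (cong (2 ℕ.* n ℕ.+_) no-fixed) (trans (ℕₚ.+-identityʳ _) (ℕₚ.*-comm 2 n))))
    where
    parity = involution-parity (_+ 1#) (λ x → trans (+-assoc x 1# 1#) (trans (cong (λ u → x + u) 2≡0) (+-identityʳ x)))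
    n = proj₁ parity
    no-fixed : ∑ (λ x → [ x ≟ x + 1# ]) ≡ 0
    no-fixed = trans (∑-cong (λ x → []-false (x ≟ x + 1#) (λ e → 1≢0 (combine₁ (- 1#) e (solve 1 (λ x → :1 :- :0 := (:- :1) :* (x :- (x :+ :1))) refl x)))))
      (trans (∑-constant 0) (ℕₚ.*-zeroʳ q))

  -- Otherwise negation is an involution that fixes only 0, and q is odd.
  even⇒char-2 : 2 ∣ q → 1# + 1# ≡ 0#
  even⇒char-2 2∣q = decide (1# + 1# ≟ 0#)
    where
    parity = involution-parity -_ (λ x → solve 1 (λ x → :- (:- x) := x) refl x)
    decide : Dec (1# + 1# ≡ 0#) → 1# + 1# ≡ 0#
    decide (yes e) = e
    decide (no 2≢0) = contradiction (∣1⇒≡1 (∣m+n∣m⇒∣n (subst (2 ∣_) (trans (proj₂ parity) (cong (2 ℕ.* proj₁ parity ℕ.+_) one-fixed)) 2∣q) (m∣m*n (proj₁ parity)))) λ ()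
      where
      one-fixed : ∑ (λ x → [ x ≟ - x ]) ≡ 1
      one-fixed = trans (∑-cong (λ x → []-cong (x ≟ - x) (0# ≟ x)
        (λ e → sym (*-cancelˡ-0 2≢0 (combine₁ 1# e (solve 1 (λ x → (:1 :+ :1) :* x :- :0 := :1 :* (x :- (:- x))) refl x))))
        (λ { refl → solve 0 (:0 := :- :0) refl }))) (∑-point 0#)

-- x³ − x takes the value 0 twice, so it misses some n.
extension : ∀ k → CyclicCubic k
extension k = RootlessCubic.cyclicCubic k 0# (- 1#) (proj₁ missed) (λ x e → proj₂ missed x (combine₁ 1# e
    (solve 2 (λ x n → x :* x :* x :- x :- n := :1 :* (x :* x :* x :- :0 :* (x :* x) :+ (:- :1) :* x :- n :- :0)) refl x (proj₁ missed))))
  where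
  open FieldProperties k
  missed : ∃[ n ] (∀ x → ¬ x * x * x - x ≡ n)
  missed = non-injective⇒missed (λ x → x * x * x - x) {0#} {1#} 0≢1
    (solve 0 (:0 :* :0 :* :0 :- :0 := :1 :* :1 :* :1 :- :1) refl)

-- The cases of even and odd q

module MSRD (k : FiniteField) (E : CyclicCubic k) where
  open Codes k E
  open Matrices k
  open Parity k

  ι-2 : ι (k.1# k.+ k.1#) ≡ 1# + 1#
  ι-2 = trans (ι-+ _ _) (cong₂ _+_ ι-1 ι-1)

  fieldCode : SymCode3
  fieldCode = codeOf field-presemifield

  equivalent-by-frame : ∀ D → IsMSRD D → ∀ {c} (P : Presemifield (twistedProduct c)) → Frame (productOf D) c → Equivalent (codeOf P) D
  equivalent-by-frame D msrd P F = frame-equivalent {codeOf P} {D} {productOf D} (codeOf-represents P) (productOf-represents D) F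

  unique-class : 2 ∣ k.q → UniqueMSRDClass
  unique-class 2∣q = fieldCode , codeOf-MSRD field-presemifield , λ D msrd →
    [ equivalent-by-frame D msrd field-presemifield , (λ F → contradiction (twisted D msrd F) (twisted-degenerate 2≡0)) ]′ (classification (productOf-presemifield D msrd))
    where
    2≡0 : 1# + 1# ≡ 0#
    2≡0 = trans (sym ι-2) (trans (cong ι (even⇒char-2 2∣q)) ι-0)
    -- A frame with c = 1 would carry cancellation over from the product of the code to the twisted
    -- product, which has zero divisors in characteristic 2.
    twisted : ∀ D → IsMSRD D → Frame (productOf D) 1# → Presemifield (twistedProduct 1#)
    twisted D msrd F = record
      { symmetricBilinear = twisted-symmetricBilinear 1#
      ; cancel = λ {x} {y} x≢0 h → χ-injective y (Presemifield.cancel (productOf-presemifield D msrd) (x≢0 ∘ χ-injective x) (ψ-injective _ (trans (law x y) h))) }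
      where open Frame F

  two-classes : ¬ (2 ∣ k.q) → TwoMSRDClasses
  two-classes odd = fieldCode , codeOf P , codeOf-MSRD field-presemifield , codeOf-MSRD P
    , not-equivalent {fieldCode} {codeOf P} (codeOf-represents field-presemifield) (codeOf-represents P)
    , λ D msrd → Sum.map (equivalent-by-frame D msrd field-presemifield) (equivalent-by-frame D msrd P) (classification (productOf-presemifield D msrd))
    where
    P : Presemifield (twistedProduct 1#)
    P = twisted-presemifield (λ e → odd (char-2⇒even (ι-injective (trans ι-2 (trans e (sym ι-0))))))

theorem3p28 : (F : FiniteField) →
    (2 < FiniteField.q F → 2 ∣ FiniteField.q F → Matrices.UniqueMSRDClass F) ×
    (¬ (2 ∣ FiniteField.q F) → Matrices.TwoMSRDClasses F)
theorem3p28 F = (λ _ → MSRD.unique-class F (extension F)) , MSRD.two-classes F (extension F)
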